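{- Let $k>\ell\ge 2$ be integers such that $(k-\ell)\nmid k$, let $s=\lceil\frac{k}{k-\ell}\rceil$, and let $s_*=s_*(k)$ be a function of $k$. There exists $\Delta_0>0$ such that for every $0<\Delta\le\Delta_0$ the following holds for all sufficiently large $n\in(k-\ell)\mathbb{N}$. Let $\mathcal{H}=(V,E)$ be an $n$-vertex $k$-graph which is $\Delta$-extremal and satisfies $\delta_{k-1}(\mathcal{H})\ge\frac{n}{s(k-\ell)}$. Let $V=A\cup B$ be a partition with $|B|=\left\lfloor\left(1-\frac{1}{s(k-\ell)}\right)n\right\rfloor$ and with $e(B)$ smallest among all such partitions, let $A',B',V_0$ be the associated vertex classes defined in the context, and let $q=|A\cap B'|$. If $\mathcal{H}[B']$ contains $sq$ vertex-disjoint $\ell$-paths $P_1,P_2,\ldots,P_{sq}$, each of length at most $s_*$ and each having both of its $\ell$-ends linkable, then $\mathcal{H}$ contains a Hamilton $\ell$-cycle.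
   Context: A $k$-graph $\mathcal{H}=(V,E)$ has a finite vertex set $V$ and $E\subseteq\binom{V}{k}$; $\delta_{k-1}(\mathcal{H})$ is the minimum, over all $(k-1)$-sets $S\subseteq V$, of the number of $v\in V\setminus S$ with $S\cup\{v\}\in E$. For $B\subseteq V$, $e(B)$ is the number of edges contained in $B$. $\mathcal{H}$ on $n$ vertices is $\Delta$-extremal if there is $B\subseteq V$ with $|B|=\left\lfloor\left(1-\frac{1}{s(k-\ell)}\right)n\right\rfloor$ and $e(B)\le\Delta n^k$. For $X,Z\subseteq V$ with $|X|<k$, $\deg(X,Z)$ is the number of $(k-|X|)$-sets $Y\subseteq Z$ with $X\cup Y\in E$. Constants: $\varepsilon_0=2k!\,\Delta\left(1-\frac{1}{s(k-\ell)}\right)^{ -k}$ and $\varepsilon_1=\varepsilon_0^{1/4}$. Given the partition $V=A\cup B$, define $A'=\{v\in V:\deg(v,B)\ge(1-\varepsilon_1)\binom{|B|}{k-1}\}$, $B'=\{v\in V:\deg(v,B)\le\varepsilon_1\binom{|B|}{k-1}\}$, and $V_0=V\setminus(A'\cup B')$. For $0\le\ell'\le\ell$, an $\ell'$-set $L'\subseteq V$ is $\varepsilon_1$-bad if $\deg(L',B)>\varepsilon_1\binom{|B|}{k-\ell'}$, and $\varepsilon_1$-good otherwise. An ordered $\ell$-set $(v_1,\dots,v_\ell)$ is linkable if for every $i\in\{1,\dots,s-1\}$ the $(\ell-(i-1)(k-\ell))$-set $\{v_{(i-1)(k-\ell)+1},v_{(i-1)(k-\ell)+2},\dots,v_\ell\}$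 is $\varepsilon_1$-good. A ($k$-uniform) $\ell$-path is a $k$-graph whose vertices can be linearly ordered as $v_1v_2\dots v_t$ so that every edge consists of $k$ consecutive vertices and two consecutive edges share exactly $\ell$ vertices; its length is its number of edges (at least one). Its two $\ell$-ends, read outward, are the ordered $\ell$-sets $(v_\ell,v_{\ell-1},\dots,v_1)$ and $(v_{t-\ell+1},\dots,v_{t-1},v_t)$. An $\ell$-cycle is defined in the same way with a cyclic ordering, and a Hamilton $\ell$-cycle in $\mathcal{H}$ is a spanning subhypergraph that is an $\ell$-cycle. $\mathcal{H}[B']$ is the subhypergraph induced on $B'$. -}

module Defs where

open import Data.Nat using (ℕ; suc; _+_; _*_; _∸_; _^_; _≤_; _<_; _⊔_; _⊓_; _/_; _%_; _!; NonZero; z≤n; s≤s; >-nonZero)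
import Data.Nat.Properties as ℕₚ
open import Data.Nat.DivMod using (m≡m%n+[m/n]*n; m%n<n)
open import Data.Nat.Divisibility using (_∣_)
open import Data.Nat.Combinatorics using (_C_)
open import Data.Integer using (+_)
import Data.Integer as ℤ
open import Data.Rational using (ℚ; 0ℚ; 1ℚ)
import Data.Rational as ℚ
import Data.Rational.Properties as ℚₚ
import Data.Rational.Unnormalised as ℚᵘ
import Data.Rational.Unnormalised.Properties as ℚᵘₚ
open import Data.Rational.Solver using (module +-*-Solver)
open import Algebra.Definitions.RawSemiring ℚ.+-*-rawSemiring using () renaming (_^_ to _^ℚ_)
open import Data.Fin using (Fin)
open import Data.Fin.Subset using (Subset; inside; outside; ⊤; ⊥; ⁅_⁆; _∈_; _⊆_; _∪_; _∩_; ∁; ∣_∣; ⋃)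
open import Data.Fin.Subset.Properties using (_⊆?_; _∈?_)
open import Data.Vec using ([]; _∷_)
open import Data.List using (List; []; _∷_; _++_; map; filter; length; foldr; take; drop; reverse; allFin)
open import Data.List.Relation.Unary.Unique.Propositional using (Unique)
open import Data.Product using (_×_; _,_; proj₁; ∃-syntax)
open import Function using (_⇔_)
open import Relation.Nullary using (¬_)
open import Relation.Nullary.Decidable using (_×-dec_; ¬?)
open import Relation.Unary using (Decidable)
open import Relation.Binary.PropositionalEquality using (_≡_; refl; sym; trans; cong; cong₂; subst; subst₂)

private
  half : ∀ ε → 0ℚ ℚ.< ε → 0ℚ ℚ.< ℚ.½ ℚ.* ε
  half ε 0<ε = subst (ℚ._< ℚ.½ ℚ.* ε) (ℚₚ.*-zeroʳ ℚ.½) (ℚₚ.*-monoʳ-<-pos ℚ.½ 0<ε)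

  half+half : ∀ ε → ℚ.½ ℚ.* ε ℚ.+ ℚ.½ ℚ.* ε ≡ ε
  half+half ε = trans (sym (ℚₚ.*-distribʳ-+ ε ℚ.½ ℚ.½)) (ℚₚ.*-identityˡ ε)

-- Real numbers are Cauchy sequences of rationals with pointwise operations.
-- There is no quotient: real equality is the relation _≈ᴿ_.
record ℝ : Set where
  constructor mkℝ
  field
    seq    : ℕ → ℚ
    cauchy : ∀ ε → 0ℚ ℚ.< ε →
             ∃[ N ] (∀ m n → N ≤ m → N ≤ n → ℚ.∣ seq m ℚ.- seq n ∣ ℚ.< ε)

open ℝ public

infix  4 _<ᴿ_ _≤ᴿ_ _≈ᴿ_
infixl 6 _+ᴿ_ _-ᴿ_
infixl 7 _*ᴿ_
infix  8 -ᴿ_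
infixr 8 _^ᴿ_

_<ᴿ_ : ℝ → ℝ → Set
x <ᴿ y = ∃[ ε ] (0ℚ ℚ.< ε × ∃[ N ] (∀ n → N ≤ n → seq x n ℚ.+ ε ℚ.≤ seq y n))

_≤ᴿ_ : ℝ → ℝ → Set
x ≤ᴿ y = ¬ (y <ᴿ x)

_≈ᴿ_ : ℝ → ℝ → Set
x ≈ᴿ y = x ≤ᴿ y × y ≤ᴿ x

fromℚ : ℚ → ℝ
fromℚ p = mkℝ (λ _ → p)
  λ ε 0<ε → 0 , λ _ _ _ _ → subst (ℚ._< ε) (sym (cong ℚ.∣_∣ (ℚₚ.+-inverseʳ p))) 0<ε

fromℕ : ℕ → ℝ
fromℕ n = fromℚ (+ n ℚ./ 1)

0ℝ 1ℝ : ℝ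
0ℝ = fromℕ 0
1ℝ = fromℕ 1

_+ᴿ_ : ℝ → ℝ → ℝ
x +ᴿ y = mkℝ (λ n → seq x n ℚ.+ seq y n) λ ε 0<ε →
  let (M , p) = cauchy x (ℚ.½ ℚ.* ε) (half ε 0<ε)
      (N , q) = cauchy y (ℚ.½ ℚ.* ε) (half ε 0<ε)
  in M ⊔ N , λ m n M⊔N≤m M⊔N≤n → subst₂ ℚ._<_
       (cong ℚ.∣_∣ (rearrange (seq x m) (seq x n) (seq y m) (seq y n))) (half+half ε)
       (ℚₚ.≤-<-trans
         (ℚₚ.∣p+q∣≤∣p∣+∣q∣ (seq x m ℚ.- seq x n) (seq y m ℚ.- seq y n))
         (ℚₚ.+-mono-<
           (p m n (ℕₚ.m⊔n≤o⇒m≤o M N M⊔N≤m) (ℕₚ.m⊔n≤o⇒m≤o M N M⊔N≤n))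
           (q m n (ℕₚ.m⊔n≤o⇒n≤o M N M⊔N≤m) (ℕₚ.m⊔n≤o⇒n≤o M N M⊔N≤n))))
  where
  rearrange : ∀ a b c d → (a ℚ.- b) ℚ.+ (c ℚ.- d) ≡ (a ℚ.+ c) ℚ.- (b ℚ.+ d)
  rearrange = solve 4 (λ a b c d → (a :- b) :+ (c :- d) := (a :+ c) :- (b :+ d)) refl
    where open +-*-Solver

-ᴿ_ : ℝ → ℝ
-ᴿ x = mkℝ (λ n → ℚ.- seq x n) λ ε 0<ε →
  let (N , p) = cauchy x ε 0<ε
  in N , λ m n N≤m N≤n → subst (λ z → ℚ.∣ z ∣ ℚ.< ε)
       (flip (seq x m) (seq x n)) (p n m N≤n N≤m)
  where
  flip : ∀ a b → b ℚ.- a ≡ ℚ.- a ℚ.- ℚ.- b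
  flip = solve 2 (λ a b → b :- a := (:- a) :- (:- b)) refl
    where open +-*-Solver

_-ᴿ_ : ℝ → ℝ → ℝ
x -ᴿ y = x +ᴿ (-ᴿ y)

private
  eventually-bounded : ∀ (x : ℝ) → ∃[ X ] (ℚ.Positive X × ∃[ N ] (∀ n → N ≤ n → ℚ.∣ seq x n ∣ ℚ.≤ X))
  eventually-bounded x =
    let (N , p) = cauchy x 1ℚ (ℚₚ.positive⁻¹ 1ℚ)
        a = seq x N
    in 1ℚ ℚ.+ ℚ.∣ a ∣
     , ℚₚ.pos+nonNeg⇒pos 1ℚ ℚ.∣ a ∣ {{ℚₚ.∣-∣-nonNeg a}}
     , N , λ n N≤n → ℚₚ.≤-trans
         (subst (λ z → ℚ.∣ z ∣ ℚ.≤ ℚ.∣ seq x n ℚ.- a ∣ ℚ.+ ℚ.∣ a ∣) (cancel (seq x n) a)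
           (ℚₚ.∣p+q∣≤∣p∣+∣q∣ (seq x n ℚ.- a) a))
         (ℚₚ.+-monoˡ-≤ ℚ.∣ a ∣ (ℚₚ.<⇒≤ (p n N N≤n ℕₚ.≤-refl)))
    where
    cancel : ∀ b a → (b ℚ.- a) ℚ.+ a ≡ b
    cancel = solve 2 (λ b a → (b :- a) :+ a := b) refl
      where open +-*-Solver

_*ᴿ_ : ℝ → ℝ → ℝ
x *ᴿ y = mkℝ (λ n → seq x n ℚ.* seq y n) λ ε 0<ε →
  let (X , posX , M₁ , boundX) = eventually-bounded x
      (Y , posY , N₁ , boundY) = eventually-bounded y
      (r , r>0 , split)        = divide X Y ε posX posY 0<ε
      (M₂ , p) = cauchy x r r>0
      (N₂ , q) = cauchy y r r>0
  in (M₁ ⊔ N₁) ⊔ (M₂ ⊔ N₂) , λ m n m≥ n≥ →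
       let m≥₁ = ℕₚ.m⊔n≤o⇒m≤o (M₁ ⊔ N₁) (M₂ ⊔ N₂) m≥
           m≥₂ = ℕₚ.m⊔n≤o⇒n≤o (M₁ ⊔ N₁) (M₂ ⊔ N₂) m≥
           n≥₁ = ℕₚ.m⊔n≤o⇒m≤o (M₁ ⊔ N₁) (M₂ ⊔ N₂) n≥
           n≥₂ = ℕₚ.m⊔n≤o⇒n≤o (M₁ ⊔ N₁) (M₂ ⊔ N₂) n≥
       in subst₂ ℚ._<_ (cong ℚ.∣_∣ (rearrange (seq x m) (seq x n) (seq y m) (seq y n))) split
            (ℚₚ.≤-<-trans
              (ℚₚ.∣p+q∣≤∣p∣+∣q∣ (seq x m ℚ.* (seq y m ℚ.- seq y n)) (seq y n ℚ.* (seq x m ℚ.- seq x n)))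
              (ℚₚ.+-mono-<
                (small X r (seq x m) _ posX (boundX m (ℕₚ.m⊔n≤o⇒m≤o M₁ N₁ m≥₁))
                  (q m n (ℕₚ.m⊔n≤o⇒n≤o M₂ N₂ m≥₂) (ℕₚ.m⊔n≤o⇒n≤o M₂ N₂ n≥₂)))
                (small Y r (seq y n) _ posY (boundY n (ℕₚ.m⊔n≤o⇒n≤o M₁ N₁ n≥₁))
                  (p m n (ℕₚ.m⊔n≤o⇒m≤o M₂ N₂ m≥₂) (ℕₚ.m⊔n≤o⇒m≤o M₂ N₂ n≥₂)))))
  where
  rearrange : ∀ a b c d → a ℚ.* (c ℚ.- d) ℚ.+ d ℚ.* (a ℚ.- b) ≡ a ℚ.* c ℚ.- b ℚ.* d
  rearrange = solve 4 (λ a b c d → a :* (c :- d) :+ d :* (a :- b) := a :* c :- b :* d) refl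
    where open +-*-Solver

  small : ∀ X r a b → ℚ.Positive X → ℚ.∣ a ∣ ℚ.≤ X → ℚ.∣ b ∣ ℚ.< r → ℚ.∣ a ℚ.* b ∣ ℚ.< X ℚ.* r
  small X r a b posX a≤X b<r = subst (ℚ._< X ℚ.* r) (sym (ℚₚ.∣p*q∣≡∣p∣*∣q∣ a b))
    (ℚₚ.≤-<-trans (ℚₚ.*-monoʳ-≤-nonNeg ℚ.∣ b ∣ {{ℚₚ.∣-∣-nonNeg b}} a≤X)
                  (ℚₚ.*-monoʳ-<-pos X {{posX}} b<r))

  divide : ∀ X Y ε → ℚ.Positive X → ℚ.Positive Y → 0ℚ ℚ.< ε →
           ∃[ r ] (0ℚ ℚ.< r × X ℚ.* r ℚ.+ Y ℚ.* r ≡ ε)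
  divide X Y ε posX posY 0<ε =
      1/Z ℚ.* ε
    , subst (ℚ._< 1/Z ℚ.* ε) (ℚₚ.*-zeroʳ 1/Z)
        (ℚₚ.*-monoʳ-<-pos 1/Z {{ℚₚ.1/pos⇒pos Z {{posZ}}}} 0<ε)
    , trans (sym (ℚₚ.*-distribʳ-+ (1/Z ℚ.* ε) X Y))
        (trans (sym (ℚₚ.*-assoc Z 1/Z ε))
          (trans (cong (ℚ._* ε) (ℚₚ.*-inverseʳ Z {{Z≢0}})) (ℚₚ.*-identityˡ ε)))
    where
    Z : ℚ
    Z = X ℚ.+ Y
    posZ : ℚ.Positive Z
    posZ = ℚₚ.pos+pos⇒pos X {{posX}} Y {{posY}}
    Z≢0 : ℚ.NonZero Z
    Z≢0 = ℚₚ.pos⇒nonZero Z {{posZ}}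
    1/Z : ℚ
    1/Z = (ℚ.1/ Z) {{Z≢0}}

_^ᴿ_ : ℝ → ℕ → ℝ
x ^ᴿ 0     = 1ℝ
x ^ᴿ suc n = x *ᴿ x ^ᴿ n

-- y = x^{1/4}: the nonnegative real whose fourth power is x, unique up to _≈ᴿ_.
IsFourthRoot : ℝ → ℝ → Set
IsFourthRoot y x = 0ℝ ≤ᴿ y × y ^ᴿ 4 ≈ᴿ x

subsets : ∀ n → List (Subset n)
subsets 0       = [] ∷ []
subsets (suc n) = map (outside ∷_) (subsets n) ++ map (inside ∷_) (subsets n)

-- k-graphs on the vertex set Fin n.
record KGraph (k n : ℕ) : Set₁ where
  field
    Edge    : Subset n → Set
    edge?   : Decidable Edge
    uniform : ∀ {S} → Edge S → ∣ S ∣ ≡ k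

open KGraph public

-- Induced subhypergraph; the ambient vertex type stays Fin n, with the
-- vertices outside U isolated.
_[_] : ∀ {k n} → KGraph k n → Subset n → KGraph k n
H [ U ] = record
  { Edge    = λ S → Edge H S × S ⊆ U
  ; edge?   = λ S → edge? H S ×-dec (S ⊆? U)
  ; uniform = λ e → uniform H (proj₁ e)
  }

module _ {k n : ℕ} (H : KGraph k n) where

  e : Subset n → ℕ
  e U = length (filter (λ S → edge? H S ×-dec (S ⊆? U)) (subsets n))

  deg : Subset n → Subset n → ℕ
  deg X Z = length (filter
    (λ Y → (∣ Y ∣ ℕₚ.≟ k ∸ ∣ X ∣) ×-dec (Y ⊆? Z) ×-dec edge? H (X ∪ Y)) (subsets n))

  codegree : Subset n → ℕ
  codegree S = length (filter (λ v → ¬? (v ∈? S) ×-dec edge? H (S ∪ ⁅ v ⁆)) (allFin n))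

  -- δ_{k-1}. Codegrees never exceed n, so the initial value n of the fold
  -- matters only when there is no (k-1)-set at all.
  δ : ℕ
  δ = foldr _⊓_ n (map codegree (filter (λ S → ∣ S ∣ ℕₚ.≟ k ∸ 1) (subsets n)))

toSubset : ∀ {n} → List (Fin n) → Subset n
toSubset vs = ⋃ (map ⁅_⁆ vs)

window : ∀ {n} → ℕ → ℕ → List (Fin n) → Subset n
window start len vs = toSubset (take len (drop start vs))

IsPartition : ∀ {n} → Subset n → Subset n → Set
IsPartition A B = A ∪ B ≡ ⊤ × A ∩ B ≡ ⊥

-- An ℓ-path contained in G. Consecutive edges are k-windows sharing exactly ℓ
-- vertices, so the i-th edge (counting from 0) starts at position i(k-ℓ), and
-- a path with p edges has ℓ + p(k-ℓ) vertices, each lying in an edge. In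
-- particular a path in G [ U ] has all its vertices in U.
record Path {k n : ℕ} (ℓ : ℕ) (G : KGraph k n) : Set where
  field
    vertices  : List (Fin n)
    size      : ℕ
    size≥1    : 1 ≤ size
    distinct  : Unique vertices
    #vertices : length vertices ≡ ℓ + size * (k ∸ ℓ)
    edges     : ∀ i → i < size → Edge G (window (i * (k ∸ ℓ)) k vertices)

  initialEnd terminalEnd : List (Fin n)
  initialEnd  = reverse (take ℓ vertices)
  terminalEnd = drop (length vertices ∸ ℓ) vertices

-- A Hamilton ℓ-cycle contained in G: a cyclic ordering of all vertices whose
-- k-windows starting at the multiples of k-ℓ are edges. Windows of the doubled
-- list are the cyclic windows. For n < 2k-ℓ consecutive windows would overlap
-- in more than ℓ vertices, hence the bound on n.
record HamiltonCycle {k n : ℕ} (ℓ : ℕ) (G : KGraph k n) : Set where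
  field
    vertices  : List (Fin n)
    distinct  : Unique vertices
    spanning  : length vertices ≡ n
    divisible : k ∸ ℓ ∣ n
    long      : k + (k ∸ ℓ) ≤ n
    edges     : ∀ i → i * (k ∸ ℓ) < n → Edge G (window (i * (k ∸ ℓ)) k (vertices ++ vertices))

⌈_/_⌉ : (a b : ℕ) .{{_ : NonZero b}} → ℕ
⌈ a / b ⌉ = (a + (b ∸ 1)) / b

private
  a≤⌈a/b⌉*b : ∀ a b .{{_ : NonZero b}} → a ≤ ⌈ a / b ⌉ * b
  a≤⌈a/b⌉*b a b@(suc b-1) = ℕₚ.+-cancelʳ-≤ b-1 a (⌈ a / b ⌉ * b) (begin
    a + b-1                               ≡⟨ m≡m%n+[m/n]*n (a + b-1) b ⟩
    (a + b-1) % b + ⌈ a / b ⌉ * b         ≤⟨ ℕₚ.+-monoˡ-≤ (⌈ a / b ⌉ * b) (ℕₚ.≤-pred (m%n<n (a + b-1) b)) ⟩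
    b-1 + ⌈ a / b ⌉ * b                   ≡⟨ ℕₚ.+-comm b-1 _ ⟩
    ⌈ a / b ⌉ * b + b-1                   ∎)
    where open ℕₚ.≤-Reasoning

  1/m<1 : ∀ m .{{_ : NonZero m}} → 2 ≤ m → + 1 ℚ./ m ℚ.< 1ℚ
  1/m<1 (suc (suc j)) _ = ℚₚ.toℚᵘ-cancel-< (ℚᵘₚ.<-respˡ-≃ (ℚᵘₚ.≃-sym (ℚₚ.toℚᵘ-fromℚᵘ (ℚᵘ.mkℚᵘ (+ 1) (suc j))))
    (ℚᵘ.*<* (ℤ.+<+ (s≤s (s≤s z≤n)))))
  1/m<1 1 (s≤s ())

  1-1/m>0 : ∀ m .{{_ : NonZero m}} → 2 ≤ m → 0ℚ ℚ.< 1ℚ ℚ.- + 1 ℚ./ m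
  1-1/m>0 m 2≤m = subst (ℚ._< 1ℚ ℚ.- + 1 ℚ./ m) (ℚₚ.+-inverseʳ (+ 1 ℚ./ m))
    (ℚₚ.+-monoˡ-< (ℚ.- (+ 1 ℚ./ m)) (1/m<1 m 2≤m))

module Setting (k ℓ : ℕ) (2≤ℓ : 2 ≤ ℓ) (ℓ<k : ℓ < k) where

  instance
    k∸ℓ-nonZero : NonZero (k ∸ ℓ)
    k∸ℓ-nonZero = >-nonZero (ℕₚ.m<n⇒0<n∸m ℓ<k)

  s : ℕ
  s = ⌈ k / (k ∸ ℓ) ⌉

  private
    2≤s[k∸ℓ] : 2 ≤ s * (k ∸ ℓ)
    2≤s[k∸ℓ] = ℕₚ.≤-trans 2≤ℓ (ℕₚ.≤-trans (ℕₚ.<⇒≤ ℓ<k) (a≤⌈a/b⌉*b k (k ∸ ℓ)))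

  instance
    s[k∸ℓ]-nonZero : NonZero (s * (k ∸ ℓ))
    s[k∸ℓ]-nonZero = >-nonZero (ℕₚ.≤-trans (s≤s z≤n) 2≤s[k∸ℓ])

  β : ℚ
  β = 1ℚ ℚ.- + 1 ℚ./ (s * (k ∸ ℓ))

  instance
    β-nonZero : ℚ.NonZero β
    β-nonZero = ℚ.>-nonZero (1-1/m>0 (s * (k ∸ ℓ)) 2≤s[k∸ℓ])

  ε₀ : ℝ → ℝ
  ε₀ Δ = fromℕ (2 * k !) *ᴿ Δ *ᴿ fromℚ ((ℚ.1/ β) ^ℚ k)

  HasExtremalSize : ∀ {n} → Subset n → Set
  HasExtremalSize {n} B = + ∣ B ∣ ≡ ℚ.floor (β ℚ.* (+ n ℚ./ 1))

  Extremal : ∀ {n} → ℝ → KGraph k n → Set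
  Extremal {n} Δ H = ∃[ B ] (HasExtremalSize B × fromℕ (e H B) ≤ᴿ Δ *ᴿ fromℕ (n ^ k))

  MinCodegreeCondition : ∀ {n} → KGraph k n → Set
  MinCodegreeCondition {n} H = + n ℚ./ (s * (k ∸ ℓ)) ℚ.≤ + δ H ℚ./ 1

  record OptimalPartition {n} (H : KGraph k n) (A B : Subset n) : Set where
    field
      partition : IsPartition A B
      size      : HasExtremalSize B
      minimal   : ∀ A* B* → IsPartition A* B* → HasExtremalSize B* → e H B ≤ e H B*

  -- Comparisons with the real ε₁ are not decidable, so A′, B′, V₀ are
  -- specified by their membership conditions rather than computed.
  record VertexClasses {n} (H : KGraph k n) (ε₁ : ℝ) (B A′ B′ V₀ : Subset n) : Set where
    field
      A′-spec : ∀ v → v ∈ A′ ⇔ (1ℝ -ᴿ ε₁) *ᴿ fromℕ (∣ B ∣ C (k ∸ 1)) ≤ᴿ fromℕ (deg H ⁅ v ⁆ B)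
      B′-spec : ∀ v → v ∈ B′ ⇔ fromℕ (deg H ⁅ v ⁆ B) ≤ᴿ ε₁ *ᴿ fromℕ (∣ B ∣ C (k ∸ 1))
      V₀-spec : V₀ ≡ ∁ (A′ ∪ B′)

  module _ {n} (H : KGraph k n) (ε₁ : ℝ) (B : Subset n) where

    Bad Good : Subset n → Set
    Bad L′  = ε₁ *ᴿ fromℕ (∣ B ∣ C (k ∸ ∣ L′ ∣)) <ᴿ fromℕ (deg H L′ B)
    Good L′ = ¬ Bad L′

    Linkable : List (Fin n) → Set
    Linkable vs = ∀ i → 1 ≤ i → i ≤ s ∸ 1 → Good (toSubset (drop ((i ∸ 1) * (k ∸ ℓ)) vs))

{-# OPTIONS --safe #-}
module Submission where

-- A Hamilton ℓ-cycle is sought as a cyclic arrangement of n positions in which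
-- every window of k consecutive positions that has to be an edge contains
-- exactly one vertex of A′ and otherwise vertices of B′, except along a few
-- pieces: the given paths and, for every vertex outside A′ ∪ B′, a short tight
-- walk in B′ through its dense link. A vertex of A′ can be made to cover s or
-- s - 1 edges of the cycle. The sq paths have at least as many edges as the q
-- vertices of A lying in B′ would have covered, so a suitable number of vertices
-- covering only s - 1 edges makes the numbers of free positions of the two kinds
-- equal to the numbers of unused vertices of A′ and of B′.
--
-- Call a partial edge good if it can be completed one vertex at a time with at
-- most θ bad choices at every step. Almost all partial edges are good because
-- e(B) is tiny and the codegree condition turns few edges inside B into many
-- edges meeting A; ends of pieces are good because they are linkable. The free
-- positions are then filled greedily, keeping every window good, apart from a
-- reserved family of positions lying far from each other. Vertices that fit too
-- few reserved positions are placed first, so that the remaining vertices can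
-- be assigned to the reserved positions by a perfect matching.
--
-- Real numbers enter only through a natural number D with 1 ≤ ε₁ D ≤ 5: all
-- smallness conditions become inequalities between natural numbers, with powers
-- of 1/D in place of powers of ε₁.

open import Defs
open import Data.Bool using (Bool; true; false; not; _∧_; _∨_; if_then_else_)
open import Data.Nat using (ℕ; zero; suc; _+_; _*_; _∸_; _^_; _≤_; _<_; z≤n; s≤s; _≤ᵇ_; _⊓_; _!; >-nonZero; _/_; _%_; NonZero; _⊔_; >-nonZero⁻¹)
open import Data.Fin using (Fin; zero; suc; toℕ; fromℕ<; cast)
open import Data.List using (List; []; _∷_; length; map; _++_; concatMap; filterᵇ; tabulate; allFin; filter; foldr; take; drop; replicate; reverse; upTo)
open import Data.List.Membership.Propositional using () renaming (_∈_ to _∈ˡ_; _∉_ to _∉ˡ_)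
open import Data.List.Relation.Unary.Any using (here; there)
open import Data.Product using (_×_; _,_; proj₁; proj₂; ∃-syntax)
open import Data.Sum using (_⊎_; inj₁; inj₂)
open import Data.Empty using (⊥-elim; ⊥)
open import Function using (_∘_; case_of_; Equivalence)
open import Relation.Nullary using (¬_; Dec; yes; no; does)
open import Relation.Binary.PropositionalEquality using (_≡_; _≢_; refl; sym; trans; cong; cong₂; subst; subst₂; module ≡-Reasoning)
open import Data.List.Membership.Propositional.Properties using (∈-++⁺ˡ; ∈-++⁺ʳ; ∈-++⁻; ∈-tabulate⁺; ∈-tabulate⁻; ∈-allFin; ∈-map⁺; ∈-filter⁺; ∈-upTo⁺)
open import Data.List.Relation.Unary.All using (All; []; _∷_)
open import Data.List.Relation.Unary.AllPairs using ([]; _∷_)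
open import Data.List.Relation.Unary.Unique.Propositional using (Unique)
open import Data.Nat.Solver using () renaming (module +-*-Solver to ℕ-Solver)
open import Data.Fin.Subset using (Subset; inside; outside; ⁅_⁆; _∪_; ∣_∣; ⊤; ∁; _∩_) renaming (⊥ to ∅; _∈_ to _∈ˢ_; _⊆_ to _⊆ˢ_)
open import Data.Vec using ([]; _∷_; lookup) renaming (tabulate to tabulateᵛ)
open import Data.Nat.Combinatorics using (_C_; nCk+nC[k+1]≡[n+1]C[k+1]; nC1≡n)
open import Data.Fin.Subset.Properties using (_⊆?_; _∈?_)
open import Relation.Nullary.Decidable using (_×-dec_; ¬?; decidable-stable)
open import Relation.Unary using (Decidable)
open import Data.Nat.DivMod using (m*n/n≡m; m≡m%n+[m/n]*n; m%n<n; m/n*n≤m)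
open import Data.List.Relation.Binary.Disjoint.Propositional using (Disjoint)
open import Data.Integer using (-[1+_])
open import Data.Rational using (ℚ; 0ℚ; 1ℚ)
open import Data.Rational.Solver using (module +-*-Solver)
open import Data.Nat.Divisibility using (_∣_; divides)
import Data.Nat.Properties as ℕₚ
import Data.Fin.Properties as Finₚ
import Data.List.Properties as Listₚ
import Data.List.Relation.Unary.All as All
import Data.List.Relation.Unary.Unique.Propositional.Properties as Uniqueₚ
import Data.Fin.Subset.Properties as Subsetₚ
import Data.Vec.Properties as Vecₚ
import Data.Integer as ℤ
import Data.Integer.Properties as ℤₚ
import Data.Integer.DivMod as ℤ-DivMod
import Data.Rational as ℚ
import Data.Rational.Properties as ℚₚ
import Data.Rational.Unnormalised as ℚᵘ
import Data.Rational.Unnormalised.Properties as ℚᵘₚ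
import Algebra.Properties.Semiring.Sum ℕₚ.+-*-semiring as Sumₚ
open import Algebra.Definitions.RawSemiring ℚ.+-*-rawSemiring using () renaming (_^_ to _^ℚ_)

-- The exponent 4 behind ε₁ creates a hierarchy of densities. A vertex outside `B′` is only known to
-- have a link of density about 1/D in `B`, so whatever spoils a walk in this link must be rarer
-- still. As e(B) is of order n^k/D^4, the non-edges with one vertex in `A′` and the others in `B′`
-- have density O(1/D^2), which suffices. Goodness turns such a density into a bound for single
-- choices: with θ about n/M, a bad set with c blanks left is missed by at least (n/M)^c tuples, so
-- D > 7 M^k excludes badness already at density 7/D. M depends only on k and ℓ, hence each position
-- rejects a fixed small share of the vertices. Greedy filling alone gets stuck once fewer vertices
-- remain than a position may reject; this is why positions are reserved. That k - ℓ does not divide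
-- k enters as ℓ < (s - 1)(k - ℓ): a vertex of `A′` covering only s - 1 edges can still be followed
-- by ℓ positions of `B′`, so all blocks begin and end alike and can be concatenated freely.

true≢false : ∀ {b : Bool} → b ≡ true → ¬ (b ≡ false)
true≢false refl ()

∧-true : ∀ {a b} → a ∧ b ≡ true → a ≡ true × b ≡ true
∧-true {true} {true} _ = refl , refl

∧-intro : ∀ {a b} → a ≡ true → b ≡ true → a ∧ b ≡ true
∧-intro refl refl = refl

not-true : ∀ {b} → not b ≡ true → b ≡ false
not-true {false} _ = refl

not-false : ∀ {b} → not b ≡ false → b ≡ true
not-false {true} _ = refl

does-true : ∀ {P : Set} (P? : Dec P) → P → does P? ≡ true
does-true (yes _) _ = refl
does-true (no ¬p) p = ⊥-elim (¬p p)

does-false : ∀ {P : Set} (P? : Dec P) → ¬ P → does P? ≡ false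
does-false (yes p) ¬p = ⊥-elim (¬p p)
does-false (no _) _ = refl

from-does : ∀ {P : Set} (P? : Dec P) → does P? ≡ true → P
from-does (yes p) _ = p

from-not-does : ∀ {P : Set} (P? : Dec P) → does P? ≡ false → ¬ P
from-not-does (no ¬p) _ = ¬p

bool-cases : ∀ b → b ≡ true ⊎ b ≡ false
bool-cases true = inj₁ refl
bool-cases false = inj₂ refl

_==_ : ∀ {n} → Fin n → Fin n → Bool
i == j = does (i Finₚ.≟ j)

==-refl : ∀ {n} (i : Fin n) → (i == i) ≡ true
==-refl i = does-true (i Finₚ.≟ i) refl

==-sound : ∀ {n} {i j : Fin n} → (i == j) ≡ true → i ≡ j
==-sound {i = i} {j} = from-does (i Finₚ.≟ j)

==-≢ : ∀ {n} {i j : Fin n} → i ≢ j → (i == j) ≡ false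
==-≢ {i = i} {j} = does-false (i Finₚ.≟ j)

ι : Bool → ℕ
ι true = 1
ι false = 0

ι-mono : ∀ {a b} → (a ≡ true → b ≡ true) → ι a ≤ ι b
ι-mono {false} _ = z≤n
ι-mono {true} f rewrite f refl = s≤s z≤n

ι≤1 : ∀ b → ι b ≤ 1
ι≤1 true = s≤s z≤n
ι≤1 false = z≤n

ι-∧ : ∀ a b → ι (a ∧ b) ≡ ι a * ι b
ι-∧ true b = sym (ℕₚ.+-identityʳ (ι b))
ι-∧ false b = refl

ι-not : ∀ b → ι b + ι (not b) ≡ 1
ι-not true = refl
ι-not false = refl

-- Sums and counting over a finite vertex set

opaque

  sum : ∀ {n} → (Fin n → ℕ) → ℕ
  sum = Sumₚ.sum

  sum-cong : ∀ {n} {f g : Fin n → ℕ} → (∀ i → f i ≡ g i) → sum f ≡ sum g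
  sum-cong = Sumₚ.sum-cong-≗

  sum-+ : ∀ {n} (f g : Fin n → ℕ) → sum (λ i → f i + g i) ≡ sum f + sum g
  sum-+ = Sumₚ.∑-distrib-+

  sum-comm : ∀ {m n} (f : Fin m → Fin n → ℕ) → sum (λ i → sum (λ j → f i j)) ≡ sum (λ j → sum (λ i → f i j))
  sum-comm = Sumₚ.∑-comm

  *-sum : ∀ {n} c (f : Fin n → ℕ) → c * sum f ≡ sum (λ i → c * f i)
  *-sum = Sumₚ.*-distribˡ-sum

  sum-mono : ∀ {n} {f g : Fin n → ℕ} → (∀ i → f i ≤ g i) → sum f ≤ sum g
  sum-mono {zero} _ = z≤n
  sum-mono {suc n} h = ℕₚ.+-mono-≤ (h zero) (sum-mono (h ∘ suc))

  sum-const : ∀ {n} c → sum {n} (λ _ → c) ≡ n * c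
  sum-const {zero} c = refl
  sum-const {suc n} c = cong (c +_) (sum-const {n} c)

  sum-+-bound : ∀ {n} {f g h : Fin n → ℕ} → (∀ i → f i ≤ g i + h i) → sum f ≤ sum g + sum h
  sum-+-bound {f = f} {g} {h} le = ℕₚ.≤-trans (sum-mono le) (ℕₚ.≤-reflexive (sum-+ g h))

  count : ∀ {n} → (Fin n → Bool) → ℕ
  count p = sum (λ i → ι (p i))

  count-sum : ∀ {n} (p : Fin n → Bool) → count p ≡ sum (λ i → ι (p i))
  count-sum p = refl

  count-mono : ∀ {n} {p q : Fin n → Bool} → (∀ i → p i ≡ true → q i ≡ true) → count p ≤ count q
  count-mono h = sum-mono (λ i → ι-mono (h i))

  count-cong : ∀ {n} {p q : Fin n → Bool} → (∀ i → p i ≡ q i) → count p ≡ count q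
  count-cong h = sum-cong (λ i → cong ι (h i))

  count≤n : ∀ {n} (p : Fin n → Bool) → count p ≤ n
  count≤n {n} p = ℕₚ.≤-trans (sum-mono (λ i → ι≤1 (p i))) (ℕₚ.≤-reflexive (trans (sum-const {n} 1) (ℕₚ.*-identityʳ n)))

  count-∨ : ∀ {n} {p q r : Fin n → Bool} → (∀ i → p i ≡ true → q i ≡ true ⊎ r i ≡ true) → count p ≤ count q + count r
  count-∨ {p = p} {q} {r} h = sum-+-bound step
    where
    step : ∀ i → ι (p i) ≤ ι (q i) + ι (r i)
    step i with bool-cases (p i)
    ... | inj₂ e rewrite e = z≤n
    ... | inj₁ e with h i e
    ...   | inj₁ e′ rewrite e′ = ℕₚ.≤-trans (ι≤1 (p i)) (s≤s z≤n)
    ...   | inj₂ e′ rewrite e′ = ℕₚ.≤-trans (ι≤1 (p i)) (ℕₚ.m≤n+m 1 (ι (q i)))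

  count-not : ∀ {n} (p : Fin n → Bool) → count p + count (not ∘ p) ≡ n
  count-not {n} p = trans (sym (sum-+ (ι ∘ p) (ι ∘ not ∘ p)))
    (trans (sum-cong (λ i → ι-not (p i))) (trans (sum-const {n} 1) (ℕₚ.*-identityʳ n)))

  count-split : ∀ {n} (p q : Fin n → Bool) → count p ≡ count (λ i → p i ∧ q i) + count (λ i → p i ∧ not (q i))
  count-split p q = trans (sum-cong (λ i → step (p i) (q i))) (sum-+ (λ i → ι (p i ∧ q i)) (λ i → ι (p i ∧ not (q i))))
    where
    step : ∀ a b → ι a ≡ ι (a ∧ b) + ι (a ∧ not b)
    step true true = refl
    step true false = refl
    step false b = refl

  count-witness : ∀ {n} (p : Fin n → Bool) → 0 < count p → ∃[ i ] p i ≡ true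
  count-witness {suc n} p lt with bool-cases (p zero)
  ... | inj₁ e = zero , e
  ... | inj₂ e rewrite e = let (i , q) = count-witness (p ∘ suc) lt in suc i , q

  count-find : ∀ {n} (p q : Fin n → Bool) → count q < count p → ∃[ i ] (p i ≡ true × q i ≡ false)
  count-find p q lt =
    let (i , e) = count-witness (λ i → p i ∧ not (q i)) (ℕₚ.≰⇒> (λ le → ℕₚ.<⇒≱ lt (bound le)))
        (a , b) = ∧-true {p i} e
    in i , a , not-true b
    where
    bound : count (λ i → p i ∧ not (q i)) ≤ 0 → count p ≤ count q
    bound le = ℕₚ.≤-trans (ℕₚ.≤-reflexive (count-split p q))
      (ℕₚ.≤-trans (ℕₚ.+-mono-≤ (count-mono (λ i e → proj₂ (∧-true {p i} e))) le) (ℕₚ.≤-reflexive (ℕₚ.+-identityʳ _)))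

  count-suc : ∀ {n} (p : Fin (suc n) → Bool) → count p ≡ ι (p zero) + count (p ∘ suc)
  count-suc p = refl

  count-all : ∀ n → count {n} (λ _ → true) ≡ n
  count-all n = trans (sum-const {n} 1) (ℕₚ.*-identityʳ n)

  count-zero : ∀ {n} {p : Fin n → Bool} → (∀ i → p i ≡ false) → count p ≡ 0
  count-zero {n} h = trans (count-cong h) (Sumₚ.sum-replicate-zero n)

  count-single : ∀ {n} (v : Fin n) → count (_== v) ≡ 1
  count-single {suc n} zero = cong suc (Sumₚ.sum-replicate-zero n)
  count-single {suc n} (suc v) = trans (count-cong (λ i → step i)) (count-single v)
    where
    step : ∀ i → (suc i == suc v) ≡ (i == v)
    step i with i Finₚ.≟ v
    ... | yes refl = refl
    ... | no i≢v = refl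

  count-remove : ∀ {n} {p : Fin n → Bool} {v} → p v ≡ true → count p ≡ suc (count (λ i → p i ∧ not (i == v)))
  count-remove {p = p} {v} pv = trans (count-split p (_== v))
    (cong (_+ count (λ i → p i ∧ not (i == v))) (trans (count-cong step) (count-single v)))
    where
    step : ∀ i → p i ∧ (i == v) ≡ (i == v)
    step i with bool-cases (i == v)
    ... | inj₁ e rewrite e | ==-sound {i = i} {v} e | pv = refl
    ... | inj₂ e rewrite e with p i
    ...   | true = refl
    ...   | false = refl

-- Predicates collected over a list

anyˡ : {A : Set} → (A → Bool) → List A → Bool
anyˡ f [] = false
anyˡ f (x ∷ xs) = f x ∨ anyˡ f xs

anyˡ-intro : {A : Set} (f : A → Bool) {xs : List A} {x : A} → x ∈ˡ xs → f x ≡ true → anyˡ f xs ≡ true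
anyˡ-intro f (here refl) e rewrite e = refl
anyˡ-intro f {y ∷ xs} (there m) e with f y
... | true = refl
... | false = anyˡ-intro f m e

anyˡ-elim : {A : Set} (f : A → Bool) (xs : List A) → anyˡ f xs ≡ true → ∃[ x ] (x ∈ˡ xs × f x ≡ true)
anyˡ-elim f (x ∷ xs) e with bool-cases (f x)
... | inj₁ t = x , here refl , t
... | inj₂ t rewrite t = let (y , m , h) = anyˡ-elim f xs e in y , there m , h

anyˡ-false : {A : Set} (f : A → Bool) {xs : List A} {x : A} → anyˡ f xs ≡ false → x ∈ˡ xs → f x ≡ false
anyˡ-false f {x = x} e m with bool-cases (f x)
... | inj₁ t = ⊥-elim (true≢false (anyˡ-intro f m t) e)
... | inj₂ t = t

count-anyˡ : ∀ {n} {A : Set} (f : A → Fin n → Bool) (xs : List A) c → (∀ x → x ∈ˡ xs → count (f x) ≤ c) →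
             count (λ v → anyˡ (λ x → f x v) xs) ≤ length xs * c
count-anyˡ {n} f [] c h = ℕₚ.≤-reflexive (count-zero {n} (λ _ → refl))
count-anyˡ f (x ∷ xs) c h = ℕₚ.≤-trans
  (count-∨ {p = λ v → anyˡ (λ x → f x v) (x ∷ xs)} {q = f x} {r = λ v → anyˡ (λ y → f y v) xs} step)
  (ℕₚ.+-mono-≤ (h x (here refl)) (count-anyˡ f xs c (λ y m → h y (there m))))
  where
  step : ∀ i → f x i ∨ anyˡ (λ y → f y i) xs ≡ true → f x i ≡ true ⊎ anyˡ (λ y → f y i) xs ≡ true
  step i e with f x i
  ... | true = inj₁ refl
  ... | false = inj₂ e

memberˡ : ∀ {n} → List (Fin n) → Fin n → Bool
memberˡ xs v = anyˡ (λ x → v == x) xs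

memberˡ-intro : ∀ {n} {xs : List (Fin n)} {v} → v ∈ˡ xs → memberˡ xs v ≡ true
memberˡ-intro {v = v} m = anyˡ-intro (λ x → v == x) m (==-refl v)

memberˡ-elim : ∀ {n} (xs : List (Fin n)) {v} → memberˡ xs v ≡ true → v ∈ˡ xs
memberˡ-elim xs {v} e = let (x , m , eq) = anyˡ-elim (λ x → v == x) xs e in subst (_∈ˡ xs) (sym (==-sound eq)) m

memberˡ-∉ : ∀ {n} (xs : List (Fin n)) {v} → memberˡ xs v ≡ false → v ∉ˡ xs
memberˡ-∉ xs e m = true≢false (memberˡ-intro m) e

count-memberˡ : ∀ {n} (xs : List (Fin n)) → count (memberˡ xs) ≤ length xs
count-memberˡ xs = ℕₚ.≤-trans
  (count-anyˡ (λ x v → v == x) xs 1 (λ x _ → ℕₚ.≤-reflexive (count-single x)))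
  (ℕₚ.≤-reflexive (ℕₚ.*-identityʳ _))

-- Perfect matchings by transpositions

Injectiveᶠ : ∀ {m n} → (Fin m → Fin n) → Set
Injectiveᶠ f = ∀ i j → f i ≡ f j → i ≡ j

count-inj : ∀ {t n} (φ : Fin t → Fin n) → Injectiveᶠ φ → (p : Fin n → Bool) → count (p ∘ φ) ≤ count p
count-inj {zero} φ inj p = ℕₚ.≤-trans (ℕₚ.≤-reflexive (count-zero (λ ()))) z≤n
count-inj {suc t} {n} φ inj p = ℕₚ.≤-trans (ℕₚ.≤-reflexive (count-suc (p ∘ φ))) (step (bool-cases (p (φ zero))))
  where
  φ′ : Fin t → Fin n
  φ′ = φ ∘ suc
  inj′ : Injectiveᶠ φ′
  inj′ i j eq = Finₚ.suc-injective (inj _ _ eq)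
  p′ : Fin n → Bool
  p′ i = p i ∧ not (i == φ zero)
  step : p (φ zero) ≡ true ⊎ p (φ zero) ≡ false → ι (p (φ zero)) + count (p ∘ φ′) ≤ count p
  step (inj₂ e) = subst (λ b → ι b + count (p ∘ φ′) ≤ count p) (sym e) (count-inj φ′ inj′ p)
  step (inj₁ e) = subst₂ (λ b c → ι b + count (p ∘ φ′) ≤ c) (sym e) (sym (count-remove {p = p} e))
    (s≤s (ℕₚ.≤-trans (count-mono {p = p ∘ φ′} {q = p′ ∘ φ′} (λ i q → ∧-intro q (cong not (==-≢ (λ eq → case inj _ _ eq of λ ())))))
                     (count-inj φ′ inj′ p′)))

enumerate : ∀ t {n} (p : Fin n → Bool) → t ≤ count p → ∃[ φ ] (Injectiveᶠ {t} φ × (∀ i → p (φ i) ≡ true))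
enumerate zero p _ = (λ ()) , (λ ()) , (λ ())
enumerate (suc t) {n} p le =
  let (v , pv) = count-witness p (ℕₚ.≤-trans (s≤s z≤n) le)
      (φ , inj , pφ) = enumerate t (λ i → p i ∧ not (i == v)) (ℕₚ.≤-pred (subst (suc t ≤_) (count-remove {p = p} pv) le))
  in ext v φ , ext-inj v φ inj (λ i eq → true≢false (==-refl v) (trans (cong (_== v) (sym eq)) (not-true (proj₂ (∧-true {p (φ i)} (pφ i)))))) ,
     λ { zero → pv ; (suc i) → proj₁ (∧-true {p (φ i)} (pφ i)) }
  where
  ext : Fin n → (Fin t → Fin n) → Fin (suc t) → Fin n
  ext v φ zero = v
  ext v φ (suc i) = φ i
  ext-inj : ∀ v φ → Injectiveᶠ φ → (∀ i → φ i ≢ v) → Injectiveᶠ (ext v φ)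
  ext-inj v φ inj ne zero zero _ = refl
  ext-inj v φ inj ne zero (suc j) eq = ⊥-elim (ne j (sym eq))
  ext-inj v φ inj ne (suc i) zero eq = ⊥-elim (ne i eq)
  ext-inj v φ inj ne (suc i) (suc j) eq = cong suc (inj i j eq)

module Matching {t n : ℕ} (U : Fin n → Bool) (t≤U : t ≤ count U) (bad : Fin t → Fin n → Bool)
  (sparse : ∀ i v → U v ≡ true → count (λ u → U u ∧ bad i u) + count (λ j → bad j v) < t) where

  swap : Fin t → Fin t → Fin t → Fin t
  swap i j x = if x == i then j else (if x == j then i else x)

  swap-i : ∀ i j → swap i j i ≡ j
  swap-i i j rewrite ==-refl i = refl

  swap-j : ∀ i j → swap i j j ≡ i
  swap-j i j with bool-cases (j == i)
  ... | inj₁ e rewrite e = ==-sound {i = j} {i} e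
  ... | inj₂ e rewrite e | ==-refl j = refl

  swap-other : ∀ i j x → x ≢ i → x ≢ j → swap i j x ≡ x
  swap-other i j x x≢i x≢j rewrite ==-≢ x≢i | ==-≢ x≢j = refl

  swap-involutive : ∀ i j x → swap i j (swap i j x) ≡ x
  swap-involutive i j x with x Finₚ.≟ i
  ... | yes refl = swap-j x j
  ... | no x≢i with x Finₚ.≟ j
  ...   | yes refl = swap-i i x
  ...   | no x≢j = swap-other i j x x≢i x≢j

  swap-injective : ∀ i j x y → swap i j x ≡ swap i j y → x ≡ y
  swap-injective i j x y eq = trans (sym (swap-involutive i j x)) (trans (cong (swap i j) eq) (swap-involutive i j y))

  swap-fewer : ∀ (φ : Fin t → Fin n) i j → bad i (φ j) ≡ false → bad j (φ i) ≡ false →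
               ∀ x → bad x (φ (swap i j x)) ≡ true → bad x (φ x) ∧ not (x == i) ≡ true
  swap-fewer φ i j good₁ good₂ x b with x Finₚ.≟ i
  ... | yes refl = ⊥-elim (true≢false b good₁)
  ... | no x≢i with x Finₚ.≟ j
  ...   | yes refl = ⊥-elim (true≢false b good₂)
  ...   | no x≢j = ∧-intro b refl

  Result : Set
  Result = ∃[ φ ] (Injectiveᶠ {t} φ × (∀ i → U (φ i) ≡ true) × (∀ i → bad i (φ i) ≡ false))

  -- Any injection serves as a start. If `i` holds an unsuitable vertex, an index `j` is excluded
  -- when `i` rejects `φ j` or `j` rejects `φ i`; by `sparse` fewer than t indices are excluded.
  -- Swapping with a remaining `j` (automatically different from `i`, since `i` rejects `φ i`)
  -- repairs `i` and spoils nothing, so the number of bad indices, bounded by `fuel`, drops.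
  improve : ∀ fuel (φ : Fin t → Fin n) → Injectiveᶠ φ → (∀ i → U (φ i) ≡ true) → count (λ i → bad i (φ i)) ≤ fuel → Result
  improve zero φ inj Uφ le = φ , inj , Uφ , λ i → case bool-cases (bad i (φ i)) of λ
    { (inj₂ e) → e
    ; (inj₁ e) → case ℕₚ.≤-trans (ℕₚ.≤-reflexive (sym (count-remove {p = λ j → bad j (φ j)} e))) le of λ () }
  improve (suc fuel) φ inj Uφ le with bool-cases (1 ≤ᵇ count (λ i → bad i (φ i)))
  ... | inj₂ e = improve fuel φ inj Uφ (ℕₚ.≤-trans (none e) z≤n)
    where
    none : ∀ {c} → (1 ≤ᵇ c) ≡ false → c ≤ 0
    none {zero} _ = z≤n
    none {suc c} ()
  ... | inj₁ e = improve fuel (φ ∘ swap i j) (λ x y eq → swap-injective i j x y (inj _ _ eq)) (λ x → Uφ (swap i j x))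
      (ℕₚ.≤-pred (ℕₚ.≤-trans (ℕₚ.≤-trans (s≤s (count-mono fewer)) (ℕₚ.≤-reflexive (sym (count-remove {p = λ x → bad x (φ x)} bad-i)))) le))
    where
    some : ∀ {c} → (1 ≤ᵇ c) ≡ true → 0 < c
    some {suc c} _ = s≤s z≤n
    wit : ∃[ i ] bad i (φ i) ≡ true
    wit = count-witness (λ i → bad i (φ i)) (some e)
    i : Fin t
    i = proj₁ wit
    bad-i : bad i (φ i) ≡ true
    bad-i = proj₂ wit
    r : Fin t → Bool
    r j = bad i (φ j) ∨ bad j (φ i)
    r-elim : ∀ j → r j ≡ true → bad i (φ j) ≡ true ⊎ bad j (φ i) ≡ true
    r-elim j eq with bad i (φ j)
    ... | true = inj₁ refl
    ... | false = inj₂ eq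
    few : count r < t
    few = ℕₚ.≤-<-trans
      (ℕₚ.≤-trans (count-∨ {p = r} {q = λ j → bad i (φ j)} {r = λ j → bad j (φ i)} r-elim)
        (ℕₚ.+-monoˡ-≤ _ (ℕₚ.≤-trans (count-mono {p = λ j → bad i (φ j)} {q = (λ u → U u ∧ bad i u) ∘ φ} (λ j q → ∧-intro (Uφ j) q))
                                    (count-inj φ inj (λ u → U u ∧ bad i u)))))
      (sparse i (φ i) (Uφ i))
    all-true : count {t} (λ _ → true) ≡ t
    all-true = count-all t
    found : ∃[ j ] (true ≡ true × r j ≡ false)
    found = count-find (λ _ → true) r (subst (count r <_) (sym all-true) few)
    j : Fin t
    j = proj₁ found
    r-false : ∀ {a b} → a ∨ b ≡ false → a ≡ false × b ≡ false
    r-false {false} {false} _ = refl , refl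
    good₁ : bad i (φ j) ≡ false
    good₁ = proj₁ (r-false {bad i (φ j)} (proj₂ (proj₂ found)))
    good₂ : bad j (φ i) ≡ false
    good₂ = proj₂ (r-false {bad i (φ j)} (proj₂ (proj₂ found)))
    fewer : ∀ x → bad x (φ (swap i j x)) ≡ true → bad x (φ x) ∧ not (x == i) ≡ true
    fewer = swap-fewer φ i j good₁ good₂

  perfect-matching : Result
  perfect-matching =
    let (φ , inj , Uφ) = enumerate t U t≤U
    in improve (count (λ i → bad i (φ i))) φ inj Uφ ℕₚ.≤-refl

-- Partial assignments of vertices to positions

-- A blank already prescribes the class of the vertex to come: in the application `true` stands for
-- A′ and `false` for B′.
data Cell (n : ℕ) : Set where
  fixed : Fin n → Cell n
  blank : Bool → Cell n

isBlank : ∀ {n} → Bool → Cell n → Bool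
isBlank τ (fixed _) = false
isBlank true (blank σ) = σ
isBlank false (blank σ) = not σ

isBlank-blank : ∀ {n} τ → isBlank {n} τ (blank τ) ≡ true
isBlank-blank true = refl
isBlank-blank false = refl

isBlank-sound : ∀ {n} τ {c : Cell n} → isBlank τ c ≡ true → c ≡ blank τ
isBlank-sound true {blank true} _ = refl
isBlank-sound false {blank false} _ = refl

upd : ∀ {n} → (Fin n → Cell n) → Fin n → Cell n → Fin n → Cell n
upd c p x q = if q == p then x else c q

upd-same : ∀ {n} (c : Fin n → Cell n) p x → upd c p x p ≡ x
upd-same c p x rewrite ==-refl p = refl

upd-other : ∀ {n} (c : Fin n → Cell n) p x {q} → q ≢ p → upd c p x q ≡ c q
upd-other c p x q≢p rewrite ==-≢ q≢p = refl

length-concatMap : {A B : Set} (f : A → List B) (xs : List A) (c : ℕ) → (∀ x → length (f x) ≤ c) → length (concatMap f xs) ≤ length xs * c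
length-concatMap f [] c h = z≤n
length-concatMap f (x ∷ xs) c h = ℕₚ.≤-trans (ℕₚ.≤-reflexive (Listₚ.length-++ (f x))) (ℕₚ.+-mono-≤ (h x) (length-concatMap f xs c h))

∈-concatMap⁺ : {A B : Set} (f : A → List B) {xs : List A} {x : A} {y : B} → x ∈ˡ xs → y ∈ˡ f x → y ∈ˡ concatMap f xs
∈-concatMap⁺ f (here refl) m = ∈-++⁺ˡ m
∈-concatMap⁺ f {x′ ∷ _} (there x∈) m = ∈-++⁺ʳ (f x′) (∈-concatMap⁺ f x∈ m)

∈-filterᵇ⁺ : {A : Set} (f : A → Bool) {xs : List A} {x : A} → x ∈ˡ xs → f x ≡ true → x ∈ˡ filterᵇ f xs
∈-filterᵇ⁺ f {x ∷ xs} (here refl) e rewrite e = here refl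
∈-filterᵇ⁺ f {y ∷ xs} (there m) e with f y
... | true = there (∈-filterᵇ⁺ f m e)
... | false = ∈-filterᵇ⁺ f m e

∈-filterᵇ⁻ : {A : Set} (f : A → Bool) {xs : List A} {x : A} → x ∈ˡ filterᵇ f xs → f x ≡ true
∈-filterᵇ⁻ f {y ∷ xs} m with bool-cases (f y)
... | inj₂ e rewrite e = ∈-filterᵇ⁻ f {xs} m
... | inj₁ e rewrite e with m
...   | here refl = e
...   | there m′ = ∈-filterᵇ⁻ f {xs} m′

length-filterᵇ : {A : Set} (f : A → Bool) (xs : List A) → length (filterᵇ f xs) ≤ length xs
length-filterᵇ f [] = z≤n
length-filterᵇ f (x ∷ xs) with f x
... | true = s≤s (length-filterᵇ f xs)
... | false = ℕₚ.≤-trans (length-filterᵇ f xs) (ℕₚ.n≤1+n _)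

IsBlank : ∀ {n} → Cell n → Set
IsBlank c = ∃[ σ ] c ≡ blank σ

cell-cases : ∀ {n} (c : Cell n) → IsBlank c ⊎ (∃[ v ] c ≡ fixed v)
cell-cases (fixed v) = inj₂ (v , refl)
cell-cases (blank σ) = inj₁ (σ , refl)

fixed≢blank : ∀ {n} {v : Fin n} {σ} → ¬ (fixed v ≡ blank σ)
fixed≢blank ()

fixed-injective : ∀ {n} {u v : Fin n} → fixed u ≡ fixed v → u ≡ v
fixed-injective refl = refl

memberˡ-cases : ∀ {n} (xs : List (Fin n)) v → v ∈ˡ xs ⊎ v ∉ˡ xs
memberˡ-cases xs v with bool-cases (memberˡ xs v)
... | inj₁ e = inj₁ (memberˡ-elim xs e)
... | inj₂ e = inj₂ (memberˡ-∉ xs e)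

∨-elim : ∀ {a b} → a ∨ b ≡ true → a ≡ true ⊎ b ≡ true
∨-elim {true} _ = inj₁ refl
∨-elim {false} e = inj₂ e

∨-false : ∀ {a b} → a ∨ b ≡ false → a ≡ false × b ≡ false
∨-false {false} {false} _ = refl , refl

∧-cong-true : ∀ {a b} → a ≡ true → a ∧ b ≡ false → b ≡ false
∧-cong-true refl e = e

-- The cyclic arrangement with everything forgotten except what the filling argument uses: each
-- window rejects few vertices at each of its blanks (`Ok-extend`), and a wholly blank window
-- accepts any first vertex of the prescribed class (`Ok-lone`). Positions and vertices are both
-- indexed by `Fin n`.
record FillingProblem (n m : ℕ) : Set where
  no-eta-equality
  field
    X           : Bool → Fin n → Bool
    X-disjoint  : ∀ v τ → X τ v ≡ true → X (not τ) v ≡ false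
    W           : Fin m → List (Fin n)
    ws          : Fin n → List (Fin m)
    K k θ       : ℕ
    ws-length   : ∀ p → length (ws p) ≤ K
    ws-complete : ∀ {p w} → p ∈ˡ W w → w ∈ˡ ws p
    W-length    : ∀ w → length (W w) ≤ k
    Ok          : (Fin n → Cell n) → Fin m → Bool
    Ok-local    : ∀ {c c′} w → (∀ {p} → p ∈ˡ W w → c p ≡ c′ p) → Ok c w ≡ Ok c′ w
    Ok-extend   : ∀ c w p τ → p ∈ˡ W w → c p ≡ blank τ → Ok c w ≡ true →
                  count (λ v → X τ v ∧ not (Ok (upd c p (fixed v)) w)) ≤ θ
    cell₀       : Fin n → Cell n
    Ok-lone     : ∀ w p τ z → p ∈ˡ W w → (∀ {q} → q ∈ˡ W w → IsBlank (cell₀ q)) → cell₀ p ≡ blank τ → X τ z ≡ true →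
                  Ok (upd cell₀ p (fixed z)) w ≡ true
    slot-room   : ∀ τ t → t ≡ suc (K * θ + K * θ) → (t + t) * suc (K * k) ≤ count (λ p → isBlank τ (cell₀ p))

few-identity : ∀ a b c → a * b + c + a ≡ a * suc b + c
few-identity = solve 3 (λ a b c → a :* b :+ c :+ a := a :* (con 1 :+ b) :+ c) refl
  where open ℕ-Solver

module Filling {n m : ℕ} (problem : FillingProblem n m) where

  open FillingProblem problem

  record State : Set where
    field
      cell    : Fin n → Cell n
      un      : Fin n → Bool
      inj     : ∀ {p q v} → cell p ≡ fixed v → cell q ≡ fixed v → p ≡ q
      fresh   : ∀ {p v} → un v ≡ true → cell p ≢ fixed v
      balance : ∀ τ → count (λ v → X τ v ∧ un v) ≡ count (λ p → isBlank τ (cell p))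
      good    : ∀ w → Ok cell w ≡ true
      origin  : ∀ {p τ} → cell p ≡ blank τ → cell₀ p ≡ blank τ

  open State

  -- `U` bounds the vertices that the windows through one position can reject together; `L` bounds
  -- the positions sharing a window with a given one, itself included.
  U L : ℕ
  U = K * θ
  L = suc (K * k)

  abstract
    -- In the final matching a slot rejects at most `U` vertices and a vertex is rejected by at most
    -- `U` slots; one more slot than both together makes a suitable swap exist.
    T : ℕ
    T = suc (U + U)

    T-def : T ≡ suc (U + U)
    T-def = refl

  Apart : Fin n → Fin n → Set
  Apart p q = p ≢ q × (∀ w → p ∈ˡ W w → q ∉ˡ W w)

  Apart-sym : ∀ {p q} → Apart p q → Apart q p
  Apart-sym (ne , h) = (λ e → ne (sym e)) , λ w a b → h w b a

  near : Fin n → List (Fin n)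
  near p = p ∷ concatMap W (ws p)

  near-complete : ∀ {p q w} → p ∈ˡ W w → q ∈ˡ W w → q ∈ˡ near p
  near-complete a b = there (∈-concatMap⁺ W (ws-complete a) b)

  near-length : ∀ p → length (near p) ≤ L
  near-length p = s≤s (ℕₚ.≤-trans (length-concatMap W (ws p) k W-length) (ℕₚ.*-monoˡ-≤ k (ws-length p)))

  count-near : ∀ xs → count (λ p → anyˡ (λ q → memberˡ (near q) p) xs) ≤ length xs * L
  count-near xs = count-anyˡ (λ q → memberˡ (near q)) xs L (λ q _ → ℕₚ.≤-trans (count-memberˡ (near q)) (near-length q))

  not-near : ∀ {p q} → memberˡ (near q) p ≡ false → Apart p q
  not-near {p} {q} e = (λ { refl → memberˡ-∉ (near q) e (here refl) }) , λ w a b → memberˡ-∉ (near q) e (near-complete b a)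

  record Slots (t : ℕ) (τ : Bool) (avoid : List (Fin n)) : Set where
    field
      at       : Fin t → Fin n
      at-blank : ∀ i → cell₀ (at i) ≡ blank τ
      at-apart : ∀ i j → i ≢ j → Apart (at i) (at j)
      at-avoid : ∀ i {a} → a ∈ˡ avoid → Apart (at i) a

  -- Greedy: every position chosen or avoided so far excludes at most `L` positions, those sharing a
  -- window with it.
  choose-slots : ∀ t τ avoid → (length avoid + t) * L ≤ count (λ p → isBlank τ (cell₀ p)) → Slots t τ avoid
  choose-slots zero τ avoid _ = record { at = λ () ; at-blank = λ () ; at-apart = λ () ; at-avoid = λ () }
  choose-slots (suc t) τ avoid room = build
      (count-find (λ p → isBlank τ (cell₀ p)) (λ p → anyˡ (λ q → memberˡ (near q) p) avoid)
        (ℕₚ.≤-<-trans (count-near avoid) (ℕₚ.<-≤-trans step room)))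
    where
    step : length avoid * L < (length avoid + suc t) * L
    step = ℕₚ.*-monoˡ-< L (ℕₚ.≤-trans (ℕₚ.≤-reflexive (ℕₚ.+-comm 1 (length avoid))) (ℕₚ.+-monoʳ-≤ (length avoid) (s≤s z≤n)))
    build : ∃[ p ] (isBlank τ (cell₀ p) ≡ true × anyˡ (λ q → memberˡ (near q) p) avoid ≡ false) → Slots (suc t) τ avoid
    build (p , b , a) = record
      { at = at′ ; at-blank = λ { zero → isBlank-sound τ b ; (suc i) → at-blank i }
      ; at-apart = apart ; at-avoid = λ { zero m → p-avoid m ; (suc i) m → at-avoid i (there m) } }
      where
      open Slots (choose-slots t τ (p ∷ avoid) (subst (λ x → x * L ≤ count (λ p → isBlank τ (cell₀ p))) (ℕₚ.+-suc (length avoid) t) room))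
      at′ : Fin (suc t) → Fin n
      at′ zero = p
      at′ (suc i) = at i
      p-avoid : ∀ {a} → a ∈ˡ avoid → Apart p a
      p-avoid m = not-near (anyˡ-false (λ q → memberˡ (near q) p) a m)
      apart : ∀ i j → i ≢ j → Apart (at′ i) (at′ j)
      apart zero zero ne = ⊥-elim (ne refl)
      apart zero (suc j) ne = Apart-sym (at-avoid j (here refl))
      apart (suc i) zero ne = at-avoid i (here refl)
      apart (suc i) (suc j) ne = at-apart i j (λ e → ne (cong suc e))

  record Placement (st : State) (p : Fin n) (τ : Bool) (v : Fin n) : Set where
    no-eta-equality
    field
      p-blank : cell st p ≡ blank τ
      v-un    : un st v ≡ true
      v-X     : X τ v ≡ true
      v-ok    : ∀ w → p ∈ˡ W w → Ok (upd (cell st) p (fixed v)) w ≡ true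

  module Place {st : State} {p : Fin n} {τ : Bool} {v : Fin n} (placement : Placement st p τ v) where

    open Placement placement

    cell′ : Fin n → Cell n
    cell′ = upd (cell st) p (fixed v)

    at-p : cell′ p ≡ fixed v
    at-p = upd-same (cell st) p (fixed v)

    off-p : ∀ {q} → q ≢ p → cell′ q ≡ cell st q
    off-p = upd-other (cell st) p (fixed v)

    un′ : Fin n → Bool
    un′ u = un st u ∧ not (u == v)

    un′-un : ∀ {u} → un′ u ≡ true → un st u ≡ true × u ≢ v
    un′-un {u} e with ∧-true {un st u} e
    ... | a , b = a , λ { refl → true≢false (==-refl v) (not-true b) }

    un′-intro : ∀ {u} → un st u ≡ true → u ≢ v → un′ u ≡ true
    un′-intro a ne = ∧-intro a (cong not (==-≢ ne))

    kept : ∀ {q u} → cell st q ≡ fixed u → cell′ q ≡ fixed u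
    kept {q} e with q Finₚ.≟ p
    ... | yes refl = ⊥-elim (fixed≢blank (trans (sym e) p-blank))
    ... | no ne = e

    balance-same : count (λ u → X τ u ∧ un′ u) ≡ count (λ q → isBlank τ (cell′ q))
    balance-same = ℕₚ.suc-injective (begin
        suc (count (λ u → X τ u ∧ un′ u))                  ≡⟨ cong suc (count-cong (λ u → assoc (X τ u) (un st u) _)) ⟩
        suc (count (λ u → (X τ u ∧ un st u) ∧ not (u == v))) ≡⟨ count-remove {p = λ u → X τ u ∧ un st u} (∧-intro v-X v-un) ⟨
        count (λ u → X τ u ∧ un st u)                      ≡⟨ balance st τ ⟩
        count (λ q → isBlank τ (cell st q))                ≡⟨ count-remove {p = λ q → isBlank τ (cell st q)} (trans (cong (isBlank τ) p-blank) (isBlank-blank τ)) ⟩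
        suc (count (λ q → isBlank τ (cell st q) ∧ not (q == p))) ≡⟨ cong suc (count-cong same) ⟩
        suc (count (λ q → isBlank τ (cell′ q)))            ∎)
      where
      open ≡-Reasoning
      assoc : ∀ a b c → a ∧ (b ∧ c) ≡ (a ∧ b) ∧ c
      assoc true b c = refl
      assoc false b c = refl
      same : ∀ q → isBlank τ (cell st q) ∧ not (q == p) ≡ isBlank τ (cell′ q)
      same q with q Finₚ.≟ p
      ... | yes _ with isBlank τ (cell st q)
      ...   | true = refl
      ...   | false = refl
      same q | no _ with isBlank τ (cell st q)
      ...   | true = refl
      ...   | false = refl

    balance-other : ∀ σ → isBlank {n} σ (blank τ) ≡ false → X σ v ≡ false →
                    count (λ u → X σ u ∧ un′ u) ≡ count (λ q → isBlank σ (cell′ q))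
    balance-other σ not-σ not-X = trans (count-cong left) (trans (balance st σ) (count-cong right))
      where
      left : ∀ u → X σ u ∧ un′ u ≡ X σ u ∧ un st u
      left u with u Finₚ.≟ v
      ... | yes refl rewrite not-X = refl
      ... | no _ with un st u
      ...   | true = refl
      ...   | false = refl
      right : ∀ q → isBlank σ (cell st q) ≡ isBlank σ (cell′ q)
      right q with q Finₚ.≟ p
      ... | yes refl rewrite p-blank = not-σ
      ... | no _ = refl

    balance′ : ∀ τ₀ → τ ≡ τ₀ → ∀ σ → count (λ u → X σ u ∧ un′ u) ≡ count (λ q → isBlank σ (cell′ q))
    balance′ true refl true = balance-same
    balance′ false refl false = balance-same
    balance′ true refl false = balance-other false refl (X-disjoint v true v-X)
    balance′ false refl true = balance-other true refl (X-disjoint v false v-X)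

    placed : State
    placed = record
      { cell = cell′ ; un = un′
      ; inj = inj′
      ; fresh = fresh′
      ; balance = balance′ τ refl
      ; good = λ w → good′ w (memberˡ-cases (W w) p)
      ; origin = origin′ }
      where
      inj′ : ∀ {q r u} → cell′ q ≡ fixed u → cell′ r ≡ fixed u → q ≡ r
      inj′ {q} {r} a b with q Finₚ.≟ p | r Finₚ.≟ p
      ... | yes refl | yes refl = refl
      ... | no _ | no _ = inj st a b
      ... | yes refl | no _ = ⊥-elim (fresh st v-un (trans b (cong fixed (sym (fixed-injective a)))))
      ... | no _ | yes refl = ⊥-elim (fresh st v-un (trans a (cong fixed (sym (fixed-injective b)))))
      fresh′ : ∀ {q u} → un′ u ≡ true → cell′ q ≢ fixed u
      fresh′ {q} e a with q Finₚ.≟ p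
      ... | yes refl = proj₂ (un′-un e) (sym (fixed-injective a))
      ... | no _ = fresh st (proj₁ (un′-un e)) a
      good′ : ∀ w → p ∈ˡ W w ⊎ p ∉ˡ W w → Ok cell′ w ≡ true
      good′ w (inj₁ m) = v-ok w m
      good′ w (inj₂ ∉) = trans (Ok-local w (λ {q} m → off-p (λ { refl → ∉ m }))) (good st w)
      origin′ : ∀ {q σ} → cell′ q ≡ blank σ → cell₀ q ≡ blank σ
      origin′ {q} e with q Finₚ.≟ p
      ... | yes refl = ⊥-elim (fixed≢blank e)
      ... | no _ = origin st e

  Completed : Set
  Completed = ∃[ f ] (Injectiveᶠ {n} {n} f × (∀ w → Ok (λ p → fixed (f p)) w ≡ true))

  opaque

    slotsᵗ : Slots T true []
    slotsᵗ = choose-slots T true [] (ℕₚ.≤-trans (ℕₚ.*-monoˡ-≤ L (ℕₚ.m≤m+n T T)) (slot-room true T T-def))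

    slotsᶠ : Slots T false (tabulate (Slots.at slotsᵗ))
    slotsᶠ = choose-slots T false (tabulate (Slots.at slotsᵗ))
      (subst (λ x → (x + T) * L ≤ count (λ p → isBlank false (cell₀ p))) (sym (Listₚ.length-tabulate (Slots.at slotsᵗ))) (slot-room false T T-def))

    slots : Bool → Fin T → Fin n
    slots true = Slots.at slotsᵗ
    slots false = Slots.at slotsᶠ

    cross : ∀ i j → Apart (slots false i) (slots true j)
    cross i j = Slots.at-avoid slotsᶠ i (∈-tabulate⁺ {f = Slots.at slotsᵗ} j)

    slots-blank : ∀ τ i → cell₀ (slots τ i) ≡ blank τ
    slots-blank true = Slots.at-blank slotsᵗ
    slots-blank false = Slots.at-blank slotsᶠ

    slots-apart : ∀ σ τ i j → slots σ i ≢ slots τ j → Apart (slots σ i) (slots τ j)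
    slots-apart true true i j ne = Slots.at-apart slotsᵗ i j (λ { refl → ne refl })
    slots-apart false false i j ne = Slots.at-apart slotsᶠ i j (λ { refl → ne refl })
    slots-apart false true i j ne = cross i j
    slots-apart true false i j ne = Apart-sym (cross j i)

    slots-inj : ∀ (τ : Bool) → Injectiveᶠ (slots τ)
    slots-inj τ i j e with i Finₚ.≟ j
    slots-inj τ i j e | yes eq = eq
    slots-inj true i j e | no ne = ⊥-elim (proj₁ (Slots.at-apart slotsᵗ i j ne) e)
    slots-inj false i j e | no ne = ⊥-elim (proj₁ (Slots.at-apart slotsᶠ i j ne) e)

    slots-types : ∀ i j → slots true i ≢ slots false j
    slots-types i j e = proj₁ (cross j i) (sym e)

  slotList : List (Fin n)
  slotList = tabulate (slots true) ++ tabulate (slots false)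

  slot-∈ : ∀ τ i → slots τ i ∈ˡ slotList
  slot-∈ true i = ∈-++⁺ˡ (∈-tabulate⁺ {f = slots true} i)
  slot-∈ false i = ∈-++⁺ʳ (tabulate (slots true)) (∈-tabulate⁺ {f = slots false} i)

  slot-∈⁻ : ∀ {p} → p ∈ˡ slotList → ∃[ τ ] ∃[ i ] p ≡ slots τ i
  slot-∈⁻ m with ∈-++⁻ (tabulate (slots true)) m
  ... | inj₁ m′ = let (i , e) = ∈-tabulate⁻ {f = slots true} m′ in true , i , e
  ... | inj₂ m′ = let (i , e) = ∈-tabulate⁻ {f = slots false} m′ in false , i , e

  slotList-length : length slotList ≡ T + T
  slotList-length = trans (Listₚ.length-++ (tabulate (slots true))) (cong₂ _+_ (Listₚ.length-tabulate (slots true)) (Listₚ.length-tabulate (slots false)))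

  Open : State → Set
  Open st = ∀ τ i → cell st (slots τ i) ≡ blank τ

  T≤blank : ∀ st → Open st → ∀ τ → T ≤ count (λ p → isBlank τ (cell st p))
  T≤blank st op τ = ℕₚ.≤-trans (ℕₚ.≤-reflexive (sym (count-all T)))
    (ℕₚ.≤-trans (count-mono (λ i _ → trans (cong (isBlank τ) (op τ i)) (isBlank-blank τ))) (count-inj (slots τ) (slots-inj τ) _))

  fits : State → Fin n → Bool → List (Fin m) → Fin n → Bool
  fits st p τ zs v = anyˡ (λ w → memberˡ (W w) p ∧ (X τ v ∧ not (Ok (upd (cell st) p (fixed v)) w))) zs

  count-unfit : ∀ st p τ → cell st p ≡ blank τ → count (fits st p τ (ws p)) ≤ U
  count-unfit st p τ e = ℕₚ.≤-trans (count-anyˡ (λ w v → memberˡ (W w) p ∧ (X τ v ∧ not (Ok (upd (cell st) p (fixed v)) w))) (ws p) θ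
      (λ w _ → each w (bool-cases (memberˡ (W w) p))))
    (ℕₚ.*-monoˡ-≤ θ (ws-length p))
    where
    each : ∀ w → memberˡ (W w) p ≡ true ⊎ memberˡ (W w) p ≡ false →
           count (λ v → memberˡ (W w) p ∧ (X τ v ∧ not (Ok (upd (cell st) p (fixed v)) w))) ≤ θ
    each w (inj₁ m) = ℕₚ.≤-trans (count-mono {q = λ v → X τ v ∧ not (Ok (upd (cell st) p (fixed v)) w)} (λ v h → proj₂ (∧-true {memberˡ (W w) p} h)))
      (Ok-extend (cell st) w p τ (memberˡ-elim (W w) m) e (good st w))
    each w (inj₂ m) = ℕₚ.≤-trans (ℕₚ.≤-reflexive (count-zero (λ v → cong (_∧ (X τ v ∧ not (Ok (upd (cell st) p (fixed v)) w))) m))) z≤n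

  fit-ok : ∀ st p τ v → X τ v ≡ true → fits st p τ (ws p) v ≡ false → ∀ w → p ∈ˡ W w → Ok (upd (cell st) p (fixed v)) w ≡ true
  fit-ok st p τ v Xv e w m = not-false (∧-cong-true Xv (∧-cong-true (memberˡ-intro m)
    (anyˡ-false (λ w → memberˡ (W w) p ∧ (X τ v ∧ not (Ok (upd (cell st) p (fixed v)) w))) e (ws-complete m))))

  find-fit : ∀ st → Open st → ∀ p τ → cell st p ≡ blank τ →
             ∃[ v ] (un st v ≡ true × X τ v ≡ true × (∀ w → p ∈ˡ W w → Ok (upd (cell st) p (fixed v)) w ≡ true))
  find-fit st op p τ e =
    let (v , a , b) = count-find (λ v → X τ v ∧ un st v) (fits st p τ (ws p))
          (ℕₚ.≤-<-trans (count-unfit st p τ e)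
            (ℕₚ.<-≤-trans (subst (U <_) (sym T-def) (s≤s (ℕₚ.m≤m+n U U))) (subst (T ≤_) (sym (balance st τ)) (T≤blank st op τ))))
        (Xv , uv) = ∧-true {X τ v} a
    in v , uv , Xv , fit-ok st p τ v Xv b

  record Filled (st : State) (ps : List (Fin n)) : Set where
    field
      st′    : State
      same   : ∀ {q} → q ∉ˡ ps → cell st′ q ≡ cell st q
      kept   : ∀ {q v} → cell st q ≡ fixed v → cell st′ q ≡ fixed v
      filled : ∀ {q} → q ∈ˡ ps → ∃[ v ] cell st′ q ≡ fixed v
      unused : ∀ {v} → un st′ v ≡ true → un st v ≡ true

  abstract
    fill : ∀ st → Open st → ∀ ps → (∀ τ i → slots τ i ∉ˡ ps) → Filled st ps
    fill st op [] avoid = record { st′ = st ; same = λ _ → refl ; kept = λ e → e ; filled = λ () ; unused = λ e → e }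
    fill st op (p ∷ ps) avoid with cell-cases (cell st p)
    ... | inj₂ (v , e) = record { st′ = st′ ; same = λ ∉ → same (∉ ∘ there) ; kept = kept
        ; filled = λ { (here refl) → v , kept e ; (there m) → filled m } ; unused = unused }
      where open Filled (fill st op ps (λ τ i → avoid τ i ∘ there))
    ... | inj₁ (τ , e) = record { st′ = st′ ; same = λ ∉ → trans (same (∉ ∘ there)) (P.off-p (λ { refl → ∉ (here refl) }))
        ; kept = λ h → kept (P.kept h)
        ; filled = λ { (here refl) → v , kept P.at-p ; (there m) → filled m } ; unused = λ h → proj₁ (P.un′-un (unused h)) }
      where
      found : ∃[ v ] (un st v ≡ true × X τ v ≡ true × (∀ w → p ∈ˡ W w → Ok (upd (cell st) p (fixed v)) w ≡ true))
      found = find-fit st op p τ e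
      v : Fin n
      v = proj₁ found
      placement : Placement st p τ v
      placement = record { p-blank = e ; v-un = proj₁ (proj₂ found) ; v-X = proj₁ (proj₂ (proj₂ found)) ; v-ok = proj₂ (proj₂ (proj₂ found)) }
      module P = Place placement
      op′ : Open P.placed
      op′ σ i = trans (P.off-p (λ eq → avoid σ i (here eq))) (op σ i)
      open Filled (fill P.placed op′ ps (λ σ i → avoid σ i ∘ there))

  Covers : List (Fin n) → State → Set
  Covers fx st = ∀ {q v} → cell st q ≡ fixed v → q ∈ˡ fx

  Filled-covers : ∀ {st ps fx} (F : Filled st ps) → Covers fx st → Covers (ps ++ fx) (Filled.st′ F)
  Filled-covers {ps = ps} F cov {q} e with memberˡ-cases ps q
  ... | inj₁ m = ∈-++⁺ˡ m
  ... | inj₂ ∉ = ∈-++⁺ʳ ps (cov (trans (sym (Filled.same F ∉)) e))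

  Filled-open : ∀ {st ps} (F : Filled st ps) → Open st → (∀ τ i → slots τ i ∉ˡ ps) → Open (Filled.st′ F)
  Filled-open F op avoid τ i = trans (Filled.same F (avoid τ i)) (op τ i)

  -- Each of `c` prescribed positions may spoil `L` positions around it and may itself have ceased
  -- to be blank, whence `suc L`; the slots account for `T + T` more.
  Room : Bool → ℕ → Set
  Room τ c = c * suc L + (T + T) < count (λ p → isBlank τ (cell₀ p))

  find-isolated : ∀ st τ fx → Covers fx st → (∀ p → cell st p ≡ cell₀ p ⊎ p ∈ˡ fx) → Room τ (length fx) →
                  ∃[ p ] (cell st p ≡ blank τ × p ∉ˡ slotList × (∀ w → p ∈ˡ W w → ∀ {q} → q ∈ˡ W w → IsBlank (cell st q)))
  find-isolated st τ fx cov diff room =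
    let (p , a , b) = count-find blank? touched (ℕₚ.+-cancelʳ-< (length fx) _ _
           (ℕₚ.≤-<-trans few (ℕₚ.<-≤-trans room many)))
        (b₁ , b₂) = ∨-false {anyˡ (λ q → memberˡ (near q) p) fx} b
    in p , isBlank-sound τ a , memberˡ-∉ slotList b₂ , λ w m {q} m′ → case cell-cases (cell st q) of λ
       { (inj₁ bl) → bl
       ; (inj₂ (v , e)) → ⊥-elim (memberˡ-∉ (near q) (anyˡ-false (λ q → memberˡ (near q) p) b₁ (cov e)) (near-complete m′ m)) }
    where
    blank? touched : Fin n → Bool
    blank? p = isBlank τ (cell st p)
    touched p = anyˡ (λ q → memberˡ (near q) p) fx ∨ memberˡ slotList p
    few : count touched + length fx ≤ length fx * suc L + (T + T)
    few = begin
      count touched + length fx                      ≤⟨ ℕₚ.+-monoˡ-≤ (length fx) (ℕₚ.≤-trans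
          (count-∨ {q = λ p → anyˡ (λ q → memberˡ (near q) p) fx} {r = memberˡ slotList} (λ p → ∨-elim))
          (ℕₚ.+-mono-≤ (count-near fx) (ℕₚ.≤-trans (count-memberˡ slotList) (ℕₚ.≤-reflexive slotList-length)))) ⟩
      length fx * L + (T + T) + length fx            ≡⟨ few-identity (length fx) L (T + T) ⟩
      length fx * suc L + (T + T)                    ∎
      where
      open ℕₚ.≤-Reasoning
    many : count (λ p → isBlank τ (cell₀ p)) ≤ count blank? + length fx
    many = ℕₚ.≤-trans (count-∨ {q = blank?} {r = memberˡ fx} step) (ℕₚ.+-monoʳ-≤ (count blank?) (count-memberˡ fx))
      where
      step : ∀ p → isBlank τ (cell₀ p) ≡ true → blank? p ≡ true ⊎ memberˡ fx p ≡ true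
      step p e with diff p
      ... | inj₁ eq = inj₁ (trans (cong (isBlank τ) eq) e)
      ... | inj₂ m = inj₂ (memberˡ-intro m)

  record Isolated (st : State) (fx : List (Fin n)) (Zp : Fin n → Bool) (c : ℕ) : Set where
    field
      st′     : State
      fx′     : List (Fin n)
      covers  : Covers fx′ st′
      differs : ∀ p → cell st′ p ≡ cell₀ p ⊎ p ∈ˡ fx′
      size    : length fx′ ≤ length fx + c
      open′   : Open st′
      kept    : ∀ {q v} → cell st q ≡ fixed v → cell st′ q ≡ fixed v
      unused  : ∀ {v} → un st′ v ≡ true → un st v ≡ true
      done    : ∀ v → Zp v ≡ true → un st′ v ≡ false

  abstract
    -- Vertices unsuited to many slots cannot wait for the matching. At a position all of whose
    -- windows are still wholly blank `Ok-lone` accepts every vertex of the class, so they are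
    -- placed there, whatever their links look like.
    isolate : ∀ τ Zp → (∀ v → Zp v ≡ true → X τ v ≡ true) → ∀ c st fx → Covers fx st →
              (∀ p → cell st p ≡ cell₀ p ⊎ p ∈ˡ fx) → Open st → Room τ (length fx + c) →
              count (λ v → Zp v ∧ un st v) ≤ c → Isolated st fx Zp c
    isolate τ Zp Zp-X c st fx cov diff op room le with bool-cases (1 ≤ᵇ count (λ v → Zp v ∧ un st v))
    ... | inj₂ e = record { st′ = st ; fx′ = fx ; covers = cov ; differs = diff ; size = ℕₚ.m≤m+n _ c ; open′ = op
        ; kept = λ h → h ; unused = λ h → h
        ; done = λ v Zv → case bool-cases (un st v) of λ
            { (inj₂ f) → f
            ; (inj₁ t) → ⊥-elim (none e (subst (0 <_) (sym (count-remove {p = λ v → Zp v ∧ un st v} (∧-intro Zv t))) (s≤s z≤n))) } }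
      where
      none : ∀ {c} → (1 ≤ᵇ c) ≡ false → ¬ (0 < c)
      none {zero} _ ()
      none {suc c} ()
    isolate τ Zp Zp-X zero st fx cov diff op room le | inj₁ e = ⊥-elim (none e le)
      where
      none : ∀ {c} → (1 ≤ᵇ c) ≡ true → ¬ (c ≤ 0)
      none {zero} ()
      none {suc c} _ ()
    isolate τ Zp Zp-X (suc c) st fx cov diff op room le | inj₁ e =
      finish (count-witness (λ v → Zp v ∧ un st v) (some e))
             (find-isolated st τ fx cov diff (ℕₚ.≤-<-trans (ℕₚ.+-monoˡ-≤ (T + T) (ℕₚ.*-monoˡ-≤ (suc L) (ℕₚ.m≤m+n (length fx) (suc c)))) room))
      where
      some : ∀ {c} → (1 ≤ᵇ c) ≡ true → 0 < c
      some {suc c} _ = s≤s z≤n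
      finish : ∃[ v ] (Zp v ∧ un st v ≡ true) →
               ∃[ p ] (cell st p ≡ blank τ × p ∉ˡ slotList × (∀ w → p ∈ˡ W w → ∀ {q} → q ∈ˡ W w → IsBlank (cell st q))) →
               Isolated st fx Zp (suc c)
      finish (v , h) (p , p-blank , p∉ , lone) = record { st′ = R.st′ ; fx′ = R.fx′ ; covers = R.covers ; differs = R.differs
          ; size = ℕₚ.≤-trans R.size (ℕₚ.≤-reflexive (sym (ℕₚ.+-suc (length fx) c)))
          ; open′ = R.open′ ; kept = λ q → R.kept (P.kept q) ; unused = λ u → proj₁ (P.un′-un (R.unused u)) ; done = R.done }
        where
        Zv : Zp v ≡ true
        Zv = proj₁ (∧-true {Zp v} h)
        ok : ∀ w → p ∈ˡ W w → Ok (upd (cell st) p (fixed v)) w ≡ true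
        ok w m = trans (Ok-local w same) (Ok-lone w p τ v m (λ m′ → let (σ , b) = lone w m m′ in σ , origin st b) (origin st p-blank) (Zp-X v Zv))
          where
          same : ∀ {q} → q ∈ˡ W w → upd (cell st) p (fixed v) q ≡ upd cell₀ p (fixed v) q
          same {q} m′ with q Finₚ.≟ p
          ... | yes _ = refl
          ... | no _ = let (σ , b) = lone w m m′ in trans b (sym (origin st b))
        placement : Placement st p τ v
        placement = record { p-blank = p-blank ; v-un = proj₂ (∧-true {Zp v} h) ; v-X = Zp-X v Zv ; v-ok = ok }
        module P = Place placement
        cov′ : Covers (p ∷ fx) P.placed
        cov′ {q} e with q Finₚ.≟ p
        ... | yes refl = here refl
        ... | no _ = there (cov e)
        diff′ : ∀ q → P.cell′ q ≡ cell₀ q ⊎ q ∈ˡ (p ∷ fx)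
        diff′ q with q Finₚ.≟ p
        ... | yes refl = inj₂ (here refl)
        ... | no _ with diff q
        ...   | inj₁ eq = inj₁ eq
        ...   | inj₂ m = inj₂ (there m)
        op′ : Open P.placed
        op′ σ i = trans (P.off-p (λ eq → p∉ (subst (_∈ˡ slotList) eq (slot-∈ σ i)))) (op σ i)
        fewer : count (λ u → Zp u ∧ P.un′ u) ≤ c
        fewer = ℕₚ.≤-pred (ℕₚ.≤-trans (ℕₚ.≤-reflexive (trans (cong suc (count-cong (λ u → assoc (Zp u) (un st u) _)))
            (sym (count-remove {p = λ u → Zp u ∧ un st u} h)))) le)
          where
          assoc : ∀ a b c → a ∧ (b ∧ c) ≡ (a ∧ b) ∧ c
          assoc true b c = refl
          assoc false b c = refl
        module R = Isolated (isolate τ Zp Zp-X c P.placed (p ∷ fx) cov′ diff′ op′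
          (subst (Room τ) (ℕₚ.+-suc (length fx) c) room) fewer)

  record Matched (st : State) (τ : Bool) (xs : List (Fin T)) : Set where
    field
      st′    : State
      filled : ∀ {i} → i ∈ˡ xs → ∃[ v ] cell st′ (slots τ i) ≡ fixed v
      same   : ∀ {q} → (∀ {i} → i ∈ˡ xs → q ≢ slots τ i) → cell st′ q ≡ cell st q
      unused : ∀ {v} → un st v ≡ true → X τ v ≡ false → un st′ v ≡ true

  abstract
    -- The slots are pairwise apart: a window through one slot contains no other, so the tests made
    -- before the first placement stay valid during all of them.
    match : ∀ τ (φ : Fin T → Fin n) → Injectiveᶠ φ → (∀ i → X τ (φ i) ≡ true) → ∀ xs → Unique xs → ∀ st →
            (∀ {i} → i ∈ˡ xs → cell st (slots τ i) ≡ blank τ) → (∀ {i} → i ∈ˡ xs → un st (φ i) ≡ true) →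
            (∀ {i} → i ∈ˡ xs → ∀ w → slots τ i ∈ˡ W w → Ok (upd (cell st) (slots τ i) (fixed (φ i))) w ≡ true) → Matched st τ xs
    match τ φ φ-inj φ-X [] _ st bl u ok = record { st′ = st ; filled = λ () ; same = λ _ → refl ; unused = λ e _ → e }
    match τ φ φ-inj φ-X (i ∷ xs) (i∉ ∷ uniq) st bl u ok = record
        { st′ = R.st′
        ; filled = λ { (here refl) → φ i , trans (R.same (λ {j} m eq → ne m (slots-inj τ i j eq))) P.at-p ; (there m) → R.filled m }
        ; same = λ h → trans (R.same (λ m → h (there m))) (P.off-p (h (here refl)))
        ; unused = λ {v} e Xv → R.unused (P.un′-intro e (λ { refl → true≢false (φ-X i) Xv })) Xv }
      where
      ne : ∀ {j} → j ∈ˡ xs → i ≢ j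
      ne m = All.lookup i∉ m
      placement : Placement st (slots τ i) τ (φ i)
      placement = record { p-blank = bl (here refl) ; v-un = u (here refl) ; v-X = φ-X i ; v-ok = ok (here refl) }
      module P = Place placement
      slot-ne : ∀ {j} → j ∈ˡ xs → slots τ j ≢ slots τ i
      slot-ne m eq = ne m (sym (slots-inj τ _ _ eq))
      ok′ : ∀ {j} → j ∈ˡ xs → ∀ w → slots τ j ∈ˡ W w → Ok (upd P.cell′ (slots τ j) (fixed (φ j))) w ≡ true
      ok′ {j} m w m′ = trans (Ok-local w same) (ok (there m) w m′)
        where
        same : ∀ {q} → q ∈ˡ W w → upd P.cell′ (slots τ j) (fixed (φ j)) q ≡ upd (cell st) (slots τ j) (fixed (φ j)) q
        same {q} m″ with q Finₚ.≟ slots τ j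
        ... | yes _ = refl
        ... | no _ = P.off-p (λ { refl → proj₂ (slots-apart τ τ j i (slot-ne m)) w m′ m″ })
      module R = Matched (match τ φ φ-inj φ-X xs uniq P.placed
        (λ m → trans (P.off-p (slot-ne m)) (bl (there m)))
        (λ m → P.un′-intro (u (there m)) (λ eq → ne m (sym (φ-inj _ _ eq)))) ok′)

  isSlot : Fin n → Bool
  isSlot = memberˡ slotList

  around : List (Fin n)
  around = concatMap (λ p → concatMap W (ws p)) slotList

  neighbours : List (Fin n)
  neighbours = filterᵇ (not ∘ isSlot) around

  others : List (Fin n)
  others = filterᵇ (not ∘ isSlot) (allFin n)

  slot∉filter : ∀ xs τ i → slots τ i ∉ˡ filterᵇ (not ∘ isSlot) xs
  slot∉filter xs τ i m = true≢false (memberˡ-intro (slot-∈ τ i)) (not-true (∈-filterᵇ⁻ (not ∘ isSlot) {xs} m))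

  neighbours-length : length neighbours ≤ (T + T) * (K * k)
  neighbours-length = ℕₚ.≤-trans (length-filterᵇ (not ∘ isSlot) around)
    (subst (λ x → length around ≤ x * (K * k)) slotList-length
      (length-concatMap (λ p → concatMap W (ws p)) slotList (K * k)
        (λ p → ℕₚ.≤-trans (length-concatMap W (ws p) k W-length) (ℕₚ.*-monoˡ-≤ k (ws-length p)))))

  module Final (st₃ : State) (open₃ : Open st₃) (nonslot₃ : ∀ {q} → isSlot q ≡ false → ∃[ v ] cell st₃ q ≡ fixed v)
    (φ : Bool → Fin T → Fin n) (φ-inj : ∀ τ → Injectiveᶠ (φ τ)) (φ-X : ∀ τ i → X τ (φ τ i) ≡ true)
    (φ-un : ∀ τ i → un st₃ (φ τ i) ≡ true)
    (φ-ok : ∀ τ i w → slots τ i ∈ˡ W w → Ok (upd (cell st₃) (slots τ i) (fixed (φ τ i))) w ≡ true) where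

    all-unique : Unique (allFin T)
    all-unique = Uniqueₚ.allFin⁺ T

    abstract
      matchᵗ : Matched st₃ true (allFin T)
      matchᵗ = match true (φ true) (φ-inj true) (φ-X true) (allFin T) all-unique st₃ (λ {i} _ → open₃ true i) (λ {i} _ → φ-un true i) (λ {i} _ → φ-ok true i)

    module Mᵗ = Matched matchᵗ

    abstract
      matchᶠ : Matched Mᵗ.st′ false (allFin T)
      matchᶠ = match false (φ false) (φ-inj false) (φ-X false) (allFin T) all-unique Mᵗ.st′
        (λ {i} _ → trans (Mᵗ.same (λ {j} _ eq → slots-types j i (sym eq))) (open₃ false i))
        (λ {i} _ → Mᵗ.unused (φ-un false i) (X-disjoint _ false (φ-X false i)))
        (λ {i} _ w m → trans (Ok-local w (same i w m)) (φ-ok false i w m))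
        where
        same : ∀ i w → slots false i ∈ˡ W w → ∀ {q} → q ∈ˡ W w →
               upd (cell Mᵗ.st′) (slots false i) (fixed (φ false i)) q ≡ upd (cell st₃) (slots false i) (fixed (φ false i)) q
        same i w m {q} m′ with q Finₚ.≟ slots false i
        ... | yes _ = refl
        ... | no ne = Mᵗ.same (λ {j} _ eq → proj₂ (slots-apart false true i j (λ e → slots-types j i (sym e))) w m (subst (_∈ˡ W w) eq m′))

    module Mᶠ = Matched matchᶠ

    all-fixed : ∀ q → ∃[ v ] cell Mᶠ.st′ q ≡ fixed v
    all-fixed q with bool-cases (isSlot q)
    ... | inj₂ e = let (v , f) = nonslot₃ e in v , trans (Mᶠ.same (λ {i} _ eq → not-slot false i eq)) (trans (Mᵗ.same (λ {i} _ eq → not-slot true i eq)) f)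
      where
      not-slot : ∀ τ i → q ≢ slots τ i
      not-slot τ i refl = true≢false (memberˡ-intro (slot-∈ τ i)) e
    ... | inj₁ e with slot-∈⁻ (memberˡ-elim slotList {q} e)
    ...   | false , i , refl = Mᶠ.filled (∈-allFin i)
    ...   | true , i , refl = let (v , f) = Mᵗ.filled (∈-allFin i) in v , trans (Mᶠ.same (λ {j} _ eq → slots-types i j eq)) f

    completion : Completed
    completion = (λ p → proj₁ (all-fixed p))
      , (λ p q eq → inj Mᶠ.st′ (proj₂ (all-fixed p)) (trans (proj₂ (all-fixed q)) (cong fixed (sym eq))))
      , λ w → trans (Ok-local w (λ {p} _ → sym (proj₂ (all-fixed p)))) (good Mᶠ.st′ w)

  record Initial : Set where
    no-eta-equality
    field
      st₀      : State
      st₀-cell : ∀ p → cell st₀ p ≡ cell₀ p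
      fx₀      : List (Fin n)
      cov₀     : Covers fx₀ st₀
      room     : ∀ τ → Room τ (length fx₀ + (T + T) * (K * k) + (U + U) + (U + U))

  module Finish (initial : Initial) where

    open Initial initial

    open₀ : Open st₀
    open₀ τ i = trans (st₀-cell _) (slots-blank τ i)

    abstract
      fill₁ : Filled st₀ neighbours
      fill₁ = fill st₀ open₀ neighbours (slot∉filter around)

    st₁ : State
    st₁ = Filled.st′ fill₁

    open₁ : Open st₁
    open₁ = Filled-open fill₁ open₀ (slot∉filter around)

    -- From here on a window through a slot can change at the slot only. Whether a vertex fits the
    -- slot is thereby decided once and for all, before any other position is filled.
    context₁ : ∀ τ i w → slots τ i ∈ˡ W w → ∀ {q} → q ∈ˡ W w → q ≢ slots τ i → ∃[ v ] cell st₁ q ≡ fixed v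
    context₁ τ i w m {q} m′ ne = Filled.filled fill₁ (∈-filterᵇ⁺ (not ∘ isSlot)
      (∈-concatMap⁺ (λ p → concatMap W (ws p)) (slot-∈ τ i) (∈-concatMap⁺ W (ws-complete m) m′))
      (cong not (not-slot (bool-cases (isSlot q)))))
      where
      not-slot : isSlot q ≡ true ⊎ isSlot q ≡ false → isSlot q ≡ false
      not-slot (inj₂ e) = e
      not-slot (inj₁ e) with slot-∈⁻ (memberˡ-elim slotList {q} e)
      ... | σ , j , refl = ⊥-elim (proj₂ (slots-apart σ τ j i ne) w m′ m)

    unfit : Bool → Fin T → Fin n → Bool
    unfit τ i = fits st₁ (slots τ i) τ (ws (slots τ i))

    rare : Bool → Fin n → Bool
    rare τ v = X τ v ∧ (un st₁ v ∧ (suc U ≤ᵇ count (λ i → unfit τ i v)))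

    rare-X : ∀ τ v → rare τ v ≡ true → X τ v ≡ true
    rare-X τ v e = proj₁ (∧-true {X τ v} e)

    -- Double counting of the pairs of a slot and a vertex unfit for it: a rare vertex is in at
    -- least U + 1 pairs, a slot in at most U, so (U + 1) times the number of rare vertices is at
    -- most T U.
    count-rare : ∀ τ → count (rare τ) ≤ U + U
    count-rare τ = ℕₚ.≤-pred (subst (count (rare τ) <_) T-def (ℕₚ.≰⇒> (λ le → ℕₚ.<⇒≱ (T*U<T*1+U T-def) (ℕₚ.≤-trans (ℕₚ.≤-reflexive (ℕₚ.*-comm T (suc U))) (ℕₚ.≤-trans (ℕₚ.*-monoʳ-≤ (suc U) le) bound)))))
      where
      open ℕₚ.≤-Reasoning
      T*U<T*1+U : ∀ {t} → t ≡ suc (U + U) → t * U < t * suc U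
      T*U<T*1+U refl = ℕₚ.*-monoʳ-< (suc (U + U)) (ℕₚ.n<1+n U)
      each : ∀ v → suc U * ι (rare τ v) ≤ sum (λ i → ι (unfit τ i v))
      each v with bool-cases (rare τ v)
      ... | inj₂ e = ℕₚ.≤-trans (ℕₚ.≤-reflexive (trans (cong (λ b → suc U * ι b) e) (ℕₚ.*-zeroʳ (suc U)))) z≤n
      ... | inj₁ e = ℕₚ.≤-trans (ℕₚ.≤-reflexive (trans (cong (λ b → suc U * ι b) e) (ℕₚ.*-identityʳ (suc U))))
        (ℕₚ.≤-trans (ℕₚ.≤ᵇ⇒≤ (suc U) _ (subst (λ b → Data.Bool.T b) (sym (proj₂ (∧-true {un st₁ v} (proj₂ (∧-true {X τ v} e))))) _))
          (ℕₚ.≤-reflexive (count-sum (λ i → unfit τ i v))))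
      bound : suc U * count (rare τ) ≤ T * U
      bound = begin
        suc U * count (rare τ)                              ≡⟨ cong (suc U *_) (count-sum (rare τ)) ⟩
        suc U * sum (λ v → ι (rare τ v))                    ≡⟨ *-sum (suc U) (λ v → ι (rare τ v)) ⟩
        sum (λ v → suc U * ι (rare τ v))                    ≤⟨ sum-mono each ⟩
        sum (λ v → sum (λ i → ι (unfit τ i v)))             ≡⟨ sum-comm (λ v i → ι (unfit τ i v)) ⟩
        sum (λ i → sum (λ v → ι (unfit τ i v)))             ≡⟨ sum-cong (λ i → sym (count-sum (unfit τ i))) ⟩
        sum (λ i → count (unfit τ i))                       ≤⟨ sum-mono (λ i → count-unfit st₁ (slots τ i) τ (open₁ τ i)) ⟩
        sum {T} (λ _ → U)                                   ≡⟨ sum-const {T} U ⟩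
        T * U                                               ∎

    F₀ : ℕ
    F₀ = length fx₀ + (T + T) * (K * k)

    size₁ : length (neighbours ++ fx₀) ≤ F₀
    size₁ = begin
      length (neighbours ++ fx₀)                   ≡⟨ Listₚ.length-++ neighbours ⟩
      length neighbours + length fx₀               ≤⟨ ℕₚ.+-monoˡ-≤ (length fx₀) neighbours-length ⟩
      (T + T) * (K * k) + length fx₀               ≡⟨ ℕₚ.+-comm _ (length fx₀) ⟩
      F₀                                           ∎
      where open ℕₚ.≤-Reasoning

    room-mono : ∀ τ {a} → a ≤ F₀ + (U + U) + (U + U) → Room τ a
    room-mono τ le = ℕₚ.≤-<-trans (ℕₚ.+-monoˡ-≤ (T + T) (ℕₚ.*-monoˡ-≤ (suc L) le)) (room τ)

    diff₁ : ∀ p → cell st₁ p ≡ cell₀ p ⊎ p ∈ˡ (neighbours ++ fx₀)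
    diff₁ p with memberˡ-cases neighbours p
    ... | inj₁ m = inj₂ (∈-++⁺ˡ m)
    ... | inj₂ ∉ = inj₁ (trans (Filled.same fill₁ ∉) (st₀-cell p))

    abstract
      isoᵗ : Isolated st₁ (neighbours ++ fx₀) (rare true) (U + U)
      isoᵗ = isolate true (rare true) (rare-X true) (U + U) st₁ (neighbours ++ fx₀) (Filled-covers fill₁ cov₀) diff₁ open₁
        (room-mono true (ℕₚ.≤-trans (ℕₚ.+-monoˡ-≤ (U + U) size₁) (ℕₚ.m≤m+n _ (U + U))))
        (ℕₚ.≤-trans (count-mono (λ v e → proj₁ (∧-true {rare true v} e))) (count-rare true))

    module Iᵗ = Isolated isoᵗ

    abstract
      isoᶠ : Isolated Iᵗ.st′ Iᵗ.fx′ (rare false) (U + U)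
      isoᶠ = isolate false (rare false) (rare-X false) (U + U) Iᵗ.st′ Iᵗ.fx′ Iᵗ.covers Iᵗ.differs Iᵗ.open′
        (room-mono false (ℕₚ.+-monoˡ-≤ (U + U) (ℕₚ.≤-trans Iᵗ.size (ℕₚ.+-monoˡ-≤ (U + U) size₁))))
        (ℕₚ.≤-trans (count-mono (λ v e → proj₁ (∧-true {rare false v} e))) (count-rare false))

    module Iᶠ = Isolated isoᶠ

    rare-used : ∀ τ v → rare τ v ≡ true → un Iᶠ.st′ v ≡ false
    rare-used false v e = Iᶠ.done v e
    rare-used true v e with bool-cases (un Iᶠ.st′ v)
    ... | inj₂ f = f
    ... | inj₁ t = ⊥-elim (true≢false (Iᶠ.unused t) (Iᵗ.done v e))

    abstract
      fill₃ : Filled Iᶠ.st′ others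
      fill₃ = fill Iᶠ.st′ Iᶠ.open′ others (slot∉filter (allFin n))

    module F₃ = Filled fill₃

    st₃ : State
    st₃ = F₃.st′

    open₃ : Open st₃
    open₃ = Filled-open fill₃ Iᶠ.open′ (slot∉filter (allFin n))

    kept₃ : ∀ {q v} → cell st₁ q ≡ fixed v → cell st₃ q ≡ fixed v
    kept₃ e = F₃.kept (Iᶠ.kept (Iᵗ.kept e))

    unused₃ : ∀ {v} → un st₃ v ≡ true → un st₁ v ≡ true
    unused₃ e = Iᵗ.unused (Iᶠ.unused (F₃.unused e))

    nonslot₃ : ∀ {q} → isSlot q ≡ false → ∃[ v ] cell st₃ q ≡ fixed v
    nonslot₃ {q} e = F₃.filled (∈-filterᵇ⁺ (not ∘ isSlot) (∈-allFin q) (cong not e))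

    fit₃ : ∀ τ i v → X τ v ≡ true → unfit τ i v ≡ false → ∀ w → slots τ i ∈ˡ W w → Ok (upd (cell st₃) (slots τ i) (fixed v)) w ≡ true
    fit₃ τ i v Xv e w m = trans (Ok-local w same) (fit-ok st₁ (slots τ i) τ v Xv e w m)
      where
      same : ∀ {q} → q ∈ˡ W w → upd (cell st₃) (slots τ i) (fixed v) q ≡ upd (cell st₁) (slots τ i) (fixed v) q
      same {q} m′ with q Finₚ.≟ slots τ i
      ... | yes _ = refl
      ... | no ne = let (u , f) = context₁ τ i w m m′ ne in trans (kept₃ f) (sym f)

    few-unfit : ∀ τ v → X τ v ∧ un st₃ v ≡ true → count (λ i → unfit τ i v) ≤ U
    few-unfit τ v e with ℕₚ._≤?_ (suc U) (count (λ i → unfit τ i v))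
    ... | no ¬le = ℕₚ.≤-pred (ℕₚ.≰⇒> ¬le)
    ... | yes le = ⊥-elim (true≢false (F₃.unused (proj₂ (∧-true {X τ v} e))) (rare-used τ v
            (∧-intro (proj₁ (∧-true {X τ v} e)) (∧-intro (unused₃ (proj₂ (∧-true {X τ v} e))) (T-true (ℕₚ.≤⇒≤ᵇ le))))))
      where
      T-true : ∀ {b} → Data.Bool.T b → b ≡ true
      T-true {true} _ = refl

    free : Bool → Fin n → Bool
    free τ v = X τ v ∧ un st₃ v

    unfit-bound : ∀ τ i → count (unfit τ i) ≤ U
    unfit-bound τ i = count-unfit st₁ (slots τ i) τ (open₁ τ i)

    sparse : ∀ τ i v → free τ v ≡ true → count (λ u → free τ u ∧ unfit τ i u) + count (λ j → unfit τ j v) < T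
    sparse τ i v e = subst (count (λ u → free τ u ∧ unfit τ i u) + count (λ j → unfit τ j v) <_) (sym T-def) (s≤s (ℕₚ.+-mono-≤
      (ℕₚ.≤-trans (count-mono {p = λ u → free τ u ∧ unfit τ i u} {q = unfit τ i} (λ u h → proj₂ (∧-true {free τ u} {unfit τ i u} h))) (unfit-bound τ i))
      (few-unfit τ v e)))

    abstract
      pm : ∀ τ → ∃[ φ ] (Injectiveᶠ {T} φ × (∀ i → free τ (φ i) ≡ true) × (∀ i → unfit τ i (φ i) ≡ false))
      pm τ = Matching.perfect-matching (free τ) (subst (T ≤_) (sym (balance st₃ τ)) (T≤blank st₃ open₃ τ)) (unfit τ) (sparse τ)

    φ : Bool → Fin T → Fin n
    φ τ = proj₁ (pm τ)
    φ-inj : ∀ τ → Injectiveᶠ (φ τ)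
    φ-inj τ = proj₁ (proj₂ (pm τ))
    φ-X : ∀ τ i → X τ (φ τ i) ≡ true
    φ-X τ i = proj₁ (∧-true {X τ (φ τ i)} (proj₁ (proj₂ (proj₂ (pm τ))) i))
    φ-un : ∀ τ i → un st₃ (φ τ i) ≡ true
    φ-un τ i = proj₂ (∧-true {X τ (φ τ i)} (proj₁ (proj₂ (proj₂ (pm τ))) i))
    φ-ok : ∀ τ i w → slots τ i ∈ˡ W w → Ok (upd (cell st₃) (slots τ i) (fixed (φ τ i))) w ≡ true
    φ-ok τ i = fit₃ τ i (φ τ i) (φ-X τ i) (proj₂ (proj₂ (proj₂ (pm τ))) i)

    completion : Completed
    completion = Final.completion st₃ open₃ nonslot₃ φ φ-inj φ-X φ-un φ-ok

  complete : (st₀ : State) → (∀ p → cell st₀ p ≡ cell₀ p) → (fx : List (Fin n)) → Covers fx st₀ →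
             (∀ τ t → t ≡ suc (U + U) → (length fx + (t + t) * (K * k) + (U + U) + (U + U)) * suc L + (t + t) < count (λ p → isBlank τ (cell₀ p))) →
             Completed
  complete st₀ st₀-cell fx cov room = Finish.completion (record { st₀ = st₀ ; st₀-cell = st₀-cell ; fx₀ = fx ; cov₀ = cov ; room = λ τ → room τ T T-def })

-- Sums over tuples of vertices

-- The tuples are ordered and may have repeated entries, so no disjointness has to be carried
-- through the inductions. The degenerate tuples are estimated separately in `tsum-degenerate`.
tsum : ∀ {n} → (Fin n → Bool) → ℕ → (Subset n → ℕ) → Subset n → ℕ
tsum P zero f S = f S
tsum P (suc b) f S = sum (λ v → ι (P v) * tsum P b f (S ∪ ⁅ v ⁆))

∪-swap : ∀ {n} (S T R : Subset n) → (S ∪ T) ∪ R ≡ (S ∪ R) ∪ T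
∪-swap S T R = trans (Subsetₚ.∪-assoc S T R) (trans (cong (S ∪_) (Subsetₚ.∪-comm T R)) (sym (Subsetₚ.∪-assoc S R T)))

tsum-*-swap : ∀ a c x → a * (c * x) ≡ c * (a * x)
tsum-*-swap = solve 3 (λ a c x → a :* (c :* x) := c :* (a :* x)) refl
  where open ℕ-Solver

tsum-const-identity : ∀ x c y → x * c * y ≡ y * x * c
tsum-const-identity = solve 3 (λ x c y → x :* c :* y := y :* x :* c) refl
  where open ℕ-Solver

tsum-change-identity : ∀ x n m d b → x + n * m * d + n * (b * d * m) ≡ x + (1 + b) * d * (n * m)
tsum-change-identity = solve 5 (λ x n m d b → x :+ n :* m :* d :+ n :* (b :* d :* m) := x :+ (con 1 :+ b) :* d :* (n :* m)) refl
  where open ℕ-Solver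

module _ {n : ℕ} where

  tsum-mono : ∀ {P : Fin n → Bool} b {f g} → (∀ R → f R ≤ g R) → ∀ S → tsum P b f S ≤ tsum P b g S
  tsum-mono zero h S = h S
  tsum-mono {P} (suc b) h S = sum-mono (λ v → ℕₚ.*-monoʳ-≤ (ι (P v)) (tsum-mono b h (S ∪ ⁅ v ⁆)))

  tsum-cong : ∀ {P : Fin n → Bool} b {f g} → (∀ R → f R ≡ g R) → ∀ S → tsum P b f S ≡ tsum P b g S
  tsum-cong zero h S = h S
  tsum-cong {P} (suc b) h S = sum-cong (λ v → cong (ι (P v) *_) (tsum-cong b h (S ∪ ⁅ v ⁆)))

  tsum-mono-P : ∀ {P Q : Fin n → Bool} → (∀ v → P v ≡ true → Q v ≡ true) → ∀ b f S → tsum P b f S ≤ tsum Q b f S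
  tsum-mono-P h zero f S = ℕₚ.≤-refl
  tsum-mono-P h (suc b) f S = sum-mono (λ v → ℕₚ.*-mono-≤ (ι-mono (h v)) (tsum-mono-P h b f (S ∪ ⁅ v ⁆)))

  tsum-+ : ∀ {P : Fin n → Bool} b f g S → tsum P b (λ R → f R + g R) S ≡ tsum P b f S + tsum P b g S
  tsum-+ zero f g S = refl
  tsum-+ {P} (suc b) f g S = trans
    (sum-cong (λ v → trans (cong (ι (P v) *_) (tsum-+ b f g (S ∪ ⁅ v ⁆))) (ℕₚ.*-distribˡ-+ (ι (P v)) _ _)))
    (sum-+ (λ v → ι (P v) * tsum P b f (S ∪ ⁅ v ⁆)) (λ v → ι (P v) * tsum P b g (S ∪ ⁅ v ⁆)))

  tsum-* : ∀ {P : Fin n → Bool} b c f S → tsum P b (λ R → c * f R) S ≡ c * tsum P b f S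
  tsum-* zero c f S = refl
  tsum-* {P} (suc b) c f S = trans
    (sum-cong (λ v → trans (cong (ι (P v) *_) (tsum-* b c f (S ∪ ⁅ v ⁆))) (tsum-*-swap (ι (P v)) c _)))
    (sym (*-sum c (λ v → ι (P v) * tsum P b f (S ∪ ⁅ v ⁆))))

  tsum-const : ∀ (P : Fin n → Bool) b c S → tsum P b (λ _ → c) S ≡ count P ^ b * c
  tsum-const P zero c S = sym (ℕₚ.*-identityˡ c)
  tsum-const P (suc b) c S = trans (sum-cong (λ v → trans (cong (ι (P v) *_) (tsum-const P b c (S ∪ ⁅ v ⁆))) (ℕₚ.*-comm (ι (P v)) _)))
    (trans (sym (*-sum (count P ^ b * c) (λ v → ι (P v))))
      (trans (cong (count P ^ b * c *_) (sym (count-sum P))) (tsum-const-identity (count P ^ b) c (count P))))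

  tsum-bound : ∀ (P : Fin n → Bool) b {f} c → (∀ R → f R ≤ c) → ∀ S → tsum P b f S ≤ n ^ b * c
  tsum-bound P b c h S = ℕₚ.≤-trans (tsum-mono b h S) (ℕₚ.≤-trans (ℕₚ.≤-reflexive (tsum-const P b c S)) (ℕₚ.*-monoˡ-≤ c (ℕₚ.^-monoˡ-≤ b (count≤n P))))

  -- Only the union of the chosen vertices matters, so a further vertex may be chosen after all
  -- others or before them.
  tsum-swap : ∀ {P : Fin n → Bool} b (w : Fin n → ℕ) f S →
              tsum P b (λ R → sum (λ v → w v * f (R ∪ ⁅ v ⁆))) S ≡ sum (λ v → w v * tsum P b f (S ∪ ⁅ v ⁆))
  tsum-swap zero w f S = refl
  tsum-swap {P} (suc b) w f S = begin
    sum (λ u → ι (P u) * tsum P b (λ R → sum (λ v → w v * f (R ∪ ⁅ v ⁆))) (S ∪ ⁅ u ⁆))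
      ≡⟨ sum-cong (λ u → trans (cong (ι (P u) *_) (tsum-swap b w f (S ∪ ⁅ u ⁆))) (*-sum (ι (P u)) _)) ⟩
    sum (λ u → sum (λ v → ι (P u) * (w v * tsum P b f ((S ∪ ⁅ u ⁆) ∪ ⁅ v ⁆))))
      ≡⟨ sum-comm (λ u v → ι (P u) * (w v * tsum P b f ((S ∪ ⁅ u ⁆) ∪ ⁅ v ⁆))) ⟩
    sum (λ v → sum (λ u → ι (P u) * (w v * tsum P b f ((S ∪ ⁅ u ⁆) ∪ ⁅ v ⁆))))
      ≡⟨ sum-cong (λ v → trans (sum-cong (λ u → trans (cong (λ R → ι (P u) * (w v * tsum P b f R)) (∪-swap S ⁅ u ⁆ ⁅ v ⁆)) (tsum-*-swap (ι (P u)) (w v) _)))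
           (sym (*-sum (w v) (λ u → ι (P u) * tsum P b f ((S ∪ ⁅ v ⁆) ∪ ⁅ u ⁆))))) ⟩
    sum (λ v → w v * tsum P (suc b) f (S ∪ ⁅ v ⁆)) ∎
    where
    open ≡-Reasoning

  tsum-last : ∀ {P : Fin n → Bool} b f S → tsum P (suc b) f S ≡ tsum P b (λ R → sum (λ v → ι (P v) * f (R ∪ ⁅ v ⁆))) S
  tsum-last {P} b f S = sym (tsum-swap b (λ v → ι (P v)) f S)

  -- Both sides carry a factor n to avoid the exponent b - 1.
  tsum-change : ∀ (P Q D : Fin n → Bool) → (∀ v → P v ≡ true → Q v ≡ true ⊎ D v ≡ true) → ∀ b {f} → (∀ R → f R ≤ 1) → ∀ S →
                n * tsum P b f S ≤ n * tsum Q b f S + b * count D * n ^ b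
  tsum-change P Q D h zero f≤1 S = ℕₚ.m≤m+n _ _
  tsum-change P Q D h (suc b) {f} f≤1 S = begin
    n * sum (λ v → ι (P v) * tsum P b f (S ∪ ⁅ v ⁆))
      ≡⟨ trans (*-sum n _) (sum-cong (λ v → tsum-*-swap n (ι (P v)) _)) ⟩
    sum (λ v → ι (P v) * (n * tsum P b f (S ∪ ⁅ v ⁆)))
      ≤⟨ sum-mono (λ v → each v) ⟩
    sum (λ v → (n * (ι (Q v) * tsum Q b f (S ∪ ⁅ v ⁆)) + ι (D v) * (n * n ^ b)) + b * count D * n ^ b)
      ≡⟨ trans (sum-+ _ _) (cong₂ _+_ (trans (sum-+ _ _) (cong₂ _+_ (sym (*-sum n _))
           (trans (sum-cong (λ v → ℕₚ.*-comm (ι (D v)) (n * n ^ b))) (trans (sym (*-sum (n * n ^ b) _)) (cong (n * n ^ b *_) (sym (count-sum D))))))) (sum-const {n} (b * count D * n ^ b))) ⟩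
    n * tsum Q (suc b) f S + n * n ^ b * count D + n * (b * count D * n ^ b)
      ≡⟨ tsum-change-identity (n * tsum Q (suc b) f S) n (n ^ b) (count D) b ⟩
    n * tsum Q (suc b) f S + suc b * count D * n ^ suc b ∎
    where
    open ℕₚ.≤-Reasoning
    each : ∀ v → ι (P v) * (n * tsum P b f (S ∪ ⁅ v ⁆)) ≤ (n * (ι (Q v) * tsum Q b f (S ∪ ⁅ v ⁆)) + ι (D v) * (n * n ^ b)) + b * count D * n ^ b
    each v with bool-cases (P v)
    ... | inj₂ e rewrite e = z≤n
    ... | inj₁ e with h v e
    ...   | inj₁ q rewrite e | q = ℕₚ.≤-trans (ℕₚ.≤-reflexive (ℕₚ.+-identityʳ _)) (ℕₚ.≤-trans (tsum-change P Q D h b f≤1 (S ∪ ⁅ v ⁆))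
            (ℕₚ.+-monoˡ-≤ _ (ℕₚ.≤-trans (ℕₚ.≤-reflexive (cong (n *_) (sym (ℕₚ.+-identityʳ _)))) (ℕₚ.m≤m+n _ _))))
    ...   | inj₂ q rewrite e | q = ℕₚ.≤-trans (ℕₚ.≤-reflexive (ℕₚ.+-identityʳ _))
            (ℕₚ.≤-trans (ℕₚ.*-monoʳ-≤ n (ℕₚ.≤-trans (tsum-bound P b 1 f≤1 (S ∪ ⁅ v ⁆)) (ℕₚ.≤-reflexive (ℕₚ.*-identityʳ _))))
              (ℕₚ.≤-trans (ℕₚ.≤-trans (ℕₚ.≤-reflexive (sym (ℕₚ.+-identityʳ _))) (ℕₚ.m≤n+m _ (n * (ι (Q v) * tsum Q b f (S ∪ ⁅ v ⁆))))) (ℕₚ.m≤m+n _ _)))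

-- Hereditary goodness of partial edges

module Goodness {n : ℕ} (X : Bool → Fin n → Bool) (E : Subset n → Bool) (θ : ℕ) where

  -- G a b S: the set S can be completed to an edge by a vertices of X true and
  -- b vertices of X false, chosen one at a time in any order of the two types,
  -- with at most θ bad choices at every step.
  G : ℕ → ℕ → Subset n → Bool
  G zero zero S = E S
  G (suc a) zero S = count (λ v → X true v ∧ not (G a zero (S ∪ ⁅ v ⁆))) ≤ᵇ θ
  G zero (suc b) S = count (λ v → X false v ∧ not (G zero b (S ∪ ⁅ v ⁆))) ≤ᵇ θ
  G (suc a) (suc b) S = (count (λ v → X true v ∧ not (G a (suc b) (S ∪ ⁅ v ⁆))) ≤ᵇ θ)
                      ∧ (count (λ v → X false v ∧ not (G (suc a) b (S ∪ ⁅ v ⁆))) ≤ᵇ θ)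

  ≤ᵇ-true : ∀ {a b} → (a ≤ᵇ b) ≡ true → a ≤ b
  ≤ᵇ-true {a} {b} e = ℕₚ.≤ᵇ⇒≤ a b (subst Data.Bool.T (sym e) _)

  ≤ᵇ-false : ∀ {a b} → (a ≤ᵇ b) ≡ false → b < a
  ≤ᵇ-false {a} {b} e = ℕₚ.≰⇒> (λ le → subst Data.Bool.T e (ℕₚ.≤⇒≤ᵇ le))

  G-true : ∀ a b S → G (suc a) b S ≡ true → count (λ v → X true v ∧ not (G a b (S ∪ ⁅ v ⁆))) ≤ θ
  G-true a zero S e = ≤ᵇ-true e
  G-true a (suc b) S e = ≤ᵇ-true (proj₁ (∧-true e))

  G-false : ∀ a b S → G a (suc b) S ≡ true → count (λ v → X false v ∧ not (G a b (S ∪ ⁅ v ⁆))) ≤ θ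
  G-false zero b S e = ≤ᵇ-true e
  G-false (suc a) b S e = ≤ᵇ-true (proj₂ (∧-true {count (λ v → X true v ∧ not (G a (suc b) (S ∪ ⁅ v ⁆))) ≤ᵇ θ} e))

  miss : ℕ → ℕ → Subset n → ℕ
  miss a b = tsum (X true) a (tsum (X false) b (λ R → ι (not (E R))))

  miss-false : ∀ a b S → miss a (suc b) S ≡ sum (λ v → ι (X false v) * miss a b (S ∪ ⁅ v ⁆))
  miss-false a b S = tsum-swap a (λ v → ι (X false v)) (tsum (X false) b (λ R → ι (not (E R)))) S

  many-miss : ∀ (P : Fin n → Bool) (g : Fin n → Bool) (f : Fin n → ℕ) c → (∀ v → g v ≡ false → c ≤ f v) →
              (count (λ v → P v ∧ not (g v)) ≤ᵇ θ) ≡ false → suc θ * c ≤ sum (λ v → ι (P v) * f v)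
  many-miss P g f c h e = ℕₚ.≤-trans (ℕₚ.*-monoˡ-≤ c (≤ᵇ-false {count (λ v → P v ∧ not (g v))} {θ} e))
    (ℕₚ.≤-trans (ℕₚ.≤-reflexive (trans (ℕₚ.*-comm _ c) (trans (cong (c *_) (count-sum (λ v → P v ∧ not (g v)))) (*-sum c _))))
      (sum-mono each))
    where
    each : ∀ v → c * ι (P v ∧ not (g v)) ≤ ι (P v) * f v
    each v with P v
    ... | false = ℕₚ.≤-reflexive (ℕₚ.*-zeroʳ c)
    ... | true with bool-cases (g v)
    ...   | inj₁ t rewrite t = ℕₚ.≤-trans (ℕₚ.≤-reflexive (ℕₚ.*-zeroʳ c)) z≤n
    ...   | inj₂ t rewrite t = ℕₚ.≤-trans (ℕₚ.≤-reflexive (ℕₚ.*-identityʳ c)) (ℕₚ.≤-trans (h v t) (ℕₚ.≤-reflexive (sym (ℕₚ.+-identityʳ _))))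

  ∧-false : ∀ {a b} → a ∧ b ≡ false → a ≡ false ⊎ b ≡ false
  ∧-false {false} _ = inj₁ refl
  ∧-false {true} e = inj₂ e

  -- A bad set has more than θ bad extensions within one of the two classes; iterating gives a tree
  -- with branching θ + 1 whose leaves are non-edges.
  bad⇒miss : ∀ a b S → G a b S ≡ false → suc θ ^ (a + b) ≤ miss a b S
  bad⇒miss zero zero S e rewrite e = s≤s z≤n
  bad⇒miss (suc a) zero S e = many-miss (X true) (λ v → G a zero (S ∪ ⁅ v ⁆)) _ (suc θ ^ (a + 0)) (λ v → bad⇒miss a zero (S ∪ ⁅ v ⁆)) e
  bad⇒miss zero (suc b) S e = many-miss (X false) (λ v → G zero b (S ∪ ⁅ v ⁆)) _ (suc θ ^ b) (λ v → bad⇒miss zero b (S ∪ ⁅ v ⁆)) e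
  bad⇒miss (suc a) (suc b) S e with ∧-false {count (λ v → X true v ∧ not (G a (suc b) (S ∪ ⁅ v ⁆))) ≤ᵇ θ} e
  ... | inj₁ e′ = many-miss (X true) (λ v → G a (suc b) (S ∪ ⁅ v ⁆)) _ (suc θ ^ (a + suc b)) (λ v → bad⇒miss a (suc b) (S ∪ ⁅ v ⁆)) e′
  -- `miss` chooses the vertices of `X true` before those of `X false`; `miss-false` brings the
  -- failing choice from `X false` to the front.
  ... | inj₂ e′ = ℕₚ.≤-trans (ℕₚ.≤-reflexive (cong (suc θ ^_) (ℕₚ.+-suc (suc a) b)))
    (ℕₚ.≤-trans (many-miss (X false) (λ v → G (suc a) b (S ∪ ⁅ v ⁆)) _ (suc θ ^ (suc a + b)) (λ v → bad⇒miss (suc a) b (S ∪ ⁅ v ⁆)) e′)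
      (ℕₚ.≤-reflexive (sym (miss-false (suc a) b S))))

  blanks : Bool → List (Cell n) → ℕ
  blanks τ [] = 0
  blanks τ (c ∷ cs) = ι (isBlank τ c) + blanks τ cs

  image : List (Cell n) → Subset n
  image [] = ∅
  image (fixed v ∷ cs) = ⁅ v ⁆ ∪ image cs
  image (blank _ ∷ cs) = image cs

  Good : List (Cell n) → Bool
  Good cs = G (blanks true cs) (blanks false cs) (image cs)

  map-local : ∀ {A : Set} {c c′ : Fin n → A} (xs : List (Fin n)) → (∀ {p} → p ∈ˡ xs → c p ≡ c′ p) → map c xs ≡ map c′ xs
  map-local [] h = refl
  map-local (x ∷ xs) h = cong₂ _∷_ (h (here refl)) (map-local xs (h ∘ there))

  module Update (c : Fin n → Cell n) (p : Fin n) (τ : Bool) (c-p : c p ≡ blank τ) (v : Fin n) where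

    c′ : Fin n → Cell n
    c′ = upd c p (fixed v)

    c′-p : c′ p ≡ fixed v
    c′-p = upd-same c p (fixed v)

    map-c′ : ∀ xs → All (p ≢_) xs → map c′ xs ≡ map c xs
    map-c′ xs ∉ = map-local xs (λ m → upd-other c p (fixed v) (λ eq → All.lookup ∉ m (sym eq)))

    head-c′ : ∀ {x} → x ≢ p → c′ x ≡ c x
    head-c′ = upd-other c p (fixed v)

    blanks-upd : ∀ xs → Unique xs → p ∈ˡ xs → blanks τ (map c xs) ≡ suc (blanks τ (map c′ xs))
    blanks-upd (x ∷ xs) (∉ ∷ u) (here refl) rewrite c′-p | c-p | isBlank-blank {n} τ | map-c′ xs ∉ = refl
    blanks-upd (x ∷ xs) (∉ ∷ u) (there m) rewrite head-c′ (All.lookup ∉ m) = trans (cong (ι (isBlank τ (c x)) +_) (blanks-upd xs u m)) (ℕₚ.+-suc _ _)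

    blanks-upd-other : ∀ σ → isBlank {n} σ (blank τ) ≡ false → ∀ xs → Unique xs → p ∈ˡ xs → blanks σ (map c xs) ≡ blanks σ (map c′ xs)
    blanks-upd-other σ ne (x ∷ xs) (∉ ∷ u) (here refl) rewrite c′-p | c-p | ne | map-c′ xs ∉ = refl
    blanks-upd-other σ ne (x ∷ xs) (∉ ∷ u) (there m) rewrite head-c′ (All.lookup ∉ m) = cong (ι (isBlank σ (c x)) +_) (blanks-upd-other σ ne xs u m)

    image-upd : ∀ xs → Unique xs → p ∈ˡ xs → image (map c′ xs) ≡ image (map c xs) ∪ ⁅ v ⁆
    image-upd (x ∷ xs) (∉ ∷ u) (here refl) rewrite c′-p | c-p | map-c′ xs ∉ = Subsetₚ.∪-comm ⁅ v ⁆ _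
    image-upd (x ∷ xs) (∉ ∷ u) (there m) rewrite head-c′ (All.lookup ∉ m) with c x
    ... | fixed w = trans (cong (⁅ w ⁆ ∪_) (image-upd xs u m)) (sym (Subsetₚ.∪-assoc ⁅ w ⁆ _ ⁅ v ⁆))
    ... | blank _ = image-upd xs u m

  -- Filling a blank lowers one of the two counters of `G` and adds a vertex to the set, which is
  -- exactly one step of the recursion of `G`. Since `G` tests both classes at every stage, the
  -- blanks may be filled in any order.
  Good-extend : ∀ c xs p τ → Unique xs → p ∈ˡ xs → c p ≡ blank τ → Good (map c xs) ≡ true →
                count (λ v → X τ v ∧ not (Good (map (upd c p (fixed v)) xs))) ≤ θ
  Good-extend c xs p true u m e good = ℕₚ.≤-trans (ℕₚ.≤-reflexive (count-cong (λ v → cong (λ z → X true v ∧ not z) (sym (same v))))) (G-true a b S good′)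
    where
    a b : ℕ
    a = blanks true (map (upd c p (fixed p)) xs)
    b = blanks false (map c xs)
    S : Subset n
    S = image (map c xs)
    eq-a : ∀ v → blanks true (map (upd c p (fixed v)) xs) ≡ a
    eq-a v = ℕₚ.suc-injective (trans (sym (Update.blanks-upd c p true e v xs u m)) (Update.blanks-upd c p true e p xs u m))
    good′ : G (suc a) b S ≡ true
    good′ = subst (λ z → G z b S ≡ true) (Update.blanks-upd c p true e p xs u m) good
    same : ∀ v → G a b (S ∪ ⁅ v ⁆) ≡ Good (map (upd c p (fixed v)) xs)
    same v rewrite eq-a v | Update.blanks-upd-other c p true e v false refl xs u m | Update.image-upd c p true e v xs u m = refl
  Good-extend c xs p false u m e good = ℕₚ.≤-trans (ℕₚ.≤-reflexive (count-cong (λ v → cong (λ z → X false v ∧ not z) (sym (same v))))) (G-false a b S good′)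
    where
    a b : ℕ
    a = blanks true (map c xs)
    b = blanks false (map (upd c p (fixed p)) xs)
    S : Subset n
    S = image (map c xs)
    eq-b : ∀ v → blanks false (map (upd c p (fixed v)) xs) ≡ b
    eq-b v = ℕₚ.suc-injective (trans (sym (Update.blanks-upd c p false e v xs u m)) (Update.blanks-upd c p false e p xs u m))
    good′ : G a (suc b) S ≡ true
    good′ = subst (λ z → G a z S ≡ true) (Update.blanks-upd c p false e p xs u m) good
    same : ∀ v → G a b (S ∪ ⁅ v ⁆) ≡ Good (map (upd c p (fixed v)) xs)
    same v rewrite eq-b v | Update.blanks-upd-other c p false e v true refl xs u m | Update.image-upd c p false e v xs u m = refl

-- Sums over all subsets, degrees and tuples

Σs : ∀ {n} → (Subset n → ℕ) → ℕ
Σs {zero} h = h []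
Σs {suc n} h = Σs (λ S → h (outside ∷ S)) + Σs (λ S → h (inside ∷ S))

Σs-cong : ∀ {n} {f g : Subset n → ℕ} → (∀ S → f S ≡ g S) → Σs f ≡ Σs g
Σs-cong {zero} h = h []
Σs-cong {suc n} h = cong₂ _+_ (Σs-cong (λ S → h (outside ∷ S))) (Σs-cong (λ S → h (inside ∷ S)))

Σs-mono : ∀ {n} {f g : Subset n → ℕ} → (∀ S → f S ≤ g S) → Σs f ≤ Σs g
Σs-mono {zero} h = h []
Σs-mono {suc n} h = ℕₚ.+-mono-≤ (Σs-mono (λ S → h (outside ∷ S))) (Σs-mono (λ S → h (inside ∷ S)))

Σs-zero : ∀ {n} {f : Subset n → ℕ} → (∀ S → f S ≡ 0) → Σs f ≡ 0
Σs-zero {zero} h = h []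
Σs-zero {suc n} h = cong₂ _+_ (Σs-zero (λ S → h (outside ∷ S))) (Σs-zero (λ S → h (inside ∷ S)))

Σs-+-identity : ∀ a b c d → (a + b) + (c + d) ≡ (a + c) + (b + d)
Σs-+-identity = solve 4 (λ a b c d → (a :+ b) :+ (c :+ d) := (a :+ c) :+ (b :+ d)) refl
  where open ℕ-Solver

Σs-+ : ∀ {n} (f g : Subset n → ℕ) → Σs (λ S → f S + g S) ≡ Σs f + Σs g
Σs-+ {zero} f g = refl
Σs-+ {suc n} f g = trans (cong₂ _+_ (Σs-+ (λ S → f (outside ∷ S)) (λ S → g (outside ∷ S))) (Σs-+ (λ S → f (inside ∷ S)) (λ S → g (inside ∷ S))))
  (Σs-+-identity (Σs (λ S → f (outside ∷ S))) _ _ _)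

Σs-* : ∀ {n} c (f : Subset n → ℕ) → Σs (λ S → c * f S) ≡ c * Σs f
Σs-* {zero} c f = refl
Σs-* {suc n} c f = trans (cong₂ _+_ (Σs-* c (λ S → f (outside ∷ S))) (Σs-* c (λ S → f (inside ∷ S)))) (sym (ℕₚ.*-distribˡ-+ c _ _))

Σs-sum : ∀ {n m} (f : Subset n → Fin m → ℕ) → Σs (λ S → sum (f S)) ≡ sum (λ v → Σs (λ S → f S v))
Σs-sum {zero} f = refl
Σs-sum {suc n} f = trans (cong₂ _+_ (Σs-sum (λ S → f (outside ∷ S))) (Σs-sum (λ S → f (inside ∷ S))))
  (sym (sum-+ (λ v → Σs (λ S → f (outside ∷ S) v)) (λ v → Σs (λ S → f (inside ∷ S) v))))

-- Adding `v` is a bijection from the sets without `v` onto the sets with `v`.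
Σs-toggle : ∀ {n} (v : Fin n) (h : Subset n → ℕ) →
            Σs (λ Y → ι (not (lookup Y v)) * h (Y ∪ ⁅ v ⁆)) ≡ Σs (λ Y → ι (lookup Y v) * h Y)
Σs-toggle {suc n} zero h = trans (cong₂ _+_
    (Σs-cong {n} (λ S → cong (λ R → 1 * h (inside ∷ R)) (Subsetₚ.∪-identityʳ S)))
    (Σs-zero {n} (λ S → refl)))
  (trans (ℕₚ.+-comm _ 0) (cong (_+ Σs {n} (λ S → 1 * h (inside ∷ S))) (sym (Σs-zero {n} (λ S → refl)))))
Σs-toggle {suc n} (suc v) h = cong₂ _+_ (Σs-toggle v (λ S → h (outside ∷ S))) (Σs-toggle v (λ S → h (inside ∷ S)))

Σs-empty : ∀ {n} (h : Subset n → ℕ) → Σs (λ Y → ι (does (∣ Y ∣ ℕₚ.≟ 0)) * h Y) ≡ h ∅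
Σs-empty {zero} h = ℕₚ.+-identityʳ _
Σs-empty {suc n} h = trans (cong₂ _+_ (Σs-empty (λ S → h (outside ∷ S))) (Σs-zero {n} (λ S → refl))) (ℕₚ.+-identityʳ _)

Σs-subsets : ∀ {n} {Q : Subset n → Set} (Q? : Decidable Q) → length (filter Q? (subsets n)) ≡ Σs (λ S → ι (does (Q? S)))
Σs-subsets {zero} Q? with does (Q? [])
... | true = refl
... | false = refl
Σs-subsets {suc n} Q? = trans (cong length (Listₚ.filter-++ Q? (map (outside ∷_) (subsets n)) (map (inside ∷_) (subsets n))))
  (trans (Listₚ.length-++ (filter Q? (map (outside ∷_) (subsets n))))
    (cong₂ _+_ (trans (filter-map (outside ∷_) (subsets n)) (Σs-subsets (λ S → Q? (outside ∷ S))))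
               (trans (filter-map (inside ∷_) (subsets n)) (Σs-subsets (λ S → Q? (inside ∷ S))))))
  where
  filter-map : ∀ (f : Subset n → Subset (suc n)) xs → length (filter Q? (map f xs)) ≡ length (filter (λ S → Q? (f S)) xs)
  filter-map f [] = refl
  filter-map f (x ∷ xs) with does (Q? (f x))
  ... | true = cong suc (filter-map f xs)
  ... | false = filter-map f xs

length-filter-allFin : ∀ {n} {Q : Fin n → Set} (Q? : Decidable Q) → length (filter Q? (allFin n)) ≡ count (λ v → does (Q? v))
length-filter-allFin {n} Q? = go n (λ v → v) Q?
  where
  go : ∀ m (f : Fin m → Fin n) {Q : Fin n → Set} (Q? : Decidable Q) → length (filter Q? (tabulate f)) ≡ count (λ v → does (Q? (f v)))
  go zero f Q? = sym (count-zero (λ ()))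
  go (suc m) f Q? = trans (step (does (Q? (f zero))) refl) (sym (count-suc (λ v → does (Q? (f v)))))
    where
    step : ∀ b → does (Q? (f zero)) ≡ b → length (filter Q? (f zero ∷ tabulate (f ∘ suc))) ≡ ι (does (Q? (f zero))) + count (λ v → does (Q? (f (suc v))))
    step true e rewrite e = cong suc (go m (f ∘ suc) Q?)
    step false e rewrite e = go m (f ∘ suc) Q?

subsets-complete : ∀ {n} (S : Subset n) → S ∈ˡ subsets n
subsets-complete [] = here refl
subsets-complete {suc n} (false ∷ S) = ∈-++⁺ˡ (∈-map⁺ (outside ∷_) (subsets-complete S))
subsets-complete {suc n} (true ∷ S) = ∈-++⁺ʳ (map (outside ∷_) (subsets n)) (∈-map⁺ (inside ∷_) (subsets-complete S))

card-count : ∀ {n} (S : Subset n) → ∣ S ∣ ≡ count (lookup S)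
card-count [] = sym (count-zero (λ ()))
card-count (true ∷ S) = trans (cong suc (card-count S)) (sym (count-suc (lookup (true ∷ S))))
card-count (false ∷ S) = trans (card-count S) (sym (count-suc (lookup (false ∷ S))))

lookup-∪ : ∀ {n} (S T : Subset n) v → lookup (S ∪ T) v ≡ lookup S v ∨ lookup T v
lookup-∪ S T v = Vecₚ.lookup-zipWith _∨_ v S T

lookup-⁅⁆ : ∀ {n} (v u : Fin n) → lookup ⁅ v ⁆ u ≡ (u == v)
lookup-⁅⁆ zero zero = refl
lookup-⁅⁆ zero (suc u) = Vecₚ.lookup-replicate u outside
lookup-⁅⁆ (suc v) zero = refl
lookup-⁅⁆ (suc v) (suc u) = lookup-⁅⁆ v u

lookup-∅ : ∀ {n} (v : Fin n) → lookup ∅ v ≡ false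
lookup-∅ v = Vecₚ.lookup-replicate v outside

subset-ext : ∀ {n} {S T : Subset n} → (∀ v → lookup S v ≡ lookup T v) → S ≡ T
subset-ext {S = []} {[]} h = refl
subset-ext {S = x ∷ S} {y ∷ T} h = cong₂ _∷_ (h zero) (subset-ext (h ∘ suc))

∪-∈ : ∀ {n} (S : Subset n) v → lookup S v ≡ true → S ∪ ⁅ v ⁆ ≡ S
∪-∈ S v e = subset-ext (λ u → trans (lookup-∪ S ⁅ v ⁆ u) (trans (cong (lookup S u ∨_) (lookup-⁅⁆ v u)) (step u)))
  where
  step : ∀ u → lookup S u ∨ (u == v) ≡ lookup S u
  step u with bool-cases (u == v)
  ... | inj₁ t rewrite t | ==-sound {i = u} {v} t | e = refl
  ... | inj₂ f rewrite f with lookup S u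
  ...   | true = refl
  ...   | false = refl

card-∪-∉ : ∀ {n} (S : Subset n) v → lookup S v ≡ false → ∣ S ∪ ⁅ v ⁆ ∣ ≡ suc ∣ S ∣
card-∪-∉ (false ∷ S) zero e = cong (suc ∘ ∣_∣) (Subsetₚ.∪-identityʳ S)
card-∪-∉ (true ∷ S) (suc v) e = cong suc (card-∪-∉ S v e)
card-∪-∉ (false ∷ S) (suc v) e = card-∪-∉ S v e

card-∪-≤ : ∀ {n} (S : Subset n) v → ∣ S ∪ ⁅ v ⁆ ∣ ≤ suc ∣ S ∣
card-∪-≤ S v with bool-cases (lookup S v)
... | inj₁ e = ℕₚ.≤-trans (ℕₚ.≤-reflexive (cong ∣_∣ (∪-∈ S v e))) (ℕₚ.n≤1+n _)
... | inj₂ e = ℕₚ.≤-reflexive (card-∪-∉ S v e)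

card-∪ : ∀ {n} (S T : Subset n) → ∣ S ∪ T ∣ ≤ ∣ S ∣ + ∣ T ∣
card-∪ [] [] = z≤n
card-∪ (true ∷ S) (true ∷ T) = s≤s (ℕₚ.≤-trans (card-∪ S T) (ℕₚ.+-monoʳ-≤ ∣ S ∣ (ℕₚ.n≤1+n _)))
card-∪ (true ∷ S) (false ∷ T) = s≤s (card-∪ S T)
card-∪ (false ∷ S) (true ∷ T) = ℕₚ.≤-trans (s≤s (card-∪ S T)) (ℕₚ.≤-reflexive (sym (ℕₚ.+-suc ∣ S ∣ ∣ T ∣)))
card-∪ (false ∷ S) (false ∷ T) = card-∪ S T

⊆-lookup : ∀ {n} {S T : Subset n} → S ⊆ˢ T → ∀ v → lookup S v ≡ true → lookup T v ≡ true
⊆-lookup h v e = Vecₚ.[]=⇒lookup (h (Vecₚ.lookup⇒[]= v _ e))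

lookup-⊆ : ∀ {n} {S T : Subset n} → (∀ v → lookup S v ≡ true → lookup T v ≡ true) → S ⊆ˢ T
lookup-⊆ h m = Vecₚ.lookup⇒[]= _ _ (h _ (Vecₚ.[]=⇒lookup m))

≟-cases : ∀ a b → (does (a ℕₚ.≟ b) ≡ true × a ≡ b) ⊎ (does (a ℕₚ.≟ b) ≡ false × a ≢ b)
≟-cases a b with bool-cases (does (a ℕₚ.≟ b))
... | inj₁ e = inj₁ (e , from-does (a ℕₚ.≟ b) e)
... | inj₂ e = inj₂ (e , from-not-does (a ℕₚ.≟ b) e)

-- For the indicator of the edges this is the degree of `S` into `Z`.
weight : ∀ {n} → ℕ → (Subset n → ℕ) → Subset n → Subset n → ℕ
weight b f S Z = Σs (λ Y → ι (does (∣ Y ∣ ℕₚ.≟ b)) * (ι (does (Y ⊆? Z)) * f (S ∪ Y)))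

each-shuffle : ∀ a b c d → a * (b * (c * d)) ≡ b * ((a * c) * d)
each-shuffle = solve 4 (λ a b c d → a :* (b :* (c :* d)) := b :* ((a :* c) :* d)) refl
  where open ℕ-Solver

*-swap : ∀ a b c → a * (b * c) ≡ b * (a * c)
*-swap = solve 3 (λ a b c → a :* (b :* c) := b :* (a :* c)) refl
  where open ℕ-Solver

tsum-weight-identity : ∀ x b y → x * ((1 + b) * y) ≡ ((1 + b) * x) * y
tsum-weight-identity = solve 3 (λ x b y → x :* ((con 1 :+ b) :* y) := ((con 1 :+ b) :* x) :* y) refl
  where open ℕ-Solver

module _ {n : ℕ} (Z : Subset n) (f : Subset n → ℕ) (t : ℕ) (f-supp : ∀ R → ∣ R ∣ ≢ t → f R ≡ 0) where

  inside-false : ∀ b S v → ∣ S ∣ + suc b ≤ t → ∀ Y → lookup Y v ≡ true →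
                 ι (does (∣ Y ∣ ℕₚ.≟ b)) * (ι (does (Y ⊆? Z)) * f ((S ∪ ⁅ v ⁆) ∪ Y)) ≡ 0
  inside-false b S v le Y e with ≟-cases ∣ Y ∣ b
  ... | inj₂ (q , _) rewrite q = refl
  ... | inj₁ (q , refl) rewrite q = trans (ℕₚ.+-identityʳ _) (trans (cong (ι (does (Y ⊆? Z)) *_) (trans (cong f eq) (f-supp (S ∪ Y) ne))) (ℕₚ.*-zeroʳ (ι (does (Y ⊆? Z)))))
    where
    eq : (S ∪ ⁅ v ⁆) ∪ Y ≡ S ∪ Y
    eq = trans (Subsetₚ.∪-assoc S ⁅ v ⁆ Y) (cong (S ∪_) (trans (Subsetₚ.∪-comm ⁅ v ⁆ Y) (∪-∈ Y v e)))
    ne : ∣ S ∪ Y ∣ ≢ t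
    ne refl = ℕₚ.<⇒≱ (ℕₚ.+-monoʳ-< ∣ S ∣ (ℕₚ.n<1+n ∣ Y ∣)) (ℕₚ.≤-trans le (card-∪ S Y))

  -- Double counting of the pairs `(v , Y)` with `v` in the (b+1)-set `Y`. Pairs in which `v`
  -- already belongs to the smaller set contribute nothing, because the union is then too small for
  -- `f`.
  weight-step : ∀ b S → ∣ S ∣ + suc b ≤ t → sum (λ v → ι (lookup Z v) * weight b f (S ∪ ⁅ v ⁆) Z) ≡ suc b * weight (suc b) f S Z
  weight-step b S le = begin
    sum (λ v → ι (lookup Z v) * weight b f (S ∪ ⁅ v ⁆) Z)
      ≡⟨ sum-cong (λ v → trans (sym (Σs-* {n} (ι (lookup Z v)) (λ Y → ι (does (∣ Y ∣ ℕₚ.≟ b)) * (ι (does (Y ⊆? Z)) * f ((S ∪ ⁅ v ⁆) ∪ Y))))) (trans (Σs-cong (λ Y → each v Y)) (Σs-toggle v (h v)))) ⟩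
    sum (λ v → Σs (λ Y → ι (lookup Y v) * g Y))
      ≡⟨ sym (Σs-sum (λ Y v → ι (lookup Y v) * g Y)) ⟩
    Σs (λ Y → sum (λ v → ι (lookup Y v) * g Y))
      ≡⟨ Σs-cong (λ Y → trans (sum-cong (λ v → ℕₚ.*-comm (ι (lookup Y v)) (g Y))) (trans (sym (*-sum (g Y) _))
           (trans (cong (g Y *_) (trans (sym (count-sum (lookup Y))) (sym (card-count Y)))) (size Y)))) ⟩
    Σs (λ Y → suc b * g Y)
      ≡⟨ Σs-* (suc b) g ⟩
    suc b * weight (suc b) f S Z ∎
    where
    open ≡-Reasoning
    g : Subset n → ℕ
    g Y = ι (does (∣ Y ∣ ℕₚ.≟ suc b)) * (ι (does (Y ⊆? Z)) * f (S ∪ Y))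
    h : Fin n → Subset n → ℕ
    h v Y = g Y
    size : ∀ Y → g Y * ∣ Y ∣ ≡ suc b * g Y
    size Y with ≟-cases ∣ Y ∣ (suc b)
    ... | inj₁ (_ , e) = trans (cong (g Y *_) e) (ℕₚ.*-comm (g Y) (suc b))
    ... | inj₂ (e , _) = trans (cong (λ b → ι b * (ι (does (Y ⊆? Z)) * f (S ∪ Y)) * ∣ Y ∣) e)
           (sym (trans (cong (λ c → suc b * (ι c * (ι (does (Y ⊆? Z)) * f (S ∪ Y)))) e) (ℕₚ.*-zeroʳ (suc b))))
    each : ∀ v Y → ι (lookup Z v) * (ι (does (∣ Y ∣ ℕₚ.≟ b)) * (ι (does (Y ⊆? Z)) * f ((S ∪ ⁅ v ⁆) ∪ Y))) ≡ ι (not (lookup Y v)) * h v (Y ∪ ⁅ v ⁆)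
    each v Y with bool-cases (lookup Y v)
    ... | inj₁ e rewrite e = trans (cong (ι (lookup Z v) *_) (inside-false b S v le Y e)) (ℕₚ.*-zeroʳ (ι (lookup Z v)))
    ... | inj₂ e rewrite e = trans (each-shuffle (ι (lookup Z v)) (ι (does (∣ Y ∣ ℕₚ.≟ b))) (ι (does (Y ⊆? Z))) _)
          (trans (cong₂ (λ x y → x * (y * f ((S ∪ ⁅ v ⁆) ∪ Y))) sizes incl)
            (trans (cong (λ R → ι (does (∣ Y ∪ ⁅ v ⁆ ∣ ℕₚ.≟ suc b)) * (ι (does ((Y ∪ ⁅ v ⁆) ⊆? Z)) * f R)) sets) (sym (ℕₚ.+-identityʳ _))))
      where
      sets : (S ∪ ⁅ v ⁆) ∪ Y ≡ S ∪ (Y ∪ ⁅ v ⁆)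
      sets = trans (Subsetₚ.∪-assoc S ⁅ v ⁆ Y) (cong (S ∪_) (Subsetₚ.∪-comm ⁅ v ⁆ Y))
      sizes : ι (does (∣ Y ∣ ℕₚ.≟ b)) ≡ ι (does (∣ Y ∪ ⁅ v ⁆ ∣ ℕₚ.≟ suc b))
      sizes rewrite card-∪-∉ Y v e = refl
      incl : ι (lookup Z v) * ι (does (Y ⊆? Z)) ≡ ι (does ((Y ∪ ⁅ v ⁆) ⊆? Z))
      incl with (Y ∪ ⁅ v ⁆) ⊆? Z
      ... | yes sub = cong₂ (λ x y → ι x * ι y)
              (⊆-lookup sub v (trans (lookup-∪ Y ⁅ v ⁆ v) (trans (cong (lookup Y v ∨_) (trans (lookup-⁅⁆ v v) (==-refl v))) (∨-true (lookup Y v)))))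
              (does-true (Y ⊆? Z) (λ m → sub (Subsetₚ.p⊆p∪q ⁅ v ⁆ m)))
        where
        ∨-true : ∀ b → b ∨ true ≡ true
        ∨-true true = refl
        ∨-true false = refl
      ... | no ¬sub with bool-cases (lookup Z v)
      ...   | inj₂ z rewrite z = refl
      ...   | inj₁ z rewrite z = trans (ℕₚ.+-identityʳ _) (cong ι (does-false (Y ⊆? Z) (λ sub → ¬sub (lookup-⊆ (λ u q → both sub u (∨-elim (trans (sym (lookup-∪ Y ⁅ v ⁆ u)) q)))))))
        where
        both : Y ⊆ˢ Z → ∀ u → lookup Y u ≡ true ⊎ lookup ⁅ v ⁆ u ≡ true → lookup Z u ≡ true
        both sub u (inj₁ q) = ⊆-lookup sub u q
        both sub u (inj₂ q) = trans (cong (lookup Z) (==-sound (trans (sym (lookup-⁅⁆ v u)) q))) z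

  -- As `f` lives on sets of size `t`, tuples with repeated entries or meeting `S` vanish, and each
  -- remaining b-set is counted in its b! orders. The hypothesis is an inequality because
  -- `S ∪ ⁅ v ⁆` in the recursion may be no larger than `S`.
  tsum-weight : ∀ b S → ∣ S ∣ + b ≤ t → tsum (lookup Z) b f S ≡ b ! * weight b f S Z
  tsum-weight zero S le = sym (trans (ℕₚ.+-identityʳ _) (trans (Σs-empty (λ Y → ι (does (Y ⊆? Z)) * f (S ∪ Y)))
    (trans (cong₂ (λ x R → ι x * f R) (does-true (∅ ⊆? Z) (λ m → ⊥-elim (Subsetₚ.∉⊥ m))) (Subsetₚ.∪-identityʳ S)) (ℕₚ.+-identityʳ _))))
  tsum-weight (suc b) S le = begin
    sum (λ v → ι (lookup Z v) * tsum (lookup Z) b f (S ∪ ⁅ v ⁆))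
      ≡⟨ sum-cong (λ v → trans (cong (ι (lookup Z v) *_) (tsum-weight b (S ∪ ⁅ v ⁆)
           (ℕₚ.≤-trans (ℕₚ.+-monoˡ-≤ b (card-∪-≤ S v)) (ℕₚ.≤-trans (ℕₚ.≤-reflexive (sym (ℕₚ.+-suc ∣ S ∣ b))) le)))) (*-swap (ι (lookup Z v)) (b !) _)) ⟩
    sum (λ v → b ! * (ι (lookup Z v) * weight b f (S ∪ ⁅ v ⁆) Z))
      ≡⟨ sym (*-sum (b !) _) ⟩
    b ! * sum (λ v → ι (lookup Z v) * weight b f (S ∪ ⁅ v ⁆) Z)
      ≡⟨ cong (b ! *_) (weight-step b S le) ⟩
    b ! * (suc b * weight (suc b) f S Z)
      ≡⟨ tsum-weight-identity (b !) b (weight (suc b) f S Z) ⟩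
    (suc b * b !) * weight (suc b) f S Z ∎
    where
    open ≡-Reasoning

degenerate : ∀ {n} → ℕ → Subset n → ℕ
degenerate t R = ι (not (does (∣ R ∣ ℕₚ.≟ t)))

degenerate≤1 : ∀ {n} t (R : Subset n) → degenerate t R ≤ 1
degenerate≤1 t R = ι≤1 _

tsum-degenerate-identity : ∀ n m t b → n * m * t + n * (b * t * m) ≡ (1 + b) * t * (n * m)
tsum-degenerate-identity = solve 4 (λ n m t b → n :* m :* t :+ n :* (b :* t :* m) := (con 1 :+ b) :* t :* (n :* m)) refl
  where open ℕ-Solver

-- A tuple degenerates only when some entry hits the fewer than `t` vertices chosen before; each of
-- the `b` choices costs a share of at most t/n. The factor `n` again avoids the exponent b - 1.
tsum-degenerate : ∀ {n} (P : Fin n → Bool) b t S → ∣ S ∣ + b ≡ t → n * tsum P b (degenerate t) S ≤ b * t * n ^ b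
tsum-degenerate {n} P zero t S e = ℕₚ.≤-reflexive (trans (cong (n *_) (cong (ι ∘ not) (does-true (∣ S ∣ ℕₚ.≟ t) (trans (sym (ℕₚ.+-identityʳ _)) e)))) (ℕₚ.*-zeroʳ n))
tsum-degenerate {n} P (suc b) t S e = begin
  n * sum (λ v → ι (P v) * tsum P b (degenerate t) (S ∪ ⁅ v ⁆))
    ≡⟨ *-sum n _ ⟩
  sum (λ v → n * (ι (P v) * tsum P b (degenerate t) (S ∪ ⁅ v ⁆)))
    ≤⟨ sum-mono each ⟩
  sum (λ v → (n * n ^ b) * ι (lookup S v) + b * t * n ^ b)
    ≡⟨ trans (sum-+ _ _) (cong₂ _+_ (trans (sym (*-sum (n * n ^ b) _)) (cong (n * n ^ b *_) (trans (sym (count-sum (lookup S))) (sym (card-count S))))) (sum-const {n} (b * t * n ^ b))) ⟩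
  (n * n ^ b) * ∣ S ∣ + n * (b * t * n ^ b)
    ≤⟨ ℕₚ.+-monoˡ-≤ _ (ℕₚ.*-monoʳ-≤ (n * n ^ b) (ℕₚ.≤-trans (ℕₚ.m≤m+n ∣ S ∣ (suc b)) (ℕₚ.≤-reflexive e))) ⟩
  (n * n ^ b) * t + n * (b * t * n ^ b)
    ≡⟨ tsum-degenerate-identity n (n ^ b) t b ⟩
  suc b * t * n ^ suc b ∎
  where
  open ℕₚ.≤-Reasoning
  drop-P : ∀ v → n * (ι (P v) * tsum P b (degenerate t) (S ∪ ⁅ v ⁆)) ≤ n * tsum P b (degenerate t) (S ∪ ⁅ v ⁆)
  drop-P v = ℕₚ.*-monoʳ-≤ n (ℕₚ.≤-trans (ℕₚ.*-monoˡ-≤ (tsum P b (degenerate t) (S ∪ ⁅ v ⁆)) (ι≤1 (P v))) (ℕₚ.≤-reflexive (ℕₚ.+-identityʳ _)))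
  each : ∀ v → n * (ι (P v) * tsum P b (degenerate t) (S ∪ ⁅ v ⁆)) ≤ (n * n ^ b) * ι (lookup S v) + b * t * n ^ b
  each v with bool-cases (lookup S v)
  ... | inj₁ i rewrite i = ℕₚ.≤-trans (drop-P v) (ℕₚ.≤-trans (ℕₚ.*-monoʳ-≤ n (tsum-bound P b 1 (degenerate≤1 t) (S ∪ ⁅ v ⁆)))
          (ℕₚ.≤-trans (ℕₚ.≤-reflexive (sym (ℕₚ.*-assoc n (n ^ b) 1))) (ℕₚ.m≤m+n _ _)))
  ... | inj₂ i = ℕₚ.≤-trans (drop-P v) (ℕₚ.≤-trans (tsum-degenerate P b t (S ∪ ⁅ v ⁆)
          (trans (cong (_+ b) (card-∪-∉ S v i)) (trans (sym (ℕₚ.+-suc ∣ S ∣ b)) e))) (ℕₚ.m≤n+m _ _))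

-- Degrees of hypergraphs

module Degrees {k n : ℕ} (H : KGraph k n) where

  E : Subset n → Bool
  E R = does (edge? H R)

  E-supp : ∀ R → ∣ R ∣ ≢ k → ι (E R) ≡ 0
  E-supp R ne = cong ι (does-false (edge? H R) (λ h → ne (uniform H h)))

  deg-tsum : ∀ b S Z → ∣ S ∣ + b ≡ k → tsum (lookup Z) b (λ R → ι (E R)) S ≡ b ! * deg H S Z
  deg-tsum b S Z e = trans (tsum-weight Z (λ R → ι (E R)) k E-supp b S (ℕₚ.≤-reflexive e))
    (cong (b ! *_) (sym (trans (Σs-subsets (λ Y → (∣ Y ∣ ℕₚ.≟ k ∸ ∣ S ∣) ×-dec (Y ⊆? Z) ×-dec edge? H (S ∪ Y)))
      (Σs-cong (λ Y → trans (ι-∧ (does (∣ Y ∣ ℕₚ.≟ k ∸ ∣ S ∣)) _) (cong₂ (λ x y → ι (does (∣ Y ∣ ℕₚ.≟ x)) * y) b-eq (ι-∧ (does (Y ⊆? Z)) _)))))))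
    where
    b-eq : k ∸ ∣ S ∣ ≡ b
    b-eq = trans (cong (_∸ ∣ S ∣) (sym e)) (ℕₚ.m+n∸m≡n ∣ S ∣ b)

  e-tsum : ∀ Z → tsum (lookup Z) k (λ R → ι (E R)) ∅ ≡ k ! * e H Z
  e-tsum Z = trans (tsum-weight Z (λ R → ι (E R)) k E-supp k ∅ (ℕₚ.≤-reflexive (cong (_+ k) (Subsetₚ.∣⊥∣≡0 n))))
    (cong (k ! *_) (sym (trans (Σs-subsets (λ S → edge? H S ×-dec (S ⊆? Z))) (Σs-cong same))))
    where
    same : ∀ Y → ι (E Y ∧ does (Y ⊆? Z)) ≡ ι (does (∣ Y ∣ ℕₚ.≟ k)) * (ι (does (Y ⊆? Z)) * ι (E (∅ ∪ Y)))
    same Y rewrite Subsetₚ.∪-identityˡ Y with ≟-cases ∣ Y ∣ k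
    ... | inj₁ (e , _) rewrite e = trans (ι-∧ (E Y) _) (trans (ℕₚ.*-comm (ι (E Y)) _) (sym (ℕₚ.+-identityʳ _)))
    ... | inj₂ (e , ne) rewrite e = trans (ι-∧ (E Y) _) (cong (_* ι (does (Y ⊆? Z))) (E-supp Y ne))

  δ≤codegree : ∀ S → ∣ S ∣ ≡ k ∸ 1 → δ H ≤ count (λ v → E (S ∪ ⁅ v ⁆))
  δ≤codegree S e = ℕₚ.≤-trans (fold-≤ (map (codegree H) (filter (λ S → ∣ S ∣ ℕₚ.≟ k ∸ 1) (subsets n)))
      (∈-map⁺ (codegree H) (∈-filter⁺ (λ S → ∣ S ∣ ℕₚ.≟ k ∸ 1) (subsets-complete S) e)))
    (ℕₚ.≤-trans (ℕₚ.≤-reflexive (length-filter-allFin (λ v → ¬? (v ∈? S) ×-dec edge? H (S ∪ ⁅ v ⁆))))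
      (count-mono (λ v h → proj₂ (∧-true {does (¬? (v ∈? S))} h))))
    where
    fold-≤ : ∀ (xs : List ℕ) {x} → x ∈ˡ xs → foldr _⊓_ n xs ≤ x
    fold-≤ (x ∷ xs) (here refl) = ℕₚ.m⊓n≤m x _
    fold-≤ (y ∷ xs) (there m) = ℕₚ.≤-trans (ℕₚ.m⊓n≤n y _) (fold-≤ xs m)

-- Bounds for binomial coefficients

-- The falling factorial N (N - 1) ... (N - b + 1), written without subtraction.
falling : ℕ → ℕ → ℕ
falling N b = b ! * (N C b)

falling-suc-identity : ∀ x y → x * 0 ≡ 1 * (y * 0)
falling-suc-identity = solve 2 (λ x y → x :* con 0 := con 1 :* (y :* con 0)) refl
  where open ℕ-Solver

falling-suc-expand : ∀ b x p q → ((1 + b) * x) * (p + q) ≡ (1 + b) * (x * p) + ((1 + b) * x) * q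
falling-suc-expand = solve 4 (λ b x p q → ((con 1 :+ b) :* x) :* (p :+ q) := (con 1 :+ b) :* (x :* p) :+ ((con 1 :+ b) :* x) :* q) refl
  where open ℕ-Solver

falling-suc-collect : ∀ f b n x y → f + (1 + b) * ((1 + n) * x) + (1 + n) * y ≡ f + (1 + n) * ((1 + b) * x + y)
falling-suc-collect = solve 5 (λ f b n x y → f :+ (con 1 :+ b) :* ((con 1 :+ n) :* x) :+ (con 1 :+ n) :* y := f :+ (con 1 :+ n) :* ((con 1 :+ b) :* x :+ y)) refl
  where open ℕ-Solver

falling-suc : ∀ N b → falling (suc N) (suc b) ≡ suc N * falling N b
falling-suc N zero = trans (cong (λ x → 1 * x) (nC1≡n (suc N))) (trans (ℕₚ.+-identityʳ _) (sym (ℕₚ.*-identityʳ _)))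
falling-suc zero (suc b) = trans (cong ((suc (suc b)) ! *_) (sym (nCk+nC[k+1]≡[n+1]C[k+1] 0 (suc b)))) (falling-suc-identity ((suc (suc b)) !) ((suc b) !))
falling-suc (suc N) (suc b) = begin
  c * (suc (suc N) C suc (suc b))                           ≡⟨ cong (c *_) (sym (nCk+nC[k+1]≡[n+1]C[k+1] (suc N) (suc b))) ⟩
  c * ((suc N C suc b) + (suc N C suc (suc b)))             ≡⟨ falling-suc-expand (suc b) ((suc b) !) (suc N C suc b) (suc N C suc (suc b)) ⟩
  suc (suc b) * F₁ + falling (suc N) (suc (suc b))          ≡⟨ cong (suc (suc b) * F₁ +_) (falling-suc N (suc b)) ⟩
  suc (suc b) * F₁ + suc N * falling N (suc b)              ≡⟨ cong (λ x → F₁ + suc b * F₁ + suc N * x) refl ⟩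
  F₁ + suc b * F₁ + suc N * falling N (suc b)               ≡⟨ cong (λ x → F₁ + suc b * x + suc N * falling N (suc b)) (falling-suc N b) ⟩
  F₁ + suc b * (suc N * falling N b) + suc N * falling N (suc b) ≡⟨ falling-suc-collect F₁ b N (falling N b) (falling N (suc b)) ⟩
  F₁ + suc N * (suc b * falling N b + falling N (suc b))    ≡⟨ cong (λ x → F₁ + suc N * x) pascal ⟩
  F₁ + suc N * F₁                                           ∎
  where
  open ≡-Reasoning
  c F₁ : ℕ
  c = (suc (suc b)) !
  F₁ = falling (suc N) (suc b)
  pascal : suc b * falling N b + falling N (suc b) ≡ F₁
  pascal = trans (sym (falling-suc-expand b (b !) (N C b) (N C suc b))) (cong ((suc b) ! *_) (nCk+nC[k+1]≡[n+1]C[k+1] N b))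

falling-zero : ∀ b → falling 0 (suc b) ≡ 0
falling-zero b = ℕₚ.*-zeroʳ ((suc b) !)

falling-≤ : ∀ N b → falling N b ≤ N ^ b
falling-≤ N zero = ℕₚ.≤-refl
falling-≤ zero (suc b) = ℕₚ.≤-trans (ℕₚ.≤-reflexive (falling-zero b)) z≤n
falling-≤ (suc N) (suc b) = ℕₚ.≤-trans (ℕₚ.≤-reflexive (falling-suc N b))
  (ℕₚ.*-monoʳ-≤ (suc N) (ℕₚ.≤-trans (falling-≤ N b) (ℕₚ.^-monoˡ-≤ b (ℕₚ.n≤1+n N))))

falling-≥ : ∀ N b → (N ∸ b) ^ b ≤ falling N b
falling-≥ N zero = ℕₚ.≤-refl
falling-≥ zero (suc b) = z≤n
falling-≥ (suc N) (suc b) = ℕₚ.≤-trans (ℕₚ.*-mono-≤ (ℕₚ.≤-trans (ℕₚ.m∸n≤m N b) (ℕₚ.n≤1+n N)) (falling-≥ N b)) (ℕₚ.≤-reflexive (sym (falling-suc N b)))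

power-gap-identity : ∀ M n x g y b → M * (n * x) + g * (n * y) + n * (b * g * y) ≡ n * (M * x) + (1 + b) * g * (n * y)
power-gap-identity = solve 6 (λ M n x g y b → M :* (n :* x) :+ g :* (n :* y) :+ n :* (b :* g :* y) := n :* (M :* x) :+ (con 1 :+ b) :* g :* (n :* y)) refl
  where open ℕ-Solver

-- Both sides carry a factor n to avoid the exponent b - 1.
power-gap : ∀ {n N M g} → N ≤ M + g → M ≤ n → N ≤ n → ∀ b → n * N ^ b ≤ n * M ^ b + b * g * n ^ b
power-gap N≤ M≤n N≤n zero = ℕₚ.m≤m+n _ _
power-gap {n} {N} {M} {g} N≤ M≤n N≤n (suc b) = begin
  n * (N * N ^ b)                                    ≡⟨ *-swap n N (N ^ b) ⟩
  N * (n * N ^ b)                                    ≤⟨ ℕₚ.*-monoʳ-≤ N (power-gap {n} {N} {M} {g} N≤ M≤n N≤n b) ⟩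
  N * (n * M ^ b + b * g * n ^ b)                    ≡⟨ ℕₚ.*-distribˡ-+ N _ _ ⟩
  N * (n * M ^ b) + N * (b * g * n ^ b)              ≤⟨ ℕₚ.+-mono-≤ (ℕₚ.*-monoˡ-≤ _ N≤) (ℕₚ.*-monoˡ-≤ _ N≤n) ⟩
  (M + g) * (n * M ^ b) + n * (b * g * n ^ b)        ≡⟨ cong (_+ n * (b * g * n ^ b)) (ℕₚ.*-distribʳ-+ (n * M ^ b) M g) ⟩
  M * (n * M ^ b) + g * (n * M ^ b) + n * (b * g * n ^ b) ≤⟨ ℕₚ.+-monoˡ-≤ _ (ℕₚ.+-monoʳ-≤ (M * (n * M ^ b)) (ℕₚ.*-monoʳ-≤ g (ℕₚ.*-monoʳ-≤ n (ℕₚ.^-monoˡ-≤ b M≤n)))) ⟩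
  M * (n * M ^ b) + g * (n * n ^ b) + n * (b * g * n ^ b) ≡⟨ power-gap-identity M n (M ^ b) g (n ^ b) b ⟩
  n * (M * M ^ b) + suc b * g * (n * n ^ b)          ∎
  where
  open ℕₚ.≤-Reasoning

*-^-identity : ∀ a b x y → (a * b) * (x * y) ≡ (a * x) * (b * y)
*-^-identity = solve 4 (λ a b x y → (a :* b) :* (x :* y) := (a :* x) :* (b :* y)) refl
  where open ℕ-Solver

*-^ : ∀ a b m → (a * b) ^ m ≡ a ^ m * b ^ m
*-^ a b zero = refl
*-^ a b (suc m) = trans (cong (a * b *_) (*-^ a b m)) (*-^-identity a b (a ^ m) (b ^ m))

cancel-*-≤ : ∀ c {a b} → 0 < c → c * a ≤ c * b → a ≤ b
cancel-*-≤ (suc c) _ h = ℕₚ.*-cancelˡ-≤ (suc c) h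

pos-^ : ∀ {n} m → 0 < n → 0 < n ^ m
pos-^ zero _ = s≤s z≤n
pos-^ (suc m) p = ℕₚ.*-mono-≤ p (pos-^ m p)

-- Counting in the extremal configuration; every real constant has been replaced by a power of 1/D.

record Extremality (κ n : ℕ) : Set₁ where
  no-eta-equality
  field
    H         : KGraph (suc κ) n
    A B A′ B′ : Subset n
    D Γ       : ℕ
    parts   : ∀ v → lookup A v ≡ not (lookup B v)
    codeg   : ∀ S → ∣ S ∣ ≡ κ → ∣ A ∣ ≤ count (λ v → does (edge? H (S ∪ ⁅ v ⁆)))
    A′-in   : ∀ v → lookup A′ v ≡ true → D * (∣ B ∣ C κ) ≤ deg H ⁅ v ⁆ B * D + 6 * (∣ B ∣ C κ)
    A′-out  : ∀ v → lookup A′ v ≡ false → deg H ⁅ v ⁆ B * D + (∣ B ∣ C κ) ≤ D * (∣ B ∣ C κ)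
    B′-in   : ∀ v → lookup B′ v ≡ true → deg H ⁅ v ⁆ B * D ≤ 6 * (∣ B ∣ C κ)
    B′-out  : ∀ v → lookup B′ v ≡ false → ∣ B ∣ C κ ≤ deg H ⁅ v ⁆ B * D
    -- e(B) is of order n^k/D^4; the fourth factor D has been spent on making the constants
    -- harmless.
    e-small : 2 * (4 ^ κ * Γ * (D * D * D) * (suc κ ! * e H B)) ≤ n * n ^ κ
    n-large : 2 * (4 ^ κ * Γ * (D * D * D) * (suc κ * suc κ)) ≤ n
    half    : n ≤ 2 * ∣ B ∣
    D-large : 13 ≤ D
    Γ-large : 4 * suc κ ≤ Γ

F-notE-dist : ∀ a b c → a * (b + c) ≡ a * c + a * b
F-notE-dist = solve 3 (λ a b c → a :* (b :+ c) := a :* c :+ a :* b) refl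
  where open ℕ-Solver

small-identity : ∀ p f c g d → p * f * (c * g * (d * d)) ≡ p * g * (d * d) * (c * f)
small-identity = solve 5 (λ p f c g d → p :* f :* (c :* g :* (d :* d)) := p :* g :* (d :* d) :* (c :* f)) refl
  where open ℕ-Solver

small-identity₂ : ∀ p g d x y z → p * g * (d * d) * (d * (x + y * z)) ≡ p * g * (d * d * d) * x + p * g * (d * d * d) * y * z
small-identity₂ = solve 6 (λ p g d x y z → p :* g :* (d :* d) :* (d :* (x :+ y :* z)) := p :* g :* (d :* d :* d) :* x :+ p :* g :* (d :* d :* d) :* y :* z) refl
  where open ℕ-Solver

miss-bound-identity : ∀ n t b κ m p q → n * (t + b * κ * m) + n * m * p + n * (b * q * m) ≡ n * t + (b * κ + p + b * q) * (n * m)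
miss-bound-identity = solve 7 (λ n t b κ m p q → n :* (t :+ b :* κ :* m) :+ n :* m :* p :+ n :* (b :* q :* m) := n :* t :+ (b :* κ :+ p :+ b :* q) :* (n :* m)) refl
  where open ℕ-Solver

loss-small-identity : ∀ d k p q → 4 * (d * d * (k * k + k * p + k * q)) ≡ 4 * (1 * (d * d) * (k * k)) + p * (4 * k) * (d * d) + q * (4 * k) * (d * d)
loss-small-identity = solve 4 (λ d k p q → con 4 :* (d :* d :* (k :* k :+ k :* p :+ k :* q)) := con 4 :* (con 1 :* (d :* d) :* (k :* k)) :+ p :* (con 4 :* k) :* (d :* d) :+ q :* (con 4 :* k) :* (d :* d)) refl
  where open ℕ-Solver

loss-small-total : ∀ n → 2 * n + n + n ≡ 4 * n
loss-small-total = solve 1 (λ n → con 2 :* n :+ n :+ n := con 4 :* n) refl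
  where open ℕ-Solver

miss-small-identity : ∀ q n t l m → q * (n * t + l * m) ≡ n * (q * t) + q * l * m
miss-small-identity = solve 5 (λ q n t l m → q :* (n :* t :+ l :* m) := n :* (q :* t) :+ q :* l :* m) refl
  where open ℕ-Solver

miss-small-identity₂ : ∀ n c m → n * (c * m) + n * m ≡ n * ((1 + c) * m)
miss-small-identity₂ = solve 3 (λ n c m → n :* (c :* m) :+ n :* m := n :* ((con 1 :+ c) :* m)) refl
  where open ℕ-Solver

small⇒good-identity : ∀ m x → m * (7 * x) ≡ x * (7 * m)
small⇒good-identity = solve 2 (λ m x → m :* (con 7 :* x) := x :* (con 7 :* m)) refl
  where open ℕ-Solver

linkable-good-identity : ∀ a b c → a * (b * c) ≡ b * (c * a)
linkable-good-identity = solve 3 (λ a b c → a :* (b :* c) := b :* (c :* a)) refl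
  where open ℕ-Solver

A′-good-identity : ∀ d n t w i → d * (n * t + w) + n * (d * i) ≡ d * (n * (t + i)) + d * w
A′-good-identity = solve 5 (λ d n t w i → d :* (n :* t :+ w) :+ n :* (d :* i) := d :* (n :* (t :+ i)) :+ d :* w) refl
  where open ℕ-Solver

A′-good-identity₂ : ∀ d n f κ a m → d * (n * f + κ * κ * m) + d * (κ * a * m) ≡ n * (d * f) + d * (κ * κ + κ * a) * m
A′-good-identity₂ = solve 6 (λ d n f κ a m → d :* (n :* f :+ κ :* κ :* m) :+ d :* (κ :* a :* m) := n :* (d :* f) :+ d :* (κ :* κ :+ κ :* a) :* m) refl
  where open ℕ-Solver

A′-good-identity₃ : ∀ n i m → n * (i + 6 * m) + n * m ≡ n * (7 * m) + n * i
A′-good-identity₃ = solve 3 (λ n i m → n :* (i :+ con 6 :* m) :+ n :* m := n :* (con 7 :* m) :+ n :* i) refl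
  where open ℕ-Solver

DF-dist : ∀ f g d c → f * (g * d + 6 * c) ≡ d * (f * g) + 6 * (f * c)
DF-dist = solve 4 (λ f g d c → f :* (g :* d :+ con 6 :* c) := d :* (f :* g) :+ con 6 :* (f :* c)) refl
  where open ℕ-Solver

module Bounds {κ n : ℕ} (hyp : Extremality κ n) where

  open Extremality hyp
  open Degrees H

  k N F C₀ bo ao : ℕ
  k = suc κ
  N = ∣ B ∣
  C₀ = N C κ
  F = falling N κ
  bo = count (λ v → lookup B v ∧ not (lookup B′ v))
  ao = count (λ v → lookup A v ∧ not (lookup A′ v))

  notE : Subset n → ℕ
  notE R = ι (not (E R))

  isE : Subset n → ℕ
  isE R = ι (E R)

  1≤D : 1 ≤ D
  1≤D = ℕₚ.≤-trans (s≤s z≤n) D-large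

  1≤Γ : 1 ≤ Γ
  1≤Γ = ℕₚ.≤-trans (s≤s z≤n) Γ-large

  1≤4^κ : 1 ≤ 4 ^ κ
  1≤4^κ = pos-^ κ (s≤s z≤n)

  scale : ∀ {a b c} → 1 ≤ a → b ≤ c → b ≤ a * c
  scale {a} {b} {c} p le = ℕₚ.≤-trans le (ℕₚ.≤-trans (ℕₚ.≤-reflexive (sym (ℕₚ.*-identityˡ c))) (ℕₚ.*-monoˡ-≤ c p))

  4k≤n : 4 * k ≤ n
  4k≤n = ℕₚ.≤-trans (ℕₚ.≤-trans Γ-large step) n-large
    where
    open ℕₚ.≤-Reasoning
    step : Γ ≤ 2 * (4 ^ κ * Γ * (D * D * D) * (k * k))
    step = begin
      Γ                                         ≡⟨ sym (trans (ℕₚ.*-identityˡ _) (trans (ℕₚ.*-identityʳ _) (trans (ℕₚ.*-identityʳ _) (ℕₚ.*-identityˡ _)))) ⟩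
      1 * (1 * Γ * 1 * 1)                       ≤⟨ ℕₚ.*-mono-≤ {x = 1} {y = 2} (s≤s z≤n) (ℕₚ.*-mono-≤ (ℕₚ.*-mono-≤ (ℕₚ.*-monoˡ-≤ Γ 1≤4^κ)
                                                     (ℕₚ.*-mono-≤ (ℕₚ.*-mono-≤ 1≤D 1≤D) 1≤D)) (s≤s z≤n)) ⟩
      2 * (4 ^ κ * Γ * (D * D * D) * (k * k))   ∎

  n>0 : 0 < n
  n>0 = ℕₚ.≤-trans (s≤s z≤n) 4k≤n

  N≤n : N ≤ n
  N≤n = Subsetₚ.∣p∣≤n B

  count-B : count (lookup B) ≡ N
  count-B = sym (card-count B)

  -- From |B| ≥ n/2 and n ≥ 4k one gets |B| - κ ≥ n/4, and `F` is at least (|B| - κ)^κ.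
  quarter : n ^ κ ≤ 4 ^ κ * F
  quarter = begin
    n ^ κ                     ≤⟨ ℕₚ.^-monoˡ-≤ κ n≤ ⟩
    (4 * (N ∸ κ)) ^ κ         ≡⟨ *-^ 4 (N ∸ κ) κ ⟩
    4 ^ κ * (N ∸ κ) ^ κ       ≤⟨ ℕₚ.*-monoʳ-≤ (4 ^ κ) (falling-≥ N κ) ⟩
    4 ^ κ * F                 ∎
    where
    open ℕₚ.≤-Reasoning
    n≤ : n ≤ 4 * (N ∸ κ)
    n≤ = begin
      n                   ≡⟨ sym (ℕₚ.m+n∸n≡m n (4 * κ)) ⟩
      n + 4 * κ ∸ 4 * κ   ≤⟨ ℕₚ.∸-monoˡ-≤ (4 * κ) (begin
        n + 4 * κ           ≤⟨ ℕₚ.+-monoʳ-≤ n (ℕₚ.≤-trans (ℕₚ.*-monoʳ-≤ 4 (ℕₚ.n≤1+n κ)) 4k≤n) ⟩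
        n + n               ≤⟨ ℕₚ.+-mono-≤ half half ⟩
        2 * N + 2 * N       ≡⟨ sym (ℕₚ.*-distribʳ-+ N 2 2) ⟩
        4 * N               ∎) ⟩
      4 * N ∸ 4 * κ       ≡⟨ sym (ℕₚ.*-distribˡ-∸ 4 N κ) ⟩
      4 * (N ∸ κ)         ∎

  C₀>0 : 0 < C₀
  C₀>0 = ℕₚ.n≢0⇒n>0 (λ e → ℕₚ.<⇒≱ (pos-^ κ n>0) (ℕₚ.≤-trans quarter (ℕₚ.≤-reflexive
    (trans (cong (λ c → 4 ^ κ * (κ ! * c)) e) (trans (cong (4 ^ κ *_) (ℕₚ.*-zeroʳ (κ !))) (ℕₚ.*-zeroʳ (4 ^ κ)))))))

  -- The degree of a common vertex would leave out at most a share 6/D and also amount to at most a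
  -- share 6/D, which forces D ≤ 12.
  disjoint : ∀ v → lookup A′ v ≡ true → lookup B′ v ≡ false
  disjoint v a with bool-cases (lookup B′ v)
  ... | inj₂ f = f
  ... | inj₁ b = ⊥-elim (ℕₚ.<⇒≱ D-large (cancel-*-≤ C₀ C₀>0 (begin
        C₀ * D                          ≡⟨ ℕₚ.*-comm C₀ D ⟩
        D * C₀                          ≤⟨ A′-in v a ⟩
        deg H ⁅ v ⁆ B * D + 6 * C₀      ≤⟨ ℕₚ.+-monoˡ-≤ (6 * C₀) (B′-in v b) ⟩
        6 * C₀ + 6 * C₀                 ≡⟨ sym (ℕₚ.*-distribʳ-+ C₀ 6 6) ⟩
        12 * C₀                         ≡⟨ ℕₚ.*-comm 12 C₀ ⟩
        C₀ * 12                         ∎)))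
    where open ℕₚ.≤-Reasoning

  link : ∀ v → tsum (lookup B) κ isE ⁅ v ⁆ ≡ κ ! * deg H ⁅ v ⁆ B
  link v = deg-tsum κ ⁅ v ⁆ B (cong (_+ κ) (Subsetₚ.∣⁅x⁆∣≡1 v))

  edges-B : tsum (lookup B) k isE ∅ ≡ k ! * e H B
  edges-B = e-tsum B

  not-edges : ∀ b S → tsum (lookup B) b notE S + tsum (lookup B) b isE S ≡ N ^ b
  not-edges b S = trans (sym (tsum-+ b notE isE S)) (trans (tsum-cong b (λ R → trans (ℕₚ.+-comm (notE R) (isE R)) (ι-not (E R))) S)
    (trans (tsum-const (lookup B) b 1 S) (trans (ℕₚ.*-identityʳ _) (cong (_^ b) count-B))))

  -- A vertex of `B` outside `B′` is the first entry of at least F/D ordered edges inside `B`.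
  bo-F : bo * F ≤ D * (k ! * e H B)
  bo-F = begin
    bo * F                                                                   ≡⟨ trans (ℕₚ.*-comm bo F) (trans (cong (F *_) (count-sum (λ v → lookup B v ∧ not (lookup B′ v)))) (*-sum F _)) ⟩
    sum (λ v → F * ι (lookup B v ∧ not (lookup B′ v)))                       ≤⟨ sum-mono each ⟩
    sum (λ v → D * (ι (lookup B v) * tsum (lookup B) κ isE (∅ ∪ ⁅ v ⁆)))     ≡⟨ sym (*-sum D _) ⟩
    D * tsum (lookup B) k isE ∅                                              ≡⟨ cong (D *_) edges-B ⟩
    D * (k ! * e H B)                                                        ∎
    where
    open ℕₚ.≤-Reasoning
    each : ∀ v → F * ι (lookup B v ∧ not (lookup B′ v)) ≤ D * (ι (lookup B v) * tsum (lookup B) κ isE (∅ ∪ ⁅ v ⁆))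
    each v with lookup B v | bool-cases (lookup B′ v)
    ... | false | _ = ℕₚ.≤-trans (ℕₚ.≤-reflexive (ℕₚ.*-zeroʳ F)) z≤n
    ... | true | inj₁ b rewrite b = ℕₚ.≤-trans (ℕₚ.≤-reflexive (ℕₚ.*-zeroʳ F)) z≤n
    ... | true | inj₂ b rewrite b = begin
      F * 1                                          ≡⟨ ℕₚ.*-identityʳ F ⟩
      κ ! * C₀                                       ≤⟨ ℕₚ.*-monoʳ-≤ (κ !) (B′-out v b) ⟩
      κ ! * (deg H ⁅ v ⁆ B * D)                      ≡⟨ trans (sym (ℕₚ.*-assoc (κ !) _ D)) (ℕₚ.*-comm _ D) ⟩
      D * (κ ! * deg H ⁅ v ⁆ B)                      ≡⟨ cong (D *_) (trans (sym (link v)) (trans (cong (tsum (lookup B) κ isE) (sym (Subsetₚ.∪-identityˡ ⁅ v ⁆))) (sym (ℕₚ.*-identityˡ _)))) ⟩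
      D * (1 * tsum (lookup B) κ isE (∅ ∪ ⁅ v ⁆))    ∎

  -- By the codegree condition a set of size κ missed by many vertices of A has as many neighbours in B.
  codegree-swap : ∀ b S → sum (λ x → ι (lookup A x) * tsum (lookup B) b notE (S ∪ ⁅ x ⁆))
                          ≤ tsum (lookup B) (suc b) isE S + n * tsum (lookup B) b (degenerate κ) S
  codegree-swap b S = begin
    sum (λ x → ι (lookup A x) * tsum (lookup B) b notE (S ∪ ⁅ x ⁆))
      ≡⟨ sym (tsum-swap b (λ x → ι (lookup A x)) notE S) ⟩
    tsum (lookup B) b (λ R → sum (λ x → ι (lookup A x) * notE (R ∪ ⁅ x ⁆))) S
      ≤⟨ tsum-mono b each S ⟩
    tsum (lookup B) b (λ R → sum (λ z → ι (lookup B z) * isE (R ∪ ⁅ z ⁆)) + n * degenerate κ R) S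
      ≡⟨ trans (tsum-+ b _ _ S) (cong₂ _+_ (sym (tsum-last b isE S)) (tsum-* b n (degenerate κ) S)) ⟩
    tsum (lookup B) (suc b) isE S + n * tsum (lookup B) b (degenerate κ) S ∎
    where
    open ℕₚ.≤-Reasoning
    to-count : ∀ (p q : Fin n → Bool) → sum (λ x → ι (p x) * ι (q x)) ≡ count (λ x → p x ∧ q x)
    to-count p q = trans (sum-cong (λ x → sym (ι-∧ (p x) (q x)))) (sym (count-sum _))
    balance : ∀ R → ∣ R ∣ ≡ κ → count (λ x → lookup A x ∧ not (E (R ∪ ⁅ x ⁆))) ≤ count (λ x → lookup B x ∧ E (R ∪ ⁅ x ⁆))
    balance R e = ℕₚ.+-cancelˡ-≤ (count (λ x → lookup A x ∧ E (R ∪ ⁅ x ⁆))) _ _ (begin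
      count (λ x → lookup A x ∧ E (R ∪ ⁅ x ⁆)) + count (λ x → lookup A x ∧ not (E (R ∪ ⁅ x ⁆)))
        ≡⟨ sym (count-split (lookup A) (λ x → E (R ∪ ⁅ x ⁆))) ⟩
      count (lookup A)
        ≡⟨ sym (card-count A) ⟩
      ∣ A ∣
        ≤⟨ codeg R e ⟩
      count (λ x → E (R ∪ ⁅ x ⁆))
        ≤⟨ count-∨ {q = λ x → lookup A x ∧ E (R ∪ ⁅ x ⁆)} {r = λ x → lookup B x ∧ E (R ∪ ⁅ x ⁆)} (λ x h → split x h (parts x)) ⟩
      count (λ x → lookup A x ∧ E (R ∪ ⁅ x ⁆)) + count (λ x → lookup B x ∧ E (R ∪ ⁅ x ⁆)) ∎)
      where
      split : ∀ x → E (R ∪ ⁅ x ⁆) ≡ true → lookup A x ≡ not (lookup B x) →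
              lookup A x ∧ E (R ∪ ⁅ x ⁆) ≡ true ⊎ lookup B x ∧ E (R ∪ ⁅ x ⁆) ≡ true
      split x h p with lookup B x
      ... | true = inj₂ h
      ... | false rewrite p = inj₁ h
    each : ∀ R → sum (λ x → ι (lookup A x) * notE (R ∪ ⁅ x ⁆)) ≤ sum (λ z → ι (lookup B z) * isE (R ∪ ⁅ z ⁆)) + n * degenerate κ R
    each R with ≟-cases ∣ R ∣ κ
    ... | inj₁ (_ , e) = ℕₚ.≤-trans (ℕₚ.≤-reflexive (to-count (lookup A) (λ x → not (E (R ∪ ⁅ x ⁆)))))
          (ℕₚ.≤-trans (balance R e) (ℕₚ.≤-trans (ℕₚ.≤-reflexive (sym (to-count (lookup B) (λ x → E (R ∪ ⁅ x ⁆))))) (ℕₚ.m≤m+n _ _)))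
    ... | inj₂ (f , _) = ℕₚ.≤-trans (ℕₚ.≤-reflexive (to-count (lookup A) (λ x → not (E (R ∪ ⁅ x ⁆)))))
          (ℕₚ.≤-trans (count≤n _) (ℕₚ.≤-trans (ℕₚ.≤-reflexive (sym (trans (cong (λ b → n * ι (not b)) f) (ℕₚ.*-identityʳ n)))) (ℕₚ.m≤n+m _ _)))

  -- A vertex of `A` outside `A′` misses at least F/D of the κ-tuples of `B`, and `codegree-swap`
  -- bounds all such misses by the ordered edges inside `B` and the degenerate tuples.
  ao-F : ao * F ≤ D * (k ! * e H B + κ * κ * n ^ κ)
  ao-F = begin
    ao * F                                                                   ≡⟨ trans (ℕₚ.*-comm ao F) (trans (cong (F *_) (count-sum (λ v → lookup A v ∧ not (lookup A′ v)))) (*-sum F _)) ⟩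
    sum (λ v → F * ι (lookup A v ∧ not (lookup A′ v)))                       ≤⟨ sum-mono each ⟩
    sum (λ v → D * (ι (lookup A v) * tsum (lookup B) κ notE (∅ ∪ ⁅ v ⁆)))    ≡⟨ sym (*-sum D _) ⟩
    D * sum (λ v → ι (lookup A v) * tsum (lookup B) κ notE (∅ ∪ ⁅ v ⁆))      ≤⟨ ℕₚ.*-monoʳ-≤ D (codegree-swap κ ∅) ⟩
    D * (tsum (lookup B) k isE ∅ + n * tsum (lookup B) κ (degenerate κ) ∅)   ≤⟨ ℕₚ.*-monoʳ-≤ D (ℕₚ.+-mono-≤ (ℕₚ.≤-reflexive edges-B)
                                                                                 (tsum-degenerate (lookup B) κ κ ∅ (cong (_+ κ) (Subsetₚ.∣⊥∣≡0 n)))) ⟩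
    D * (k ! * e H B + κ * κ * n ^ κ)                                        ∎
    where
    open ℕₚ.≤-Reasoning
    F-notE : ∀ v → lookup A′ v ≡ false → F ≤ D * tsum (lookup B) κ notE ⁅ v ⁆
    F-notE v a = ℕₚ.+-cancelˡ-≤ (D * tsum (lookup B) κ isE ⁅ v ⁆) _ _ (begin
      D * tsum (lookup B) κ isE ⁅ v ⁆ + κ ! * C₀             ≡⟨ cong (_+ κ ! * C₀) (trans (cong (D *_) (link v)) (trans (ℕₚ.*-comm D _) (ℕₚ.*-assoc (κ !) _ D))) ⟩
      κ ! * (deg H ⁅ v ⁆ B * D) + κ ! * C₀                    ≡⟨ sym (ℕₚ.*-distribˡ-+ (κ !) _ C₀) ⟩
      κ ! * (deg H ⁅ v ⁆ B * D + C₀)                          ≤⟨ ℕₚ.*-monoʳ-≤ (κ !) (A′-out v a) ⟩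
      κ ! * (D * C₀)                                          ≡⟨ *-swap (κ !) D C₀ ⟩
      D * F                                                   ≤⟨ ℕₚ.*-monoʳ-≤ D (falling-≤ N κ) ⟩
      D * N ^ κ                                               ≡⟨ cong (D *_) (sym (not-edges κ ⁅ v ⁆)) ⟩
      D * (tsum (lookup B) κ notE ⁅ v ⁆ + tsum (lookup B) κ isE ⁅ v ⁆) ≡⟨ F-notE-dist D _ _ ⟩
      D * tsum (lookup B) κ isE ⁅ v ⁆ + D * tsum (lookup B) κ notE ⁅ v ⁆ ∎)
    each : ∀ v → F * ι (lookup A v ∧ not (lookup A′ v)) ≤ D * (ι (lookup A v) * tsum (lookup B) κ notE (∅ ∪ ⁅ v ⁆))
    each v with lookup A v | bool-cases (lookup A′ v)
    ... | false | _ = ℕₚ.≤-trans (ℕₚ.≤-reflexive (ℕₚ.*-zeroʳ F)) z≤n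
    ... | true | inj₁ a rewrite a = ℕₚ.≤-trans (ℕₚ.≤-reflexive (ℕₚ.*-zeroʳ F)) z≤n
    ... | true | inj₂ a rewrite a = ℕₚ.≤-trans (ℕₚ.≤-reflexive (ℕₚ.*-identityʳ F)) (ℕₚ.≤-trans (F-notE v a)
          (ℕₚ.≤-reflexive (cong (D *_) (trans (cong (tsum (lookup B) κ notE) (sym (Subsetₚ.∪-identityˡ ⁅ v ⁆))) (sym (ℕₚ.*-identityˡ _))))))

  -- `quarter` converts `F` into n^κ. One of the three factors D in `e-small` and `n-large` pays for
  -- the D of the hypothesis, and each of the two summands takes at most half of the right side.
  small : ∀ c → c * F ≤ D * (k ! * e H B + κ * κ * n ^ κ) → c * Γ * (D * D) ≤ n
  small c h = cancel-*-≤ (n ^ κ) (pos-^ κ n>0) (begin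
    n ^ κ * (c * Γ * (D * D))                                      ≤⟨ ℕₚ.*-monoˡ-≤ _ quarter ⟩
    4 ^ κ * F * (c * Γ * (D * D))                                  ≡⟨ small-identity (4 ^ κ) F c Γ D ⟩
    4 ^ κ * Γ * (D * D) * (c * F)                                  ≤⟨ ℕₚ.*-monoʳ-≤ (4 ^ κ * Γ * (D * D)) h ⟩
    4 ^ κ * Γ * (D * D) * (D * (k ! * e H B + κ * κ * n ^ κ))      ≡⟨ small-identity₂ (4 ^ κ) Γ D (k ! * e H B) (κ * κ) (n ^ κ) ⟩
    Q * (k ! * e H B) + Q * (κ * κ) * n ^ κ                        ≤⟨ halves (Q * (k ! * e H B)) (Q * (κ * κ) * n ^ κ) e-small bound ⟩
    n * n ^ κ                                                      ≡⟨ ℕₚ.*-comm n _ ⟩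
    n ^ κ * n                                                      ∎)
    where
    open ℕₚ.≤-Reasoning
    Q : ℕ
    Q = 4 ^ κ * Γ * (D * D * D)
    bound : 2 * (Q * (κ * κ) * n ^ κ) ≤ n * n ^ κ
    bound = begin
      2 * (Q * (κ * κ) * n ^ κ)    ≡⟨ sym (ℕₚ.*-assoc 2 (Q * (κ * κ)) (n ^ κ)) ⟩
      2 * (Q * (κ * κ)) * n ^ κ    ≤⟨ ℕₚ.*-monoˡ-≤ (n ^ κ) (ℕₚ.≤-trans (ℕₚ.*-monoʳ-≤ 2 (ℕₚ.*-monoʳ-≤ Q (ℕₚ.*-mono-≤ (ℕₚ.n≤1+n κ) (ℕₚ.n≤1+n κ)))) n-large) ⟩
      n * n ^ κ                    ∎
    halves : ∀ x y {z} → 2 * x ≤ z → 2 * y ≤ z → x + y ≤ z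
    halves x y {z} p q = ℕₚ.*-cancelˡ-≤ 2 (ℕₚ.≤-trans (ℕₚ.≤-reflexive (ℕₚ.*-distribˡ-+ 2 x y))
      (ℕₚ.≤-trans (ℕₚ.+-mono-≤ p q) (ℕₚ.≤-reflexive (cong (z +_) (sym (ℕₚ.+-identityʳ z))))))

  ao-small : ao * Γ * (D * D) ≤ n
  ao-small = small ao ao-F

  bo-small : bo * Γ * (D * D) ≤ n
  bo-small = small bo (ℕₚ.≤-trans bo-F (ℕₚ.*-monoʳ-≤ D (ℕₚ.m≤m+n _ _)))

  X : Bool → Fin n → Bool
  X true = lookup A′
  X false = lookup B′

  miss : ℕ → ℕ → Subset n → ℕ
  miss a b = tsum (X true) a (tsum (X false) b notE)

  B′-split : ∀ v → lookup B′ v ≡ true → lookup B v ≡ true ⊎ lookup A v ∧ not (lookup A′ v) ≡ true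
  B′-split v b with bool-cases (lookup B v) | bool-cases (lookup A′ v)
  ... | inj₁ t | _ = inj₁ t
  ... | inj₂ f | inj₁ a = ⊥-elim (true≢false b (disjoint v a))
  ... | inj₂ f | inj₂ a = inj₂ (∧-intro (trans (parts v) (cong not f)) (cong not a))

  A′-split : ∀ v → lookup A′ v ≡ true → lookup A v ≡ true ⊎ lookup B v ∧ not (lookup B′ v) ≡ true
  A′-split v a with bool-cases (lookup B v)
  ... | inj₂ f = inj₁ (trans (parts v) (cong not f))
  ... | inj₁ t = inj₂ (∧-intro t (cong not (disjoint v a)))

  -- The three errors of `miss-bound`: tuples with repetitions, vertices of A′ that belong to `B`,
  -- and vertices of B′ that belong to `A`.
  loss : ℕ → ℕ
  loss b = b * κ + bo + b * ao

  notE≤1 : ∀ R → notE R ≤ 1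
  notE≤1 R = ι≤1 _

  -- With A and B in place of A′ and B′ this is `codegree-swap`: non-edges with one vertex in A are
  -- paid for by edges inside B. `tsum-change` and `A′-split` account for the exchange of the
  -- classes.
  miss-bound : ∀ b S → ∣ S ∣ + b ≡ κ → n * miss 1 b S ≤ n * tsum (lookup B) (suc b) isE S + loss b * n ^ suc b
  miss-bound b S sz = begin
    n * sum (λ x → ι (X true x) * tsum (X false) b notE (S ∪ ⁅ x ⁆))
      ≡⟨ trans (*-sum n _) (sum-cong (λ x → *-swap n (ι (X true x)) _)) ⟩
    sum (λ x → ι (X true x) * (n * tsum (X false) b notE (S ∪ ⁅ x ⁆)))
      ≤⟨ sum-mono each ⟩
    sum (λ x → (n * (ι (lookup A x) * t x) + (n * n ^ b) * ι (lookup B x ∧ not (lookup B′ x))) + b * ao * n ^ b)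
      ≡⟨ trans (sum-+ _ _) (cong₂ _+_ (trans (sum-+ _ _) (cong₂ _+_ (sym (*-sum n _))
           (trans (sym (*-sum (n * n ^ b) _)) (cong (n * n ^ b *_) (sym (count-sum (λ x → lookup B x ∧ not (lookup B′ x)))))))) (sum-const {n} (b * ao * n ^ b))) ⟩
    n * sum (λ x → ι (lookup A x) * t x) + n * n ^ b * bo + n * (b * ao * n ^ b)
      ≤⟨ ℕₚ.+-monoˡ-≤ _ (ℕₚ.+-monoˡ-≤ _ (ℕₚ.*-monoʳ-≤ n (ℕₚ.≤-trans (codegree-swap b S)
           (ℕₚ.+-monoʳ-≤ (tsum (lookup B) (suc b) isE S) (tsum-degenerate (lookup B) b κ S sz))))) ⟩
    n * (tsum (lookup B) (suc b) isE S + b * κ * n ^ b) + n * n ^ b * bo + n * (b * ao * n ^ b)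
      ≡⟨ miss-bound-identity n (tsum (lookup B) (suc b) isE S) b κ (n ^ b) bo ao ⟩
    n * tsum (lookup B) (suc b) isE S + loss b * n ^ suc b ∎
    where
    open ℕₚ.≤-Reasoning
    t : Fin n → ℕ
    t x = tsum (lookup B) b notE (S ∪ ⁅ x ⁆)
    change : ∀ x → n * tsum (X false) b notE (S ∪ ⁅ x ⁆) ≤ n * t x + b * ao * n ^ b
    change x = tsum-change (X false) (lookup B) (λ v → lookup A v ∧ not (lookup A′ v)) B′-split b notE≤1 (S ∪ ⁅ x ⁆)
    t-bound : ∀ x → t x ≤ n ^ b
    t-bound x = ℕₚ.≤-trans (tsum-bound (lookup B) b 1 notE≤1 (S ∪ ⁅ x ⁆)) (ℕₚ.≤-reflexive (ℕₚ.*-identityʳ _))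
    each : ∀ x → ι (X true x) * (n * tsum (X false) b notE (S ∪ ⁅ x ⁆))
                 ≤ (n * (ι (lookup A x) * t x) + (n * n ^ b) * ι (lookup B x ∧ not (lookup B′ x))) + b * ao * n ^ b
    each x with bool-cases (lookup A′ x)
    ... | inj₂ f rewrite f = z≤n
    ... | inj₁ a with A′-split x a
    ...   | inj₁ q rewrite a | q = ℕₚ.≤-trans (ℕₚ.≤-reflexive (ℕₚ.+-identityʳ _)) (ℕₚ.≤-trans (change x)
            (ℕₚ.+-monoˡ-≤ _ (ℕₚ.≤-trans (ℕₚ.≤-reflexive (cong (n *_) (sym (ℕₚ.+-identityʳ _)))) (ℕₚ.m≤m+n _ _))))
    ...   | inj₂ q rewrite a | q = ℕₚ.≤-trans (ℕₚ.≤-reflexive (ℕₚ.+-identityʳ _)) (ℕₚ.≤-trans (change x)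
            (ℕₚ.+-monoˡ-≤ _ (ℕₚ.≤-trans (ℕₚ.*-monoʳ-≤ n (t-bound x))
              (ℕₚ.≤-trans (ℕₚ.≤-reflexive (sym (ℕₚ.*-identityʳ _))) (ℕₚ.m≤n+m _ _)))))

  loss-small : ∀ b → b ≤ κ → D * D * loss b ≤ n
  loss-small b b≤κ = ℕₚ.*-cancelˡ-≤ 4 (begin
    4 * (D * D * (b * κ + bo + b * ao))
      ≤⟨ ℕₚ.*-monoʳ-≤ 4 (ℕₚ.*-monoʳ-≤ (D * D) (ℕₚ.+-mono-≤ (ℕₚ.+-mono-≤ (ℕₚ.*-mono-≤ b≤k κ≤k) (scale {k} (s≤s z≤n) ℕₚ.≤-refl)) (ℕₚ.*-monoˡ-≤ ao b≤k))) ⟩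
    4 * (D * D * (k * k + k * bo + k * ao))
      ≡⟨ loss-small-identity D k bo ao ⟩
    4 * (1 * (D * D) * (k * k)) + bo * (4 * k) * (D * D) + ao * (4 * k) * (D * D)
      ≤⟨ ℕₚ.+-mono-≤ (ℕₚ.+-mono-≤ (ℕₚ.*-monoʳ-≤ 4 first)
           (ℕₚ.≤-trans (ℕₚ.*-monoˡ-≤ (D * D) (ℕₚ.*-monoʳ-≤ bo Γ-large)) bo-small))
           (ℕₚ.≤-trans (ℕₚ.*-monoˡ-≤ (D * D) (ℕₚ.*-monoʳ-≤ ao Γ-large)) ao-small) ⟩
    4 * (4 ^ κ * Γ * (D * D * D) * (k * k)) + n + n
      ≡⟨ cong (λ x → x + n + n) (ℕₚ.*-assoc 2 2 (4 ^ κ * Γ * (D * D * D) * (k * k))) ⟩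
    2 * (2 * (4 ^ κ * Γ * (D * D * D) * (k * k))) + n + n
      ≤⟨ ℕₚ.+-monoˡ-≤ n (ℕₚ.+-monoˡ-≤ n (ℕₚ.*-monoʳ-≤ 2 n-large)) ⟩
    2 * n + n + n
      ≡⟨ loss-small-total n ⟩
    4 * n ∎)
    where
    open ℕₚ.≤-Reasoning
    κ≤k : κ ≤ k
    κ≤k = ℕₚ.n≤1+n κ
    b≤k : b ≤ k
    b≤k = ℕₚ.≤-trans b≤κ κ≤k
    first : 1 * (D * D) * (k * k) ≤ 4 ^ κ * Γ * (D * D * D) * (k * k)
    first = ℕₚ.*-monoˡ-≤ (k * k) (ℕₚ.*-mono-≤ (ℕₚ.*-mono-≤ 1≤4^κ 1≤Γ)
      (ℕₚ.≤-trans (ℕₚ.≤-reflexive (sym (ℕₚ.*-identityʳ (D * D)))) (ℕₚ.*-monoʳ-≤ (D * D) 1≤D)))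

  miss-small : ∀ Q c b S → ∣ S ∣ + b ≡ κ → Q ≤ D * D → Q * tsum (lookup B) (suc b) isE S ≤ c * n ^ suc b → Q * miss 1 b S ≤ suc c * n ^ suc b
  miss-small Q c b S sz Q≤ h = cancel-*-≤ n n>0 (begin
    n * (Q * miss 1 b S)                                             ≡⟨ *-swap n Q _ ⟩
    Q * (n * miss 1 b S)                                             ≤⟨ ℕₚ.*-monoʳ-≤ Q (miss-bound b S sz) ⟩
    Q * (n * tsum (lookup B) (suc b) isE S + loss b * n ^ suc b)     ≡⟨ miss-small-identity Q n (tsum (lookup B) (suc b) isE S) (loss b) (n ^ suc b) ⟩
    n * (Q * tsum (lookup B) (suc b) isE S) + Q * loss b * n ^ suc b ≤⟨ ℕₚ.+-mono-≤ (ℕₚ.*-monoʳ-≤ n h)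
                                                                          (ℕₚ.*-monoˡ-≤ (n ^ suc b) (ℕₚ.≤-trans (ℕₚ.*-monoˡ-≤ (loss b) Q≤) (loss-small b b≤κ))) ⟩
    n * (c * n ^ suc b) + n * n ^ suc b                              ≡⟨ miss-small-identity₂ n c (n ^ suc b) ⟩
    n * (suc c * n ^ suc b)                                          ∎)
    where
    open ℕₚ.≤-Reasoning
    b≤κ : b ≤ κ
    b≤κ = ℕₚ.≤-trans (ℕₚ.m≤n+m b ∣ S ∣) (ℕₚ.≤-reflexive sz)

  D≤DD : D ≤ D * D
  D≤DD = scale 1≤D ℕₚ.≤-refl

  edges-small : D * D * tsum (lookup B) k isE ∅ ≤ 1 * n ^ k
  edges-small = begin
    D * D * tsum (lookup B) k isE ∅                    ≡⟨ cong (D * D *_) edges-B ⟩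
    D * D * (k ! * e H B)                              ≤⟨ scale {2} (s≤s z≤n) (ℕₚ.*-monoˡ-≤ (k ! * e H B) (begin
        D * D                           ≡⟨ sym (trans (cong (_* (D * D * 1)) (ℕₚ.*-identityˡ 1)) (trans (ℕₚ.*-identityˡ _) (ℕₚ.*-identityʳ _))) ⟩
        1 * 1 * (D * D * 1)             ≤⟨ ℕₚ.*-mono-≤ (ℕₚ.*-mono-≤ 1≤4^κ 1≤Γ) (ℕₚ.*-monoʳ-≤ (D * D) 1≤D) ⟩
        4 ^ κ * Γ * (D * D * D)         ∎)) ⟩
    2 * (4 ^ κ * Γ * (D * D * D) * (k ! * e H B))      ≤⟨ e-small ⟩
    n * n ^ κ                                          ≡⟨ sym (ℕₚ.*-identityˡ _) ⟩
    1 * n ^ k                                          ∎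
    where open ℕₚ.≤-Reasoning

  -- The second factor D is what `dense` uses later: there the bad configurations compete with a
  -- link of density only about 1/D.
  miss-empty : D * D * miss 1 κ ∅ ≤ 2 * n ^ k
  miss-empty = miss-small (D * D) 1 κ ∅ (cong (_+ κ) (Subsetₚ.∣⊥∣≡0 n)) ℕₚ.≤-refl edges-small

  record Resolution : Set where
    no-eta-equality
    field
      M θ  : ℕ
      n≤Mθ : n ≤ M * suc θ
      D>M  : 7 * M ^ k < D

  module Base (resolution : Resolution) where

    open Resolution resolution

    open Goodness X E θ hiding (miss)

    1≤M : 1 ≤ M
    1≤M = ℕₚ.n≢0⇒n>0 (λ M≡0 → ℕₚ.<⇒≱ n>0 (subst (λ x → n ≤ x * suc θ) M≡0 n≤Mθ))

    n^≤ : ∀ c → c ≤ k → n ^ c ≤ M ^ k * suc θ ^ c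
    n^≤ c c≤k = ℕₚ.≤-trans (ℕₚ.^-monoˡ-≤ c n≤Mθ) (ℕₚ.≤-trans (ℕₚ.≤-reflexive (*-^ M (suc θ) c))
      (ℕₚ.*-monoˡ-≤ (suc θ ^ c) (ℕₚ.^-monoʳ-≤ M {{>-nonZero 1≤M}} c≤k)))

    -- By `bad⇒miss` a bad set would be missed by (θ + 1)^(a + b) tuples, at least n^(a + b)/M^k;
    -- this exceeds 7 n^(a + b)/D because D > 7 M^k.
    small⇒good : ∀ a b S → a + b ≤ k → D * miss a b S ≤ 7 * n ^ (a + b) → G a b S ≡ true
    small⇒good a b S le h with bool-cases (G a b S)
    ... | inj₁ t = t
    ... | inj₂ f = ⊥-elim (ℕₚ.<⇒≱ D>M (cancel-*-≤ (n ^ (a + b)) (pos-^ (a + b) n>0) (begin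
        n ^ (a + b) * D                         ≡⟨ ℕₚ.*-comm _ D ⟩
        D * n ^ (a + b)                         ≤⟨ ℕₚ.*-monoʳ-≤ D (ℕₚ.≤-trans (n^≤ (a + b) le) (ℕₚ.*-monoʳ-≤ (M ^ k) (bad⇒miss a b S f))) ⟩
        D * (M ^ k * miss a b S)                ≡⟨ *-swap D (M ^ k) _ ⟩
        M ^ k * (D * miss a b S)                ≤⟨ ℕₚ.*-monoʳ-≤ (M ^ k) h ⟩
        M ^ k * (7 * n ^ (a + b))               ≡⟨ small⇒good-identity (M ^ k) (n ^ (a + b)) ⟩
        n ^ (a + b) * (7 * M ^ k)               ∎)))
      where
      open ℕₚ.≤-Reasoning

    -- The degree threshold contributes 6 units of edges inside B; passing to non-edges through A′
    -- adds one unit for the loss. This is the 7 of `small⇒good`.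
    linkable-good : ∀ b S → ∣ S ∣ + b ≡ κ → deg H S B * D ≤ 6 * (N C suc b) → G 1 b S ≡ true
    linkable-good b S sz h = small⇒good 1 b S (s≤s (ℕₚ.≤-trans (ℕₚ.m≤n+m b ∣ S ∣) (ℕₚ.≤-reflexive sz)))
      (miss-small D 6 b S sz D≤DD (begin
        D * tsum (lookup B) (suc b) isE S       ≡⟨ cong (D *_) (deg-tsum (suc b) S B (trans (ℕₚ.+-suc ∣ S ∣ b) (cong suc sz))) ⟩
        D * ((suc b) ! * deg H S B)             ≡⟨ linkable-good-identity D ((suc b) !) (deg H S B) ⟩
        (suc b) ! * (deg H S B * D)             ≤⟨ ℕₚ.*-monoʳ-≤ ((suc b) !) h ⟩
        (suc b) ! * (6 * (N C suc b))           ≡⟨ *-swap ((suc b) !) 6 _ ⟩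
        6 * falling N (suc b)                   ≤⟨ ℕₚ.*-monoʳ-≤ 6 (ℕₚ.≤-trans (falling-≤ N (suc b)) (ℕₚ.^-monoˡ-≤ (suc b) N≤n)) ⟩
        6 * n ^ suc b                           ∎))
      where
      open ℕₚ.≤-Reasoning

    empty-good : G 1 κ ∅ ≡ true
    empty-good = small⇒good 1 κ ∅ ℕₚ.≤-refl (ℕₚ.≤-trans (ℕₚ.≤-trans (ℕₚ.*-monoˡ-≤ (miss 1 κ ∅) D≤DD) miss-empty) (ℕₚ.*-monoˡ-≤ (n ^ k) {x = 2} {y = 7} (s≤s (s≤s z≤n))))

    B′-good : ∀ b → suc b ≡ κ → ∀ y → lookup B′ y ≡ true → G 1 b ⁅ y ⁆ ≡ true
    B′-good b refl y h = linkable-good b ⁅ y ⁆ (cong (_+ b) (Subsetₚ.∣⁅x⁆∣≡1 y)) (B′-in y h)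

    -- The misses are the complement of the link of `x`, and `A′-in` leaves a share of 6/D.
    -- Replacing |B|^κ by the falling factorial and B′ by `B` costs κ κ + κ ao, which `loss-small`
    -- keeps within a seventh unit.
    A′-good : ∀ x → lookup A′ x ≡ true → G 0 κ ⁅ x ⁆ ≡ true
    A′-good x a = small⇒good 0 κ ⁅ x ⁆ (ℕₚ.n≤1+n κ) (cancel-*-≤ n n>0 (ℕₚ.+-cancelʳ-≤ (n * (D * I)) _ _ (begin
        n * (D * miss 0 κ ⁅ x ⁆) + n * (D * I)
          ≡⟨ cong (_+ n * (D * I)) (*-swap n D _) ⟩
        D * (n * miss 0 κ ⁅ x ⁆) + n * (D * I)
          ≤⟨ ℕₚ.+-monoˡ-≤ _ (ℕₚ.*-monoʳ-≤ D (tsum-change (X false) (lookup B) (λ v → lookup A v ∧ not (lookup A′ v)) B′-split κ notE≤1 ⁅ x ⁆)) ⟩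
        D * (n * tsum (lookup B) κ notE ⁅ x ⁆ + κ * ao * n ^ κ) + n * (D * I)
          ≡⟨ A′-good-identity D n (tsum (lookup B) κ notE ⁅ x ⁆) (κ * ao * n ^ κ) I ⟩
        D * (n * (tsum (lookup B) κ notE ⁅ x ⁆ + I)) + D * (κ * ao * n ^ κ)
          ≡⟨ cong (λ z → D * (n * z) + D * (κ * ao * n ^ κ)) (not-edges κ ⁅ x ⁆) ⟩
        D * (n * N ^ κ) + D * (κ * ao * n ^ κ)
          ≤⟨ ℕₚ.+-monoˡ-≤ _ (ℕₚ.*-monoʳ-≤ D (power-gap {n} {N} {N ∸ κ} {κ} (ℕₚ.≤-trans (ℕₚ.m≤n+m∸n N κ) (ℕₚ.≤-reflexive (ℕₚ.+-comm κ _))) (ℕₚ.≤-trans (ℕₚ.m∸n≤m N κ) N≤n) N≤n κ)) ⟩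
        D * (n * (N ∸ κ) ^ κ + κ * κ * n ^ κ) + D * (κ * ao * n ^ κ)
          ≤⟨ ℕₚ.+-monoˡ-≤ _ (ℕₚ.*-monoʳ-≤ D (ℕₚ.+-monoˡ-≤ _ (ℕₚ.*-monoʳ-≤ n (falling-≥ N κ)))) ⟩
        D * (n * F + κ * κ * n ^ κ) + D * (κ * ao * n ^ κ)
          ≡⟨ A′-good-identity₂ D n F κ ao (n ^ κ) ⟩
        n * (D * F) + D * (κ * κ + κ * ao) * n ^ κ
          ≤⟨ ℕₚ.+-mono-≤ (ℕₚ.*-monoʳ-≤ n DF) (ℕₚ.*-monoˡ-≤ (n ^ κ) (ℕₚ.≤-trans (ℕₚ.*-mono-≤ D≤DD (ℕₚ.+-monoˡ-≤ (κ * ao) (ℕₚ.m≤m+n (κ * κ) bo))) (loss-small κ ℕₚ.≤-refl))) ⟩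
        n * (D * I + 6 * n ^ κ) + n * n ^ κ
          ≡⟨ A′-good-identity₃ n (D * I) (n ^ κ) ⟩
        n * (7 * n ^ κ) + n * (D * I) ∎)))
      where
      open ℕₚ.≤-Reasoning
      I : ℕ
      I = tsum (lookup B) κ isE ⁅ x ⁆
      DF : D * F ≤ D * I + 6 * n ^ κ
      DF = begin
        D * (κ ! * C₀)                               ≡⟨ *-swap D (κ !) C₀ ⟩
        κ ! * (D * C₀)                               ≤⟨ ℕₚ.*-monoʳ-≤ (κ !) (A′-in x a) ⟩
        κ ! * (deg H ⁅ x ⁆ B * D + 6 * C₀)           ≡⟨ DF-dist (κ !) (deg H ⁅ x ⁆ B) D C₀ ⟩
        D * (κ ! * deg H ⁅ x ⁆ B) + 6 * F            ≤⟨ ℕₚ.+-mono-≤ (ℕₚ.≤-reflexive (cong (D *_) (sym (link x))))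
                                                          (ℕₚ.*-monoʳ-≤ 6 (ℕₚ.≤-trans (falling-≤ N κ) (ℕₚ.^-monoˡ-≤ κ N≤n))) ⟩
        D * I + 6 * n ^ κ                            ∎

-- Subsets as lists

lookup-toSubset : ∀ {n} (xs : List (Fin n)) u → lookup (toSubset xs) u ≡ memberˡ xs u
lookup-toSubset [] u = lookup-∅ u
lookup-toSubset (x ∷ xs) u = trans (lookup-∪ ⁅ x ⁆ (toSubset xs) u) (cong₂ _∨_ (lookup-⁅⁆ x u) (lookup-toSubset xs u))

toSubset-++ : ∀ {n} (xs ys : List (Fin n)) → toSubset (xs ++ ys) ≡ toSubset xs ∪ toSubset ys
toSubset-++ [] ys = sym (Subsetₚ.∪-identityˡ _)
toSubset-++ (x ∷ xs) ys = trans (cong (⁅ x ⁆ ∪_) (toSubset-++ xs ys)) (sym (Subsetₚ.∪-assoc ⁅ x ⁆ (toSubset xs) (toSubset ys)))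

memberˡ-false : ∀ {n} (xs : List (Fin n)) {v} → v ∉ˡ xs → memberˡ xs v ≡ false
memberˡ-false xs {v} ∉ with bool-cases (memberˡ xs v)
... | inj₁ t = ⊥-elim (∉ (memberˡ-elim xs t))
... | inj₂ f = f

card-toSubset : ∀ {n} {xs : List (Fin n)} → Unique xs → ∣ toSubset xs ∣ ≡ length xs
card-toSubset {n} [] = Subsetₚ.∣⊥∣≡0 n
card-toSubset {xs = x ∷ xs} (∉ ∷ u) = trans (cong ∣_∣ (Subsetₚ.∪-comm ⁅ x ⁆ (toSubset xs)))
  (trans (card-∪-∉ (toSubset xs) x (trans (lookup-toSubset xs x) (memberˡ-false xs (λ m → All.lookup ∉ m refl)))) (cong suc (card-toSubset u)))

elements : ∀ {n} → Subset n → List (Fin n)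
elements {n} R = filterᵇ (lookup R) (allFin n)

elements-unique : ∀ {n} (R : Subset n) → Unique (elements R)
elements-unique {n} R = Uniqueₚ.filter⁺ (λ x → Data.Bool.T? (lookup R x)) (Uniqueₚ.allFin⁺ n)

toSubset-elements : ∀ {n} (R : Subset n) → toSubset (elements R) ≡ R
toSubset-elements {n} R = subset-ext (λ u → trans (lookup-toSubset (elements R) u) (step u (bool-cases (lookup R u))))
  where
  step : ∀ u → lookup R u ≡ true ⊎ lookup R u ≡ false → memberˡ (elements R) u ≡ lookup R u
  step u (inj₁ e) = trans (memberˡ-intro (∈-filterᵇ⁺ (lookup R) (∈-allFin u) e)) (sym e)
  step u (inj₂ e) = trans (memberˡ-false (elements R) (λ m → true≢false (∈-filterᵇ⁻ (lookup R) {allFin n} m) e)) (sym e)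

remove : ∀ {n} → Subset n → Fin n → Subset n
remove R y = tabulateᵛ (λ u → lookup R u ∧ not (u == y))

lookup-remove : ∀ {n} (R : Subset n) y u → lookup (remove R y) u ≡ lookup R u ∧ not (u == y)
lookup-remove R y u = Vecₚ.lookup∘tabulate (λ u → lookup R u ∧ not (u == y)) u

remove-∪ : ∀ {n} (S : Subset n) y → lookup S y ≡ false → remove (S ∪ ⁅ y ⁆) y ≡ S
remove-∪ S y e = subset-ext (λ u → trans (lookup-remove (S ∪ ⁅ y ⁆) y u)
  (trans (cong (_∧ not (u == y)) (trans (lookup-∪ S ⁅ y ⁆ u) (cong (lookup S u ∨_) (lookup-⁅⁆ y u)))) (step u (bool-cases (u == y)))))
  where
  step : ∀ u → (u == y) ≡ true ⊎ (u == y) ≡ false → (lookup S u ∨ (u == y)) ∧ not (u == y) ≡ lookup S u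
  step u (inj₁ t) rewrite t | ==-sound {i = u} {y} t | e = refl
  step u (inj₂ f) rewrite f with lookup S u
  ... | true = refl
  ... | false = refl

-- Sums over the subsets of a set

Σs-term : ∀ {n} (f : Subset n → ℕ) S → f S ≤ Σs f
Σs-term f [] = ℕₚ.≤-refl
Σs-term f (false ∷ S) = ℕₚ.≤-trans (Σs-term (λ S → f (outside ∷ S)) S) (ℕₚ.m≤m+n _ _)
Σs-term {suc n} f (true ∷ S) = ℕₚ.≤-trans (Σs-term (λ S → f (inside ∷ S)) S) (ℕₚ.m≤n+m _ (Σs (λ S → f (outside ∷ S))))

abstract
  Σs-witness : ∀ {n} (p : Subset n → Bool) → 0 < Σs (λ S → ι (p S)) → ∃[ S ] p S ≡ true
  Σs-witness {zero} p lt with bool-cases (p [])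
  ... | inj₁ e = [] , e
  ... | inj₂ e rewrite e = ⊥-elim (ℕₚ.n≮0 lt)
  Σs-witness {suc n} p lt with Σs (λ S → ι (p (outside ∷ S))) in eq
  ... | suc _ = let (S , h) = Σs-witness (λ S → p (outside ∷ S)) (subst (0 <_) (sym eq) (s≤s z≤n)) in outside ∷ S , h
  ... | zero = let (S , h) = Σs-witness (λ S → p (inside ∷ S)) lt in inside ∷ S , h

-- For the indicator `h` of bad sets this is the number of bad subsets of `R`; its vanishing says
-- that every part of `R` is good.
below : ∀ {n} → (Subset n → ℕ) → Subset n → ℕ
below h R = Σs (λ L → ι (does (L ⊆? R)) * h L)

below-step : ∀ {n} (h : Subset n → ℕ) R y → below h (R ∪ ⁅ y ⁆) ≤ below h R + below (λ L → h (L ∪ ⁅ y ⁆)) R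
below-step {n} h R y = begin
  Σs g                                                                              ≡⟨ Σs-cong {n} (λ L → split (lookup L y) (g L)) ⟩
  Σs (λ L → ι (not (lookup L y)) * g L + ι (lookup L y) * g L)                      ≡⟨ Σs-+ (λ L → ι (not (lookup L y)) * g L) (λ L → ι (lookup L y) * g L) ⟩
  Σs (λ L → ι (not (lookup L y)) * g L) + Σs (λ L → ι (lookup L y) * g L)           ≡⟨ cong (Σs (λ L → ι (not (lookup L y)) * g L) +_) (sym (Σs-toggle y g)) ⟩
  Σs (λ L → ι (not (lookup L y)) * g L) + Σs (λ L → ι (not (lookup L y)) * g (L ∪ ⁅ y ⁆)) ≤⟨ ℕₚ.+-mono-≤ (Σs-mono {n} first) (Σs-mono {n} second) ⟩
  below h R + below (λ L → h (L ∪ ⁅ y ⁆)) R                                         ∎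
  where
  open ℕₚ.≤-Reasoning
  g : Subset n → ℕ
  g L = ι (does (L ⊆? (R ∪ ⁅ y ⁆))) * h L
  split : ∀ b x → x ≡ ι (not b) * x + ι b * x
  split true x = sym (ℕₚ.+-identityʳ x)
  split false x = sym (trans (ℕₚ.+-identityʳ _) (ℕₚ.+-identityʳ x))
  restrict : ∀ {L} → lookup L y ≡ false → (∀ u → lookup L u ≡ true → lookup (R ∪ ⁅ y ⁆) u ≡ true) → L ⊆ˢ R
  restrict {L} f sub = lookup-⊆ (λ u q → case ∨-elim (trans (sym (lookup-∪ R ⁅ y ⁆ u)) (sub u q)) of λ
    { (inj₁ r) → r
    ; (inj₂ r) → ⊥-elim (true≢false q (trans (cong (lookup L) (==-sound (trans (sym (lookup-⁅⁆ y u)) r))) f)) })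
  first : ∀ L → ι (not (lookup L y)) * g L ≤ ι (does (L ⊆? R)) * h L
  first L with bool-cases (lookup L y)
  ... | inj₁ t rewrite t = z≤n
  ... | inj₂ f rewrite f = ℕₚ.≤-trans (ℕₚ.≤-reflexive (ℕₚ.+-identityʳ _)) (ℕₚ.*-monoˡ-≤ (h L) (ι-mono {does (L ⊆? (R ∪ ⁅ y ⁆))} (λ q →
        does-true (L ⊆? R) (restrict {L} f (⊆-lookup (from-does (L ⊆? (R ∪ ⁅ y ⁆)) q))))))
  second : ∀ L → ι (not (lookup L y)) * g (L ∪ ⁅ y ⁆) ≤ ι (does (L ⊆? R)) * h (L ∪ ⁅ y ⁆)
  second L with bool-cases (lookup L y)
  ... | inj₁ t rewrite t = z≤n
  ... | inj₂ f rewrite f = ℕₚ.≤-trans (ℕₚ.≤-reflexive (ℕₚ.+-identityʳ _)) (ℕₚ.*-monoˡ-≤ (h (L ∪ ⁅ y ⁆)) (ι-mono {does ((L ∪ ⁅ y ⁆) ⊆? (R ∪ ⁅ y ⁆))} (λ q →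
        does-true (L ⊆? R) (restrict {L} f (λ u m → ⊆-lookup (from-does ((L ∪ ⁅ y ⁆) ⊆? (R ∪ ⁅ y ⁆)) q) u
          (trans (lookup-∪ L ⁅ y ⁆ u) (cong (_∨ lookup ⁅ y ⁆ u) m)))))))

below-∅ : ∀ {n} (h : Subset n → ℕ) → below h ∅ ≤ h ∅
below-∅ {n} h = ℕₚ.≤-trans (Σs-mono {n} (λ L → ℕₚ.*-monoˡ-≤ (h L) (ι-mono {does (L ⊆? ∅)} (λ q →
    does-true (∣ L ∣ ℕₚ.≟ 0) (ℕₚ.n≤0⇒n≡0 (ℕₚ.≤-trans (Subsetₚ.p⊆q⇒∣p∣≤∣q∣ (from-does (L ⊆? ∅) q)) (ℕₚ.≤-reflexive (Subsetₚ.∣⊥∣≡0 n))))))))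
  (ℕₚ.≤-reflexive (Σs-empty h))

tsum-below-dist : ∀ q n a b → q * (n * a + b) ≡ n * (q * a) + q * b
tsum-below-dist = solve 4 (λ q n a b → q :* (n :* a :+ b) := n :* (q :* a) :+ q :* b) refl
  where open ℕ-Solver

tsum-below-identity : ∀ n t c m → n * (t * c * m) + t * (c * n) * m ≡ (2 * t) * c * (n * m)
tsum-below-identity = solve 4 (λ n t c m → n :* (t :* c :* m) :+ t :* (c :* n) :* m := (con 2 :* t) :* c :* (n :* m)) refl
  where open ℕ-Solver

-- A subset of `R ∪ ⁅ y ⁆` omits `y` or arises from a subset of `R` by adding `y`, so every vertex
-- of the tuple doubles the bound. In the second case the summation over `y` moves into `h′`, which
-- satisfies the hypothesis with `c * n` in place of `c`.
tsum-below : ∀ {n} (P : Fin n → Bool) Q b (h : Subset n → ℕ) c → (∀ j → j ≤ b → Q * tsum P j h ∅ ≤ c * n ^ j) →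
             Q * tsum P b (below h) ∅ ≤ 2 ^ b * c * n ^ b
tsum-below {n} P Q zero h c hyp = ℕₚ.≤-trans (ℕₚ.*-monoʳ-≤ Q (below-∅ h)) (ℕₚ.≤-trans (hyp 0 z≤n) (ℕₚ.≤-reflexive (cong (_* 1) (sym (ℕₚ.*-identityˡ c)))))
tsum-below {n} P Q (suc b) h c hyp = begin
  Q * tsum P (suc b) (below h) ∅                                          ≡⟨ cong (Q *_) (tsum-last b (below h) ∅) ⟩
  Q * tsum P b (λ R → sum (λ v → ι (P v) * below h (R ∪ ⁅ v ⁆))) ∅        ≤⟨ ℕₚ.*-monoʳ-≤ Q (tsum-mono b pointwise ∅) ⟩
  Q * tsum P b (λ R → n * below h R + below h′ R) ∅                       ≡⟨ cong (Q *_) (trans (tsum-+ b _ _ ∅) (cong (_+ tsum P b (below h′) ∅) (tsum-* b n (below h) ∅))) ⟩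
  Q * (n * tsum P b (below h) ∅ + tsum P b (below h′) ∅)                  ≡⟨ tsum-below-dist Q n _ _ ⟩
  n * (Q * tsum P b (below h) ∅) + Q * tsum P b (below h′) ∅              ≤⟨ ℕₚ.+-mono-≤ (ℕₚ.*-monoʳ-≤ n (tsum-below P Q b h c (λ j le → hyp j (ℕₚ.m≤n⇒m≤1+n le))))
                                                                               (tsum-below P Q b h′ (c * n) hyp′) ⟩
  n * (2 ^ b * c * n ^ b) + 2 ^ b * (c * n) * n ^ b                       ≡⟨ tsum-below-identity n (2 ^ b) c (n ^ b) ⟩
  2 ^ suc b * c * n ^ suc b                                               ∎
  where
  open ℕₚ.≤-Reasoning
  h′ : Subset n → ℕ
  h′ L = sum (λ v → ι (P v) * h (L ∪ ⁅ v ⁆))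
  hyp′ : ∀ j → j ≤ b → Q * tsum P j h′ ∅ ≤ c * n * n ^ j
  hyp′ j le = ℕₚ.≤-trans (ℕₚ.≤-reflexive (cong (Q *_) (sym (tsum-last j h ∅)))) (ℕₚ.≤-trans (hyp (suc j) (s≤s le)) (ℕₚ.≤-reflexive (sym (ℕₚ.*-assoc c n (n ^ j)))))
  pointwise : ∀ R → sum (λ v → ι (P v) * below h (R ∪ ⁅ v ⁆)) ≤ n * below h R + below h′ R
  pointwise R = begin
    sum (λ v → ι (P v) * below h (R ∪ ⁅ v ⁆))
      ≤⟨ sum-mono (λ v → ℕₚ.≤-trans (ℕₚ.*-monoʳ-≤ (ι (P v)) (below-step h R v)) (ℕₚ.≤-trans (ℕₚ.≤-reflexive (ℕₚ.*-distribˡ-+ (ι (P v)) _ _))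
           (ℕₚ.+-monoˡ-≤ _ (ℕₚ.≤-trans (ℕₚ.*-monoˡ-≤ (below h R) (ι≤1 (P v))) (ℕₚ.≤-reflexive (ℕₚ.*-identityˡ _)))))) ⟩
    sum (λ v → below h R + ι (P v) * below (λ L → h (L ∪ ⁅ v ⁆)) R)
      ≡⟨ trans (sum-+ _ _) (cong₂ _+_ (sum-const {n} (below h R)) swap) ⟩
    n * below h R + below h′ R ∎
    where
    swap : sum (λ v → ι (P v) * below (λ L → h (L ∪ ⁅ v ⁆)) R) ≡ below h′ R
    swap = trans (sum-cong (λ v → sym (Σs-* {n} (ι (P v)) (λ L → ι (does (L ⊆? R)) * h (L ∪ ⁅ v ⁆)))))
      (trans (sym (Σs-sum {n} (λ L v → ι (P v) * (ι (does (L ⊆? R)) * h (L ∪ ⁅ v ⁆)))))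
        (Σs-cong {n} (λ L → trans (sum-cong (λ v → *-swap (ι (P v)) (ι (does (L ⊆? R))) _)) (sym (*-sum (ι (does (L ⊆? R))) _)))))

tsum-concat : ∀ {n} (P : Fin n → Bool) j b f S → tsum P j (tsum P b f) S ≡ tsum P (j + b) f S
tsum-concat P zero b f S = refl
tsum-concat P (suc j) b f S = sum-cong (λ v → cong (ι (P v) *_) (tsum-concat P j b f (S ∪ ⁅ v ⁆)))

tsum-shift : ∀ {n} (P : Fin n → Bool) b (f : Subset n → ℕ) v S → tsum P b (λ R → f (R ∪ ⁅ v ⁆)) S ≡ tsum P b f (S ∪ ⁅ v ⁆)
tsum-shift P zero f v S = refl
tsum-shift P (suc b) f v S = sum-cong (λ u → cong (ι (P u) *_) (trans (tsum-shift P b f v (S ∪ ⁅ u ⁆)) (cong (tsum P b f) (∪-swap S ⁅ u ⁆ ⁅ v ⁆))))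

-- Pruning a dense family of sets so that every face of a member has many extensions

module Pruning {n : ℕ} (ρ : ℕ) (Q : Fin n → Set) (f₀ : Subset n → Bool) (f₀-size : ∀ R → f₀ R ≡ true → ∣ R ∣ ≡ suc ρ)
  (f₀-Q : ∀ R → f₀ R ≡ true → ∀ u → lookup R u ≡ true → Q u) (η : ℕ) where

  low : (Subset n → Bool) → Subset n → Bool
  low f S = count (λ z → f (S ∪ ⁅ z ⁆)) ≤ᵇ η

  low-faces : (Subset n → Bool) → Subset n → ℕ
  low-faces f R = count (λ y → lookup R y ∧ low f (remove R y))

  -- No fixed point is sought: by `extend`, one step of a walk leads from round t + 1 back to round
  -- t, so t rounds support a walk of t steps, and the loss of each round is easy to bound.
  pruned : ℕ → Subset n → Bool
  pruned zero = f₀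
  pruned (suc t) R = pruned t R ∧ (low-faces (pruned t) R ≤ᵇ 0)

  pruned-f₀ : ∀ t R → pruned t R ≡ true → f₀ R ≡ true
  pruned-f₀ zero R h = h
  pruned-f₀ (suc t) R h = pruned-f₀ t R (proj₁ (∧-true h))

  ≤ᵇ-elim : ∀ {a b} → (a ≤ᵇ b) ≡ true → a ≤ b
  ≤ᵇ-elim {a} {b} e = ℕₚ.≤ᵇ⇒≤ a b (subst Data.Bool.T (sym e) _)

  ≤ᵇ-not : ∀ {a b} → (a ≤ᵇ b) ≡ false → b < a
  ≤ᵇ-not {a} {b} e = ℕₚ.≰⇒> (λ le → subst Data.Bool.T e (ℕₚ.≤⇒≤ᵇ le))

  extend : ∀ t R y → pruned (suc t) R ≡ true → lookup R y ≡ true → η < count (λ z → pruned t (remove R y ∪ ⁅ z ⁆))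
  extend t R y h m = ≤ᵇ-not (not-low (bool-cases (low (pruned t) (remove R y))))
    where
    not-low : low (pruned t) (remove R y) ≡ true ⊎ low (pruned t) (remove R y) ≡ false → low (pruned t) (remove R y) ≡ false
    not-low (inj₂ f) = f
    not-low (inj₁ l) = ⊥-elim (ℕₚ.<⇒≱ (subst (0 <_) (sym (count-remove {p = λ y → lookup R y ∧ low (pruned t) (remove R y)} (∧-intro m l))) (s≤s z≤n))
      (≤ᵇ-elim (proj₂ (∧-true {pruned t R} h))))

  total : (Subset n → Bool) → ℕ
  total f = Σs (λ R → ι (f R))

  faces : ℕ
  faces = Σs {n} (λ S → ι (does (∣ S ∣ ℕₚ.≟ ρ)))

  -- Every deleted set is charged to one of its low faces, and a ρ-set is charged at most η times
  -- since it is low only with at most η extensions.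
  pruning-step : ∀ t → total (pruned t) ≤ total (pruned (suc t)) + η * faces
  pruning-step t = begin
    Σs (λ R → ι (f R))
      ≤⟨ Σs-mono {n} each ⟩
    Σs (λ R → ι (pruned (suc t) R) + sum (λ y → ι (lookup R y) * h y R))
      ≡⟨ trans (Σs-+ {n} _ _) (cong (total (pruned (suc t)) +_) (Σs-sum {n} (λ R y → ι (lookup R y) * h y R))) ⟩
    total (pruned (suc t)) + sum (λ y → Σs (λ R → ι (lookup R y) * h y R))
      ≡⟨ cong (total (pruned (suc t)) +_) (trans (sum-cong (λ y → sym (Σs-toggle y (h y)))) (sym (Σs-sum {n} (λ S y → ι (not (lookup S y)) * h y (S ∪ ⁅ y ⁆))))) ⟩
    total (pruned (suc t)) + Σs (λ S → sum (λ y → ι (not (lookup S y)) * h y (S ∪ ⁅ y ⁆)))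
      ≤⟨ ℕₚ.+-monoʳ-≤ (total (pruned (suc t))) (Σs-mono {n} face) ⟩
    total (pruned (suc t)) + Σs (λ (S : Subset n) → η * ι (does (∣ S ∣ ℕₚ.≟ ρ)))
      ≡⟨ cong (total (pruned (suc t)) +_) (Σs-* {n} η _) ⟩
    total (pruned (suc t)) + η * faces ∎
    where
    open ℕₚ.≤-Reasoning
    f : Subset n → Bool
    f = pruned t
    h : Fin n → Subset n → ℕ
    h y R = ι (low f (remove R y)) * ι (f R)
    each : ∀ R → ι (f R) ≤ ι (pruned (suc t) R) + sum (λ y → ι (lookup R y) * h y R)
    each R with bool-cases (f R)
    ... | inj₂ e = ℕₚ.≤-trans (ℕₚ.≤-reflexive (cong ι e)) z≤n
    ... | inj₁ e with bool-cases (low-faces f R ≤ᵇ 0)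
    ...   | inj₁ l = ℕₚ.≤-trans (ℕₚ.≤-reflexive (trans (cong ι e) (sym (cong ι (∧-intro e l))))) (ℕₚ.m≤m+n _ _)
    ...   | inj₂ l = ℕₚ.≤-trans (ℕₚ.≤-trans (ι≤1 (f R)) (≤ᵇ-not {low-faces f R} {0} l)) (ℕₚ.≤-trans (ℕₚ.≤-reflexive faces-sum) (ℕₚ.m≤n+m _ (ι (pruned (suc t) R))))
      where
      faces-sum : low-faces f R ≡ sum (λ y → ι (lookup R y) * h y R)
      faces-sum = trans (count-sum _) (sum-cong (λ y → trans (ι-∧ (lookup R y) _)
        (cong (ι (lookup R y) *_) (sym (trans (cong (λ b → ι (low f (remove R y)) * ι b) e) (ℕₚ.*-identityʳ _))))))
    face : ∀ S → sum (λ y → ι (not (lookup S y)) * h y (S ∪ ⁅ y ⁆)) ≤ η * ι (does (∣ S ∣ ℕₚ.≟ ρ))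
    face S with ≟-cases ∣ S ∣ ρ
    ... | inj₂ (q , ne) = ℕₚ.≤-trans (ℕₚ.≤-trans (sum-mono {g = λ _ → 0} vanish) (ℕₚ.≤-reflexive (trans (sum-const {n} 0) (ℕₚ.*-zeroʳ n)))) z≤n
      where
      vanish : ∀ y → ι (not (lookup S y)) * h y (S ∪ ⁅ y ⁆) ≤ 0
      vanish y with bool-cases (lookup S y)
      ... | inj₁ t rewrite t = z≤n
      ... | inj₂ m with bool-cases (f (S ∪ ⁅ y ⁆))
      ...   | inj₁ e = ⊥-elim (ne (ℕₚ.suc-injective (trans (sym (card-∪-∉ S y m)) (f₀-size (S ∪ ⁅ y ⁆) (pruned-f₀ t _ e)))))
      ...   | inj₂ e = ℕₚ.≤-reflexive (trans (cong (λ b → ι (not (lookup S y)) * (ι (low f (remove (S ∪ ⁅ y ⁆) y)) * ι b)) e)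
              (trans (cong (ι (not (lookup S y)) *_) (ℕₚ.*-zeroʳ (ι (low f (remove (S ∪ ⁅ y ⁆) y))))) (ℕₚ.*-zeroʳ (ι (not (lookup S y))))))
    ... | inj₁ (q , _) = ℕₚ.≤-trans (bound (bool-cases (low f S))) (ℕₚ.≤-reflexive (sym (trans (cong (λ b → η * ι b) q) (ℕₚ.*-identityʳ η))))
      where
      term : ∀ y → ι (not (lookup S y)) * h y (S ∪ ⁅ y ⁆) ≤ ι (low f S) * ι (f (S ∪ ⁅ y ⁆))
      term y with bool-cases (lookup S y)
      ... | inj₁ t rewrite t = z≤n
      ... | inj₂ m = ℕₚ.≤-trans (ℕₚ.*-monoˡ-≤ (h y (S ∪ ⁅ y ⁆)) (ι≤1 (not (lookup S y)))) (ℕₚ.≤-reflexive (trans (ℕₚ.*-identityˡ _) (cong (λ R → ι (low f R) * ι (f (S ∪ ⁅ y ⁆))) (remove-∪ S y m))))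
      bound : low f S ≡ true ⊎ low f S ≡ false → sum (λ y → ι (not (lookup S y)) * h y (S ∪ ⁅ y ⁆)) ≤ η
      bound (inj₂ l) = ℕₚ.≤-trans (sum-mono {g = λ _ → 0} (λ y → ℕₚ.≤-trans (term y) (ℕₚ.≤-reflexive (cong (λ b → ι b * ι (f (S ∪ ⁅ y ⁆))) l))))
        (ℕₚ.≤-trans (ℕₚ.≤-reflexive (trans (sum-const {n} 0) (ℕₚ.*-zeroʳ n))) z≤n)
      bound (inj₁ l) = ℕₚ.≤-trans (sum-mono {g = λ y → ι (f (S ∪ ⁅ y ⁆))} (λ y → ℕₚ.≤-trans (term y) (ℕₚ.≤-reflexive (trans (cong (λ b → ι b * ι (f (S ∪ ⁅ y ⁆))) l) (ℕₚ.*-identityˡ _)))))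
        (ℕₚ.≤-trans (ℕₚ.≤-reflexive (sym (count-sum (λ y → f (S ∪ ⁅ y ⁆))))) (≤ᵇ-elim l))

  pruning : ∀ t → total f₀ ≤ total (pruned t) + t * (η * faces)
  pruning zero = ℕₚ.m≤m+n _ _
  pruning (suc t) = ℕₚ.≤-trans (pruning t) (ℕₚ.≤-trans (ℕₚ.+-monoˡ-≤ (t * (η * faces)) (pruning-step t))
    (ℕₚ.≤-reflexive (ℕₚ.+-assoc (total (pruned (suc t))) (η * faces) _)))

  faces-bound : ρ ! * faces ≤ n ^ ρ
  faces-bound = begin
    ρ ! * faces                                                                 ≡⟨ cong (ρ ! *_) (Σs-cong {n} same) ⟩
    ρ ! * weight ρ p ∅ Data.Fin.Subset.⊤                                        ≡⟨ sym (tsum-weight Data.Fin.Subset.⊤ p ρ (λ R ne → cong ι (does-false (∣ R ∣ ℕₚ.≟ ρ) ne)) ρ ∅ (ℕₚ.≤-reflexive (cong (_+ ρ) (Subsetₚ.∣⊥∣≡0 n)))) ⟩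
    tsum (lookup Data.Fin.Subset.⊤) ρ p ∅                                       ≤⟨ tsum-bound (lookup Data.Fin.Subset.⊤) ρ 1 (λ R → ι≤1 _) ∅ ⟩
    n ^ ρ * 1                                                                   ≡⟨ ℕₚ.*-identityʳ _ ⟩
    n ^ ρ                                                                       ∎
    where
    open ℕₚ.≤-Reasoning
    p : Subset n → ℕ
    p R = ι (does (∣ R ∣ ℕₚ.≟ ρ))
    same : ∀ S → ι (does (∣ S ∣ ℕₚ.≟ ρ)) ≡ ι (does (∣ S ∣ ℕₚ.≟ ρ)) * (ι (does (S ⊆? Data.Fin.Subset.⊤)) * p (∅ ∪ S))
    same S rewrite Subsetₚ.∪-identityˡ S | does-true (S ⊆? Data.Fin.Subset.⊤) (Subsetₚ.⊆-max S) = square (does (∣ S ∣ ℕₚ.≟ ρ))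
      where
      square : ∀ b → ι b ≡ ι b * (1 * ι b)
      square true = refl
      square false = refl

  record Extension (w : List (Fin n)) (t : ℕ) (av : List (Fin n)) : Set where
    field
      zs      : List (Fin n)
      #zs     : length zs ≡ t
      unique  : Unique zs
      fresh   : ∀ {z} → z ∈ˡ zs → z ∉ˡ av
      inside-Q : ∀ {z} → z ∈ˡ zs → Q z
      windows : ∀ i → i ≤ t → f₀ (toSubset (take (suc ρ) (drop i (w ++ zs)))) ≡ true

  take-++ˡ : ∀ {A : Set} (xs ys : List A) m → length xs ≡ m → take m (xs ++ ys) ≡ xs
  take-++ˡ [] ys zero _ = refl
  take-++ˡ (x ∷ xs) ys (suc m) e = cong (x ∷_) (take-++ˡ xs ys m (ℕₚ.suc-injective e))

  -- The oldest vertex is dropped and the remaining face extended. `av` holds the current window and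
  -- everything used so far; its length stays at most η, so one of the more than η extensions is a
  -- new vertex.
  walk : ∀ t w av → Unique w → length w ≡ suc ρ → length av + t ≤ suc η → (∀ {z} → z ∈ˡ w → z ∈ˡ av) →
         pruned t (toSubset w) ≡ true → Extension w t av
  walk zero w av u len room sub h = record { zs = [] ; #zs = refl ; unique = [] ; fresh = λ () ; inside-Q = λ ()
    ; windows = λ { zero _ → subst (λ l → f₀ (toSubset l) ≡ true) (sym (take-++ˡ w [] (suc ρ) len)) h } }
  walk (suc t) (y ∷ ws) av u@(y∉ ∷ uws) len room sub h = build (count-find (λ z → pruned t (remove R y ∪ ⁅ z ⁆)) (memberˡ av)
      (ℕₚ.≤-<-trans (count-memberˡ av) (ℕₚ.≤-<-trans (ℕₚ.≤-trans (ℕₚ.m≤m+n (length av) t) (ℕₚ.≤-pred (ℕₚ.≤-trans (ℕₚ.≤-reflexive (sym (ℕₚ.+-suc (length av) t))) room)))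
        (extend t R y h (trans (lookup-toSubset (y ∷ ws) y) (memberˡ-intro {xs = y ∷ ws} (here refl)))))))
    where
    R : Subset n
    R = toSubset (y ∷ ws)
    build : ∃[ z ] (pruned t (remove R y ∪ ⁅ z ⁆) ≡ true × memberˡ av z ≡ false) → Extension (y ∷ ws) (suc t) av
    build (z , pz , z∉) = record
      { zs = z ∷ zs ; #zs = cong suc #zs ; unique = All.tabulate (λ m → λ { refl → fresh m (here refl) }) ∷ unique
      ; fresh = λ { (here refl) → memberˡ-∉ av z∉ ; (there m) → λ a → fresh m (there a) }
      ; inside-Q = λ { (here refl) → f₀-Q (remove R y ∪ ⁅ z ⁆) (pruned-f₀ t _ pz) z z∈ ; (there m) → inside-Q m }
      ; windows = λ { zero _ → subst (λ l → f₀ (toSubset l) ≡ true) (sym (take-++ˡ (y ∷ ws) (z ∷ zs) (suc ρ) len)) (pruned-f₀ (suc t) R h)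
                    ; (suc i) (s≤s le) → subst (λ l → f₀ (toSubset (take (suc ρ) (drop i l))) ≡ true) (Listₚ.++-assoc ws (z ∷ []) zs) (windows i le) } }
      where
      new : toSubset (ws ++ z ∷ []) ≡ remove R y ∪ ⁅ z ⁆
      new = trans (toSubset-++ ws (z ∷ [])) (cong₂ _∪_ (sym (trans (cong (λ S → remove S y) (Subsetₚ.∪-comm ⁅ y ⁆ (toSubset ws)))
              (remove-∪ (toSubset ws) y (trans (lookup-toSubset ws y) (memberˡ-false ws (λ m → All.lookup y∉ m refl)))))) (Subsetₚ.∪-identityʳ ⁅ z ⁆))
      z∈ : lookup (remove R y ∪ ⁅ z ⁆) z ≡ true
      z∈ = trans (cong (λ S → lookup S z) (Subsetₚ.∪-comm (remove R y) ⁅ z ⁆))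
        (trans (lookup-∪ ⁅ z ⁆ (remove R y) z) (cong (_∨ lookup (remove R y) z) (trans (lookup-⁅⁆ z z) (==-refl z))))
      z∉ws : z ∉ˡ ws
      z∉ws m = memberˡ-∉ av z∉ (sub (there m))
      unique′ : Unique (ws ++ z ∷ [])
      unique′ = Uniqueₚ.++⁺ uws ([] ∷ []) (λ { (m , here refl) → z∉ws m })
      sub′ : ∀ {u} → u ∈ˡ ws ++ z ∷ [] → u ∈ˡ z ∷ av
      sub′ m = case ∈-++⁻ ws m of λ { (inj₁ m′) → there (sub (there m′)) ; (inj₂ (here refl)) → here refl }
      open Extension (walk t (ws ++ z ∷ []) (z ∷ av) unique′
        (trans (Listₚ.length-++ ws) (trans (ℕₚ.+-comm (length ws) 1) len))
        (ℕₚ.≤-trans (ℕₚ.≤-reflexive (sym (ℕₚ.+-suc (length av) t))) room)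
        sub′
        (trans (cong (pruned t) new) pz))

-- Vertices outside B′ have a dense link, in which tight walks with good ends exist

dense-expand : ∀ w d n x y z κ b u m → 8 * (w * (d * (n * (x + (y + z)) + κ * (b + u) * m)))
  ≡ n * (4 * (2 * (w * (d * x)))) + (n * (8 * (w * (d * y))) + 8 * (w * (d * (n * z))) + (8 * (w * (d * (κ * b))) * m + 8 * (w * (d * (κ * u))) * m))
dense-expand = solve 10 (λ w d n x y z κ b u m → con 8 :* (w :* (d :* (n :* (x :+ (y :+ z)) :+ κ :* (b :+ u) :* m)))
  := n :* (con 4 :* (con 2 :* (w :* (d :* x)))) :+ (n :* (con 8 :* (w :* (d :* y))) :+ con 8 :* (w :* (d :* (n :* z))) :+ (con 8 :* (w :* (d :* (κ :* b))) :* m :+ con 8 :* (w :* (d :* (κ :* u))) :* m))) refl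
  where open ℕ-Solver

record WalkSetting (ρ n : ℕ) : Set₁ where
  no-eta-equality
  field
    hyp        : Extremality (suc ρ) n
    resolution : Bounds.Resolution hyp
    t          : ℕ
  open Extremality hyp public
  open Bounds.Resolution resolution public
  field
    D-dense : 8 * (4 ^ suc ρ * (2 ^ suc ρ * suc (2 * M ^ suc (suc ρ)))) ≤ D
    D-κ     : 8 * (4 ^ suc ρ * suc ρ) ≤ D
    n-walk  : 2 * (4 ^ suc ρ * (D * (suc ρ * (t * (suc ρ + t))))) < n

bad-tuples-identity : ∀ m s d t → m * s * (d * t) ≡ m * (d * (s * t))
bad-tuples-identity = solve 4 (λ m s d t → m :* s :* (d :* t) := m :* (d :* (s :* t))) refl
  where open ℕ-Solver

bad-tuples-identity₂ : ∀ m x y → m * (2 * (x * y)) ≡ x * (2 * m * y)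
bad-tuples-identity₂ = solve 3 (λ m x y → m :* (con 2 :* (x :* y)) := x :* (con 2 :* m :* y)) refl
  where open ℕ-Solver

dense-identity : ∀ n m → n * (4 * m) + n * (4 * m) ≡ n * (8 * m)
dense-identity = solve 2 (λ n m → n :* (con 4 :* m) :+ n :* (con 4 :* m) := n :* (con 8 :* m)) refl
  where open ℕ-Solver

dense-identity₂ : ∀ n w d t → n * (8 * (w * (d * t))) ≡ 8 * (w * (d * (n * t)))
dense-identity₂ = solve 4 (λ n w d t → n :* (con 8 :* (w :* (d :* t))) := con 8 :* (w :* (d :* (n :* t)))) refl
  where open ℕ-Solver

dense-identity₃ : ∀ n m → n * m + n * m + (n * m + n * m) ≡ n * (4 * m)
dense-identity₃ = solve 2 (λ n m → n :* m :+ n :* m :+ (n :* m :+ n :* m) := n :* (con 4 :* m)) refl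
  where open ℕ-Solver

t₂-small-identity : ∀ d w t → d * (8 * (w * (d * t))) ≡ 8 * w * (d * d * t)
t₂-small-identity = solve 3 (λ d w t → d :* (con 8 :* (w :* (d :* t))) := con 8 :* w :* (d :* d :* t)) refl
  where open ℕ-Solver

t₂-small-identity₂ : ∀ w x c m → 8 * w * (x * c * m) ≡ 8 * (w * (x * c)) * m
t₂-small-identity₂ = solve 4 (λ w x c m → con 8 :* w :* (x :* c :* m) := con 8 :* (w :* (x :* c)) :* m) refl
  where open ℕ-Solver

t₃-small-identity : ∀ w d x m → 8 * (w * (d * (x * m))) ≡ 2 * (w * 4 * (1 * 1 * d) * x) * m
t₃-small-identity = solve 4 (λ w d x m → con 8 :* (w :* (d :* (x :* m))) := con 2 :* (w :* con 4 :* (con 1 :* con 1 :* d) :* x) :* m) refl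
  where open ℕ-Solver

bo-term-identity : ∀ w d κ b → 8 * (w * (d * (κ * b))) ≡ b * 1 * (8 * (w * κ) * d)
bo-term-identity = solve 4 (λ w d κ b → con 8 :* (w :* (d :* (κ :* b))) := b :* con 1 :* (con 8 :* (w :* κ) :* d)) refl
  where open ℕ-Solver

survivors-identity : ∀ w d κ r t e f → 2 * (w * (d * (κ * r * (t * (e * f))))) ≡ r * f * (2 * (w * (d * (κ * (t * e)))))
survivors-identity = solve 7 (λ w d κ r t e f → con 2 :* (w :* (d :* (κ :* r :* (t :* (e :* f))))) := r :* f :* (con 2 :* (w :* (d :* (κ :* (t :* e)))))) refl
  where open ℕ-Solver

module Walks {ρ n : ℕ} (setting : WalkSetting ρ n) where

  open WalkSetting setting

  k κ C₀ F bo ao : ℕ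
  k = suc (suc ρ)
  κ = suc ρ
  C₀ = ∣ B ∣ C κ
  F = falling ∣ B ∣ κ
  bo = Bounds.bo hyp
  ao = Bounds.ao hyp

  E : Subset n → Bool
  E = Degrees.E H

  isE notE : Subset n → ℕ
  isE R = ι (E R)
  notE R = ι (not (E R))

  X : Bool → Fin n → Bool
  X = Bounds.X hyp

  G : ℕ → ℕ → Subset n → Bool
  G = Goodness.G X E θ

  miss : ℕ → ℕ → Subset n → ℕ
  miss = Goodness.miss X E θ

  bad⇒miss : ∀ a b S → G a b S ≡ false → suc θ ^ (a + b) ≤ miss a b S
  bad⇒miss = Goodness.bad⇒miss X E θ

  1≤D : 1 ≤ D
  1≤D = Bounds.1≤D hyp

  1≤Γ : 1 ≤ Γ
  1≤Γ = Bounds.1≤Γ hyp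

  n>0 : 0 < n
  n>0 = Bounds.n>0 hyp

  quarter : n ^ κ ≤ 4 ^ κ * F
  quarter = Bounds.quarter hyp

  link : ∀ v → tsum (lookup B) κ isE ⁅ v ⁆ ≡ κ ! * deg H ⁅ v ⁆ B
  link = Bounds.link hyp

  bo-small : bo * Γ * (D * D) ≤ n
  bo-small = Bounds.bo-small hyp

  loss-small : ∀ b → b ≤ κ → D * D * (b * κ + bo + b * ao) ≤ n
  loss-small = Bounds.loss-small hyp

  miss-empty : D * D * miss 1 κ ∅ ≤ 2 * n ^ k
  miss-empty = Bounds.miss-empty hyp

  n^≤ : ∀ c → c ≤ k → n ^ c ≤ M ^ k * suc θ ^ c
  n^≤ = Bounds.Base.n^≤ hyp resolution

  -- The number of blanks is read off |L|, so for tuples with repeated entries this differs from the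
  -- test in `bad-tuples`; the difference is paid for by `degenerate-small`.
  bad : Subset n → ℕ
  bad L = ι (not (G 1 (κ ∸ ∣ L ∣) L))

  c : ℕ
  c = suc (2 * M ^ k)

  miss-concat : ∀ j b → tsum (lookup B′) j (miss 1 b) ∅ ≡ miss 1 (j + b) ∅
  miss-concat j b = trans (tsum-swap j (λ x → ι (lookup A′ x)) (tsum (lookup B′) b notE) ∅)
    (sum-cong (λ x → cong (ι (lookup A′ x) *_) (tsum-concat (lookup B′) j b notE (∅ ∪ ⁅ x ⁆))))

  -- Markov's inequality: each bad j-tuple is the start of at least (θ + 1)^(κ - j + 1) missed
  -- tuples, and by `miss-concat` the misses of all starts add up to `miss 1 κ ∅`.
  bad-tuples : ∀ j → j ≤ κ → D * D * tsum (lookup B′) j (λ R → ι (not (G 1 (κ ∸ j) R))) ∅ ≤ 2 * M ^ k * n ^ j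
  bad-tuples j j≤κ = cancel-*-≤ (n ^ suc b) (pos-^ (suc b) n>0) (begin
    n ^ suc b * (D * D * τ)                     ≤⟨ ℕₚ.*-monoˡ-≤ (D * D * τ) (n^≤ (suc b) (s≤s (ℕₚ.m∸n≤m κ j))) ⟩
    M ^ k * suc θ ^ suc b * (D * D * τ)         ≡⟨ bad-tuples-identity (M ^ k) (suc θ ^ suc b) (D * D) τ ⟩
    M ^ k * (D * D * (suc θ ^ suc b * τ))       ≤⟨ ℕₚ.*-monoʳ-≤ (M ^ k) (ℕₚ.*-monoʳ-≤ (D * D) markov) ⟩
    M ^ k * (D * D * miss 1 κ ∅)                ≤⟨ ℕₚ.*-monoʳ-≤ (M ^ k) miss-empty ⟩
    M ^ k * (2 * n ^ k)                         ≡⟨ cong (λ x → M ^ k * (2 * (n * n ^ x))) (sym (ℕₚ.m∸n+n≡m j≤κ)) ⟩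
    M ^ k * (2 * n ^ (suc b + j))               ≡⟨ cong (λ x → M ^ k * (2 * x)) (ℕₚ.^-distribˡ-+-* n (suc b) j) ⟩
    M ^ k * (2 * (n ^ suc b * n ^ j))           ≡⟨ bad-tuples-identity₂ (M ^ k) (n ^ suc b) (n ^ j) ⟩
    n ^ suc b * (2 * M ^ k * n ^ j)             ∎)
    where
    open ℕₚ.≤-Reasoning
    b τ : ℕ
    b = κ ∸ j
    τ = tsum (lookup B′) j (λ R → ι (not (G 1 b R))) ∅
    pointwise : ∀ R → suc θ ^ suc b * ι (not (G 1 b R)) ≤ miss 1 b R
    pointwise R with bool-cases (G 1 b R)
    ... | inj₁ g = ℕₚ.≤-trans (ℕₚ.≤-reflexive (trans (cong (λ z → suc θ ^ suc b * ι (not z)) g) (ℕₚ.*-zeroʳ (suc θ ^ suc b)))) z≤n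
    ... | inj₂ g = ℕₚ.≤-trans (ℕₚ.≤-reflexive (trans (cong (λ z → suc θ ^ suc b * ι (not z)) g) (ℕₚ.*-identityʳ (suc θ ^ suc b)))) (bad⇒miss 1 b R g)
    markov : suc θ ^ suc b * τ ≤ miss 1 κ ∅
    markov = ℕₚ.≤-trans (ℕₚ.≤-reflexive (sym (tsum-* j (suc θ ^ suc b) _ ∅))) (ℕₚ.≤-trans (tsum-mono j pointwise ∅)
      (ℕₚ.≤-reflexive (trans (miss-concat j b) (cong (λ x → miss 1 x ∅) (ℕₚ.m+[n∸m]≡n j≤κ)))))

  degenerate-small : ∀ j → j ≤ κ → D * D * tsum (lookup B′) j (degenerate j) ∅ ≤ n ^ j
  degenerate-small j j≤κ = cancel-*-≤ n n>0 (begin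
    n * (D * D * tsum (lookup B′) j (degenerate j) ∅)     ≡⟨ *-swap n (D * D) _ ⟩
    D * D * (n * tsum (lookup B′) j (degenerate j) ∅)     ≤⟨ ℕₚ.*-monoʳ-≤ (D * D) (tsum-degenerate (lookup B′) j j ∅ (cong (_+ j) (Subsetₚ.∣⊥∣≡0 n))) ⟩
    D * D * (j * j * n ^ j)                               ≡⟨ sym (ℕₚ.*-assoc (D * D) (j * j) (n ^ j)) ⟩
    D * D * (j * j) * n ^ j                               ≤⟨ ℕₚ.*-monoˡ-≤ (n ^ j) (ℕₚ.≤-trans (ℕₚ.*-monoʳ-≤ (D * D) (ℕₚ.≤-trans (ℕₚ.*-monoʳ-≤ j j≤κ) (ℕₚ.≤-trans (ℕₚ.m≤m+n (j * κ) bo) (ℕₚ.m≤m+n _ (j * ao))))) (loss-small j j≤κ)) ⟩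
    n * n ^ j                                             ∎)
    where
    open ℕₚ.≤-Reasoning

  bad-small : ∀ j → j ≤ κ → D * D * tsum (lookup B′) j bad ∅ ≤ c * n ^ j
  bad-small j j≤κ = begin
    D * D * tsum (lookup B′) j bad ∅
      ≤⟨ ℕₚ.*-monoʳ-≤ (D * D) (ℕₚ.≤-trans (tsum-mono j pointwise ∅) (ℕₚ.≤-reflexive (tsum-+ j _ _ ∅))) ⟩
    D * D * (tsum (lookup B′) j (degenerate j) ∅ + tsum (lookup B′) j (λ R → ι (not (G 1 (κ ∸ j) R))) ∅)
      ≡⟨ ℕₚ.*-distribˡ-+ (D * D) _ _ ⟩
    D * D * tsum (lookup B′) j (degenerate j) ∅ + D * D * tsum (lookup B′) j (λ R → ι (not (G 1 (κ ∸ j) R))) ∅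
      ≤⟨ ℕₚ.+-mono-≤ (degenerate-small j j≤κ) (bad-tuples j j≤κ) ⟩
    n ^ j + 2 * M ^ k * n ^ j ∎
    where
    open ℕₚ.≤-Reasoning
    pointwise : ∀ R → bad R ≤ degenerate j R + ι (not (G 1 (κ ∸ j) R))
    pointwise R with ≟-cases ∣ R ∣ j
    ... | inj₁ (_ , refl) = ℕₚ.m≤n+m _ (degenerate j R)
    ... | inj₂ (f , _) = ℕₚ.≤-trans (ι≤1 _) (ℕₚ.≤-trans (ℕₚ.≤-reflexive (sym (cong (λ b → ι (not b)) f))) (ℕₚ.m≤m+n _ _))

  record Outsider : Set where
    no-eta-equality
    field
      v       : Fin n
      v∉B′    : lookup B′ v ≡ false
      U       : List (Fin n)
      U-small : 8 * (4 ^ κ * (D * (κ * length U))) ≤ n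

  module _ (outsider : Outsider) where

    open Outsider outsider

    allowed : Fin n → Bool
    allowed u = lookup B u ∧ (lookup B′ u ∧ not (memberˡ U u))

    P : Subset n
    P = tabulateᵛ allowed

    lookup-P : ∀ u → lookup P u ≡ allowed u
    lookup-P u = Vecₚ.lookup∘tabulate allowed u

    P-B′ : ∀ u → lookup P u ≡ true → lookup B′ u ≡ true
    P-B′ u h = proj₁ (∧-true {lookup B′ u} (proj₂ (∧-true {lookup B u} (trans (sym (lookup-P u)) h))))

    P-∉ : ∀ u → lookup P u ≡ true → u ∉ˡ U
    P-∉ u h = memberˡ-∉ U (not-true (proj₂ (∧-true {lookup B′ u} (proj₂ (∧-true {lookup B u} (trans (sym (lookup-P u)) h))))))

    -- All subsets of `R` are required to be good, not only `R`: the windows of the cycle cut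
    -- prefixes and suffixes of various lengths from the ends of the walk.
    linked : Subset n → Bool
    linked R = E (R ∪ ⁅ v ⁆) ∧ (below bad R ≤ᵇ 0)

    q : Subset n → ℕ
    q R = ι (does (∣ R ∣ ℕₚ.≟ κ) ∧ linked R)

    f₀ : Subset n → Bool
    f₀ R = does (∣ R ∣ ℕₚ.≟ κ) ∧ (does (R ⊆? P) ∧ linked R)

    total₀ : ℕ
    total₀ = Σs (λ R → ι (f₀ R))

    q-total : tsum (lookup P) κ q ∅ ≡ κ ! * total₀
    q-total = trans (tsum-weight P q κ (λ R ne → cong (λ b → ι (b ∧ linked R)) (does-false (∣ R ∣ ℕₚ.≟ κ) ne)) κ ∅ (ℕₚ.≤-reflexive (cong (_+ κ) (Subsetₚ.∣⊥∣≡0 n))))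
      (cong (κ ! *_) (Σs-cong {n} same))
      where
      same : ∀ Y → ι (does (∣ Y ∣ ℕₚ.≟ κ)) * (ι (does (Y ⊆? P)) * q (∅ ∪ Y)) ≡ ι (f₀ Y)
      same Y rewrite Subsetₚ.∪-identityˡ Y = bits (does (∣ Y ∣ ℕₚ.≟ κ)) (does (Y ⊆? P)) (linked Y)
        where
        bits : ∀ a b d → ι a * (ι b * ι (a ∧ d)) ≡ ι (a ∧ (b ∧ d))
        bits true true d = trans (ℕₚ.+-identityʳ _) (ℕₚ.+-identityʳ _)
        bits true false d = refl
        bits false b d = refl

    split : ∀ R → isE (R ∪ ⁅ v ⁆) ≤ q R + (below bad R + degenerate κ R)
    split R with bool-cases (E (R ∪ ⁅ v ⁆)) | ≟-cases ∣ R ∣ κ | bool-cases (below bad R ≤ᵇ 0)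
    ... | inj₂ f | _ | _ = ℕₚ.≤-trans (ℕₚ.≤-reflexive (cong ι f)) z≤n
    ... | inj₁ _ | inj₂ (f , _) | _ = ℕₚ.≤-trans (ι≤1 _) (ℕₚ.≤-trans (ℕₚ.≤-reflexive (sym (cong (λ b → ι (not b)) f)))
            (ℕₚ.≤-trans (ℕₚ.m≤n+m _ (below bad R)) (ℕₚ.m≤n+m _ (q R))))
    ... | inj₁ e | inj₁ (s , _) | inj₁ b = ℕₚ.≤-trans (ι≤1 _) (ℕₚ.≤-trans (ℕₚ.≤-reflexive (sym (cong ι (∧-intro s (∧-intro e b))))) (ℕₚ.m≤m+n _ _))
    ... | inj₁ _ | inj₁ _ | inj₂ b = ℕₚ.≤-trans (ι≤1 _) (ℕₚ.≤-trans (positive b) (ℕₚ.≤-trans (ℕₚ.m≤m+n _ (degenerate κ R)) (ℕₚ.m≤n+m _ (q R))))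
      where
      positive : ∀ {x} → (x ≤ᵇ 0) ≡ false → 1 ≤ x
      positive {suc x} _ = s≤s z≤n

    outside-P : ℕ
    outside-P = count (λ u → (lookup B u ∧ not (lookup B′ u)) ∨ memberˡ U u)

    B-split : ∀ u → lookup B u ≡ true → lookup P u ≡ true ⊎ (lookup B u ∧ not (lookup B′ u)) ∨ memberˡ U u ≡ true
    B-split u b rewrite lookup-P u | b with lookup B′ u | memberˡ U u
    ... | true | true = inj₂ refl
    ... | true | false = inj₁ refl
    ... | false | _ = inj₂ refl

    outside-P≤ : outside-P ≤ bo + length U
    outside-P≤ = ℕₚ.≤-trans (count-∨ {q = λ u → lookup B u ∧ not (lookup B′ u)} {r = memberˡ U} (λ u → ∨-elim)) (ℕₚ.+-monoʳ-≤ bo (count-memberˡ U))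

    -- The constant 8 leaves room for the four error terms below.
    dense : n ^ κ ≤ 2 * (4 ^ κ * (D * (κ ! * total₀)))
    dense = ℕₚ.*-cancelˡ-≤ 4 (cancel-*-≤ n n>0 (ℕₚ.+-cancelʳ-≤ (n * (4 * n ^ κ)) _ _ (begin
      n * (4 * n ^ κ) + n * (4 * n ^ κ)
        ≡⟨ dense-identity n (n ^ κ) ⟩
      n * (8 * n ^ κ)
        ≤⟨ ℕₚ.*-monoʳ-≤ n (ℕₚ.*-monoʳ-≤ 8 (ℕₚ.≤-trans quarter (ℕₚ.*-monoʳ-≤ w F≤))) ⟩
      n * (8 * (w * (D * tsum (lookup B) κ isE ⁅ v ⁆)))
        ≡⟨ dense-identity₂ n w D (tsum (lookup B) κ isE ⁅ v ⁆) ⟩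
      8 * (w * (D * (n * tsum (lookup B) κ isE ⁅ v ⁆)))
        ≤⟨ ℕₚ.*-monoʳ-≤ 8 (ℕₚ.*-monoʳ-≤ w (ℕₚ.*-monoʳ-≤ D (ℕₚ.≤-trans
             (tsum-change (lookup B) (lookup P) (λ u → (lookup B u ∧ not (lookup B′ u)) ∨ memberˡ U u) B-split κ (λ R → ι≤1 (E R)) ⁅ v ⁆)
             (ℕₚ.+-mono-≤ (ℕₚ.*-monoʳ-≤ n t-split) (ℕₚ.*-monoˡ-≤ (n ^ κ) (ℕₚ.*-monoʳ-≤ κ outside-P≤)))))) ⟩
      8 * (w * (D * (n * (κ ! * total₀ + (t₂ + t₃)) + κ * (bo + length U) * n ^ κ)))
        ≡⟨ dense-expand w D n (κ ! * total₀) t₂ t₃ κ bo (length U) (n ^ κ) ⟩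
      n * (4 * (2 * (w * (D * (κ ! * total₀))))) + (n * (8 * (w * (D * t₂))) + 8 * (w * (D * (n * t₃))) + (8 * (w * (D * (κ * bo))) * n ^ κ + 8 * (w * (D * (κ * length U))) * n ^ κ))
        ≤⟨ ℕₚ.+-monoʳ-≤ (n * (4 * (2 * (w * (D * (κ ! * total₀)))))) (ℕₚ.+-mono-≤ (ℕₚ.+-mono-≤ (ℕₚ.*-monoʳ-≤ n t₂-small) t₃-small) (ℕₚ.+-mono-≤ (ℕₚ.*-monoˡ-≤ (n ^ κ) bo-term) (ℕₚ.*-monoˡ-≤ (n ^ κ) U-small))) ⟩
      n * (4 * (2 * (w * (D * (κ ! * total₀))))) + (n * n ^ κ + n * n ^ κ + (n * n ^ κ + n * n ^ κ))
        ≡⟨ cong (n * (4 * (2 * (w * (D * (κ ! * total₀))))) +_) (dense-identity₃ n (n ^ κ)) ⟩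
      n * (4 * (2 * (w * (D * (κ ! * total₀))))) + n * (4 * n ^ κ) ∎)))
      where
      open ℕₚ.≤-Reasoning
      w t₂ t₃ : ℕ
      w = 4 ^ κ
      t₂ = tsum (lookup P) κ (below bad) ∅
      t₃ = tsum (lookup P) κ (degenerate κ) ∅
      F≤ : F ≤ D * tsum (lookup B) κ isE ⁅ v ⁆
      F≤ = begin
        κ ! * C₀                                 ≤⟨ ℕₚ.*-monoʳ-≤ (κ !) (B′-out v v∉B′) ⟩
        κ ! * (deg H ⁅ v ⁆ B * D)                ≡⟨ trans (sym (ℕₚ.*-assoc (κ !) _ D)) (ℕₚ.*-comm _ D) ⟩
        D * (κ ! * deg H ⁅ v ⁆ B)                ≡⟨ cong (D *_) (sym (link v)) ⟩
        D * tsum (lookup B) κ isE ⁅ v ⁆          ∎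
      t-split : tsum (lookup P) κ isE ⁅ v ⁆ ≤ κ ! * total₀ + (t₂ + t₃)
      t-split = begin
        tsum (lookup P) κ isE ⁅ v ⁆                        ≡⟨ trans (cong (tsum (lookup P) κ isE) (sym (Subsetₚ.∪-identityˡ ⁅ v ⁆))) (sym (tsum-shift (lookup P) κ isE v ∅)) ⟩
        tsum (lookup P) κ (λ R → isE (R ∪ ⁅ v ⁆)) ∅        ≤⟨ tsum-mono {P = lookup P} κ split ∅ ⟩
        tsum (lookup P) κ (λ R → q R + (below bad R + degenerate κ R)) ∅ ≡⟨ trans (tsum-+ {P = lookup P} κ q (λ R → below bad R + degenerate κ R) ∅) (cong₂ _+_ q-total (tsum-+ {P = lookup P} κ (below bad) (degenerate κ) ∅)) ⟩
        κ ! * total₀ + (t₂ + t₃)                           ∎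
      t₂-small : 8 * (w * (D * t₂)) ≤ n ^ κ
      t₂-small = cancel-*-≤ D 1≤D (begin
        D * (8 * (w * (D * t₂)))             ≡⟨ t₂-small-identity D w t₂ ⟩
        8 * w * (D * D * t₂)                 ≤⟨ ℕₚ.*-monoʳ-≤ (8 * w) (ℕₚ.≤-trans (ℕₚ.*-monoʳ-≤ (D * D) (tsum-mono-P P-B′ κ (below bad) ∅))
                                                  (tsum-below (lookup B′) (D * D) κ bad c bad-small)) ⟩
        8 * w * (2 ^ κ * c * n ^ κ)          ≡⟨ t₂-small-identity₂ w (2 ^ κ) c (n ^ κ) ⟩
        8 * (w * (2 ^ κ * c)) * n ^ κ        ≤⟨ ℕₚ.*-monoˡ-≤ (n ^ κ) D-dense ⟩
        D * n ^ κ                            ∎)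
      t₃-small : 8 * (w * (D * (n * t₃))) ≤ n * n ^ κ
      t₃-small = begin
        8 * (w * (D * (n * t₃)))                        ≤⟨ ℕₚ.*-monoʳ-≤ 8 (ℕₚ.*-monoʳ-≤ w (ℕₚ.*-monoʳ-≤ D (tsum-degenerate (lookup P) κ κ ∅ (cong (_+ κ) (Subsetₚ.∣⊥∣≡0 n))))) ⟩
        8 * (w * (D * (κ * κ * n ^ κ)))                 ≡⟨ t₃-small-identity w D (κ * κ) (n ^ κ) ⟩
        2 * (w * 4 * (1 * 1 * D) * (κ * κ)) * n ^ κ     ≤⟨ ℕₚ.*-monoˡ-≤ (n ^ κ) (ℕₚ.≤-trans (ℕₚ.*-monoʳ-≤ 2 (ℕₚ.*-mono-≤ (ℕₚ.*-mono-≤ (ℕₚ.*-monoʳ-≤ w 4≤Γ)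
                                                             (ℕₚ.*-monoˡ-≤ D (ℕₚ.*-mono-≤ 1≤D 1≤D))) (ℕₚ.*-mono-≤ (ℕₚ.n≤1+n κ) (ℕₚ.n≤1+n κ)))) n-large) ⟩
        n * n ^ κ                                       ∎
        where
        4≤Γ : 4 ≤ Γ
        4≤Γ = ℕₚ.≤-trans (ℕₚ.*-monoʳ-≤ 4 {x = 1} {y = k} (s≤s z≤n)) Γ-large
      bo-term : 8 * (w * (D * (κ * bo))) ≤ n
      bo-term = begin
        8 * (w * (D * (κ * bo)))            ≡⟨ bo-term-identity w D κ bo ⟩
        bo * 1 * (8 * (w * κ) * D)          ≤⟨ ℕₚ.*-mono-≤ (ℕₚ.*-monoʳ-≤ bo 1≤Γ) (ℕₚ.*-monoˡ-≤ D D-κ) ⟩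
        bo * Γ * (D * D)                    ≤⟨ bo-small ⟩
        n                                   ∎

    f₀-size : ∀ R → f₀ R ≡ true → ∣ R ∣ ≡ κ
    f₀-size R h = from-does (∣ R ∣ ℕₚ.≟ κ) (proj₁ (∧-true h))

    f₀-P : ∀ R → f₀ R ≡ true → ∀ u → lookup R u ≡ true → lookup P u ≡ true
    f₀-P R h = ⊆-lookup (from-does (R ⊆? P) (proj₁ (∧-true {does (R ⊆? P)} (proj₂ (∧-true {does (∣ R ∣ ℕₚ.≟ κ)} h)))))

    f₀-linked : ∀ R → f₀ R ≡ true → linked R ≡ true
    f₀-linked R h = proj₂ (∧-true {does (R ⊆? P)} (proj₂ (∧-true {does (∣ R ∣ ℕₚ.≟ κ)} h)))

    open Pruning ρ (λ u → lookup P u ≡ true) f₀ f₀-size f₀-P (κ + t)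

    -- Pruning deletes a number of sets of order n^(κ - 1), against the order n^κ/D provided by
    -- `dense`; `n-walk` makes n large enough in terms of D.
    survivors : 0 < total (pruned t)
    survivors = ℕₚ.n≢0⇒n>0 (λ z → ℕₚ.<⇒≱ n-walk (cancel-*-≤ (n ^ ρ) (pos-^ ρ n>0) (begin
      n ^ ρ * n                                                               ≡⟨ ℕₚ.*-comm _ n ⟩
      n ^ κ                                                                   ≤⟨ dense ⟩
      2 * (4 ^ κ * (D * (κ ! * total₀)))                                      ≤⟨ ℕₚ.*-monoʳ-≤ 2 (ℕₚ.*-monoʳ-≤ (4 ^ κ) (ℕₚ.*-monoʳ-≤ D (ℕₚ.*-monoʳ-≤ (κ !)
                                                                                   (ℕₚ.≤-trans (pruning t) (ℕₚ.≤-reflexive (cong (_+ t * ((κ + t) * faces)) z)))))) ⟩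
      2 * (4 ^ κ * (D * (κ * ρ ! * (t * ((κ + t) * faces)))))                 ≡⟨ survivors-identity (4 ^ κ) D κ (ρ !) t (κ + t) faces ⟩
      ρ ! * faces * (2 * (4 ^ κ * (D * (κ * (t * (κ + t))))))                 ≤⟨ ℕₚ.*-monoˡ-≤ _ faces-bound ⟩
      n ^ ρ * (2 * (4 ^ κ * (D * (κ * (t * (κ + t))))))                       ∎)))
      where
      open ℕₚ.≤-Reasoning

    record Walk : Set where
      field
        ys      : List (Fin n)
        #ys     : length ys ≡ κ + t
        unique  : Unique ys
        in-B′   : ∀ {y} → y ∈ˡ ys → lookup B′ y ≡ true
        avoid-U : ∀ {y} → y ∈ˡ ys → y ∉ˡ U
        edge    : ∀ i → i ≤ t → E (toSubset (take κ (drop i ys)) ∪ ⁅ v ⁆) ≡ true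
        good    : ∀ i → i ≤ t → ∀ L → (∀ u → lookup L u ≡ true → lookup (toSubset (take κ (drop i ys))) u ≡ true) → G 1 (κ ∸ ∣ L ∣) L ≡ true

    abstract
      walk-exists : Walk
      walk-exists = build (Σs-witness (pruned t) survivors)
        where
        build : ∃[ R ] pruned t R ≡ true → Walk
        build (R , h) = record
          { ys = w ++ zs ; #ys = trans (Listₚ.length-++ w) (cong₂ _+_ w-length #zs)
          ; unique = Uniqueₚ.++⁺ (elements-unique R) unique (λ { (m , m′) → fresh m′ m })
          ; in-B′ = λ m → P-B′ _ (all-P m) ; avoid-U = λ m → P-∉ _ (all-P m)
          ; edge = λ i le → proj₁ (∧-true (f₀-linked _ (windows i le)))
          ; good = λ i le L sub → good-from (toSubset (take κ (drop i (w ++ zs)))) (f₀-linked _ (windows i le)) L sub }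
          where
          w : List (Fin n)
          w = elements R
          w-R : toSubset w ≡ R
          w-R = toSubset-elements R
          w-length : length w ≡ κ
          w-length = trans (sym (card-toSubset (elements-unique R))) (trans (cong ∣_∣ w-R) (f₀-size R (pruned-f₀ t R h)))
          open Extension (walk t w w (elements-unique R) w-length (ℕₚ.≤-trans (ℕₚ.≤-reflexive (cong (_+ t) w-length)) (ℕₚ.n≤1+n _)) (λ m → m)
            (trans (cong (pruned t) w-R) h))
          all-P : ∀ {y} → y ∈ˡ (w ++ zs) → lookup P y ≡ true
          all-P {y} m with ∈-++⁻ w m
          ... | inj₁ m′ = f₀-P R (pruned-f₀ t R h) y (∈-filterᵇ⁻ (lookup R) {allFin n} m′)
          ... | inj₂ m′ = inside-Q m′
          good-from : ∀ S → linked S ≡ true → ∀ L → (∀ u → lookup L u ≡ true → lookup S u ≡ true) → G 1 (κ ∸ ∣ L ∣) L ≡ true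
          good-from S l L sub = decide (bool-cases (G 1 (κ ∸ ∣ L ∣) L))
            where
            decide : G 1 (κ ∸ ∣ L ∣) L ≡ true ⊎ G 1 (κ ∸ ∣ L ∣) L ≡ false → G 1 (κ ∸ ∣ L ∣) L ≡ true
            decide (inj₁ g) = g
            decide (inj₂ g) = ⊥-elim (ℕₚ.<⇒≱ (s≤s z≤n) (ℕₚ.≤-trans (ℕₚ.≤-reflexive (sym (cong₂ (λ a b → ι a * ι (not b)) (does-true (L ⊆? S) (lookup-⊆ sub)) g)))
              (ℕₚ.≤-trans (Σs-term (λ L → ι (does (L ⊆? S)) * bad L) L) (≤ᵇ-elim (proj₂ (∧-true {E (S ∪ ⁅ v ⁆)} l))))))

-- Windows of lists

module _ {A : Set} where

  drop-++ : ∀ j (xs ys : List A) → drop j (xs ++ ys) ≡ drop j xs ++ drop (j ∸ length xs) ys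
  drop-++ zero [] ys = refl
  drop-++ zero (x ∷ xs) ys = refl
  drop-++ (suc j) [] ys = refl
  drop-++ (suc j) (x ∷ xs) ys = drop-++ j xs ys

  take-++ : ∀ j (xs ys : List A) → take j (xs ++ ys) ≡ take j xs ++ take (j ∸ length xs) ys
  take-++ zero [] ys = refl
  take-++ zero (x ∷ xs) ys = refl
  take-++ (suc j) [] ys = refl
  take-++ (suc j) (x ∷ xs) ys = cong (x ∷_) (take-++ j xs ys)

  take-all : ∀ j (xs : List A) → length xs ≤ j → take j xs ≡ xs
  take-all zero [] _ = refl
  take-all (suc j) [] _ = refl
  take-all (suc j) (x ∷ xs) (s≤s le) = cong (x ∷_) (take-all j xs le)

  drop-all : ∀ j (xs : List A) → length xs ≤ j → drop j xs ≡ []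
  drop-all zero [] _ = refl
  drop-all (suc j) [] _ = refl
  drop-all (suc j) (x ∷ xs) (s≤s le) = drop-all j xs le

  take-drop-prefix : ∀ i m (xs ys : List A) → i + m ≤ length xs → take m (drop i (xs ++ ys)) ≡ take m (drop i xs)
  take-drop-prefix i m xs ys le = begin
    take m (drop i (xs ++ ys))                                                   ≡⟨ cong (take m) (drop-++ i xs ys) ⟩
    take m (drop i xs ++ drop (i ∸ length xs) ys)                                ≡⟨ take-++ m (drop i xs) _ ⟩
    take m (drop i xs) ++ take (m ∸ length (drop i xs)) (drop (i ∸ length xs) ys) ≡⟨ cong (λ j → take m (drop i xs) ++ take j (drop (i ∸ length xs) ys)) (ℕₚ.m≤n⇒m∸n≡0 enough) ⟩
    take m (drop i xs) ++ []                                                     ≡⟨ Listₚ.++-identityʳ _ ⟩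
    take m (drop i xs)                                                           ∎
    where
    open ≡-Reasoning
    enough : m ≤ length (drop i xs)
    enough = ℕₚ.≤-trans (ℕₚ.m+n≤o⇒m≤o∸n m (ℕₚ.≤-trans (ℕₚ.≤-reflexive (ℕₚ.+-comm m i)) le)) (ℕₚ.≤-reflexive (sym (Listₚ.length-drop i xs)))

  drop-suffix : ∀ j (xs ys : List A) → drop (length xs + j) (xs ++ ys) ≡ drop j ys
  drop-suffix j [] ys = refl
  drop-suffix j (x ∷ xs) ys = drop-suffix j xs ys

inside′-identity : ∀ a l d → a + (l + d) ≡ d + a + l
inside′-identity = solve 3 (λ a l d → a :+ (l :+ d) := d :+ a :+ l) refl
  where open ℕ-Solver

module Windows {A : Set} (Φ : List A → Set) (d ℓ k : ℕ) (k-eq : k ≡ ℓ + d) where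

  AllWin : List A → Set
  AllWin xs = ∀ i → i * d + k ≤ length xs → Φ (take k (drop (i * d) xs))

  -- Since k = ℓ + d, a window starting at a multiple of d inside `U` ends within `U ++ E`, and
  -- every other window starts in `E ++ S`. An overlap of length ℓ is therefore all that two parts
  -- have to share.
  glue : ∀ U E S u → length U ≡ u * d → length E ≡ ℓ → AllWin (U ++ E) → AllWin (E ++ S) → AllWin (U ++ E ++ S)
  glue U E S u lU lE first second i le with ℕₚ._<?_ i u
  ... | yes i<u = subst Φ (sym (trans (cong (λ xs → take k (drop (i * d) xs)) (sym (Listₚ.++-assoc U E S))) (take-drop-prefix (i * d) k (U ++ E) S inside′))) (first i inside′)
    where
    open ℕₚ.≤-Reasoning
    inside′ : i * d + k ≤ length (U ++ E)
    inside′ = begin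
      i * d + k             ≡⟨ cong (i * d +_) k-eq ⟩
      i * d + (ℓ + d)       ≡⟨ inside′-identity (i * d) ℓ d ⟩
      suc i * d + ℓ         ≤⟨ ℕₚ.+-monoˡ-≤ ℓ (ℕₚ.*-monoˡ-≤ d i<u) ⟩
      u * d + ℓ             ≡⟨ sym (trans (Listₚ.length-++ U) (cong₂ _+_ lU lE)) ⟩
      length (U ++ E)       ∎
  ... | no i≮u = subst Φ (cong (take k) (sym shift)) (second (i ∸ u) fits′)
    where
    u≤i : u ≤ i
    u≤i = ℕₚ.≮⇒≥ i≮u
    i-eq : i * d ≡ length U + (i ∸ u) * d
    i-eq = trans (cong (_* d) (sym (ℕₚ.m+[n∸m]≡n u≤i))) (trans (ℕₚ.*-distribʳ-+ d u (i ∸ u)) (cong (_+ (i ∸ u) * d) (sym lU)))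
    shift : drop (i * d) (U ++ E ++ S) ≡ drop ((i ∸ u) * d) (E ++ S)
    shift = trans (cong (λ j → drop j (U ++ E ++ S)) i-eq) (drop-suffix ((i ∸ u) * d) U (E ++ S))
    fits′ : (i ∸ u) * d + k ≤ length (E ++ S)
    fits′ = ℕₚ.+-cancelˡ-≤ (length U) _ _ (ℕₚ.≤-trans (ℕₚ.≤-reflexive (trans (sym (ℕₚ.+-assoc (length U) ((i ∸ u) * d) k)) (cong (_+ k) (sym i-eq))))
      (ℕₚ.≤-trans le (ℕₚ.≤-reflexive (Listₚ.length-++ U))))

-- A cyclic pattern of cells, built from blocks

record Scheme (n : ℕ) : Set where
  no-eta-equality
  field
    X         : Bool → Fin n → Bool
    E         : Subset n → Bool
    θ d s′ ℓ κ : ℕ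
    k-eq      : suc κ ≡ ℓ + d
    s′d≤κ     : s′ * d ≤ κ
    ℓ<s′d     : ℓ < s′ * d
    ∅-good    : Goodness.G X E θ 1 κ ∅ ≡ true

length-front-swap : ∀ l d x → l + (d + x) ≡ d + (l + x)
length-front-swap = solve 3 (λ l d x → l :+ (d :+ x) := d :+ (l :+ x)) refl
  where open ℕ-Solver

size′-identity : ∀ s d l p → s * d + ((l + p * d) + s * d) ≡ l + (s + (p + s)) * d
size′-identity = solve 4 (λ s d l p → s :* d :+ ((l :+ p :* d) :+ s :* d) := l :+ (s :+ (p :+ s)) :* d) refl
  where open ℕ-Solver

module Template {n : ℕ} (scheme : Scheme n) where

  open Scheme scheme
  open Goodness X E θ

  k s : ℕ
  k = suc κ
  s = suc s′

  0<d : 0 < d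
  0<d = ℕₚ.n≢0⇒n>0 (λ d≡0 → ℕₚ.<⇒≱ ℓ<s′d (subst (λ x → s′ * x ≤ ℓ) (sym d≡0) (ℕₚ.≤-trans (ℕₚ.≤-reflexive (ℕₚ.*-zeroʳ s′)) z≤n)))

  d-pred : suc (d ∸ 1) ≡ d
  d-pred = ℕₚ.m+[n∸m]≡n 0<d

  fixeds : List (Cell n) → List (Fin n)
  fixeds [] = []
  fixeds (fixed v ∷ cs) = v ∷ fixeds cs
  fixeds (blank _ ∷ cs) = fixeds cs

  fixeds-++ : ∀ xs ys → fixeds (xs ++ ys) ≡ fixeds xs ++ fixeds ys
  fixeds-++ [] ys = refl
  fixeds-++ (fixed v ∷ xs) ys = cong (v ∷_) (fixeds-++ xs ys)
  fixeds-++ (blank _ ∷ xs) ys = fixeds-++ xs ys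

  fixeds-fixed : ∀ vs → fixeds (map fixed vs) ≡ vs
  fixeds-fixed [] = refl
  fixeds-fixed (v ∷ vs) = cong (v ∷_) (fixeds-fixed vs)

  blanks-++ : ∀ τ xs ys → blanks τ (xs ++ ys) ≡ blanks τ xs + blanks τ ys
  blanks-++ τ [] ys = refl
  blanks-++ τ (x ∷ xs) ys = trans (cong (ι (isBlank τ x) +_) (blanks-++ τ xs ys)) (sym (ℕₚ.+-assoc (ι (isBlank τ x)) _ _))

  blanks-fixed : ∀ τ vs → blanks τ (map fixed vs) ≡ 0
  blanks-fixed τ [] = refl
  blanks-fixed τ (v ∷ vs) = blanks-fixed τ vs

  image-fixeds : ∀ cs → image cs ≡ toSubset (fixeds cs)
  image-fixeds [] = refl
  image-fixeds (fixed v ∷ cs) = cong (⁅ v ⁆ ∪_) (image-fixeds cs)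
  image-fixeds (blank _ ∷ cs) = image-fixeds cs

  cells-total : ∀ cs → blanks true cs + blanks false cs + length (fixeds cs) ≡ length cs
  cells-total [] = refl
  cells-total (fixed v ∷ cs) = trans (ℕₚ.+-suc _ _) (cong suc (cells-total cs))
  cells-total (blank true ∷ cs) = cong suc (cells-total cs)
  cells-total (blank false ∷ cs) = trans (cong (_+ length (fixeds cs)) (ℕₚ.+-suc _ _)) (cong suc (cells-total cs))

  Bs : ℕ → List (Cell n)
  Bs m = replicate m (blank false)

  Bs-true : ∀ m → blanks true (Bs m) ≡ 0
  Bs-true zero = refl
  Bs-true (suc m) = Bs-true m

  Bs-fixeds : ∀ m → fixeds (Bs m) ≡ []
  Bs-fixeds zero = refl
  Bs-fixeds (suc m) = Bs-fixeds m

  take-fixeds : ∀ m cs → fixeds cs ≡ [] → fixeds (take m cs) ≡ []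
  take-fixeds zero cs e = refl
  take-fixeds (suc m) [] e = refl
  take-fixeds (suc m) (blank _ ∷ cs) e = take-fixeds m cs e

  drop-fixeds : ∀ m cs → fixeds cs ≡ [] → fixeds (drop m cs) ≡ []
  drop-fixeds zero cs e = e
  drop-fixeds (suc m) [] e = refl
  drop-fixeds (suc m) (blank _ ∷ cs) e = drop-fixeds m cs e

  take-blanks : ∀ τ m cs → blanks τ cs ≡ 0 → blanks τ (take m cs) ≡ 0
  take-blanks τ zero cs e = refl
  take-blanks τ (suc m) [] e = refl
  take-blanks τ (suc m) (c ∷ cs) e = cong₂ _+_ (ℕₚ.m+n≡0⇒m≡0 (ι (isBlank τ c)) e) (take-blanks τ m cs (ℕₚ.m+n≡0⇒n≡0 (ι (isBlank τ c)) e))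

  drop-blanks : ∀ τ m cs → blanks τ cs ≡ 0 → blanks τ (drop m cs) ≡ 0
  drop-blanks τ zero cs e = e
  drop-blanks τ (suc m) [] e = refl
  drop-blanks τ (suc m) (c ∷ cs) e = drop-blanks τ m cs (ℕₚ.m+n≡0⇒n≡0 (ι (isBlank τ c)) e)

  take-map : ∀ m (vs : List (Fin n)) → take m (map {B = Cell n} fixed vs) ≡ map fixed (take m vs)
  take-map zero vs = refl
  take-map (suc m) [] = refl
  take-map (suc m) (v ∷ vs) = cong (fixed v ∷_) (take-map m vs)

  drop-map : ∀ m (vs : List (Fin n)) → drop m (map {B = Cell n} fixed vs) ≡ map fixed (drop m vs)
  drop-map zero vs = refl
  drop-map (suc m) [] = refl
  drop-map (suc m) (v ∷ vs) = drop-map m vs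

  one-true : ∀ P S j → blanks true P ≡ 0 → blanks true S ≡ 0 → j ≤ length P → length P < j + k →
             blanks true (take k (drop j (P ++ blank true ∷ S))) ≡ 1
  one-true P S j p₀ s₀ j≤ <k = begin
    blanks true (take k (drop j (P ++ blank true ∷ S)))                   ≡⟨ cong (λ xs → blanks true (take k xs)) (trans (drop-++ j P _) (cong (λ i → drop j P ++ drop i (blank true ∷ S)) (ℕₚ.m≤n⇒m∸n≡0 j≤))) ⟩
    blanks true (take k (drop j P ++ blank true ∷ S))                     ≡⟨ trans (cong (blanks true) (take-++ k (drop j P) _)) (blanks-++ true (take k (drop j P)) _) ⟩
    blanks true (take k (drop j P)) + blanks true (take r (blank true ∷ S)) ≡⟨ cong₂ (λ x r → x + blanks true (take r (blank true ∷ S))) (take-blanks true k (drop j P) (drop-blanks true j P p₀)) (sym r-suc) ⟩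
    suc (blanks true (take (r ∸ 1) S))                                    ≡⟨ cong suc (take-blanks true (r ∸ 1) S s₀) ⟩
    1                                                                     ∎
    where
    open ≡-Reasoning
    r : ℕ
    r = k ∸ length (drop j P)
    r-suc : suc (r ∸ 1) ≡ r
    r-suc = ℕₚ.m+[n∸m]≡n (ℕₚ.m<n⇒0<n∸m (subst (_< k) (sym (Listₚ.length-drop j P))
      (ℕₚ.+-cancelˡ-< j _ _ (ℕₚ.≤-<-trans (ℕₚ.≤-reflexive (ℕₚ.m+[n∸m]≡n j≤)) <k))))

  -- The second condition forces a wholly blank window to contain exactly one position of class
  -- `true`; without it a lone vertex would not leave a window of the shape treated in `Ok-lone`.
  Φ : List (Cell n) → Set
  Φ c = Good c ≡ true × (blanks true c ≡ 1 ⊎ ∃[ v ] (fixed v ∈ˡ c))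

  open Windows Φ d ℓ k k-eq

  good-window : ∀ c S f → length c ≡ k → blanks true c ≡ 1 → fixeds c ≡ S → length S ≡ f → G 1 (κ ∸ f) (toSubset S) ≡ true → Φ c
  good-window c S f lc one fc lS g = trans (cong₂ (λ a b → G a b (image c)) one b-eq) (trans (cong (G 1 (κ ∸ f)) (trans (image-fixeds c) (cong toSubset fc))) g) , inj₁ one
    where
    b-eq : blanks false c ≡ κ ∸ f
    b-eq = trans (sym (ℕₚ.m+n∸n≡m (blanks false c) f)) (cong (_∸ f) (ℕₚ.suc-injective (trans (cong₂ (λ a g → a + blanks false c + g) (sym one) (sym (trans (cong length fc) lS)))
      (trans (cells-total c) lc))))

  window-length : ∀ {A : Set} i (xs : List A) → i * d + k ≤ length xs → length (take k (drop (i * d) xs)) ≡ k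
  window-length i xs le = trans (Listₚ.length-take k (drop (i * d) xs)) (ℕₚ.m≤n⇒m⊓n≡m (subst (k ≤_) (sym (Listₚ.length-drop (i * d) xs))
    (ℕₚ.m+n≤o⇒m≤o∸n k (ℕₚ.≤-trans (ℕₚ.≤-reflexive (ℕₚ.+-comm k (i * d))) le))))

  -- After ℓ blanks of B′ the A′-position of σ has index κ, which lies in all s windows starting at
  -- 0, d, ..., s′ d; that of τ has index ℓ and lies in s′ windows. `front` is σ cut so that the
  -- piece behind it starts after s d positions, counted with the ℓ preceding blanks.
  σ τ front : List (Cell n)
  σ = Bs (d ∸ 1) ++ blank true ∷ Bs (s′ * d)
  τ = blank true ∷ Bs (s′ * d ∸ 1)
  front = Bs (d ∸ 1) ++ blank true ∷ Bs (s′ * d ∸ ℓ)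

  length-Bs : ∀ m → length (Bs m) ≡ m
  length-Bs m = Listₚ.length-replicate m

  length-σ : length σ ≡ s * d
  length-σ = trans (Listₚ.length-++ (Bs (d ∸ 1))) (trans (cong₂ (λ x y → x + suc y) (length-Bs (d ∸ 1)) (length-Bs (s′ * d)))
    (trans (ℕₚ.+-suc (d ∸ 1) (s′ * d)) (cong (_+ s′ * d) d-pred)))

  length-τ : length τ ≡ s′ * d
  length-τ = trans (cong suc (length-Bs (s′ * d ∸ 1))) (ℕₚ.m+[n∸m]≡n (ℕₚ.≤-trans (s≤s z≤n) ℓ<s′d))

  length-front : ℓ + length front ≡ s * d
  length-front = trans (cong (ℓ +_) (trans (Listₚ.length-++ (Bs (d ∸ 1))) (trans (cong₂ (λ x y → x + suc y) (length-Bs (d ∸ 1)) (length-Bs (s′ * d ∸ ℓ)))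
    (trans (ℕₚ.+-suc (d ∸ 1) (s′ * d ∸ ℓ)) (cong (_+ (s′ * d ∸ ℓ)) d-pred)))))
    (trans (length-front-swap ℓ d (s′ * d ∸ ℓ)) (cong (d +_) (ℕₚ.m+[n∸m]≡n (ℕₚ.<⇒≤ ℓ<s′d))))

  last-window : ∀ i → i * d + k ≤ s * d + ℓ → i ≤ s′
  last-window i le = ℕₚ.≤-pred (ℕₚ.*-cancelʳ-< d (i) s (ℕₚ.+-cancelʳ-< ℓ _ _ (ℕₚ.<-≤-trans (ℕₚ.+-monoʳ-< (i * d) ℓ<k) le)))
    where
    ℓ<k : ℓ < k
    ℓ<k = ℕₚ.<-≤-trans ℓ<s′d (ℕₚ.≤-trans s′d≤κ (ℕₚ.n≤1+n κ))

  i*d≤κ : ∀ i → i ≤ s′ → i * d ≤ κ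
  i*d≤κ i le = ℕₚ.≤-trans (ℕₚ.*-monoˡ-≤ d le) s′d≤κ

  κ-eq : ℓ + (d ∸ 1) ≡ κ
  κ-eq = ℕₚ.suc-injective (trans (sym (ℕₚ.+-suc ℓ (d ∸ 1))) (trans (cong (ℓ +_) d-pred) (sym k-eq)))

  -- These are the parts that windows cut from an end `V`: a window starting in `V` and running into
  -- σ keeps a suffix, one starting in the blanks before `V` reaches a prefix. Truncated subtraction
  -- yields the empty set when a window does not meet `V`.
  TailGood HeadGood : List (Fin n) → Set
  TailGood V = ∀ j → j ≤ s′ → G 1 (κ ∸ (ℓ ∸ j * d)) (toSubset (drop (j * d) V)) ≡ true
  HeadGood V = ∀ j → j ≤ s′ → G 1 (κ ∸ (k ∸ (s * d ∸ j * d))) (toSubset (take (k ∸ (s * d ∸ j * d)) V)) ≡ true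

  tail-windows : ∀ V → length V ≡ ℓ → TailGood V → AllWin (map fixed V ++ σ)
  tail-windows V lV good i le = good-window c (drop (i * d) V) (ℓ ∸ i * d) (window-length i L le)
      (trans (cong (λ xs → blanks true (take k (drop (i * d) xs))) L-eq)
        (one-true (map fixed V ++ Bs (d ∸ 1)) (Bs (s′ * d)) (i * d) (trans (blanks-++ true (map fixed V) _) (cong₂ _+_ (blanks-fixed true V) (Bs-true (d ∸ 1)))) (Bs-true (s′ * d))
          (subst (i * d ≤_) (sym lP) (i*d≤κ i i≤)) (subst (_< i * d + k) (sym lP) (ℕₚ.m≤n+m k (i * d)))))
      (begin
        fixeds (take k (drop (i * d) L))                                           ≡⟨ cong (λ xs → fixeds (take k xs)) (trans (drop-++ (i * d) (map fixed V) σ) (cong (_++ R) (drop-map (i * d) V))) ⟩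
        fixeds (take k (map fixed V′ ++ R))                                        ≡⟨ cong fixeds (take-++ k (map fixed V′) R) ⟩
        fixeds (take k (map fixed V′) ++ take (k ∸ length (map {B = Cell n} fixed V′)) R) ≡⟨ fixeds-++ (take k (map fixed V′)) _ ⟩
        fixeds (take k (map fixed V′)) ++ fixeds (take (k ∸ length (map {B = Cell n} fixed V′)) R)
          ≡⟨ cong₂ _++_ (trans (cong fixeds (take-all k (map fixed V′) short)) (fixeds-fixed V′)) (take-fixeds (k ∸ length (map {B = Cell n} fixed V′)) R (drop-fixeds (i * d ∸ length (map {B = Cell n} fixed V)) σ σ-fixeds)) ⟩
        V′ ++ []                                                                   ≡⟨ Listₚ.++-identityʳ V′ ⟩
        V′                                                                         ∎)
      (trans (Listₚ.length-drop (i * d) V) (cong (_∸ i * d) lV)) (good i i≤)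
    where
    open ≡-Reasoning
    L c R : List (Cell n)
    L = map fixed V ++ σ
    c = take k (drop (i * d) L)
    R = drop (i * d ∸ length (map {B = Cell n} fixed V)) σ
    V′ : List (Fin n)
    V′ = drop (i * d) V
    i≤ : i ≤ s′
    i≤ = last-window i (ℕₚ.≤-trans le (ℕₚ.≤-reflexive (trans (Listₚ.length-++ (map fixed V)) (trans (cong₂ _+_ (trans (Listₚ.length-map fixed V) lV) length-σ) (ℕₚ.+-comm ℓ _)))))
    L-eq : L ≡ (map fixed V ++ Bs (d ∸ 1)) ++ blank true ∷ Bs (s′ * d)
    L-eq = sym (Listₚ.++-assoc (map fixed V) (Bs (d ∸ 1)) _)
    lP : length (map fixed V ++ Bs (d ∸ 1)) ≡ κ
    lP = trans (Listₚ.length-++ (map fixed V)) (trans (cong₂ _+_ (trans (Listₚ.length-map fixed V) lV) (length-Bs (d ∸ 1))) κ-eq)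
    σ-fixeds : fixeds σ ≡ []
    σ-fixeds = trans (fixeds-++ (Bs (d ∸ 1)) _) (cong₂ _++_ (Bs-fixeds (d ∸ 1)) (Bs-fixeds (s′ * d)))
    short : length (map {B = Cell n} fixed V′) ≤ k
    short = ℕₚ.≤-trans (ℕₚ.≤-reflexive (trans (Listₚ.length-map fixed V′) (trans (Listₚ.length-drop (i * d) V) (cong (_∸ i * d) lV))))
      (ℕₚ.≤-trans (ℕₚ.m∸n≤m ℓ (i * d)) (ℕₚ.≤-trans (ℕₚ.m≤m+n ℓ d) (ℕₚ.≤-reflexive (sym k-eq))))

  head-windows : ∀ V → length V ≡ ℓ → HeadGood V → AllWin ((Bs ℓ ++ front) ++ map fixed V)
  head-windows V lV good i le = good-window c (take f V) f (window-length i L le)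
      (trans (cong (λ xs → blanks true (take k (drop (i * d) xs))) L-eq)
        (one-true (Bs ℓ ++ Bs (d ∸ 1)) (Bs (s′ * d ∸ ℓ) ++ map fixed V) (i * d)
          (trans (blanks-++ true (Bs ℓ) _) (cong₂ _+_ (Bs-true ℓ) (Bs-true (d ∸ 1))))
          (trans (blanks-++ true (Bs (s′ * d ∸ ℓ)) _) (cong₂ _+_ (Bs-true (s′ * d ∸ ℓ)) (blanks-fixed true V)))
          (subst (i * d ≤_) (sym lP) (i*d≤κ i i≤)) (subst (_< i * d + k) (sym lP) (ℕₚ.m≤n+m k (i * d)))))
      (begin
        fixeds (take k (drop (i * d) L))                        ≡⟨ cong (λ xs → fixeds (take k xs)) (trans (drop-++ (i * d) Z (map fixed V)) (cong (λ j → drop (i * d) Z ++ drop j (map fixed V)) (ℕₚ.m≤n⇒m∸n≡0 (subst (i * d ≤_) (sym lZ) id≤sd)))) ⟩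
        fixeds (take k (Z′ ++ map fixed V))                     ≡⟨ trans (cong fixeds (take-++ k Z′ (map fixed V))) (fixeds-++ (take k Z′) _) ⟩
        fixeds (take k Z′) ++ fixeds (take (k ∸ length Z′) (map fixed V))
          ≡⟨ cong₂ _++_ (take-fixeds k Z′ (drop-fixeds (i * d) Z Z-fixeds)) (trans (cong fixeds (trans (cong (λ j → take j (map fixed V)) (cong (k ∸_) lZ′)) (take-map f V))) (fixeds-fixed (take f V))) ⟩
        take f V                                                ∎)
      (trans (Listₚ.length-take f V) (ℕₚ.m≤n⇒m⊓n≡m (subst (f ≤_) (sym lV) f≤ℓ))) (good i i≤)
    where
    open ≡-Reasoning
    Z Z′ L c : List (Cell n)
    Z = Bs ℓ ++ front
    Z′ = drop (i * d) Z
    L = Z ++ map fixed V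
    c = take k (drop (i * d) L)
    f : ℕ
    f = k ∸ (s * d ∸ i * d)
    lZ : length Z ≡ s * d
    lZ = trans (Listₚ.length-++ (Bs ℓ)) (trans (cong (_+ length front) (length-Bs ℓ)) length-front)
    lZ′ : length Z′ ≡ s * d ∸ i * d
    lZ′ = trans (Listₚ.length-drop (i * d) Z) (cong (_∸ i * d) lZ)
    i≤ : i ≤ s′
    i≤ = last-window i (ℕₚ.≤-trans le (ℕₚ.≤-reflexive (trans (Listₚ.length-++ Z) (cong₂ _+_ lZ (trans (Listₚ.length-map fixed V) lV)))))
    id≤sd : i * d ≤ s * d
    id≤sd = ℕₚ.*-monoˡ-≤ d (ℕₚ.≤-trans i≤ (ℕₚ.n≤1+n s′))
    f≤ℓ : f ≤ ℓ
    f≤ℓ = ℕₚ.≤-trans (ℕₚ.∸-monoʳ-≤ k (ℕₚ.≤-trans (ℕₚ.≤-reflexive (sym (ℕₚ.m+n∸n≡m d (i * d)))) (ℕₚ.∸-monoˡ-≤ (i * d) (ℕₚ.*-monoˡ-≤ d (s≤s i≤)))))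
      (ℕₚ.≤-reflexive (trans (cong (_∸ d) k-eq) (ℕₚ.m+n∸n≡m ℓ d)))
    front-fixeds : fixeds front ≡ []
    front-fixeds = trans (fixeds-++ (Bs (d ∸ 1)) _) (cong₂ _++_ (Bs-fixeds (d ∸ 1)) (Bs-fixeds (s′ * d ∸ ℓ)))
    Z-fixeds : fixeds Z ≡ []
    Z-fixeds = trans (fixeds-++ (Bs ℓ) front) (cong₂ _++_ (Bs-fixeds ℓ) front-fixeds)
    L-eq : L ≡ (Bs ℓ ++ Bs (d ∸ 1)) ++ blank true ∷ (Bs (s′ * d ∸ ℓ) ++ map fixed V)
    L-eq = trans (cong (_++ map fixed V) (sym (Listₚ.++-assoc (Bs ℓ) (Bs (d ∸ 1)) _))) (Listₚ.++-assoc (Bs ℓ ++ Bs (d ∸ 1)) (blank true ∷ Bs (s′ * d ∸ ℓ)) (map fixed V))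
    lP : length (Bs ℓ ++ Bs (d ∸ 1)) ≡ κ
    lP = trans (Listₚ.length-++ (Bs ℓ)) (trans (cong₂ _+_ (length-Bs ℓ) (length-Bs (d ∸ 1))) κ-eq)

  -- Every block ends with ℓ blanks of B′ and has correct windows when preceded by such blanks, so
  -- any sequence of blocks is correct. `c` is the number of edges that the block accounts for.
  record Block : Set where
    field
      body   : List (Cell n)
      init   : List (Cell n)
      ending : body ≡ init ++ Bs ℓ
      c      : ℕ
      size   : length body ≡ c * d
      wins   : AllWin (Bs ℓ ++ body)

  open Block

  bodies : List Block → List (Cell n)
  bodies bs = concatMap body bs

  bodies-windows : ∀ bs → AllWin (Bs ℓ ++ bodies bs)
  bodies-windows [] i le = ⊥-elim (ℕₚ.<⇒≱ (ℕₚ.<-≤-trans ℓ<k (ℕₚ.m≤n+m k (i * d))) (ℕₚ.≤-trans le (ℕₚ.≤-reflexive (trans (Listₚ.length-++ (Bs ℓ)) (trans (ℕₚ.+-identityʳ _) (length-Bs ℓ))))))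
    where
    ℓ<k : ℓ < k
    ℓ<k = ℕₚ.<-≤-trans ℓ<s′d (ℕₚ.≤-trans s′d≤κ (ℕₚ.n≤1+n κ))
  bodies-windows (b ∷ bs) = subst AllWin eq (glue (Bs ℓ ++ init b) (Bs ℓ) (bodies bs) (c b) size′ (length-Bs ℓ)
      (subst AllWin (trans (cong (Bs ℓ ++_) (ending b)) (sym (Listₚ.++-assoc (Bs ℓ) (init b) (Bs ℓ)))) (wins b)) (bodies-windows bs))
    where
    eq : (Bs ℓ ++ init b) ++ Bs ℓ ++ bodies bs ≡ Bs ℓ ++ body b ++ bodies bs
    eq = trans (Listₚ.++-assoc (Bs ℓ) (init b) _) (cong (Bs ℓ ++_) (trans (sym (Listₚ.++-assoc (init b) (Bs ℓ) (bodies bs))) (cong (_++ bodies bs) (sym (ending b)))))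
    size′ : length (Bs ℓ ++ init b) ≡ c b * d
    size′ = trans (Listₚ.length-++ (Bs ℓ)) (trans (cong (_+ length (init b)) (length-Bs ℓ)) (trans (ℕₚ.+-comm ℓ _)
      (trans (sym (trans (cong length (ending b)) (trans (Listₚ.length-++ (init b)) (cong (length (init b) +_) (length-Bs ℓ))))) (size b))))

  Bs-split : ∀ a b → b ≤ a → Bs a ≡ Bs (a ∸ b) ++ Bs b
  Bs-split a b le = trans (cong Bs (sym (ℕₚ.m∸n+n≡m le))) (Bs-+ (a ∸ b))
    where
    Bs-+ : ∀ m → Bs (m + b) ≡ Bs m ++ Bs b
    Bs-+ zero = refl
    Bs-+ (suc m) = cong (blank false ∷_) (Bs-+ m)

  empty-windows : ∀ P S u → blanks true P ≡ 0 → blanks true S ≡ 0 → fixeds (P ++ blank true ∷ S) ≡ [] → length (P ++ blank true ∷ S) ≡ u * d + ℓ →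
                  (∀ i → i < u → i * d ≤ length P × length P < i * d + k) → AllWin (P ++ blank true ∷ S)
  empty-windows P S u p₀ s₀ nofix len range i le = good-window _ [] 0 (window-length i L le)
      (one-true P S (i * d) p₀ s₀ (proj₁ (range i i<u)) (proj₂ (range i i<u)))
      (take-fixeds k (drop (i * d) L) (drop-fixeds (i * d) L nofix)) refl ∅-good
    where
    L : List (Cell n)
    L = P ++ blank true ∷ S
    i<u : i < u
    i<u = ℕₚ.*-cancelʳ-< d i u (ℕₚ.+-cancelʳ-< ℓ _ _ (ℕₚ.<-≤-trans (ℕₚ.+-monoʳ-< (i * d) (ℕₚ.<-≤-trans ℓ<s′d (ℕₚ.≤-trans s′d≤κ (ℕₚ.n≤1+n κ)))) (ℕₚ.≤-trans le (ℕₚ.≤-reflexive len))))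

  σ-block : Block
  σ-block = record
    { body = σ ; init = Bs (d ∸ 1) ++ blank true ∷ Bs (s′ * d ∸ ℓ)
    ; ending = trans (cong (λ xs → Bs (d ∸ 1) ++ blank true ∷ xs) (Bs-split (s′ * d) ℓ (ℕₚ.<⇒≤ ℓ<s′d))) (sym (Listₚ.++-assoc (Bs (d ∸ 1)) (blank true ∷ Bs (s′ * d ∸ ℓ)) (Bs ℓ)))
    ; c = s ; size = length-σ
    ; wins = subst AllWin (Listₚ.++-assoc (Bs ℓ) (Bs (d ∸ 1)) _) (empty-windows (Bs ℓ ++ Bs (d ∸ 1)) (Bs (s′ * d)) s
        (trans (blanks-++ true (Bs ℓ) _) (cong₂ _+_ (Bs-true ℓ) (Bs-true (d ∸ 1)))) (Bs-true (s′ * d))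
        (trans (fixeds-++ (Bs ℓ ++ Bs (d ∸ 1)) _) (cong₂ _++_ (trans (fixeds-++ (Bs ℓ) _) (cong₂ _++_ (Bs-fixeds ℓ) (Bs-fixeds (d ∸ 1)))) (Bs-fixeds (s′ * d))))
        (trans (cong length (Listₚ.++-assoc (Bs ℓ) (Bs (d ∸ 1)) _)) (trans (Listₚ.length-++ (Bs ℓ)) (trans (cong₂ _+_ (length-Bs ℓ) length-σ) (ℕₚ.+-comm ℓ _))))
        (λ i i<s → subst (i * d ≤_) (sym lP) (i*d≤κ i (ℕₚ.≤-pred i<s)) , subst (_< i * d + k) (sym lP) (ℕₚ.m≤n+m k (i * d)))) }
    where
    lP : length (Bs ℓ ++ Bs (d ∸ 1)) ≡ κ
    lP = trans (Listₚ.length-++ (Bs ℓ)) (trans (cong₂ _+_ (length-Bs ℓ) (length-Bs (d ∸ 1))) κ-eq)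

  -- Here ℓ < s′ d is decisive: behind the A′-position there are s′ d - 1 ≥ ℓ blanks, enough for the
  -- common ending. The s′ windows all reach index ℓ because (i + 1) d ≤ s′ d < ℓ + d + 1 for i <
  -- s′.
  τ-block : Block
  τ-block = record
    { body = τ ; init = blank true ∷ Bs (s′ * d ∸ 1 ∸ ℓ)
    ; ending = cong (blank true ∷_) (Bs-split (s′ * d ∸ 1) ℓ ℓ≤)
    ; c = s′ ; size = length-τ
    ; wins = empty-windows (Bs ℓ) (Bs (s′ * d ∸ 1)) s′ (Bs-true ℓ) (Bs-true (s′ * d ∸ 1))
        (trans (fixeds-++ (Bs ℓ) _) (cong₂ _++_ (Bs-fixeds ℓ) (Bs-fixeds (s′ * d ∸ 1))))
        (trans (Listₚ.length-++ (Bs ℓ)) (trans (cong₂ _+_ (length-Bs ℓ) length-τ) (ℕₚ.+-comm ℓ _)))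
        (λ i i<s′ → subst (i * d ≤_) (sym (length-Bs ℓ)) (i*d≤ℓ i i<s′)
                  , subst (_< i * d + k) (sym (length-Bs ℓ)) (ℕₚ.<-≤-trans (ℕₚ.<-≤-trans ℓ<s′d (ℕₚ.≤-trans s′d≤κ (ℕₚ.n≤1+n κ))) (ℕₚ.m≤n+m k (i * d)))) }
    where
    ℓ≤ : ℓ ≤ s′ * d ∸ 1
    ℓ≤ = ℕₚ.∸-monoˡ-≤ 1 ℓ<s′d
    i*d≤ℓ : ∀ i → i < s′ → i * d ≤ ℓ
    i*d≤ℓ i i<s′ = ℕₚ.+-cancelˡ-≤ d _ _ (ℕₚ.≤-trans (ℕₚ.*-monoˡ-≤ d i<s′) (ℕₚ.≤-trans s′d≤κ (ℕₚ.≤-trans (ℕₚ.n≤1+n κ) (ℕₚ.≤-reflexive (trans k-eq (ℕₚ.+-comm ℓ d))))))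

  record Piece : Set where
    field
      vs        : List (Fin n)
      p         : ℕ
      #vs       : length vs ≡ ℓ + p * d
      edges     : ∀ i → i < p → E (toSubset (take k (drop (i * d) vs))) ≡ true
      head-good : HeadGood (take ℓ vs)
      tail-good : TailGood (drop (p * d) vs)

  piece-windows : ∀ (P : Piece) → let open Piece P in AllWin (map fixed vs)
  piece-windows P i le = edge-Φ , has (take k (drop (i * d) vs)) (window-length i vs le′) (trans (cong (take k) (drop-map (i * d) vs)) (take-map k (drop (i * d) vs)))
    where
    open Piece P
    le′ : i * d + k ≤ length vs
    le′ = ℕₚ.≤-trans le (ℕₚ.≤-reflexive (Listₚ.length-map fixed vs))
    i<p : i < p
    i<p = ℕₚ.*-cancelʳ-< d i p (ℕₚ.+-cancelʳ-< ℓ _ _ (ℕₚ.<-≤-trans (ℕₚ.+-monoʳ-< (i * d) (ℕₚ.<-≤-trans ℓ<s′d (ℕₚ.≤-trans s′d≤κ (ℕₚ.n≤1+n κ)))) (ℕₚ.≤-trans le′ (ℕₚ.≤-reflexive (trans #vs (ℕₚ.+-comm ℓ _))))))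
    c-eq : take k (drop (i * d) (map fixed vs)) ≡ map fixed (take k (drop (i * d) vs))
    c-eq = trans (cong (take k) (drop-map (i * d) vs)) (take-map k (drop (i * d) vs))
    edge-Φ : Good (take k (drop (i * d) (map fixed vs))) ≡ true
    edge-Φ = trans (cong Good c-eq) (trans (cong₂ (λ a b → G a b (image (map fixed (take k (drop (i * d) vs))))) (blanks-fixed true (take k (drop (i * d) vs))) (blanks-fixed false (take k (drop (i * d) vs))))
      (trans (cong E (trans (image-fixeds (map fixed (take k (drop (i * d) vs)))) (cong toSubset (fixeds-fixed (take k (drop (i * d) vs)))))) (edges i i<p)))
    has : ∀ us {cs} → length us ≡ k → cs ≡ map fixed us → blanks true cs ≡ 1 ⊎ ∃[ v ] (fixed v ∈ˡ cs)
    has (u ∷ us) _ refl = inj₂ (u , here refl)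

  piece-body : Piece → List (Cell n)
  piece-body P = front ++ map fixed (Piece.vs P) ++ σ

  piece-block : Piece → Block
  piece-block P = record
    { body = piece-body P ; init = front ++ map fixed vs ++ init σ-block
    ; ending = trans (cong (λ xs → front ++ map fixed vs ++ xs) (ending σ-block)) (trans (cong (front ++_) (sym (Listₚ.++-assoc (map fixed vs) (init σ-block) (Bs ℓ)))) (sym (Listₚ.++-assoc front _ (Bs ℓ))))
    ; c = s + (p + s) ; size = size′
    ; wins = subst AllWin eq₁ (glue (Bs ℓ ++ front) (map fixed V₁) (map fixed V₂ ++ σ) s lU (trans (Listₚ.length-map fixed V₁) lV₁)
        (head-windows V₁ lV₁ head-good)
        (subst AllWin eq₂ (glue (map fixed V₃) (map fixed V₄) σ p lV₃ (trans (Listₚ.length-map fixed V₄) lV₄)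
          (subst AllWin eq₃ (piece-windows P)) (tail-windows V₄ lV₄ tail-good)))) }
    where
    open Piece P
    -- The first and the last ℓ vertices of a piece may overlap. The piece is therefore split in two
    -- ways, and `glue` is applied once at each end.
    V₁ V₂ V₃ V₄ : List (Fin n)
    V₁ = take ℓ vs
    V₂ = drop ℓ vs
    V₃ = take (p * d) vs
    V₄ = drop (p * d) vs
    lU : length (Bs ℓ ++ front) ≡ s * d
    lU = trans (Listₚ.length-++ (Bs ℓ)) (trans (cong (_+ length front) (length-Bs ℓ)) length-front)
    lV₁ : length V₁ ≡ ℓ
    lV₁ = trans (Listₚ.length-take ℓ vs) (ℕₚ.m≤n⇒m⊓n≡m (ℕₚ.≤-trans (ℕₚ.m≤m+n ℓ (p * d)) (ℕₚ.≤-reflexive (sym #vs))))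
    lV₃ : length (map {B = Cell n} fixed V₃) ≡ p * d
    lV₃ = trans (Listₚ.length-map fixed V₃) (trans (Listₚ.length-take (p * d) vs) (ℕₚ.m≤n⇒m⊓n≡m (ℕₚ.≤-trans (ℕₚ.m≤n+m (p * d) ℓ) (ℕₚ.≤-reflexive (sym #vs)))))
    lV₄ : length V₄ ≡ ℓ
    lV₄ = trans (Listₚ.length-drop (p * d) vs) (trans (cong (_∸ p * d) #vs) (ℕₚ.m+n∸n≡m ℓ (p * d)))
    join : ∀ m → map fixed (take m vs) ++ map fixed (drop m vs) ≡ map {B = Cell n} fixed vs
    join m = trans (sym (Listₚ.map-++ fixed (take m vs) (drop m vs))) (cong (map fixed) (Listₚ.take++drop≡id m vs))
    eq₁ : (Bs ℓ ++ front) ++ map fixed V₁ ++ map fixed V₂ ++ σ ≡ Bs ℓ ++ piece-body P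
    eq₁ = trans (Listₚ.++-assoc (Bs ℓ) front _) (cong (λ xs → Bs ℓ ++ front ++ xs) (trans (sym (Listₚ.++-assoc (map fixed V₁) (map fixed V₂) σ)) (cong (_++ σ) (join ℓ))))
    eq₂ : map fixed V₃ ++ map fixed V₄ ++ σ ≡ map fixed V₁ ++ map fixed V₂ ++ σ
    eq₂ = trans (sym (Listₚ.++-assoc (map fixed V₃) (map fixed V₄) σ)) (trans (cong (_++ σ) (trans (join (p * d)) (sym (join ℓ)))) (Listₚ.++-assoc (map fixed V₁) (map fixed V₂) σ))
    eq₃ : map fixed vs ≡ map fixed V₃ ++ map fixed V₄
    eq₃ = sym (join (p * d))
    size′ : length (piece-body P) ≡ (s + (p + s)) * d
    size′ = ℕₚ.+-cancelˡ-≡ ℓ _ _ (begin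
      ℓ + length (piece-body P)                                      ≡⟨ cong (ℓ +_) (trans (Listₚ.length-++ front) (cong (length front +_) (trans (Listₚ.length-++ (map fixed vs)) (cong₂ _+_ (trans (Listₚ.length-map fixed vs) #vs) length-σ)))) ⟩
      ℓ + (length front + ((ℓ + p * d) + s * d))                     ≡⟨ sym (ℕₚ.+-assoc ℓ _ _) ⟩
      (ℓ + length front) + ((ℓ + p * d) + s * d)                     ≡⟨ cong (_+ ((ℓ + p * d) + s * d)) length-front ⟩
      s * d + ((ℓ + p * d) + s * d)                                  ≡⟨ size′-identity s d ℓ p ⟩
      ℓ + (s + (p + s)) * d                                          ∎)
      where
      open ≡-Reasoning

-- Completing a cyclic pattern to a Hamilton cycle

allFin-window : ∀ {m n} (f : Fin m → Fin n) o → (∀ x → toℕ (f x) ≡ o + toℕ x) → ∀ a i {p} → p ∈ˡ take a (drop i (tabulate f)) →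
                o + i ≤ toℕ p × toℕ p < o + i + a
allFin-window {zero} f o h zero zero ()
allFin-window {zero} f o h (suc a) zero ()
allFin-window {zero} f o h zero (suc i) ()
allFin-window {zero} f o h (suc a) (suc i) ()
allFin-window {suc m} f o h (suc a) zero (here refl) = ℕₚ.≤-reflexive (sym (h zero)) ,
  ℕₚ.≤-<-trans (ℕₚ.≤-reflexive (h zero)) (ℕₚ.m<m+n (o + 0) (s≤s z≤n))
allFin-window {suc m} f o h (suc a) zero (there m∈) with allFin-window (f ∘ suc) (suc o) (λ x → trans (h (suc x)) (ℕₚ.+-suc o (toℕ x))) a zero m∈
... | lo , hi = ℕₚ.≤-trans (ℕₚ.n≤1+n _) lo , ℕₚ.<-≤-trans hi (ℕₚ.≤-reflexive (sym (ℕₚ.+-suc (o + 0) a)))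
allFin-window {suc m} f o h a (suc i) {p} m∈ with allFin-window (f ∘ suc) (suc o) (λ x → trans (h (suc x)) (ℕₚ.+-suc o (toℕ x))) a i m∈
... | lo , hi = subst (_≤ toℕ p) (sym (ℕₚ.+-suc o i)) lo , subst (toℕ p <_) (cong (_+ a) (sym (ℕₚ.+-suc o i))) hi

<∸⇒+< : ∀ {a} c {b} → a < c ∸ b → a + b < c
<∸⇒+< {a} c {b} h = ℕₚ.<-≤-trans (ℕₚ.+-monoˡ-< b h) (ℕₚ.≤-reflexive (ℕₚ.m∸n+n≡m (ℕₚ.<⇒≤ (ℕₚ.m∸n≢0⇒n<m {c} {b} (λ z → ℕₚ.n≮0 (subst (a <_) z h))))))

module CyclicWindows (n m d k : ℕ) (n-eq : n ≡ m * d) (0<d : 0 < d) (k≤n : k ≤ n) where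

  instance
    d-nonZero : Data.Nat.NonZero d
    d-nonZero = >-nonZero 0<d

  W : Fin m → List (Fin n)
  W w = take k (drop (toℕ w * d) (allFin n ++ allFin n))

  start<n : ∀ (w : Fin m) → toℕ w * d < n
  start<n w = subst (toℕ w * d <_) (sym n-eq) (ℕₚ.*-monoˡ-< d (Finₚ.toℕ<n w))

  length-allFin : length (allFin n) ≡ n
  length-allFin = Listₚ.length-tabulate (λ x → x)

  W-split : ∀ (w : Fin m) → W w ≡ take k (drop (toℕ w * d) (allFin n)) ++ take (k ∸ (n ∸ toℕ w * d)) (allFin n)
  W-split w = begin
    take k (drop i (allFin n ++ allFin n))                                     ≡⟨ cong (take k) (drop-++ i (allFin n) (allFin n)) ⟩
    take k (drop i (allFin n) ++ drop (i ∸ length (allFin n)) (allFin n))      ≡⟨ cong (λ x → take k (drop i (allFin n) ++ drop x (allFin n))) (ℕₚ.m≤n⇒m∸n≡0 (subst (i ≤_) (sym length-allFin) (ℕₚ.<⇒≤ (start<n w)))) ⟩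
    take k (drop i (allFin n) ++ allFin n)                                     ≡⟨ take-++ k (drop i (allFin n)) (allFin n) ⟩
    take k (drop i (allFin n)) ++ take (k ∸ length (drop i (allFin n))) (allFin n) ≡⟨ cong (λ x → take k (drop i (allFin n)) ++ take (k ∸ x) (allFin n)) (trans (Listₚ.length-drop i (allFin n)) (cong (_∸ i) length-allFin)) ⟩
    take k (drop i (allFin n)) ++ take (k ∸ (n ∸ i)) (allFin n)                ∎
    where
    open ≡-Reasoning
    i : ℕ
    i = toℕ w * d

  first-part : ∀ (w : Fin m) {p} → p ∈ˡ take k (drop (toℕ w * d) (allFin n)) → toℕ w * d ≤ toℕ p × toℕ p < toℕ w * d + k
  first-part w m∈ = allFin-window (λ x → x) 0 (λ x → refl) k (toℕ w * d) m∈

  second-part : ∀ (w : Fin m) {p} → p ∈ˡ take (k ∸ (n ∸ toℕ w * d)) (allFin n) → toℕ p < k ∸ (n ∸ toℕ w * d)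
  second-part w m∈ = proj₂ (allFin-window (λ x → x) 0 (λ x → refl) (k ∸ (n ∸ toℕ w * d)) 0 m∈)

  W-unique : ∀ w → Unique (W w)
  W-unique w = subst Unique (sym (W-split w)) (Uniqueₚ.++⁺ (Uniqueₚ.take⁺ k (Uniqueₚ.drop⁺ (toℕ w * d) (Uniqueₚ.allFin⁺ n))) (Uniqueₚ.take⁺ (k ∸ (n ∸ toℕ w * d)) (Uniqueₚ.allFin⁺ n))
    (λ { (a , b) → ℕₚ.<⇒≱ (ℕₚ.<-≤-trans (second-part w b) short) (proj₁ (first-part w a)) }))
    where
    short : k ∸ (n ∸ toℕ w * d) ≤ toℕ w * d
    short = ℕₚ.≤-trans (ℕₚ.∸-monoˡ-≤ (n ∸ toℕ w * d) k≤n) (ℕₚ.≤-reflexive (ℕₚ.m∸[m∸n]≡n (ℕₚ.<⇒≤ (start<n w))))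

  W-length : ∀ w → length (W w) ≤ k
  W-length w = ℕₚ.≤-trans (ℕₚ.≤-reflexive (Listₚ.length-take k _)) (ℕₚ.m⊓n≤m k _)

  window-at : ℕ → List (Fin m)
  window-at x with ℕₚ._<?_ x m
  ... | yes lt = fromℕ< lt ∷ []
  ... | no _ = []

  window-at-toℕ : ∀ (w : Fin m) → w ∈ˡ window-at (toℕ w)
  window-at-toℕ w with ℕₚ._<?_ (toℕ w) m
  ... | yes lt = here (sym (Finₚ.fromℕ<-toℕ w lt))
  ... | no ≮ = ⊥-elim (≮ (Finₚ.toℕ<n w))

  window-at-length : ∀ x → length (window-at x) ≤ 1
  window-at-length x with ℕₚ._<?_ x m
  ... | yes _ = s≤s z≤n
  ... | no _ = z≤n

  -- A window through `t` starts at t - j for some j < k. Rounding and truncation may add further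
  -- windows; what matters is that none is omitted and that there are at most k.
  covering : ℕ → List (Fin m)
  covering t = concatMap (λ j → window-at ((t ∸ j) / d)) (upTo k)

  covering-length : ∀ t → length (covering t) ≤ k
  covering-length t = ℕₚ.≤-trans (length-concatMap (λ j → window-at ((t ∸ j) / d)) (upTo k) 1 (λ j → window-at-length _))
    (ℕₚ.≤-reflexive (trans (ℕₚ.*-identityʳ _) (Listₚ.length-upTo k)))

  covering-complete : ∀ (w : Fin m) t j → j < k → toℕ w * d + j ≡ t → w ∈ˡ covering t
  covering-complete w t j j<k e = ∈-concatMap⁺ (λ j → window-at ((t ∸ j) / d)) (∈-upTo⁺ j<k)
    (subst (λ x → w ∈ˡ window-at x) (sym (trans (cong (_/ d) (trans (cong (_∸ j) (sym e)) (ℕₚ.m+n∸n≡m _ j))) (m*n/n≡m (toℕ w) d))) (window-at-toℕ w))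

  -- The second list catches the windows that wrap around, in which `p` appears as p + n.
  ws : Fin n → List (Fin m)
  ws p = covering (toℕ p) ++ covering (toℕ p + n)

  ws-length : ∀ p → length (ws p) ≤ k + k
  ws-length p = ℕₚ.≤-trans (ℕₚ.≤-reflexive (Listₚ.length-++ (covering (toℕ p)))) (ℕₚ.+-mono-≤ (covering-length _) (covering-length _))

  ws-complete : ∀ {p w} → p ∈ˡ W w → w ∈ˡ ws p
  ws-complete {p} {w} m∈ with ∈-++⁻ (take k (drop (toℕ w * d) (allFin n))) (subst (p ∈ˡ_) (W-split w) m∈)
  ... | inj₁ a = let (lo , hi) = first-part w a in ∈-++⁺ˡ (covering-complete w (toℕ p) (toℕ p ∸ toℕ w * d)
          (ℕₚ.+-cancelˡ-< (toℕ w * d) _ _ (ℕₚ.≤-<-trans (ℕₚ.≤-reflexive (ℕₚ.m+[n∸m]≡n lo)) hi)) (ℕₚ.m+[n∸m]≡n lo))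
  ... | inj₂ b = ∈-++⁺ʳ (covering (toℕ p)) (covering-complete w (toℕ p + n) (n ∸ toℕ w * d + toℕ p)
          (ℕₚ.≤-<-trans (ℕₚ.≤-reflexive (ℕₚ.+-comm (n ∸ toℕ w * d) (toℕ p))) (<∸⇒+< k {n ∸ toℕ w * d} (second-part w b)))
          (trans (sym (ℕₚ.+-assoc (toℕ w * d) _ (toℕ p))) (trans (cong (_+ toℕ p) (ℕₚ.m+[n∸m]≡n (ℕₚ.<⇒≤ (start<n w)))) (ℕₚ.+-comm n (toℕ p)))))

tabulate-lookup : ∀ {A : Set} {m} (cs : List A) (eq : m ≡ length cs) → tabulate {n = m} (λ p → Data.List.lookup cs (cast eq p)) ≡ cs
tabulate-lookup {m = zero} [] eq = refl
tabulate-lookup {m = suc m} (c ∷ cs) eq = cong (c ∷_) (tabulate-lookup cs (ℕₚ.suc-injective eq))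

map-allFin : ∀ {A : Set} {n} (c : Fin n → A) → map c (allFin n) ≡ tabulate c
map-allFin c = Listₚ.map-tabulate (λ x → x) c

-- The number of free positions of each type that the filling argument needs when x positions are prescribed.
opaque

  demand : ℕ → ℕ → ℕ → ℕ
  demand k θ x = (x + (T + T) * ((k + k) * k) + (U + U) + (U + U)) * suc (suc ((k + k) * k)) + (T + T)
    where
    U T : ℕ
    U = (k + k) * θ
    T = suc (U + U)

  demand-def : ∀ k θ x {K U T L} → K ≡ k + k → U ≡ K * θ → T ≡ suc (U + U) → L ≡ suc (K * k) →
               demand k θ x ≡ (x + (T + T) * (K * k) + (U + U) + (U + U)) * suc L + (T + T)
  demand-def k θ x refl refl refl refl = refl

  demand-mono : ∀ k θ {x y} → x ≤ y → demand k θ x ≤ demand k θ y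
  demand-mono k θ le = ℕₚ.+-monoˡ-≤ _ (ℕₚ.*-monoˡ-≤ _ (ℕₚ.+-monoˡ-≤ _ (ℕₚ.+-monoˡ-≤ _ (ℕₚ.+-monoˡ-≤ _ le))))

count-unique : ∀ {n} {xs : List (Fin n)} → Unique xs → count (memberˡ xs) ≡ length xs
count-unique {xs = xs} u = trans (count-cong (λ v → sym (lookup-toSubset xs v))) (trans (sym (card-count (toSubset xs))) (card-toSubset u))

record GoodScheme (n : ℕ) : Set where
  no-eta-equality
  field
    X          : Bool → Fin n → Bool
    X-disjoint : ∀ v τ → X τ v ≡ true → X (not τ) v ≡ false
    E          : Subset n → Bool
    θ d s′ ℓ κ′ : ℕ
    k-eq       : suc (suc κ′) ≡ ℓ + d
    s′d≤κ      : s′ * d ≤ suc κ′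
    ℓ<s′d      : ℓ < s′ * d
    ∅-good     : Goodness.G X E θ 1 (suc κ′) ∅ ≡ true
    true-good  : ∀ z → X true z ≡ true → Goodness.G X E θ 0 (suc κ′) ⁅ z ⁆ ≡ true
    false-good : ∀ z → X false z ≡ true → Goodness.G X E θ 1 κ′ ⁅ z ⁆ ≡ true

  κ : ℕ
  κ = suc κ′

  scheme : Scheme n
  scheme = record { X = X ; E = E ; θ = θ ; d = d ; s′ = s′ ; ℓ = ℓ ; κ = κ ; k-eq = k-eq ; s′d≤κ = s′d≤κ ; ℓ<s′d = ℓ<s′d ; ∅-good = ∅-good }

pieces-length-identity : ∀ s p d z l → (s + (p + s)) * d + (z + 2 * s * l) * d ≡ ((p + z) + 2 * s * (1 + l)) * d
pieces-length-identity = solve 5 (λ s p d z l → (s :+ (p :+ s)) :* d :+ (z :+ con 2 :* s :* l) :* d := ((p :+ z) :+ con 2 :* s :* (con 1 :+ l)) :* d) refl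
  where open ℕ-Solver

fits-identity : ∀ a l d → a + (l + d) ≡ l + (d + a)
fits-identity = solve 3 (λ a l d → a :+ (l :+ d) := l :+ (d :+ a)) refl
  where open ℕ-Solver

module Completion {n : ℕ} (goodScheme : GoodScheme n) where

  open GoodScheme goodScheme
  open Goodness X E θ
  open Template scheme
  open Windows Φ d ℓ k k-eq

  K U T L : ℕ
  K = k + k
  U = K * θ
  T = suc (U + U)
  L = suc (K * k)

  record CyclicPattern : Set where
    no-eta-equality
    field
      m               : ℕ
      n-eq            : n ≡ m * d
      k≤n             : k ≤ n
      cs              : List (Cell n)
      #cs             : n ≡ length cs
      pattern-windows : ∀ (w : Fin m) → Φ (take k (drop (toℕ w * d) (cs ++ cs)))
      fixeds-unique   : Unique (fixeds cs)
      balanced        : ∀ τ → count (λ v → X τ v ∧ not (memberˡ (fixeds cs) v)) ≡ blanks τ cs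
      room            : ∀ τ → demand k θ (length (fixeds cs)) < blanks τ cs

  module Cyclic (cyclicPattern : CyclicPattern) where

    open CyclicPattern cyclicPattern
    open CyclicWindows n m d k n-eq 0<d k≤n

    cell₀ : Fin n → Cell n
    cell₀ p = Data.List.lookup cs (cast #cs p)

    cells-eq : map cell₀ (allFin n) ≡ cs
    cells-eq = trans (map-allFin cell₀) (tabulate-lookup cs #cs)

    map-W : ∀ {A : Set} (c : Fin n → A) w → map c (W w) ≡ take k (drop (toℕ w * d) (map c (allFin n) ++ map c (allFin n)))
    map-W c w = trans (sym (Listₚ.take-map k (drop (toℕ w * d) (allFin n ++ allFin n))))
      (cong (take k) (trans (sym (Listₚ.drop-map (toℕ w * d) (allFin n ++ allFin n))) (cong (drop (toℕ w * d)) (Listₚ.map-++ c (allFin n) (allFin n)))))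

    Φ₀ : ∀ w → Φ (map cell₀ (W w))
    Φ₀ w = subst Φ (sym (trans (map-W cell₀ w) (cong (λ xs → take k (drop (toℕ w * d) (xs ++ xs))) cells-eq))) (pattern-windows w)

    #W : ∀ w → length (W w) ≡ k
    #W w = trans (Listₚ.length-take k (drop i (allFin n ++ allFin n))) (ℕₚ.m≤n⇒m⊓n≡m (subst (k ≤_) (sym len) (ℕₚ.m+n≤o⇒m≤o∸n k (ℕₚ.+-mono-≤ k≤n (ℕₚ.<⇒≤ (start<n w))))))
      where
      i : ℕ
      i = toℕ w * d
      len : length (drop i (allFin n ++ allFin n)) ≡ n + n ∸ i
      len = trans (Listₚ.length-drop i (allFin n ++ allFin n)) (cong (_∸ i) (trans (Listₚ.length-++ (allFin n)) (cong₂ _+_ length-allFin length-allFin)))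

    Ok : (Fin n → Cell n) → Fin m → Bool
    Ok c w = Good (map c (W w))

    Ok-local : ∀ {c c′} w → (∀ {p} → p ∈ˡ W w → c p ≡ c′ p) → Ok c w ≡ Ok c′ w
    Ok-local w h = cong Good (map-local (W w) h)

    Ok-extend : ∀ c w p τ → p ∈ˡ W w → c p ≡ blank τ → Ok c w ≡ true → count (λ v → X τ v ∧ not (Ok (upd c p (fixed v)) w)) ≤ θ
    Ok-extend c w p τ m∈ = Good-extend c (W w) p τ (W-unique w) m∈

    all-blank : ∀ (c : Fin n → Cell n) xs → (∀ {q} → q ∈ˡ xs → IsBlank (c q)) → fixeds (map c xs) ≡ []
    all-blank c [] h = refl
    all-blank c (x ∷ xs) h with c x | h (here refl)
    ... | blank _ | _ = all-blank c xs (h ∘ there)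
    ... | fixed _ | _ , ()

    fixeds-∈ : ∀ {v} (cs : List (Cell n)) → fixed v ∈ˡ cs → v ∈ˡ fixeds cs
    fixeds-∈ (fixed _ ∷ cs) (here refl) = here refl
    fixeds-∈ (fixed _ ∷ cs) (there m∈) = there (fixeds-∈ cs m∈)
    fixeds-∈ (blank _ ∷ cs) (there m∈) = fixeds-∈ cs m∈

    -- By `Φ₀` a wholly blank window has one blank of A′ and κ of B′. After `z` is inserted, its
    -- image is ⁅ z ⁆, and `true-good` or `false-good` is the goodness of this singleton.
    Ok-lone : ∀ w p τ z → p ∈ˡ W w → (∀ {q} → q ∈ˡ W w → IsBlank (cell₀ q)) → cell₀ p ≡ blank τ → X τ z ≡ true →
              Ok (upd cell₀ p (fixed z)) w ≡ true
    Ok-lone w p τ z m∈ bl e Xz = finish τ e Xz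
      where
      none : fixeds (map cell₀ (W w)) ≡ []
      none = all-blank cell₀ (W w) bl
      no-fixed : ∀ {v} → ¬ (fixed v ∈ˡ map cell₀ (W w))
      no-fixed {v} h = case subst (v ∈ˡ_) none (fixeds-∈ (map cell₀ (W w)) h) of λ ()
      one : blanks true (map cell₀ (W w)) ≡ 1
      one with proj₂ (Φ₀ w)
      ... | inj₁ e = e
      ... | inj₂ (v , h) = ⊥-elim (no-fixed h)
      rest : blanks false (map cell₀ (W w)) ≡ κ
      rest = ℕₚ.suc-injective (trans (sym (trans (cong₂ (λ a f → a + blanks false (map cell₀ (W w)) + length f) one none) (ℕₚ.+-identityʳ _)))
        (trans (cells-total (map cell₀ (W w))) (trans (Listₚ.length-map cell₀ (W w)) (#W w))))
      image′ : image (map (upd cell₀ p (fixed z)) (W w)) ≡ ⁅ z ⁆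
      image′ = trans (Update.image-upd cell₀ p τ e z (W w) (W-unique w) m∈) (trans (cong (_∪ ⁅ z ⁆) (trans (image-fixeds (map cell₀ (W w))) (cong toSubset none))) (Subsetₚ.∪-identityˡ ⁅ z ⁆))
      finish : ∀ σ → cell₀ p ≡ blank σ → X σ z ≡ true → Ok (upd cell₀ p (fixed z)) w ≡ true
      finish true e Xz = trans (cong₂ (λ a b → G a b (image (map (upd cell₀ p (fixed z)) (W w))))
          (ℕₚ.suc-injective (trans (sym (Update.blanks-upd cell₀ p true e z (W w) (W-unique w) m∈)) one))
          (trans (sym (Update.blanks-upd-other cell₀ p true e z false refl (W w) (W-unique w) m∈)) rest))
        (trans (cong (G 0 κ) image′) (true-good z Xz))
      finish false e Xz = trans (cong₂ (λ a b → G a b (image (map (upd cell₀ p (fixed z)) (W w))))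
          (trans (sym (Update.blanks-upd-other cell₀ p false e z true refl (W w) (W-unique w) m∈)) one)
          (ℕₚ.suc-injective (trans (sym (Update.blanks-upd cell₀ p false e z (W w) (W-unique w) m∈)) rest)))
        (trans (cong (G 1 κ′) image′) (false-good z Xz))

    blanks-count : ∀ {m} τ (c : Fin m → Cell n) → blanks τ (tabulate c) ≡ count (λ p → isBlank τ (c p))
    blanks-count {zero} τ c = sym (count-zero (λ ()))
    blanks-count {suc m} τ c = trans (cong (ι (isBlank τ (c zero)) +_) (blanks-count τ (c ∘ suc))) (sym (count-suc (λ p → isBlank τ (c p))))

    cs-count : ∀ τ → count (λ p → isBlank τ (cell₀ p)) ≡ blanks τ cs
    cs-count τ = trans (sym (blanks-count τ cell₀)) (cong (blanks τ) (tabulate-lookup cs #cs))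

    fixeds-at : ∀ {m} (c : Fin m → Cell n) p {v} → c p ≡ fixed v → v ∈ˡ fixeds (tabulate c)
    fixeds-at c p {v} e = fixeds-∈ (tabulate c) (subst (_∈ˡ tabulate c) e (∈-tabulate⁺ {f = c} p))

    fixeds-inj : ∀ {m} (c : Fin m → Cell n) → Unique (fixeds (tabulate c)) → ∀ p q {v} → c p ≡ fixed v → c q ≡ fixed v → p ≡ q
    fixeds-inj c u zero zero a b = refl
    fixeds-inj c u zero (suc q) {v} a b with c zero
    fixeds-inj c (∉ ∷ _) zero (suc q) refl b | fixed v = ⊥-elim (All.lookup ∉ (fixeds-at (c ∘ suc) q b) refl)
    fixeds-inj c u (suc p) zero {v} a b with c zero
    fixeds-inj c (∉ ∷ _) (suc p) zero a refl | fixed v = ⊥-elim (All.lookup ∉ (fixeds-at (c ∘ suc) p a) refl)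
    fixeds-inj c u (suc p) (suc q) a b with c zero
    fixeds-inj c (_ ∷ u) (suc p) (suc q) a b | fixed _ = cong suc (fixeds-inj (c ∘ suc) u p q a b)
    fixeds-inj c u (suc p) (suc q) a b | blank _ = cong suc (fixeds-inj (c ∘ suc) u p q a b)

    fixed-positions : ∀ {m} (c : Fin m → Cell n) → ∃[ ps ] (length ps ≡ length (fixeds (tabulate c)) × (∀ {q v} → c q ≡ fixed v → q ∈ˡ ps))
    fixed-positions {zero} c = [] , refl , λ { {()} }
    fixed-positions {suc m} c with c zero in e₀ | fixed-positions (c ∘ suc)
    ... | fixed v | ps , len , cov = zero ∷ map suc ps , cong suc (trans (Listₚ.length-map suc ps) len) , λ { {zero} _ → here refl ; {suc q} e → there (∈-map⁺ suc (cov e)) }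
    ... | blank _ | ps , len , cov = map suc ps , trans (Listₚ.length-map suc ps) len , λ { {zero} e → ⊥-elim (fixed≢blank (trans (sym e) e₀)) ; {suc q} e → ∈-map⁺ suc (cov e) }

    tab-fixeds : fixeds (tabulate cell₀) ≡ fixeds cs
    tab-fixeds = cong fixeds (tabulate-lookup cs #cs)

    -- Inside the filling argument T is opaque; it equals suc (U + U).
    roomy : ∀ τ t → t ≡ T → (length (fixeds cs) + (t + t) * (K * k) + (U + U) + (U + U)) * suc L + (t + t) < count (λ p → isBlank τ (cell₀ p))
    roomy τ t refl = subst₂ _<_ (demand-def k θ (length (fixeds cs)) refl refl refl refl) (sym (cs-count τ)) (room τ)

    slot-room : ∀ τ t → t ≡ T → (t + t) * L ≤ count (λ p → isBlank τ (cell₀ p))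
    slot-room τ t e = ℕₚ.≤-trans (begin
      (t + t) * suc (K * k)                                                                         ≡⟨ trans (ℕₚ.*-suc (t + t) (K * k)) (ℕₚ.+-comm (t + t) _) ⟩
      (t + t) * (K * k) + (t + t)                                                                   ≤⟨ ℕₚ.+-monoˡ-≤ (t + t) grow ⟩
      (length (fixeds cs) + (t + t) * (K * k) + (U + U) + (U + U)) * suc L + (t + t)                ∎) (ℕₚ.<⇒≤ (roomy τ t e))
      where
      open ℕₚ.≤-Reasoning
      grow : (t + t) * (K * k) ≤ (length (fixeds cs) + (t + t) * (K * k) + (U + U) + (U + U)) * suc L
      grow = ℕₚ.≤-trans (ℕₚ.≤-trans (ℕₚ.m≤n+m _ (length (fixeds cs))) (ℕₚ.≤-trans (ℕₚ.m≤m+n _ (U + U)) (ℕₚ.m≤m+n _ (U + U)))) (ℕₚ.m≤m*n _ (suc L))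

    problem : FillingProblem n m
    problem = record
      { X = X ; X-disjoint = X-disjoint ; W = W ; ws = ws ; K = K ; k = k ; θ = θ ; ws-length = ws-length ; ws-complete = ws-complete ; W-length = W-length
      ; Ok = Ok ; Ok-local = Ok-local ; Ok-extend = Ok-extend ; cell₀ = cell₀ ; Ok-lone = Ok-lone ; slot-room = slot-room }

    start : Filling.State problem
    start = record
      { cell = cell₀ ; un = λ v → not (memberˡ (fixeds cs) v)
      ; inj = λ {p} {q} → fixeds-inj cell₀ (subst Unique (sym tab-fixeds) fixeds-unique) p q
      ; fresh = λ {p} {v} u e → memberˡ-∉ (fixeds cs) (not-true u) (subst (v ∈ˡ_) tab-fixeds (fixeds-at cell₀ p e))
      ; balance = λ τ → trans (balanced τ) (sym (cs-count τ))
      ; good = λ w → proj₁ (Φ₀ w)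
      ; origin = λ e → e }

    HamiltonList : Set
    HamiltonList = ∃[ vs ] (Unique vs × length vs ≡ n × (∀ (w : Fin m) → E (toSubset (take k (drop (toℕ w * d) (vs ++ vs)))) ≡ true))

    abstract
      completed : ∃[ f ] (Injectiveᶠ {n} {n} f × (∀ w → Ok (λ p → fixed (f p)) w ≡ true))
      completed = let (ps , len , cov) = fixed-positions cell₀ in
        Filling.complete problem start (λ p → refl) ps cov
          (λ τ t e → subst (λ x → (x + (t + t) * (K * k) + (U + U) + (U + U)) * suc L + (t + t) < count (λ p → isBlank τ (cell₀ p)))
            (sym (trans len (cong length tab-fixeds))) (roomy τ t e))

    hamilton-list : HamiltonList
    hamilton-list = map f (allFin n) , Uniqueₚ.map⁺ (f-inj _ _) (Uniqueₚ.allFin⁺ n) , trans (Listₚ.length-map f (allFin n)) length-allFin , λ w →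
        subst (λ xs → E (toSubset xs) ≡ true) (map-W f w) (edge w)
      where
      f : Fin n → Fin n
      f = proj₁ completed
      f-inj : Injectiveᶠ f
      f-inj = proj₁ (proj₂ completed)
      map-fixed : ∀ xs → map (λ p → fixed (f p)) xs ≡ map fixed (map f xs)
      map-fixed xs = Listₚ.map-∘ xs
      edge : ∀ w → E (toSubset (map f (W w))) ≡ true
      edge w = trans (sym (trans (cong Good (map-fixed (W w))) (trans
        (cong₂ (λ a b → G a b (image (map fixed (map f (W w))))) (blanks-fixed true (map f (W w))) (blanks-fixed false (map f (W w))))
        (cong E (trans (image-fixeds (map fixed (map f (W w)))) (cong toSubset (fixeds-fixed (map f (W w)))))))))
        (proj₂ (proj₂ completed) w)

  -- Assembling pieces and blocks into a balanced cyclic pattern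

  module Assembly where

    open Block
    open Piece

    used : List Piece → List (Fin n)
    used ps = concatMap vs ps

    sizes : List Piece → ℕ
    sizes ps = foldr _+_ 0 (map p ps)

    -- Each piece takes two vertices of A′, one before and one behind it, each covering s edges; `t`
    -- further vertices cover s′ edges and `suc a` cover s. The successor guarantees a last σ-block,
    -- at which the cycle is closed.
    record Cover : Set where
      no-eta-equality
      field
        ps      : List Piece
        a t m   : ℕ
        n-eq    : n ≡ m * d
        k≤n     : k ≤ n
        unique  : Unique (used ps)
        used-B  : ∀ {v} → v ∈ˡ used ps → X true v ≡ false
        cover   : ∀ v → v ∉ˡ used ps → X true v ≡ false → X false v ≡ true
        A-count : count (X true) ≡ 2 * length ps + (t + suc a)
        m-eq    : m ≡ (sizes ps + 2 * s * length ps) + (t * s′ + suc a * s)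
        room    : demand k θ (length (used ps)) < count (X true)
        room′   : demand k θ (length (used ps)) + count (X true) + length (used ps) < n

    module Assembled (covering : Cover) where

      open Cover covering

      blocks : List Block
      blocks = map piece-block ps ++ (replicate t τ-block ++ replicate a σ-block)

      -- The ℓ blanks at the end of `Q` are rotated to the front. Then `cs ++ cs` begins with
      -- `Bs ℓ ++ Q`, and the windows that wrap around become ordinary windows of a sequence of
      -- blocks.
      Q Q₀ cs : List (Cell n)
      Q = bodies (blocks ++ σ-block ∷ [])
      Q₀ = bodies blocks ++ init σ-block
      cs = Bs ℓ ++ Q₀

      bodies-++ : ∀ xs ys → bodies (xs ++ ys) ≡ bodies xs ++ bodies ys
      bodies-++ xs ys = Listₚ.concatMap-++ body xs ys

      Q-eq : Q ≡ Q₀ ++ Bs ℓ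
      Q-eq = trans (bodies-++ blocks (σ-block ∷ [])) (trans (cong (bodies blocks ++_) (trans (Listₚ.++-identityʳ σ) (ending σ-block))) (sym (Listₚ.++-assoc (bodies blocks) (init σ-block) (Bs ℓ))))

      Q-split : Q ≡ bodies (map piece-block ps) ++ (bodies (replicate t τ-block) ++ bodies (replicate (suc a) σ-block))
      Q-split = trans (cong bodies (trans (Listₚ.++-assoc (map piece-block ps) _ (σ-block ∷ [])) (cong (map piece-block ps ++_)
          (trans (Listₚ.++-assoc (replicate t τ-block) _ _) (cong (replicate t τ-block ++_) (snoc a))))))
        (trans (bodies-++ (map piece-block ps) _) (cong (bodies (map piece-block ps) ++_) (bodies-++ (replicate t τ-block) _)))
        where
        snoc : ∀ a → replicate a σ-block ++ σ-block ∷ [] ≡ replicate (suc a) σ-block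
        snoc zero = refl
        snoc (suc a) = cong (σ-block ∷_) (snoc a)

      replicate-length : ∀ a b → length (bodies (replicate a b)) ≡ (a * c b) * d
      replicate-length zero b = refl
      replicate-length (suc a) b = trans (Listₚ.length-++ (body b)) (trans (cong₂ _+_ (size b) (replicate-length a b)) (sym (ℕₚ.*-distribʳ-+ d (c b) (a * c b))))

      replicate-blanks : ∀ a b {x} → blanks true (body b) ≡ x → blanks true (bodies (replicate a b)) ≡ a * x
      replicate-blanks zero b e = refl
      replicate-blanks (suc a) b e = trans (blanks-++ true (body b) _) (cong₂ _+_ e (replicate-blanks a b e))

      replicate-fixeds : ∀ a b → fixeds (body b) ≡ [] → fixeds (bodies (replicate a b)) ≡ []
      replicate-fixeds zero b e = refl
      replicate-fixeds (suc a) b e = trans (fixeds-++ (body b) _) (cong₂ _++_ e (replicate-fixeds a b e))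

      σ-one : blanks true σ ≡ 1
      σ-one = trans (blanks-++ true (Bs (d ∸ 1)) _) (cong₂ (λ x y → x + suc y) (Bs-true (d ∸ 1)) (Bs-true (s′ * d)))

      τ-one : blanks true τ ≡ 1
      τ-one = cong suc (Bs-true (s′ * d ∸ 1))

      front-one : blanks true front ≡ 1
      front-one = trans (blanks-++ true (Bs (d ∸ 1)) _) (cong₂ (λ x y → x + suc y) (Bs-true (d ∸ 1)) (Bs-true (s′ * d ∸ ℓ)))

      σ-none : fixeds σ ≡ []
      σ-none = trans (fixeds-++ (Bs (d ∸ 1)) _) (cong₂ _++_ (Bs-fixeds (d ∸ 1)) (Bs-fixeds (s′ * d)))

      front-none : fixeds front ≡ []
      front-none = trans (fixeds-++ (Bs (d ∸ 1)) _) (cong₂ _++_ (Bs-fixeds (d ∸ 1)) (Bs-fixeds (s′ * d ∸ ℓ)))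

      pieces-length : ∀ ps → length (bodies (map piece-block ps)) ≡ (sizes ps + 2 * s * length ps) * d
      pieces-length [] = cong (_* d) (sym (ℕₚ.*-zeroʳ (2 * s)))
      pieces-length (P ∷ ps) = trans (Listₚ.length-++ (piece-body P)) (trans (cong₂ _+_ (size (piece-block P)) (pieces-length ps)) (pieces-length-identity s (p P) d (sizes ps) (length ps)))

      pieces-blanks : ∀ ps → blanks true (bodies (map piece-block ps)) ≡ 2 * length ps
      pieces-blanks [] = refl
      pieces-blanks (P ∷ ps) = trans (blanks-++ true (piece-body P) _) (trans (cong₂ _+_
          (trans (blanks-++ true front _) (cong₂ _+_ front-one (trans (blanks-++ true (map fixed (vs P)) σ) (cong₂ _+_ (blanks-fixed true (vs P)) σ-one))))
          (pieces-blanks ps)) (sym (ℕₚ.*-distribˡ-+ 2 1 (length ps))))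

      pieces-fixeds : ∀ ps → fixeds (bodies (map piece-block ps)) ≡ used ps
      pieces-fixeds [] = refl
      pieces-fixeds (P ∷ ps) = trans (fixeds-++ (piece-body P) _) (cong₂ _++_
        (trans (fixeds-++ front _) (trans (cong₂ _++_ front-none (trans (fixeds-++ (map fixed (vs P)) σ) (cong₂ _++_ (fixeds-fixed (vs P)) σ-none))) (Listₚ.++-identityʳ (vs P))))
        (pieces-fixeds ps))

      Q-length : length Q ≡ n
      Q-length = begin
        length Q                                                                    ≡⟨ trans (cong length Q-split) (trans (Listₚ.length-++ (bodies (map piece-block ps))) (cong (length (bodies (map piece-block ps)) +_) (Listₚ.length-++ (bodies (replicate t τ-block))))) ⟩
        length (bodies (map piece-block ps)) + (length (bodies (replicate t τ-block)) + length (bodies (replicate (suc a) σ-block)))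
          ≡⟨ cong₂ _+_ (pieces-length ps) (cong₂ _+_ (replicate-length t τ-block) (replicate-length (suc a) σ-block)) ⟩
        (sizes ps + 2 * s * length ps) * d + ((t * s′) * d + (suc a * s) * d)       ≡⟨ trans (cong ((sizes ps + 2 * s * length ps) * d +_) (sym (ℕₚ.*-distribʳ-+ d (t * s′) (suc a * s)))) (sym (ℕₚ.*-distribʳ-+ d (sizes ps + 2 * s * length ps) _)) ⟩
        ((sizes ps + 2 * s * length ps) + (t * s′ + suc a * s)) * d                 ≡⟨ trans (cong (_* d) (sym m-eq)) (sym n-eq) ⟩
        n                                                                           ∎
        where open ≡-Reasoning

      Q-true : blanks true Q ≡ count (X true)
      Q-true = trans (cong (blanks true) Q-split) (trans (blanks-++ true (bodies (map piece-block ps)) _) (trans (cong (blanks true (bodies (map piece-block ps)) +_) (blanks-++ true (bodies (replicate t τ-block)) _))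
        (trans (cong₂ _+_ (pieces-blanks ps) (cong₂ _+_ (trans (replicate-blanks t τ-block τ-one) (ℕₚ.*-identityʳ t)) (trans (replicate-blanks (suc a) σ-block σ-one) (ℕₚ.*-identityʳ (suc a))))) (sym A-count))))

      Q-fixeds : fixeds Q ≡ used ps
      Q-fixeds = trans (cong fixeds Q-split) (trans (fixeds-++ (bodies (map piece-block ps)) _) (trans (cong₂ _++_ (pieces-fixeds ps)
        (trans (fixeds-++ (bodies (replicate t τ-block)) _) (cong₂ _++_ (replicate-fixeds t τ-block (Bs-fixeds (s′ * d ∸ 1))) (replicate-fixeds (suc a) σ-block σ-none)))) (Listₚ.++-identityʳ (used ps))))

      cs-length : n ≡ length cs
      cs-length = trans (sym Q-length) (trans (cong length Q-eq) (trans (Listₚ.length-++ Q₀) (trans (ℕₚ.+-comm (length Q₀) (length (Bs ℓ))) (sym (Listₚ.length-++ (Bs ℓ))))))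

      cs-true : blanks true cs ≡ count (X true)
      cs-true = trans (blanks-++ true (Bs ℓ) Q₀) (trans (ℕₚ.+-comm (blanks true (Bs ℓ)) (blanks true Q₀)) (trans (sym (blanks-++ true Q₀ (Bs ℓ))) (trans (cong (blanks true) (sym Q-eq)) Q-true)))

      cs-fixeds : fixeds cs ≡ used ps
      cs-fixeds = trans (fixeds-++ (Bs ℓ) Q₀) (trans (cong (_++ fixeds Q₀) (Bs-fixeds ℓ)) (trans (sym (trans (cong (fixeds Q₀ ++_) (Bs-fixeds ℓ)) (Listₚ.++-identityʳ _)))
        (trans (sym (fixeds-++ Q₀ (Bs ℓ))) (trans (cong fixeds (sym Q-eq)) Q-fixeds))))

      cs-false : count (X true) + blanks false cs + length (used ps) ≡ n
      cs-false = trans (cong₂ (λ x y → x + blanks false cs + length y) (sym cs-true) (sym cs-fixeds)) (trans (cells-total cs) (sym cs-length))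

      pattern-windows : ∀ (w : Fin m) → Φ (take k (drop (toℕ w * d) (cs ++ cs)))
      pattern-windows w = subst Φ (trans (sym (take-drop-prefix (toℕ w * d) k (Bs ℓ ++ Q) Q₀ fits)) (cong (λ xs → take k (drop (toℕ w * d) xs)) (sym doubled)))
          (bodies-windows (blocks ++ σ-block ∷ []) (toℕ w) fits)
        where
        doubled : cs ++ cs ≡ (Bs ℓ ++ Q) ++ Q₀
        doubled = trans (Listₚ.++-assoc (Bs ℓ) Q₀ cs) (trans (cong (Bs ℓ ++_) (trans (sym (Listₚ.++-assoc Q₀ (Bs ℓ) Q₀)) (cong (_++ Q₀) (sym Q-eq)))) (sym (Listₚ.++-assoc (Bs ℓ) Q Q₀)))
        fits : toℕ w * d + k ≤ length (Bs ℓ ++ Q)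
        fits = begin
          toℕ w * d + k               ≡⟨ cong (toℕ w * d +_) k-eq ⟩
          toℕ w * d + (ℓ + d)         ≡⟨ fits-identity (toℕ w * d) ℓ d ⟩
          ℓ + suc (toℕ w) * d         ≤⟨ ℕₚ.+-monoʳ-≤ ℓ (ℕₚ.*-monoˡ-≤ d (Finₚ.toℕ<n w)) ⟩
          ℓ + m * d                   ≡⟨ cong₂ _+_ (sym (length-Bs ℓ)) (trans (sym n-eq) (sym Q-length)) ⟩
          length (Bs ℓ) + length Q    ≡⟨ sym (Listₚ.length-++ (Bs ℓ)) ⟩
          length (Bs ℓ ++ Q)          ∎
          where
          open ℕₚ.≤-Reasoning

      free : Fin n → Bool
      free v = not (memberˡ (used ps) v)

      free-true : count (λ v → X true v ∧ free v) ≡ count (X true)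
      free-true = count-cong step
        where
        step : ∀ v → X true v ∧ free v ≡ X true v
        step v with bool-cases (memberˡ (used ps) v)
        ... | inj₁ u = trans (cong (_∧ free v) (used-B (memberˡ-elim (used ps) u))) (sym (used-B (memberˡ-elim (used ps) u)))
        ... | inj₂ f rewrite f with X true v
        ...   | true = refl
        ...   | false = refl

      free-split : count free ≡ count (λ v → X true v ∧ free v) + count (λ v → X false v ∧ free v)
      free-split = trans (count-split free (X true)) (cong₂ _+_ (count-cong (λ v → ∧-swap (free v) (X true v))) (count-cong step))
        where
        ∧-swap : ∀ a b → a ∧ b ≡ b ∧ a
        ∧-swap true true = refl
        ∧-swap true false = refl
        ∧-swap false true = refl
        ∧-swap false false = refl
        step : ∀ v → free v ∧ not (X true v) ≡ X false v ∧ free v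
        step v with bool-cases (memberˡ (used ps) v) | bool-cases (X true v)
        ... | inj₁ u | _ rewrite u = sym (∧-swap (X false v) false)
        ... | inj₂ f | inj₁ a rewrite f | a | X-disjoint v true a = refl
        ... | inj₂ f | inj₂ a rewrite f | a | cover v (memberˡ-∉ (used ps) f) a = refl

      balanced : ∀ τ → count (λ v → X τ v ∧ free v) ≡ blanks τ cs
      balanced true = trans free-true (sym cs-true)
      balanced false = ℕₚ.+-cancelˡ-≡ (count (X true)) _ _ (ℕₚ.+-cancelʳ-≡ (length (used ps)) _ _ (begin
        count (X true) + count (λ v → X false v ∧ free v) + length (used ps)            ≡⟨ cong (λ x → x + count (λ v → X false v ∧ free v) + length (used ps)) (sym free-true) ⟩
        count (λ v → X true v ∧ free v) + count (λ v → X false v ∧ free v) + length (used ps) ≡⟨ cong₂ _+_ (sym free-split) (sym (count-unique unique)) ⟩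
        count free + count (memberˡ (used ps))                                          ≡⟨ ℕₚ.+-comm (count free) _ ⟩
        count (memberˡ (used ps)) + count free                                          ≡⟨ count-not (memberˡ (used ps)) ⟩
        n                                                                               ≡⟨ sym cs-false ⟩
        count (X true) + blanks false cs + length (used ps)                             ∎))
        where open ≡-Reasoning

      rooms : ∀ τ → demand k θ (length (used ps)) < blanks τ cs
      rooms true = subst (demand k θ (length (used ps)) <_) (sym cs-true) room
      rooms false = ℕₚ.+-cancelʳ-< (count (X true)) _ _ (ℕₚ.+-cancelʳ-< (length (used ps)) _ _ (ℕₚ.<-≤-trans room′ (ℕₚ.≤-reflexive
        (trans (sym cs-false) (cong (_+ length (used ps)) (ℕₚ.+-comm (count (X true)) (blanks false cs)))))))

      assembled : ∃[ xs ] (Unique xs × length xs ≡ n × (∀ (w : Fin m) → E (toSubset (take k (drop (toℕ w * d) (xs ++ xs)))) ≡ true))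
      assembled = Cyclic.hamilton-list (record
        { m = m ; n-eq = n-eq ; k≤n = k≤n ; cs = cs ; #cs = cs-length ; pattern-windows = pattern-windows
        ; fixeds-unique = subst Unique (sym cs-fixeds) unique
        ; balanced = λ τ → trans (count-cong (λ v → cong (λ xs → X τ v ∧ not (memberˡ xs v)) cs-fixeds)) (balanced τ)
        ; room = λ τ → subst (λ x → demand k θ (length x) < blanks τ cs) (sym cs-fixeds) (rooms τ) })

unique-++⁻ : ∀ {A : Set} {xs ys : List A} → Unique (xs ++ ys) → ∀ {v} → v ∈ˡ xs → v ∉ˡ ys
unique-++⁻ {xs = x ∷ xs} (∉ ∷ u) (here refl) m = All.lookup ∉ (∈-++⁺ʳ xs m) refl
unique-++⁻ {xs = x ∷ xs} (∉ ∷ u) (there m′) m = unique-++⁻ u m′ m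

toSubset-reverse : ∀ {n} (xs : List (Fin n)) → toSubset (reverse xs) ≡ toSubset xs
toSubset-reverse [] = refl
toSubset-reverse (x ∷ xs) = trans (cong toSubset (Listₚ.unfold-reverse x xs)) (trans (toSubset-++ (reverse xs) (x ∷ []))
  (trans (cong₂ _∪_ (toSubset-reverse xs) (Subsetₚ.∪-identityʳ ⁅ x ⁆)) (Subsetₚ.∪-comm (toSubset xs) ⁅ x ⁆)))

drop-reverse : ∀ {n} j (xs : List (Fin n)) → j ≤ length xs → toSubset (drop j (reverse xs)) ≡ toSubset (take (length xs ∸ j) xs)
drop-reverse j xs le = trans (cong (λ ys → toSubset (drop j (reverse ys))) (sym (Listₚ.take++drop≡id i xs)))
  (trans (cong (λ ys → toSubset (drop j ys)) (Listₚ.reverse-++ (take i xs) (drop i xs)))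
    (trans (cong (λ x → toSubset (drop x (reverse (drop i xs) ++ reverse (take i xs)))) j-eq)
      (trans (cong toSubset (drop-suffix 0 (reverse (drop i xs)) (reverse (take i xs)))) (toSubset-reverse (take i xs)))))
  where
  i : ℕ
  i = length xs ∸ j
  j-eq : j ≡ length (reverse (drop i xs)) + 0
  j-eq = sym (trans (ℕₚ.+-identityʳ _) (trans (Listₚ.length-reverse (drop i xs)) (trans (Listₚ.length-drop i xs) (ℕₚ.m∸[m∸n]≡n le))))

-- Absorbing given vertices one after the other into pairwise disjoint pieces

absorb-identity : ∀ a b c → a + b + c ≡ b + (a + c)
absorb-identity = solve 3 (λ a b c → a :+ b :+ c := b :+ (a :+ c)) refl
  where open ℕ-Solver

module Absorption {n : ℕ} {Piece : Set} (vs : Piece → List (Fin n)) (p : Piece → ℕ) (B′ : Fin n → Bool) (c s : ℕ) where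

  record Absorber (v : Fin n) (Us : List (Fin n)) : Set where
    field
      piece     : Piece
      distinct  : Unique (vs piece)
      member    : ∀ {u} → u ∈ˡ vs piece → (B′ u ≡ true × u ∉ˡ Us) ⊎ u ≡ v
      covers    : v ∈ˡ vs piece
      #vertices : length (vs piece) ≡ c
      #edges    : p piece ≡ s

  record Absorbed (vs₀ Us : List (Fin n)) : Set where
    field
      ps       : List Piece
      unique   : Unique (concatMap vs ps)
      within   : ∀ {u} → u ∈ˡ concatMap vs ps → (B′ u ≡ true × u ∉ˡ Us) ⊎ u ∈ˡ vs₀
      contains : ∀ {u} → u ∈ˡ vs₀ → u ∈ˡ concatMap vs ps
      #used    : length (concatMap vs ps) ≡ length vs₀ * c
      #ps      : length ps ≡ length vs₀
      #sizes   : foldr _+_ 0 (map p ps) ≡ length vs₀ * s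

  -- The vertices to be absorbed lie outside B′ while a piece leaves B′ only at its own vertex `v`,
  -- so it cannot contain another vertex of the list; the remaining overlaps are excluded because
  -- later pieces avoid the vertices of this one.
  absorb-step : ∀ v vs₀ Us → v ∉ˡ vs₀ → (∀ {u} → u ∈ˡ vs₀ → B′ u ≡ false) → (W : Absorber v Us) →
                Absorbed vs₀ (vs (Absorber.piece W) ++ Us) → Absorbed (v ∷ vs₀) Us
  absorb-step v vs₀ Us v∉ ∉B′ W R = record
      { ps = W.piece ∷ R.ps
      ; unique = Uniqueₚ.++⁺ W.distinct R.unique (λ { (a , b) → apart a b })
      ; within = λ m → within′ m (∈-++⁻ (vs W.piece) m)
      ; contains = λ { (here refl) → ∈-++⁺ˡ W.covers ; (there m) → ∈-++⁺ʳ (vs W.piece) (R.contains m) }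
      ; #used = trans (Listₚ.length-++ (vs W.piece)) (cong₂ _+_ W.#vertices R.#used)
      ; #ps = cong suc R.#ps
      ; #sizes = cong₂ _+_ W.#edges R.#sizes }
    where
    module W = Absorber W
    module R = Absorbed R
    apart : ∀ {w} → w ∈ˡ vs W.piece → w ∉ˡ concatMap vs R.ps
    apart {w} a b with R.within b
    ... | inj₁ (_ , ∉) = ∉ (∈-++⁺ˡ a)
    ... | inj₂ h with W.member a
    ...   | inj₁ (b′ , _) = true≢false b′ (∉B′ h)
    ...   | inj₂ refl = v∉ h
    within′ : ∀ {u} → u ∈ˡ concatMap vs (W.piece ∷ R.ps) → u ∈ˡ vs W.piece ⊎ u ∈ˡ concatMap vs R.ps → (B′ u ≡ true × u ∉ˡ Us) ⊎ u ∈ˡ (v ∷ vs₀)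
    within′ _ (inj₁ h) with W.member h
    ... | inj₁ b = inj₁ b
    ... | inj₂ refl = inj₂ (here refl)
    within′ _ (inj₂ h) with R.within h
    ... | inj₁ (b , ∉) = inj₁ (b , λ m′ → ∉ (∈-++⁺ʳ (vs W.piece) m′))
    ... | inj₂ h′ = inj₂ (there h′)

  -- `Us` grows by `c` with each piece. The size condition is imposed on the final length, and
  -- antitonicity of `Fits` hands it down to every step.
  absorb : (Fits : ℕ → Set) → (∀ {x y} → x ≤ y → Fits y → Fits x) → (∀ v → B′ v ≡ false → ∀ Us → Fits (length Us) → Absorber v Us) →
           ∀ vs₀ Us → Unique vs₀ → (∀ {v} → v ∈ˡ vs₀ → B′ v ≡ false) → Fits (length Us + length vs₀ * c) → Absorbed vs₀ Us
  absorb Fits anti absorber [] Us _ _ _ = record { ps = [] ; unique = [] ; within = λ () ; contains = λ () ; #used = refl ; #ps = refl ; #sizes = refl }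
  absorb Fits anti absorber (v ∷ vs₀) Us (v∉ ∷ u) ∉B′ small = absorb-step v vs₀ Us (λ m → All.lookup v∉ m refl) (λ m → ∉B′ (there m)) W
      (absorb Fits anti absorber vs₀ (vs (Absorber.piece W) ++ Us) u (λ m → ∉B′ (there m)) (anti (ℕₚ.≤-reflexive lengths) small))
    where
    W : Absorber v Us
    W = absorber v (∉B′ (here refl)) Us (anti (ℕₚ.m≤m+n (length Us) _) small)
    lengths : length (vs (Absorber.piece W) ++ Us) + length vs₀ * c ≡ length Us + (c + length vs₀ * c)
    lengths = trans (cong (_+ length vs₀ * c) (trans (Listₚ.length-++ (vs (Absorber.piece W))) (cong (_+ length Us) (Absorber.#vertices W))))
      (absorb-identity c (length Us) (length vs₀ * c))

used-size-identity : ∀ l p d m z → (l + p * d) + (m * l + z * d) ≡ (l + m * l) + (p + z) * d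
used-size-identity = solve 5 (λ l p d m z → (l :+ p :* d) :+ (m :* l :+ z :* d) := (l :+ m :* l) :+ (p :+ z) :* d) refl
  where open ℕ-Solver

module Tabulated {n : ℕ} {Piece : Set} (vs : Piece → List (Fin n)) (p : Piece → ℕ) (ℓ d : ℕ) (#vs : ∀ P → length (vs P) ≡ ℓ + p P * d) where

  total : List Piece → ℕ
  total ps = foldr _+_ 0 (map p ps)

  used-∈ : ∀ {np} (f : Fin np → Piece) {v} → v ∈ˡ concatMap vs (tabulate f) → ∃[ i ] v ∈ˡ vs (f i)
  used-∈ {suc np} f m with ∈-++⁻ (vs (f zero)) m
  ... | inj₁ h = zero , h
  ... | inj₂ h = let (i , h′) = used-∈ (f ∘ suc) h in suc i , h′

  used-unique : ∀ {np} (f : Fin np → Piece) → (∀ i → Unique (vs (f i))) → (∀ i j → i ≢ j → Disjoint (vs (f i)) (vs (f j))) → Unique (concatMap vs (tabulate f))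
  used-unique {zero} f u dis = []
  used-unique {suc np} f u dis = Uniqueₚ.++⁺ (u zero) (used-unique (f ∘ suc) (u ∘ suc) (λ i j ne → dis (suc i) (suc j) (λ e → ne (Finₚ.suc-injective e))))
    (λ { (a , b) → let (i , h) = used-∈ (f ∘ suc) b in dis zero (suc i) (λ ()) (a , h) })

  used-size : ∀ {np} (f : Fin np → Piece) → length (concatMap vs (tabulate f)) ≡ np * ℓ + total (tabulate f) * d
  used-size {zero} f = refl
  used-size {suc np} f = trans (Listₚ.length-++ (vs (f zero))) (trans (cong₂ _+_ (#vs (f zero)) (used-size (f ∘ suc))) (used-size-identity ℓ (p (f zero)) d np (total (tabulate (f ∘ suc)))))

  sizes-lower : ∀ {np} (f : Fin np → Piece) → (∀ i → 1 ≤ p (f i)) → np ≤ total (tabulate f)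
  sizes-lower {zero} f h = z≤n
  sizes-lower {suc np} f h = ℕₚ.+-mono-≤ (h zero) (sizes-lower (f ∘ suc) (h ∘ suc))

  sizes-upper : ∀ {np} (f : Fin np → Piece) c → (∀ i → p (f i) ≤ c) → total (tabulate f) ≤ np * c
  sizes-upper {zero} f c h = z≤n
  sizes-upper {suc np} f c h = ℕₚ.+-mono-≤ (h zero) (sizes-upper (f ∘ suc) c (h ∘ suc))

  used-++ : ∀ xs ys → concatMap vs (xs ++ ys) ≡ concatMap vs xs ++ concatMap vs ys
  used-++ xs ys = Listₚ.concatMap-++ vs xs ys

  sizes-++ : ∀ xs ys → total (xs ++ ys) ≡ total xs + total ys
  sizes-++ [] ys = refl
  sizes-++ (x ∷ xs) ys = trans (cong (p x +_) (sizes-++ xs ys)) (sym (ℕₚ.+-assoc (p x) _ _))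

-- Class sizes and the balance between vertices and edges

module Classes {n : ℕ} (A B A′ B′ : Fin n → Bool) (parts : ∀ v → A v ≡ not (B v)) (disjoint : ∀ v → B′ v ≡ true → A′ v ≡ false) where

  isV₀ : Fin n → Bool
  isV₀ v = not (A′ v) ∧ not (B′ v)

  ao bo q α : ℕ
  ao = count (λ v → A v ∧ not (A′ v))
  bo = count (λ v → B v ∧ not (B′ v))
  q = count (λ v → A v ∧ B′ v)
  α = count A′

  V₀-bound : count isV₀ ≤ ao + bo
  V₀-bound = count-∨ step
    where
    step : ∀ v → isV₀ v ≡ true → A v ∧ not (A′ v) ≡ true ⊎ B v ∧ not (B′ v) ≡ true
    step v h with ∧-true {not (A′ v)} h | bool-cases (B v)
    ... | a , b | inj₁ t = inj₂ (∧-intro t b)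
    ... | a , b | inj₂ t = inj₁ (∧-intro (trans (parts v) (cong not t)) a)

  q≤ao : q ≤ ao
  q≤ao = count-mono (λ v h → let (a , b) = ∧-true {A v} h in ∧-intro a (cong not (disjoint v b)))

  A-cover : count A ≤ q + (α + count isV₀)
  A-cover = ℕₚ.≤-trans (count-∨ {q = λ v → A v ∧ B′ v} {r = λ v → A′ v ∨ isV₀ v} step)
      (ℕₚ.+-monoʳ-≤ q (count-∨ {q = A′} {r = isV₀} (λ v → ∨-elim)))
    where
    step : ∀ v → A v ≡ true → A v ∧ B′ v ≡ true ⊎ A′ v ∨ isV₀ v ≡ true
    step v a with A′ v | B′ v
    ... | true | _ = inj₂ refl
    ... | false | true = inj₁ (∧-intro a refl)
    ... | false | false = inj₂ refl

  A≤α : count A ≤ α + ao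
  A≤α = count-∨ step
    where
    step : ∀ v → A v ≡ true → A′ v ≡ true ⊎ A v ∧ not (A′ v) ≡ true
    step v a with A′ v
    ... | true = inj₁ refl
    ... | false = inj₂ (∧-intro a refl)

  α≤A : α ≤ count A + bo
  α≤A = count-∨ step
    where
    step : ∀ v → A′ v ≡ true → A v ≡ true ⊎ B v ∧ not (B′ v) ≡ true
    step v a with bool-cases (B v) | bool-cases (B′ v)
    ... | inj₂ f | _ = inj₁ (trans (parts v) (cong not f))
    ... | inj₁ t | inj₂ f = inj₂ (∧-intro t (cong not f))
    ... | inj₁ _ | inj₁ b = ⊥-elim (true≢false a (disjoint v b))

enough-edges-identity : ∀ s q a v → s * (q + (a + v)) ≡ s * q + v * s + s * a
enough-edges-identity = solve 4 (λ s q a v → s :* (q :+ (a :+ v)) := s :* q :+ v :* s :+ s :* a) refl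
  where open ℕ-Solver

t-bound-identity : ∀ s w u m → s * w * u + w * s + (m + s + s * w) ≡ m + (w * (s * u + 2 * s) + s)
t-bound-identity = solve 4 (λ s w u m → s :* w :* u :+ w :* s :+ (m :+ s :+ s :* w) := m :+ (w :* (s :* u :+ con 2 :* s) :+ s)) refl
  where open ℕ-Solver

slack-identity : ∀ s w u → 2 * (s * w + w) + (w * (s * u + 2 * s) + s) + 1 + w + (s * w + 2 * w + (s * u + 4 * s + 4)) ≡ (s * u + 5 * s + 5) * (1 + w)
slack-identity = solve 3 (λ s w u → con 2 :* (s :* w :+ w) :+ (w :* (s :* u :+ con 2 :* s) :+ s) :+ con 1 :+ w :+ (s :* w :+ con 2 :* w :+ (s :* u :+ con 4 :* s :+ con 4)) := (s :* u :+ con 5 :* s :+ con 5) :* (con 1 :+ w)) refl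
  where open ℕ-Solver

A-count-identity : ∀ x t a → x + t + 1 + a ≡ x + (t + (1 + a))
A-count-identity = solve 3 (λ x t a → x :+ t :+ con 1 :+ a := x :+ (t :+ (con 1 :+ a))) refl
  where open ℕ-Solver

m-eq-identity : ∀ s z l t a → z + (1 + s) * (2 * l + (t + (1 + a))) ≡ ((z + 2 * (1 + s) * l) + (t * s + (1 + a) * (1 + s))) + t
m-eq-identity = solve 5 (λ s z l t a → z :+ (con 1 :+ s) :* (con 2 :* l :+ (t :+ (con 1 :+ a))) := ((z :+ con 2 :* (con 1 :+ s) :* l) :+ (t :* s :+ (con 1 :+ a) :* (con 1 :+ s))) :+ t) refl
  where open ℕ-Solver

used-bound-identity : ∀ s q l t d x → s * q * l + s * q * t * d + x ≡ s * (l + t * d) * q + x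
used-bound-identity = solve 6 (λ s q l t d x → s :* q :* l :+ s :* q :* t :* d :+ x := s :* (l :+ t :* d) :* q :+ x) refl
  where open ℕ-Solver

used-bound-identity₂ : ∀ a w b → a * w + w * b ≡ (a + b) * w
used-bound-identity₂ = solve 3 (λ a w b → a :* w :+ w :* b := (a :+ b) :* w) refl
  where open ℕ-Solver

room′-identity : ∀ d a w c → d + (a + w) + c ≡ d + (w + c) + a
room′-identity = solve 4 (λ d a w c → d :+ (a :+ w) :+ c := d :+ (w :+ c) :+ a) refl
  where open ℕ-Solver

record Bookkeeping : Set where
  no-eta-equality
  field
    s′ ℓ d m s⋆ q α nv ao bo A edges n : ℕ
    A-low      : m ≤ suc s′ * A
    A-high     : suc s′ * A ≤ m + suc s′
    A≤         : A ≤ q + (α + nv)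
    A≤α        : A ≤ α + ao
    α≤A        : α ≤ A + bo
    q≤ao       : q ≤ ao
    nv≤w       : nv ≤ ao + bo
    path-lower : suc s′ * q ≤ edges
    path-upper : edges ≤ suc s′ * q * s⋆
    enough-A   : (suc s′ * s⋆ + 5 * suc s′ + 5) * suc (ao + bo) ≤ A

module Budget (bookkeeping : Bookkeeping) where

  open Bookkeeping bookkeeping

  s w number size : ℕ
  s = suc s′
  w = ao + bo
  number = s * q + nv
  size = edges + nv * s

  cᵤ : ℕ
  cᵤ = s * (ℓ + s⋆ * d) + (ℓ + s * d)

  q≤w : q ≤ w
  q≤w = ℕₚ.≤-trans q≤ao (ℕₚ.m≤m+n ao bo)

  -- Every edge is accounted for: a vertex of A′ covers s or s - 1 of them, and t counts the latter.
  enough-edges : m ≤ size + s * α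
  enough-edges = begin
    m                                    ≤⟨ A-low ⟩
    s * A                            ≤⟨ ℕₚ.*-monoʳ-≤ s A≤ ⟩
    s * (q + (α + nv))                   ≡⟨ enough-edges-identity s q α nv ⟩
    s * q + nv * s + s * α               ≤⟨ ℕₚ.+-monoˡ-≤ (s * α) (ℕₚ.+-monoˡ-≤ (nv * s) path-lower) ⟩
    size + s * α             ∎
    where
    open ℕₚ.≤-Reasoning

  -- If every vertex of A′ covered s edges, `size + s * α` edges would be covered in all; each
  -- τ-block gives up exactly one of the surplus.
  t : ℕ
  t = size + s * α ∸ m

  t-eq : m + t ≡ size + s * α
  t-eq = ℕₚ.m+[n∸m]≡n enough-edges

  -- `A-high` allows s |A| to exceed m by at most s, and every other contribution to the surplus is
  -- a multiple of w.
  t-bound : t ≤ w * (s * s⋆ + 2 * s) + s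
  t-bound = ℕₚ.+-cancelˡ-≤ m _ _ (begin
    m + t                                                          ≡⟨ t-eq ⟩
    edges + nv * s + s * α                                   ≤⟨ ℕₚ.+-mono-≤ (ℕₚ.+-mono-≤ (ℕₚ.≤-trans path-upper (ℕₚ.*-monoˡ-≤ s⋆ (ℕₚ.*-monoʳ-≤ s q≤w))) (ℕₚ.*-monoˡ-≤ s nv≤w))
                                                                       (ℕₚ.≤-trans (ℕₚ.*-monoʳ-≤ s (ℕₚ.≤-trans α≤A (ℕₚ.+-monoʳ-≤ A (ℕₚ.m≤n+m bo ao)))) (ℕₚ.≤-reflexive (ℕₚ.*-distribˡ-+ s A w))) ⟩
    s * w * s⋆ + w * s + (s * A + s * w)                       ≤⟨ ℕₚ.+-monoʳ-≤ (s * w * s⋆ + w * s) (ℕₚ.+-monoˡ-≤ (s * w) A-high) ⟩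
    s * w * s⋆ + w * s + (m + s + s * w)                           ≡⟨ t-bound-identity s w s⋆ m ⟩
    m + (w * (s * s⋆ + 2 * s) + s)                                 ∎)
    where
    open ℕₚ.≤-Reasoning

  -- The pieces and the τ-blocks use O(w + 1) vertices of A′, which `enough-A` provides; the final 1
  -- is the σ-block that closes the cycle.
  slack : 2 * number + t + 1 ≤ α
  slack = ℕₚ.+-cancelʳ-≤ ao _ _ (begin
    2 * number + t + 1 + ao                                            ≤⟨ ℕₚ.+-mono-≤ (ℕₚ.+-monoˡ-≤ 1 (ℕₚ.+-mono-≤ (ℕₚ.*-monoʳ-≤ 2 (ℕₚ.+-mono-≤ (ℕₚ.*-monoʳ-≤ s q≤w) nv≤w)) t-bound)) (ℕₚ.m≤m+n ao bo) ⟩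
    2 * (s * w + w) + (w * (s * s⋆ + 2 * s) + s) + 1 + w                          ≤⟨ ℕₚ.m≤m+n _ (s * w + 2 * w + (s * s⋆ + 4 * s + 4)) ⟩
    2 * (s * w + w) + (w * (s * s⋆ + 2 * s) + s) + 1 + w + (s * w + 2 * w + (s * s⋆ + 4 * s + 4)) ≡⟨ slack-identity s w s⋆ ⟩
    (s * s⋆ + 5 * s + 5) * suc w                                                  ≤⟨ enough-A ⟩
    A                                                                         ≤⟨ A≤α ⟩
    α + ao                                                                        ∎)
    where
    open ℕₚ.≤-Reasoning

  a : ℕ
  a = α ∸ (2 * number + t + 1)

  A-count : α ≡ 2 * number + (t + suc a)
  A-count = trans (sym (ℕₚ.m+[n∸m]≡n slack)) (A-count-identity (2 * number) t a)

  m-eq : m ≡ (size + 2 * s * number) + (t * s′ + suc a * s)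
  m-eq = ℕₚ.+-cancelʳ-≡ t _ _ (trans t-eq (trans (cong (λ x → size + s * x) A-count) (m-eq-identity s′ (size) (number) t a)))

  used-bound : s * q * ℓ + edges * d + nv * (ℓ + s * d) ≤ cᵤ * w
  used-bound = begin
    s * q * ℓ + edges * d + nv * (ℓ + s * d)                       ≤⟨ ℕₚ.+-monoˡ-≤ _ (ℕₚ.+-monoʳ-≤ (s * q * ℓ) (ℕₚ.*-monoˡ-≤ d path-upper)) ⟩
    s * q * ℓ + s * q * s⋆ * d + nv * (ℓ + s * d)              ≡⟨ used-bound-identity s q ℓ s⋆ d (nv * (ℓ + s * d)) ⟩
    s * (ℓ + s⋆ * d) * q + nv * (ℓ + s * d)                    ≤⟨ ℕₚ.+-mono-≤ (ℕₚ.*-monoʳ-≤ (s * (ℓ + s⋆ * d)) q≤w) (ℕₚ.*-monoˡ-≤ (ℓ + s * d) nv≤w) ⟩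
    s * (ℓ + s⋆ * d) * w + w * (ℓ + s * d)                     ≡⟨ used-bound-identity₂ (s * (ℓ + s⋆ * d)) w (ℓ + s * d) ⟩
    cᵤ * w                                                     ∎
    where
    open ℕₚ.≤-Reasoning

  module Room (dem : ℕ → ℕ) (dem-mono : ∀ {x y} → x ≤ y → dem x ≤ dem y) (use : ℕ) (use≤ : use ≤ cᵤ * w)
    (enough : dem (cᵤ * w) + suc cᵤ * w < A) (A-half : A + A ≤ n) where

    demand-bound : dem use + suc cᵤ * w < A
    demand-bound = ℕₚ.≤-<-trans (ℕₚ.+-monoˡ-≤ (suc cᵤ * w) (dem-mono use≤)) enough

    room : dem use < α
    room = ℕₚ.+-cancelʳ-< ao (dem use) α (ℕₚ.≤-<-trans (ℕₚ.+-monoʳ-≤ (dem use) (ℕₚ.≤-trans (ℕₚ.m≤m+n ao bo) (ℕₚ.m≤m+n w (cᵤ * w)))) (ℕₚ.<-≤-trans demand-bound A≤α))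

    room′ : dem use + α + use < n
    room′ = begin-strict
      dem use + α + use                    ≤⟨ ℕₚ.+-mono-≤ (ℕₚ.+-monoʳ-≤ (dem use) (ℕₚ.≤-trans α≤A (ℕₚ.+-monoʳ-≤ A (ℕₚ.m≤n+m bo ao)))) use≤ ⟩
      dem use + (A + w) + cᵤ * w           ≡⟨ room′-identity (dem use) A w (cᵤ * w) ⟩
      dem use + (w + cᵤ * w) + A           <⟨ ℕₚ.+-monoˡ-< A demand-bound ⟩
      A + A                                ≤⟨ A-half ⟩
      n                                    ∎
      where
      open ℕₚ.≤-Reasoning

-- The union of the given paths and the absorbing pieces

record PathFamily (n : ℕ) (Piece : Set) : Set where
  no-eta-equality
  field
    vs         : Piece → List (Fin n)
    p          : Piece → ℕ
    ℓ d c s    : ℕ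
    #vs        : ∀ P → length (vs P) ≡ ℓ + p P * d
    A B A′ B′  : Fin n → Bool
    parts      : ∀ v → A v ≡ not (B v)
    disjoint   : ∀ v → B′ v ≡ true → A′ v ≡ false
    np         : ℕ
    f          : Fin np → Piece
    f-unique   : ∀ i → Unique (vs (f i))
    f-disjoint : ∀ i j → i ≢ j → Disjoint (vs (f i)) (vs (f j))
    f-B′       : ∀ i {v} → v ∈ˡ vs (f i) → B′ v ≡ true

module Combine {n : ℕ} {Piece : Set} (pathFamily : PathFamily n Piece) where

  open PathFamily pathFamily
  open Classes A B A′ B′ parts disjoint
  open Tabulated vs p ℓ d #vs
  open Absorption vs p B′ c s

  paths : List Piece
  paths = tabulate f

  vs₀ : List (Fin n)
  vs₀ = filterᵇ isV₀ (allFin n)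

  vs₀-count : length vs₀ ≡ count isV₀
  vs₀-count = length-filter-allFin (λ v → Data.Bool.T? (isV₀ v))

  vs₀-unique : Unique vs₀
  vs₀-unique = Uniqueₚ.filter⁺ (λ v → Data.Bool.T? (isV₀ v)) (Uniqueₚ.allFin⁺ n)

  vs₀-∉B′ : ∀ {v} → v ∈ˡ vs₀ → B′ v ≡ false
  vs₀-∉B′ {v} h = not-true (proj₂ (∧-true {not (A′ v)} (∈-filterᵇ⁻ isV₀ {allFin n} h)))

  vs₀-∉A′ : ∀ {v} → v ∈ˡ vs₀ → A′ v ≡ false
  vs₀-∉A′ {v} h = not-true (proj₁ (∧-true {not (A′ v)} (∈-filterᵇ⁻ isV₀ {allFin n} h)))

  path-B′ : ∀ {v} → v ∈ˡ concatMap vs paths → B′ v ≡ true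
  path-B′ h = let (i , h′) = used-∈ f h in f-B′ i h′

  module Union (R : Absorbed vs₀ (concatMap vs paths)) where

    module R = Absorbed R

    pieces : List Piece
    pieces = paths ++ R.ps

    unique : Unique (concatMap vs pieces)
    unique = subst Unique (sym (used-++ paths R.ps)) (Uniqueₚ.++⁺ (used-unique f f-unique f-disjoint) R.unique
      (λ { (a , b) → case R.within b of λ { (inj₁ (_ , ∉)) → ∉ a ; (inj₂ h) → true≢false (path-B′ a) (vs₀-∉B′ h) } }))

    outside-A′ : ∀ {v} → v ∈ˡ concatMap vs pieces → A′ v ≡ false
    outside-A′ {v} h with ∈-++⁻ (concatMap vs paths) (subst (v ∈ˡ_) (used-++ paths R.ps) h)
    ... | inj₁ a = disjoint v (path-B′ a)
    ... | inj₂ b with R.within b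
    ...   | inj₁ (b′ , _) = disjoint v b′
    ...   | inj₂ h′ = vs₀-∉A′ h′

    cover : ∀ v → v ∉ˡ concatMap vs pieces → A′ v ≡ false → B′ v ≡ true
    cover v ∉ a with bool-cases (B′ v)
    ... | inj₁ t = t
    ... | inj₂ b = ⊥-elim (∉ (subst (v ∈ˡ_) (sym (used-++ paths R.ps)) (∈-++⁺ʳ (concatMap vs paths) (R.contains (∈-filterᵇ⁺ isV₀ (∈-allFin v) (∧-intro (cong not a) (cong not b)))))))

    #used : length (concatMap vs pieces) ≡ np * ℓ + total paths * d + length vs₀ * c
    #used = trans (cong length (used-++ paths R.ps)) (trans (Listₚ.length-++ (concatMap vs paths)) (cong₂ _+_ (used-size f) R.#used))

    #sizes : total pieces ≡ total paths + length vs₀ * s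
    #sizes = trans (sizes-++ paths R.ps) (cong (total paths +_) R.#sizes)

    #pieces : length pieces ≡ np + length vs₀
    #pieces = trans (Listₚ.length-++ paths) (cong₂ _+_ (Listₚ.length-tabulate f) R.#ps)

-- Prefixes and suffixes of lists

take-∈ : ∀ {A : Set} {v : A} a (xs : List A) → v ∈ˡ take a xs → v ∈ˡ xs
take-∈ (suc a) (x ∷ xs) (here refl) = here refl
take-∈ (suc a) (x ∷ xs) (there m) = there (take-∈ a xs m)

drop-∈ : ∀ {A : Set} {v : A} a (xs : List A) → v ∈ˡ drop a xs → v ∈ˡ xs
drop-∈ zero xs m = m
drop-∈ (suc a) (x ∷ xs) m = there (drop-∈ a xs m)

split-take : ∀ {A : Set} {v : A} a b (xs : List A) → v ∈ˡ take (a + b) xs → v ∈ˡ take a xs ⊎ v ∈ˡ take b (drop a xs)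
split-take zero b xs m = inj₂ m
split-take (suc a) b (x ∷ xs) (here refl) = inj₁ (here refl)
split-take (suc a) b (x ∷ xs) (there m) with split-take a b xs m
... | inj₁ h = inj₁ (there h)
... | inj₂ h = inj₂ h

take-mono : ∀ {A : Set} {v : A} a b (xs : List A) → a ≤ b → v ∈ˡ take a xs → v ∈ˡ take b xs
take-mono (suc a) (suc b) (x ∷ xs) (s≤s le) (here refl) = here refl
take-mono (suc a) (suc b) (x ∷ xs) (s≤s le) (there m) = there (take-mono a b xs le m)

take-take : ∀ {A : Set} a b (xs : List A) → a ≤ b → take a (take b xs) ≡ take a xs
take-take zero b xs le = refl
take-take (suc a) (suc b) [] le = refl
take-take (suc a) (suc b) (x ∷ xs) (s≤s le) = cong (x ∷_) (take-take a b xs le)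

unique-reverse : ∀ {n} {xs : List (Fin n)} → Unique xs → Unique (reverse xs)
unique-reverse {xs = []} _ = []
unique-reverse {xs = x ∷ xs} (∉ ∷ u) = subst Unique (sym (Listₚ.unfold-reverse x xs)) (Uniqueₚ.++⁺ (unique-reverse u) ([] ∷ []) (λ { (m , here refl) →
  All.lookup ∉ (memberˡ-elim xs (trans (sym (lookup-toSubset xs x)) (trans (cong (λ S → lookup S x) (sym (toSubset-reverse xs))) (trans (lookup-toSubset (reverse xs) x) (memberˡ-intro m))))) refl }))

-- Pieces with good ends in the hypergraph

record CoreSetting (ρ n : ℕ) : Set₁ where
  no-eta-equality
  field
    hyp        : Extremality (suc ρ) n
    resolution : Bounds.Resolution hyp
    ℓ s′       : ℕ
  open Extremality hyp public
  open Bounds.Resolution resolution public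
  field
    k-eq    : suc (suc ρ) ≡ ℓ + (suc (suc ρ) ∸ ℓ)
    s′d≤κ   : s′ * (suc (suc ρ) ∸ ℓ) ≤ suc ρ
    ℓ<s′d   : ℓ < s′ * (suc (suc ρ) ∸ ℓ)
    D-dense : 8 * (4 ^ suc ρ * (2 ^ suc ρ * suc (2 * M ^ suc (suc ρ)))) ≤ D
    D-κ     : 8 * (4 ^ suc ρ * suc ρ) ≤ D
    n-walk  : 2 * (4 ^ suc ρ * (D * (suc ρ * (s′ * (suc (suc ρ) ∸ ℓ) * (suc ρ + s′ * (suc (suc ρ) ∸ ℓ)))))) < n

cover-identity : ∀ d x l → d + x + l ≡ x + (l + d)
cover-identity = solve 3 (λ d x l → d :+ x :+ l := x :+ (l :+ d)) refl
  where open ℕ-Solver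

module Core {ρ n : ℕ} (setting : CoreSetting ρ n) where

  open CoreSetting setting

  d κ : ℕ
  d = suc (suc ρ) ∸ ℓ
  κ = suc ρ

  k s N ao bo : ℕ
  k = suc κ
  s = suc s′
  N = ∣ B ∣
  ao = Bounds.ao hyp
  bo = Bounds.bo hyp

  E : Subset n → Bool
  E = Degrees.E H

  X : Bool → Fin n → Bool
  X = Bounds.X hyp

  disjoint : ∀ v → lookup A′ v ≡ true → lookup B′ v ≡ false
  disjoint = Bounds.disjoint hyp

  G : ℕ → ℕ → Subset n → Bool
  G = Goodness.G X E θ

  linkable-good : ∀ b S → ∣ S ∣ + b ≡ κ → deg H S B * D ≤ 6 * (N C suc b) → G 1 b S ≡ true
  linkable-good = Bounds.Base.linkable-good hyp resolution

  empty-good : G 1 κ ∅ ≡ true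
  empty-good = Bounds.Base.empty-good hyp resolution

  B′-good : ∀ b → suc b ≡ κ → ∀ y → lookup B′ y ≡ true → G 1 b ⁅ y ⁆ ≡ true
  B′-good = Bounds.Base.B′-good hyp resolution

  A′-good : ∀ x → lookup A′ x ≡ true → G 0 κ ⁅ x ⁆ ≡ true
  A′-good = Bounds.Base.A′-good hyp resolution

  X-disjoint : ∀ v τ → X τ v ≡ true → X (not τ) v ≡ false
  X-disjoint v true h = disjoint v h
  X-disjoint v false h with bool-cases (lookup A′ v)
  ... | inj₂ f = f
  ... | inj₁ a = ⊥-elim (true≢false h (disjoint v a))

  goodScheme : GoodScheme n
  goodScheme = record
    { X = X ; X-disjoint = X-disjoint ; E = E ; θ = θ ; d = d ; s′ = s′ ; ℓ = ℓ ; κ′ = ρ ; k-eq = k-eq ; s′d≤κ = s′d≤κ ; ℓ<s′d = ℓ<s′d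
    ; ∅-good = empty-good ; true-good = A′-good ; false-good = B′-good ρ refl }

  walkSetting : WalkSetting ρ n
  walkSetting = record { hyp = hyp ; resolution = resolution ; t = s′ * d ; D-dense = D-dense ; D-κ = D-κ ; n-walk = n-walk }

  TailGood HeadGood : List (Fin n) → Set
  TailGood = Template.TailGood (GoodScheme.scheme goodScheme)
  HeadGood = Template.HeadGood (GoodScheme.scheme goodScheme)

  i*d≤κ : ∀ i → i ≤ s′ → i * d ≤ κ
  i*d≤κ = Template.i*d≤κ (GoodScheme.scheme goodScheme)

  Piece : Set
  Piece = Template.Piece (GoodScheme.scheme goodScheme)

  vs : Piece → List (Fin n)
  vs = Template.Piece.vs

  p : Piece → ℕ
  p = Template.Piece.p

  #vs : ∀ Q → length (vs Q) ≡ ℓ + p Q * d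
  #vs = Template.Piece.#vs

  ℓ≤κ : ℓ ≤ κ
  ℓ≤κ = ℕₚ.<⇒≤ (ℕₚ.<-≤-trans ℓ<s′d s′d≤κ)

  -- The prefix that window j cuts from the head of a piece is as long as the suffix that window s′
  -- - j cuts from a tail. Heads are thus tails read backwards.
  head-index : ∀ j → j ≤ s′ → k ∸ (s * d ∸ j * d) ≡ ℓ ∸ (s′ ∸ j) * d
  head-index j j≤ = trans (cong₂ _∸_ (trans k-eq (ℕₚ.+-comm ℓ d)) (trans (sym (ℕₚ.*-distribʳ-∸ d s j)) (cong (_* d) (ℕₚ.+-∸-assoc 1 j≤)))) (ℕₚ.[m+n]∸[m+o]≡n∸o d ℓ ((s′ ∸ j) * d))

  ∅-at : ∀ x → x ≡ 0 → G 1 (κ ∸ x) ∅ ≡ true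
  ∅-at x refl = empty-good

  LinkableEnd : List (Fin n) → Set
  LinkableEnd W = ∀ j → j < s′ → deg H (toSubset (drop (j * d) W)) B * D ≤ 6 * (N C (k ∸ ∣ toSubset (drop (j * d) W) ∣))

  linkable-end : ∀ W → Unique W → length W ≡ ℓ → LinkableEnd W → TailGood W
  linkable-end W u len link j j≤ with ℕₚ.m≤n⇒m<n∨m≡n j≤
  -- Linkability has s - 1 conditions, for j < s′; at j = s′ the suffix is empty since ℓ < s′ d, and
  -- its goodness is `empty-good`.
  ... | inj₂ refl = subst (λ x → G 1 (κ ∸ (ℓ ∸ s′ * d)) (toSubset x) ≡ true) (sym (drop-all (s′ * d) W (subst (_≤ s′ * d) (sym len) (ℕₚ.<⇒≤ ℓ<s′d))))
        (∅-at (ℓ ∸ s′ * d) (ℕₚ.m≤n⇒m∸n≡0 (ℕₚ.<⇒≤ ℓ<s′d)))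
  ... | inj₁ j< = linkable-good b S sz (subst (λ x → deg H S B * D ≤ 6 * (N C x)) (trans (cong (k ∸_) card) (ℕₚ.+-∸-assoc 1 small)) (link j j<))
    where
    S : Subset n
    S = toSubset (drop (j * d) W)
    b : ℕ
    b = κ ∸ (ℓ ∸ j * d)
    card : ∣ S ∣ ≡ ℓ ∸ j * d
    card = trans (card-toSubset (Uniqueₚ.drop⁺ (j * d) u)) (trans (Listₚ.length-drop (j * d) W) (cong (_∸ j * d) len))
    small : ℓ ∸ j * d ≤ κ
    small = ℕₚ.≤-trans (ℕₚ.m∸n≤m ℓ (j * d)) ℓ≤κ
    sz : ∣ S ∣ + b ≡ κ
    sz = trans (cong (_+ b) card) (ℕₚ.m+[n∸m]≡n small)

  -- The initial end is read outward, so its suffixes are, as sets, the prefixes of `W`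
  -- (`drop-reverse`). When the window starts too early to reach `W`, the set is empty.
  linkable-head : ∀ W → Unique W → length W ≡ ℓ → LinkableEnd (reverse W) → HeadGood W
  linkable-head W u len link j j≤ = subst (λ x → G 1 (κ ∸ x) (toSubset (take x W)) ≡ true) (sym (head-index j j≤))
      (decide (ℕₚ.≤-total (i * d) ℓ))
    where
    i : ℕ
    i = s′ ∸ j
    good : G 1 (κ ∸ (ℓ ∸ i * d)) (toSubset (drop (i * d) (reverse W))) ≡ true
    good = linkable-end (reverse W) (unique-reverse u) (trans (Listₚ.length-reverse W) len) link i (ℕₚ.m∸n≤m s′ j)
    decide : i * d ≤ ℓ ⊎ ℓ ≤ i * d → G 1 (κ ∸ (ℓ ∸ i * d)) (toSubset (take (ℓ ∸ i * d) W)) ≡ true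
    decide (inj₁ le) = subst (λ S → G 1 (κ ∸ (ℓ ∸ i * d)) S ≡ true) (trans (drop-reverse (i * d) W (subst (i * d ≤_) (sym len) le)) (cong (λ x → toSubset (take (x ∸ i * d) W)) len)) good
    decide (inj₂ le) = subst (λ x → G 1 (κ ∸ x) (toSubset (take x W)) ≡ true) (sym (ℕₚ.m≤n⇒m∸n≡0 le)) empty-good

  path-piece : (P : Path ℓ (H [ B′ ])) → LinkableEnd (Path.initialEnd P) → LinkableEnd (Path.terminalEnd P) → Piece
  path-piece P link-i link-t = record
    { vs = vertices ; p = size ; #vs = #vertices
    ; edges = λ i i< → does-true (edge? H _) (proj₁ (Path.edges P i i<))
    ; head-good = linkable-head (take ℓ vertices) (Uniqueₚ.take⁺ ℓ distinct) (trans (Listₚ.length-take ℓ vertices) (ℕₚ.m≤n⇒m⊓n≡m (ℕₚ.≤-trans (ℕₚ.m≤m+n ℓ _) (ℕₚ.≤-reflexive (sym #vertices))))) link-i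
    ; tail-good = linkable-end (drop (size * d) vertices) (Uniqueₚ.drop⁺ (size * d) distinct)
        (trans (Listₚ.length-drop (size * d) vertices) (trans (cong (_∸ size * d) #vertices) (ℕₚ.m+n∸n≡m ℓ (size * d))))
        (subst (λ x → LinkableEnd (drop x vertices)) (trans (cong (_∸ ℓ) #vertices) (ℕₚ.m+n∸m≡n ℓ (size * d))) link-t) }
    where open Path P

  -- The windows of a path with at least one edge cover its vertices, and each window is an edge
  -- lying in B′; the induction extends the covered prefix window by window.
  path-vertex-B′ : (P : Path ℓ (H [ B′ ])) → ∀ {v} → v ∈ˡ Path.vertices P → lookup B′ v ≡ true
  path-vertex-B′ P {v} m∈ = cover size ℕₚ.≤-refl m∈′
    where
    open Path P
    m∈′ : v ∈ˡ take (size * d + ℓ) vertices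
    m∈′ = subst (v ∈ˡ_) (sym (take-all (size * d + ℓ) vertices (ℕₚ.≤-reflexive (trans #vertices (ℕₚ.+-comm ℓ (size * d)))))) m∈
    in-window : ∀ i → i < size → v ∈ˡ take k (drop (i * d) vertices) → lookup B′ v ≡ true
    in-window i i< m = ⊆-lookup (proj₂ (Path.edges P i i<)) v (trans (lookup-toSubset (take k (drop (i * d) vertices)) v) (memberˡ-intro m))
    cover : ∀ j → j ≤ size → v ∈ˡ take (j * d + ℓ) vertices → lookup B′ v ≡ true
    cover zero _ m = in-window 0 size≥1 (take-mono ℓ k vertices (ℕₚ.≤-trans (ℕₚ.m≤m+n ℓ d) (ℕₚ.≤-reflexive (sym k-eq))) m)
    cover (suc j) j< m with split-take (j * d) k vertices (subst (λ x → v ∈ˡ take x vertices) (trans (cover-identity d (j * d) ℓ) (cong (j * d +_) (sym k-eq))) m)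
    ... | inj₂ h = in-window j j< h
    ... | inj₁ h = cover j (ℕₚ.<⇒≤ j<) (take-mono (j * d) (j * d + ℓ) vertices (ℕₚ.m≤m+n _ ℓ) h)

  module WalkPiece (outsider : Walks.Outsider walkSetting) where

    open Walks.Outsider outsider renaming (U to Us)
    open Walks.Walk (Walks.walk-exists walkSetting outsider)

    -- With `v` at index κ, every window starting at an index at most κ contains `v`, and its other
    -- vertices form a κ-window of the walk. As s′ d ≤ κ, this makes all s windows starting at
    -- multiples of d edges.
    ws : List (Fin n)
    ws = take κ ys ++ v ∷ drop κ ys

    ws-∈ : ∀ {u} → u ∈ˡ ws → u ∈ˡ ys ⊎ u ≡ v
    ws-∈ {u} m with ∈-++⁻ (take κ ys) m
    ... | inj₁ h = inj₁ (subst (u ∈ˡ_) (Listₚ.take++drop≡id κ ys) (∈-++⁺ˡ h))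
    ... | inj₂ (here refl) = inj₂ refl
    ... | inj₂ (there h) = inj₁ (subst (u ∈ˡ_) (Listₚ.take++drop≡id κ ys) (∈-++⁺ʳ (take κ ys) h))

    v∉ys : v ∉ˡ ys
    v∉ys m = true≢false (in-B′ m) v∉B′

    length-take-ys : length (take κ ys) ≡ κ
    length-take-ys = trans (Listₚ.length-take κ ys) (ℕₚ.m≤n⇒m⊓n≡m (ℕₚ.≤-trans (ℕₚ.m≤m+n κ _) (ℕₚ.≤-reflexive (sym #ys))))

    ws-unique : Unique ws
    ws-unique = Uniqueₚ.++⁺ (Uniqueₚ.take⁺ κ unique) (All.tabulate (λ m → λ { refl → v∉ys (drop-∈ κ ys m) }) ∷ Uniqueₚ.drop⁺ κ unique)
      (λ { (a , here refl) → v∉ys (take-∈ κ ys a) ; (a , there b) → unique-++⁻ (subst Unique (sym (Listₚ.take++drop≡id κ ys)) unique) a b })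

    ws-length : length ws ≡ ℓ + s * d
    ws-length = trans (Listₚ.length-++ (take κ ys)) (trans (cong₂ (λ x y → x + suc y) length-take-ys (trans (Listₚ.length-drop κ ys) (trans (cong (_∸ κ) #ys) (ℕₚ.m+n∸m≡n κ (s′ * d)))))
      (trans (ℕₚ.+-suc κ (s′ * d)) (trans (cong (_+ s′ * d) k-eq) (ℕₚ.+-assoc ℓ d (s′ * d)))))

    window-sets : ∀ i → i ≤ κ → toSubset (take k (drop i ws)) ≡ toSubset (take κ (drop i ys)) ∪ ⁅ v ⁆
    window-sets i i≤ = begin
      toSubset (take k (drop i ws))                                ≡⟨ cong (λ xs → toSubset (take k xs)) (trans (drop-++ i (take κ ys) (v ∷ drop κ ys)) (cong (λ x → a ++ drop x (v ∷ drop κ ys)) i∸)) ⟩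
      toSubset (take k (a ++ v ∷ drop κ ys))                       ≡⟨ cong toSubset (trans (take-++ k a _) (cong₂ (λ xs x → xs ++ take x (v ∷ drop κ ys)) (take-all k a (ℕₚ.≤-trans (ℕₚ.≤-reflexive la) (ℕₚ.≤-trans (ℕₚ.m∸n≤m κ i) (ℕₚ.n≤1+n κ)))) count-eq)) ⟩
      toSubset (a ++ v ∷ take i (drop κ ys))                       ≡⟨ trans (toSubset-++ a _) (trans (cong (toSubset a ∪_) (Subsetₚ.∪-comm ⁅ v ⁆ _)) (sym (Subsetₚ.∪-assoc (toSubset a) _ ⁅ v ⁆))) ⟩
      (toSubset a ∪ toSubset (take i (drop κ ys))) ∪ ⁅ v ⁆         ≡⟨ cong (_∪ ⁅ v ⁆) (sym (toSubset-++ a (take i (drop κ ys)))) ⟩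
      toSubset (a ++ take i (drop κ ys)) ∪ ⁅ v ⁆                   ≡⟨ cong (λ xs → toSubset xs ∪ ⁅ v ⁆) (sym ys-window) ⟩
      toSubset (take κ (drop i ys)) ∪ ⁅ v ⁆                        ∎
      where
      open ≡-Reasoning
      a : List (Fin n)
      a = drop i (take κ ys)
      i∸ : i ∸ length (take κ ys) ≡ 0
      i∸ = ℕₚ.m≤n⇒m∸n≡0 (subst (i ≤_) (sym length-take-ys) i≤)
      la : length a ≡ κ ∸ i
      la = trans (Listₚ.length-drop i (take κ ys)) (cong (_∸ i) length-take-ys)
      count-eq : k ∸ length a ≡ suc i
      count-eq = trans (cong (k ∸_) la) (trans (ℕₚ.+-∸-assoc 1 (ℕₚ.m∸n≤m κ i)) (cong suc (ℕₚ.m∸[m∸n]≡n i≤)))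
      ys-window : take κ (drop i ys) ≡ a ++ take i (drop κ ys)
      ys-window = trans (cong (λ xs → take κ (drop i xs)) (sym (Listₚ.take++drop≡id κ ys)))
        (trans (cong (take κ) (trans (drop-++ i (take κ ys) (drop κ ys)) (cong (λ x → a ++ drop x (drop κ ys)) i∸)))
          (trans (take-++ κ a (drop κ ys)) (cong₂ (λ xs x → xs ++ take x (drop κ ys)) (take-all κ a (ℕₚ.≤-trans (ℕₚ.≤-reflexive la) (ℕₚ.m∸n≤m κ i))) (trans (cong (κ ∸_) la) (ℕₚ.m∸[m∸n]≡n i≤)))))

    good-sublist : ∀ i → i ≤ s′ * d → ∀ xs → Unique xs → (∀ {u} → u ∈ˡ xs → u ∈ˡ take κ (drop i ys)) → ∀ x → length xs ≡ x → G 1 (κ ∸ x) (toSubset xs) ≡ true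
    good-sublist i i≤ xs u sub x refl = subst (λ y → G 1 (κ ∸ y) (toSubset xs) ≡ true) (card-toSubset u)
      (good i i≤ (toSubset xs) (λ w h → trans (lookup-toSubset (take κ (drop i ys)) w) (memberˡ-intro (sub (memberˡ-elim xs {w} (trans (sym (lookup-toSubset xs w)) h))))))

    head : HeadGood (take ℓ ws)
    head j j≤ = subst (λ x → G 1 (κ ∸ x) (toSubset (take x (take ℓ ws))) ≡ true) (sym (head-index j j≤))
        (subst (λ xs → G 1 (κ ∸ f) (toSubset xs) ≡ true) (sym prefix)
          (good-sublist 0 z≤n (take f ys) (Uniqueₚ.take⁺ f unique) (λ {u} m → subst (u ∈ˡ_) (Listₚ.take++drop≡id f (take κ ys)) (∈-++⁺ˡ (subst (u ∈ˡ_) (sym (take-take f κ ys f≤κ)) m)))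
            f (trans (Listₚ.length-take f ys) (ℕₚ.m≤n⇒m⊓n≡m (ℕₚ.≤-trans f≤κ (ℕₚ.≤-trans (ℕₚ.m≤m+n κ _) (ℕₚ.≤-reflexive (sym #ys))))))))
      where
      f : ℕ
      f = ℓ ∸ (s′ ∸ j) * d
      f≤κ : f ≤ κ
      f≤κ = ℕₚ.≤-trans (ℕₚ.m∸n≤m ℓ ((s′ ∸ j) * d)) ℓ≤κ
      prefix : take f (take ℓ ws) ≡ take f ys
      prefix = trans (take-take f ℓ ws (ℕₚ.m∸n≤m ℓ ((s′ ∸ j) * d))) (trans (take-drop-prefix 0 f (take κ ys) _ (subst (f ≤_) (sym length-take-ys) f≤κ)) (take-take f κ ys f≤κ))

    -- Since κ < s d, the tail lies behind `v` and consists of vertices of the last κ-window of the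
    -- walk, all subsets of which are good.
    tail : TailGood (drop (s * d) ws)
    tail j j≤ = subst (λ xs → G 1 (κ ∸ (ℓ ∸ j * d)) (toSubset xs) ≡ true) (sym suffix)
        (good-sublist (s′ * d) ℕₚ.≤-refl (drop x ys) (Uniqueₚ.drop⁺ x unique) sub (ℓ ∸ j * d)
          (trans (Listₚ.length-drop x ys) (trans (cong (_∸ x) #ys) lengths)))
      where
      open ≡-Reasoning
      -- x + 1 = (s + j) d is the position in ws, which contains v before it.
      y x : ℕ
      y = s * d ∸ suc κ
      x = κ + (y + j * d)
      κ<sd : suc κ ≤ s * d
      κ<sd = ℕₚ.≤-trans (ℕₚ.≤-reflexive (trans k-eq (ℕₚ.+-comm ℓ d))) (ℕₚ.+-monoʳ-≤ d (ℕₚ.<⇒≤ ℓ<s′d))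
      sd-eq : suc κ + y ≡ s * d
      sd-eq = ℕₚ.m+[n∸m]≡n κ<sd
      suffix : drop (j * d) (drop (s * d) ws) ≡ drop x ys
      suffix = begin
        drop (j * d) (drop (s * d) ws)                             ≡⟨ Listₚ.drop-drop (s * d) (j * d) ws ⟩
        drop (s * d + j * d) ws                                    ≡⟨ cong (λ z → drop z ws) (trans (cong (_+ j * d) (sym sd-eq)) (trans (cong suc (ℕₚ.+-assoc κ y (j * d))) (sym (ℕₚ.+-suc κ _)))) ⟩
        drop (κ + suc (y + j * d)) ws                              ≡⟨ cong (λ z → drop (z + suc (y + j * d)) ws) (sym length-take-ys) ⟩
        drop (length (take κ ys) + suc (y + j * d)) ws             ≡⟨ drop-suffix (suc (y + j * d)) (take κ ys) (v ∷ drop κ ys) ⟩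
        drop (y + j * d) (drop κ ys)                               ≡⟨ Listₚ.drop-drop κ (y + j * d) ys ⟩
        drop x ys                                                  ∎
      lengths : κ + s′ * d ∸ x ≡ ℓ ∸ j * d
      lengths = begin
        κ + s′ * d ∸ (κ + (y + j * d))             ≡⟨ ℕₚ.[m+n]∸[m+o]≡n∸o κ (s′ * d) (y + j * d) ⟩
        s′ * d ∸ (y + j * d)                       ≡⟨ cong (_∸ (y + j * d)) s′d-eq ⟩
        (y + ℓ) ∸ (y + j * d)                      ≡⟨ ℕₚ.[m+n]∸[m+o]≡n∸o y ℓ (j * d) ⟩
        ℓ ∸ j * d                                  ∎
        where
        s′d-eq : s′ * d ≡ y + ℓ
        s′d-eq = ℕₚ.+-cancelˡ-≡ d _ _ (trans (sym sd-eq) (trans (cong (_+ y) k-eq) (cover-identity ℓ d y)))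
      s′d≤x : s′ * d ≤ x
      s′d≤x = ℕₚ.≤-trans s′d≤κ (ℕₚ.m≤m+n κ _)
      sub : ∀ {u} → u ∈ˡ drop x ys → u ∈ˡ take κ (drop (s′ * d) ys)
      sub {u} m = subst (u ∈ˡ_) (sym (take-all κ (drop (s′ * d) ys) (ℕₚ.≤-reflexive (trans (Listₚ.length-drop (s′ * d) ys) (trans (cong (_∸ s′ * d) #ys) (ℕₚ.m+n∸n≡m κ (s′ * d)))))))
        (drop-∈ (x ∸ s′ * d) (drop (s′ * d) ys) (subst (u ∈ˡ_) (trans (cong (λ z → drop z ys) (sym (ℕₚ.m+[n∸m]≡n s′d≤x))) (sym (Listₚ.drop-drop (s′ * d) (x ∸ s′ * d) ys))) m))

    piece : Piece
    piece = record
      { vs = ws ; p = s ; #vs = ws-length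
      ; edges = λ i i< → trans (cong E (window-sets (i * d) (i*d≤κ i (ℕₚ.≤-pred i<)))) (edge (i * d) (ℕₚ.*-monoˡ-≤ d (ℕₚ.≤-pred i<)))
      ; head-good = head ; tail-good = tail }

    piece-∈ : ∀ {u} → u ∈ˡ ws → (lookup B′ u ≡ true × u ∉ˡ Us) ⊎ u ≡ v
    piece-∈ m with ws-∈ m
    ... | inj₁ h = inj₁ (in-B′ h , avoid-U h)
    ... | inj₂ e = inj₂ e

    v∈ws : v ∈ˡ ws
    v∈ws = ∈-++⁺ʳ (take κ ys) (here refl)

  module Ab = Absorption {Piece = Piece} vs p (lookup B′) (ℓ + s * d) s

  walk-cost : ℕ → ℕ
  walk-cost x = 8 * (4 ^ κ * (D * (κ * x)))

  walk-cost-mono : ∀ {x y} → x ≤ y → walk-cost x ≤ walk-cost y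
  walk-cost-mono le = ℕₚ.*-monoʳ-≤ 8 (ℕₚ.*-monoʳ-≤ (4 ^ κ) (ℕₚ.*-monoʳ-≤ D (ℕₚ.*-monoʳ-≤ κ le)))

  abstract
    absorber : ∀ v → lookup B′ v ≡ false → ∀ Us → walk-cost (length Us) ≤ n → Ab.Absorber v Us
    absorber v v∉B′ Us small = record
      { piece = WalkPiece.piece o ; distinct = WalkPiece.ws-unique o ; member = WalkPiece.piece-∈ o
      ; covers = WalkPiece.v∈ws o ; #vertices = WalkPiece.ws-length o ; #edges = refl }
      where
      o : Walks.Outsider walkSetting
      o = record { v = v ; v∉B′ = v∉B′ ; U = Us ; U-small = small }

    absorb : ∀ vs₀ Us → Unique vs₀ → (∀ {v} → v ∈ˡ vs₀ → lookup B′ v ≡ false) →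
             walk-cost (length Us + length vs₀ * (ℓ + s * d)) ≤ n → Ab.Absorbed vs₀ Us
    absorb = Ab.absorb (λ x → walk-cost x ≤ n) (λ {x} {y} le → ℕₚ.≤-trans (walk-cost-mono {x} {y} le)) absorber

  module Tab = Tabulated vs p ℓ d #vs

  -- The number of vertices in all pieces per unit of ao + bo: s paths with at most ℓ + s⋆ d
  -- vertices for each vertex of A in B′, and one piece with ℓ + s d vertices for each vertex
  -- outside A′ and B′.
  ⋃-small : ℕ → ℕ
  ⋃-small s⋆ = s * (ℓ + s⋆ * d) + (ℓ + s * d)

  record Problem : Set where
    no-eta-equality
    field
      m           : ℕ
      n-eq        : n ≡ m * d
      k≤n         : k ≤ n
      s⋆ q        : ℕ
      q-eq        : q ≡ count (λ v → lookup A v ∧ lookup B′ v)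
      P           : Fin (s * q) → Path ℓ (H [ B′ ])
      P-disjoint  : ∀ i j → i ≢ j → Disjoint (Path.vertices (P i)) (Path.vertices (P j))
      P-size      : ∀ i → Path.size (P i) ≤ s⋆
      P-ends      : ∀ i → LinkableEnd (Path.initialEnd (P i)) × LinkableEnd (Path.terminalEnd (P i))
      A-low       : m ≤ s * ∣ A ∣
      A-high      : s * ∣ A ∣ ≤ m + s
      A-half      : ∣ A ∣ + ∣ A ∣ ≤ n
      enough-A    : (s * s⋆ + 5 * s + 5) * suc (ao + bo) ≤ ∣ A ∣
      enough-room : demand k θ (⋃-small s⋆ * (ao + bo)) + suc (⋃-small s⋆) * (ao + bo) < ∣ A ∣
      sparse-used : walk-cost (⋃-small s⋆ * (ao + bo)) ≤ n

  module Final (problem : Problem) where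

    open Problem problem

    f : Fin (s * q) → Piece
    f i = path-piece (P i) (proj₁ (P-ends i)) (proj₂ (P-ends i))

    module Cl = Classes (lookup A) (lookup B) (lookup A′) (lookup B′) parts (λ v → X-disjoint v false)

    family : PathFamily n Piece
    family = record
      { vs = vs ; p = p ; ℓ = ℓ ; d = d ; c = ℓ + s * d ; s = s ; #vs = #vs ; A = lookup A ; B = lookup B ; A′ = lookup A′ ; B′ = lookup B′
      ; parts = parts ; disjoint = λ v → X-disjoint v false ; np = s * q ; f = f ; f-unique = λ i → Path.distinct (P i) ; f-disjoint = P-disjoint
      ; f-B′ = λ i → path-vertex-B′ (P i) }

    module Co = Combine family

    α nv e′ : ℕ
    α = count (lookup A′)
    nv = length Co.vs₀
    e′ = Tab.total Co.paths

    card-A : count (lookup A) ≡ ∣ A ∣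
    card-A = sym (card-count A)

    bookkeeping : Bookkeeping
    bookkeeping = record
      { s′ = s′ ; ℓ = ℓ ; d = d ; m = m ; s⋆ = s⋆ ; q = q ; α = α ; nv = nv ; ao = ao ; bo = bo ; A = ∣ A ∣ ; edges = e′ ; n = n ; A-low = A-low ; A-high = A-high
      ; A≤ = subst₂ _≤_ card-A (cong₂ (λ x y → x + (α + y)) (sym q-eq) (sym Co.vs₀-count)) Cl.A-cover
      ; A≤α = subst (_≤ α + ao) card-A Cl.A≤α ; α≤A = subst (λ x → α ≤ x + bo) card-A Cl.α≤A
      ; q≤ao = subst (_≤ ao) (sym q-eq) Cl.q≤ao ; nv≤w = subst (_≤ ao + bo) (sym Co.vs₀-count) Cl.V₀-bound
      ; path-lower = Tab.sizes-lower f (λ i → Path.size≥1 (P i)) ; path-upper = Tab.sizes-upper f s⋆ P-size ; enough-A = enough-A }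

    module Bu = Budget bookkeeping

    used-bound : length (concatMap vs Co.paths) + nv * (ℓ + s * d) ≤ ⋃-small s⋆ * (ao + bo)
    used-bound = ℕₚ.≤-trans (ℕₚ.≤-reflexive (cong (_+ nv * (ℓ + s * d)) (Tab.used-size f))) Bu.used-bound

    abstract
      absorbed : Ab.Absorbed Co.vs₀ (concatMap vs Co.paths)
      absorbed = absorb Co.vs₀ (concatMap vs Co.paths) Co.vs₀-unique Co.vs₀-∉B′
        (ℕₚ.≤-trans (walk-cost-mono {length (concatMap vs Co.paths) + nv * (ℓ + s * d)} {⋃-small s⋆ * (ao + bo)} used-bound) sparse-used)

    module Al = Co.Union absorbed

    module Ro = Bu.Room (demand k θ) (demand-mono k θ) (length (concatMap vs Al.pieces)) (subst (_≤ ⋃-small s⋆ * (ao + bo)) (sym Al.#used) Bu.used-bound) enough-room A-half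

    hamilton : ∃[ xs ] (Unique xs × length xs ≡ n × (∀ (i : Fin m) → E (toSubset (take k (drop (toℕ i * d) (xs ++ xs)))) ≡ true))
    hamilton = Completion.Assembly.Assembled.assembled goodScheme (record
      { ps = Al.pieces ; a = Bu.a ; t = Bu.t ; m = m ; n-eq = n-eq ; k≤n = k≤n ; unique = Al.unique ; used-B = Al.outside-A′ ; cover = Al.cover
      ; A-count = trans Bu.A-count (cong (λ x → 2 * x + (Bu.t + suc Bu.a)) (sym Al.#pieces))
      ; m-eq = trans Bu.m-eq (cong₂ (λ x y → x + 2 * s * y + (Bu.t * s′ + suc Bu.a * s)) (sym Al.#sizes) (sym Al.#pieces))
      ; room = Ro.room ; room′ = Ro.room′ })

-- The choice of constants

scaled-≤ : ∀ z X {n a} → 0 < z → n ≤ z * a → z * X ≤ n → X ≤ a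
scaled-≤ z X 0<z n≤ h = cancel-*-≤ z 0<z (ℕₚ.≤-trans h n≤)

fraction-identity : ∀ c d a b → 2 * (c * d * (a + b)) ≡ a * (2 * c) * (d * 1) + b * (2 * c) * (d * 1)
fraction-identity = solve 4 (λ c d a b → con 2 :* (c :* d :* (a :+ b)) := a :* (con 2 :* c) :* (d :* con 1) :+ b :* (con 2 :* c) :* (d :* con 1)) refl
  where open ℕ-Solver

fraction : ∀ c Γ {D n ao bo} → 1 ≤ D → 2 * c ≤ Γ → ao * Γ * (D * D) ≤ n → bo * Γ * (D * D) ≤ n → c * D * (ao + bo) ≤ n
fraction c Γ {D} {n} {ao} {bo} 1≤D 2c≤Γ ao≤ bo≤ = ℕₚ.*-cancelˡ-≤ 2 (begin
  2 * (c * D * (ao + bo))                                ≡⟨ fraction-identity c D ao bo ⟩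
  ao * (2 * c) * (D * 1) + bo * (2 * c) * (D * 1)        ≤⟨ ℕₚ.+-mono-≤ (ℕₚ.*-mono-≤ (ℕₚ.*-monoʳ-≤ ao 2c≤Γ) (ℕₚ.*-monoʳ-≤ D 1≤D)) (ℕₚ.*-mono-≤ (ℕₚ.*-monoʳ-≤ bo 2c≤Γ) (ℕₚ.*-monoʳ-≤ D 1≤D)) ⟩
  ao * Γ * (D * D) + bo * Γ * (D * D)                    ≤⟨ ℕₚ.+-mono-≤ ao≤ bo≤ ⟩
  n + n                                                  ≡⟨ cong (n +_) (sym (ℕₚ.+-identityʳ n)) ⟩
  2 * n                                                  ∎)
  where
  open ℕₚ.≤-Reasoning

fraction₁ : ∀ c Γ {D n ao bo} → 1 ≤ D → 2 * c ≤ Γ → ao * Γ * (D * D) ≤ n → bo * Γ * (D * D) ≤ n → c * (ao + bo) ≤ n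
fraction₁ c Γ {D} {n} {ao} {bo} 1≤D 2c≤Γ ao≤ bo≤ = ℕₚ.≤-trans
  (ℕₚ.*-monoˡ-≤ (ao + bo) (ℕₚ.≤-trans (ℕₚ.≤-reflexive (sym (ℕₚ.*-identityʳ c))) (ℕₚ.*-monoʳ-≤ c 1≤D))) (fraction c Γ {D} {n} {ao} {bo} 1≤D 2c≤Γ ao≤ bo≤)

-- The coefficients of `x` and θ depend on k only, so the ratio M of n to θ can be fixed in advance
-- from the coefficient of θ.
demand-linear : ∀ k θ x → demand k θ x ≡ x * (2 * k * k + 2) + θ * ((16 * k * k * k + 8 * k) * (2 * k * k + 2) + 8 * k) + (4 * k * k * (2 * k * k + 2) + 2)
demand-linear k θ x = trans (demand-def k θ x refl refl refl refl) (arith k θ x)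
  where
  open ℕ-Solver
  arith : ∀ k θ x → (x + (1 + ((k + k) * θ + (k + k) * θ) + (1 + ((k + k) * θ + (k + k) * θ))) * ((k + k) * k) + ((k + k) * θ + (k + k) * θ) + ((k + k) * θ + (k + k) * θ)) * (1 + (1 + (k + k) * k))
          + (1 + ((k + k) * θ + (k + k) * θ) + (1 + ((k + k) * θ + (k + k) * θ)))
          ≡ x * (2 * k * k + 2) + θ * ((16 * k * k * k + 8 * k) * (2 * k * k + 2) + 8 * k) + (4 * k * k * (2 * k * k + 2) + 2)
  arith = solve 3 (λ k θ x → (x :+ (con 1 :+ ((k :+ k) :* θ :+ (k :+ k) :* θ) :+ (con 1 :+ ((k :+ k) :* θ :+ (k :+ k) :* θ))) :* ((k :+ k) :* k) :+ ((k :+ k) :* θ :+ (k :+ k) :* θ) :+ ((k :+ k) :* θ :+ (k :+ k) :* θ)) :* (con 1 :+ (con 1 :+ (k :+ k) :* k)) :+ (con 1 :+ ((k :+ k) :* θ :+ (k :+ k) :* θ) :+ (con 1 :+ ((k :+ k) :* θ :+ (k :+ k) :* θ)))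
    := x :* (con 2 :* k :* k :+ con 2) :+ θ :* ((con 16 :* k :* k :* k :+ con 8 :* k) :* (con 2 :* k :* k :+ con 2) :+ con 8 :* k) :+ (con 4 :* k :* k :* (con 2 :* k :* k :+ con 2) :+ con 2)) refl

a-half-identity : ∀ n → (n + n) + (n + n) ≡ 4 * n
a-half-identity = solve 1 (λ n → (n :+ n) :+ (n :+ n) := con 4 :* n) refl
  where open ℕ-Solver

half-identity : ∀ a b → (a + b) + (a + b) ≡ a + a + 2 * b
half-identity = solve 2 (λ a b → (a :+ b) :+ (a :+ b) := a :+ a :+ con 2 :* b) refl
  where open ℕ-Solver

e-small-identity : ∀ d x g f e → d * (2 * (x * g * (d * d * d) * (f * e))) ≡ 2 * (x * g * (f * (e * (d * d * d * d))))
e-small-identity = solve 5 (λ d x g f e → d :* (con 2 :* (x :* g :* (d :* d :* d) :* (f :* e))) := con 2 :* (x :* g :* (f :* (e :* (d :* d :* d :* d))))) refl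
  where open ℕ-Solver

e-small-identity₂ : ∀ x g f c y → 2 * (x * g * (f * (c * y))) ≡ 2 * (x * g * (f * c)) * y
e-small-identity₂ = solve 5 (λ x g f c y → con 2 :* (x :* g :* (f :* (c :* y))) := con 2 :* (x :* g :* (f :* c)) :* y) refl
  where open ℕ-Solver

enough-A-identity : ∀ z c w → 2 * (z * (c * (1 + w))) ≡ 2 * (z * c) + 2 * (z * c) * w
enough-A-identity = solve 3 (λ z c w → con 2 :* (z :* (c :* (con 1 :+ w))) := con 2 :* (z :* c) :+ con 2 :* (z :* c) :* w) refl
  where open ℕ-Solver

sparse-used-identity : ∀ x d κ c w → 8 * (x * (d * (κ * (c * w)))) ≡ 8 * (x * (κ * c)) * d * w
sparse-used-identity = solve 5 (λ x d κ c w → con 8 :* (x :* (d :* (κ :* (c :* w)))) := con 8 :* (x :* (κ :* c)) :* d :* w) refl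
  where open ℕ-Solver

enough-room-identity : ∀ z c w x θ y v → 4 * (z * (1 + (c * w * x + θ * y + (v + 2) + (1 + c) * w))) ≡ 4 * (z * (c * x + (1 + c))) * w + 4 * (z * y) * θ + 4 * (z * (v + 3))
enough-room-identity = solve 7 (λ z c w x θ y v → con 4 :* (z :* (con 1 :+ (c :* w :* x :+ θ :* y :+ (v :+ con 2) :+ (con 1 :+ c) :* w))) := con 4 :* (z :* (c :* x :+ (con 1 :+ c))) :* w :+ con 4 :* (z :* y) :* θ :+ con 4 :* (z :* (v :+ con 3))) refl
  where open ℕ-Solver

enough-room-identity₂ : ∀ n → n + n + n + n ≡ 4 * n
enough-room-identity₂ = solve 1 (λ n → n :+ n :+ n :+ n := con 4 :* n) refl
  where open ℕ-Solver

A-low-identity : ∀ s d a → s * d * a ≡ d * (s * a)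
A-low-identity = solve 3 (λ s d a → s :* d :* a := d :* (s :* a)) refl
  where open ℕ-Solver

A-high-identity : ∀ s d a → d * (s * a) ≡ s * d * a
A-high-identity = solve 3 (λ s d a → d :* (s :* a) := s :* d :* a) refl
  where open ℕ-Solver

A-high-identity₂ : ∀ m d s → m * d + s * d ≡ d * (m + s)
A-high-identity₂ = solve 3 (λ m d s → m :* d :+ s :* d := d :* (m :+ s)) refl
  where open ℕ-Solver

sum-parts : ∀ {n} {A B : Subset n} → (∀ v → lookup A v ≡ not (lookup B v)) → ∣ A ∣ + ∣ B ∣ ≡ n
sum-parts {n} {A} {B} parts = trans (cong₂ _+_ (trans (card-count A) (count-cong parts)) (card-count B)) (trans (ℕₚ.+-comm _ (count (lookup B))) (count-not (lookup B)))

record Parameters : Set where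
  no-eta-equality
  field
    ρ ℓ s′ s⋆ c₀ : ℕ
  s : ℕ
  s = suc s′
  d : ℕ
  d = suc (suc ρ) ∸ ℓ
  κ : ℕ
  κ = suc ρ
  field
    k-eq  : suc κ ≡ ℓ + d
    s′d≤κ : s′ * d ≤ κ
    ℓ<s′d : ℓ < s′ * d
    0<d   : 0 < d
    4≤z   : 4 ≤ s * d

module Constants (parameters : Parameters) where

  open Parameters parameters

  -- `c₁` and `c₂` are the coefficients in `enough-A` and `sparse-used`; `c₃`, `c₄`, `c₅` are those
  -- of w, of θ and of 1 in `enough-room`. The factor `z` translates bounds by |A| into bounds by n,
  -- as n ≤ z |A|.
  k z cᵤ c₁ c₂ c₃ c₄ c₅ : ℕ
  k = suc κ
  z = s * d
  cᵤ = s * (ℓ + s⋆ * d) + (ℓ + s * d)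
  c₁ = z * (s * s⋆ + 5 * s + 5)
  c₂ = 8 * (4 ^ κ * (κ * cᵤ))
  c₃ = z * (cᵤ * (2 * k * k + 2) + suc cᵤ)
  c₄ = z * ((16 * k * k * k + 8 * k) * (2 * k * k + 2) + 8 * k)
  c₅ = z * (4 * k * k * (2 * k * k + 2) + 3)

  opaque

    -- The choices do not run in a circle: `M` depends on k and ℓ, Γ in addition on the length bound
    -- of the paths, `D₀` on both, and only `n₀` depends on the actual D, which is not bounded in
    -- terms of the rest because Δ may be arbitrarily small.
    M Γ D₀ : ℕ
    M = suc (4 * c₄)
    Γ = 4 * k + (4 * c₁ + (2 * c₂ + 8 * c₃))
    D₀ = 13 + (suc (7 * M ^ k) + (8 * (4 ^ κ * (2 ^ κ * suc (2 * M ^ k))) + (8 * (4 ^ κ * κ) + 2 * (4 ^ κ * Γ * (k ! * c₀)))))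

    n₀ : ℕ → ℕ
    n₀ D = 2 * (4 ^ κ * Γ * (D * D * D) * (k * k)) + (suc (2 * (4 ^ κ * (D * (κ * (s * d * (κ + s * d)))))) + (2 * c₁ + (4 * c₅ + (z + (k + d)))))

    M-pos : NonZero M
    M-pos = _

    4c₄≤M : 4 * c₄ ≤ M
    4c₄≤M = ℕₚ.n≤1+n _

    4k≤Γ : 4 * k ≤ Γ
    4k≤Γ = ℕₚ.m≤m+n _ _

    4c₁≤Γ : 4 * c₁ ≤ Γ
    4c₁≤Γ = ℕₚ.≤-trans (ℕₚ.m≤m+n _ _) (ℕₚ.m≤n+m _ (4 * k))

    2c₂≤Γ : 2 * c₂ ≤ Γ
    2c₂≤Γ = ℕₚ.≤-trans (ℕₚ.m≤m+n _ _) (ℕₚ.≤-trans (ℕₚ.m≤n+m _ (4 * c₁)) (ℕₚ.m≤n+m _ (4 * k)))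

    8c₃≤Γ : 8 * c₃ ≤ Γ
    8c₃≤Γ = ℕₚ.≤-trans (ℕₚ.m≤n+m _ (2 * c₂)) (ℕₚ.≤-trans (ℕₚ.m≤n+m _ (4 * c₁)) (ℕₚ.m≤n+m _ (4 * k)))

    13≤D₀ : 13 ≤ D₀
    13≤D₀ = ℕₚ.m≤m+n 13 _

    M<D₀ : 7 * M ^ k < D₀
    M<D₀ = ℕₚ.≤-trans (ℕₚ.m≤m+n (suc (7 * M ^ k)) _) (ℕₚ.m≤n+m _ 13)

    dense≤D₀ : 8 * (4 ^ κ * (2 ^ κ * suc (2 * M ^ k))) ≤ D₀
    dense≤D₀ = ℕₚ.≤-trans (ℕₚ.m≤m+n (8 * (4 ^ κ * (2 ^ κ * suc (2 * M ^ k)))) _) (ℕₚ.≤-trans (ℕₚ.m≤n+m _ (suc (7 * M ^ k))) (ℕₚ.m≤n+m _ 13))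

    κ≤D₀ : 8 * (4 ^ κ * κ) ≤ D₀
    κ≤D₀ = ℕₚ.≤-trans (ℕₚ.m≤m+n (8 * (4 ^ κ * κ)) _) (ℕₚ.≤-trans (ℕₚ.m≤n+m _ (8 * (4 ^ κ * (2 ^ κ * suc (2 * M ^ k))))) (ℕₚ.≤-trans (ℕₚ.m≤n+m _ (suc (7 * M ^ k))) (ℕₚ.m≤n+m _ 13)))

    edges≤D₀ : 2 * (4 ^ κ * Γ * (k ! * c₀)) ≤ D₀
    edges≤D₀ = ℕₚ.≤-trans (ℕₚ.m≤n+m _ (8 * (4 ^ κ * κ))) (ℕₚ.≤-trans (ℕₚ.m≤n+m _ (8 * (4 ^ κ * (2 ^ κ * suc (2 * M ^ k))))) (ℕₚ.≤-trans (ℕₚ.m≤n+m _ (suc (7 * M ^ k))) (ℕₚ.m≤n+m _ 13)))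

    large≤n₀ : ∀ D → 2 * (4 ^ κ * Γ * (D * D * D) * (k * k)) ≤ n₀ D
    large≤n₀ D = ℕₚ.m≤m+n _ _

    walk<n₀ : ∀ D → 2 * (4 ^ κ * (D * (κ * (s * d * (κ + s * d))))) < n₀ D
    walk<n₀ D = ℕₚ.≤-trans (ℕₚ.m≤m+n (suc (2 * (4 ^ κ * (D * (κ * (s * d * (κ + s * d))))))) _) (ℕₚ.m≤n+m _ (2 * (4 ^ κ * Γ * (D * D * D) * (k * k))))

    rest≤n₀ : ∀ D → 2 * c₁ + (4 * c₅ + (z + (k + d))) ≤ n₀ D
    rest≤n₀ D = ℕₚ.≤-trans (ℕₚ.m≤n+m _ (suc (2 * (4 ^ κ * (D * (κ * (s * d * (κ + s * d)))))))) (ℕₚ.m≤n+m _ (2 * (4 ^ κ * Γ * (D * D * D) * (k * k))))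

  2c₁≤n₀ : ∀ D → 2 * c₁ ≤ n₀ D
  2c₁≤n₀ D = ℕₚ.≤-trans (ℕₚ.m≤m+n (2 * c₁) _) (rest≤n₀ D)

  4c₅≤n₀ : ∀ D → 4 * c₅ ≤ n₀ D
  4c₅≤n₀ D = ℕₚ.≤-trans (ℕₚ.≤-trans (ℕₚ.m≤m+n (4 * c₅) _) (ℕₚ.m≤n+m _ (2 * c₁))) (rest≤n₀ D)

  z≤n₀ : ∀ D → z ≤ n₀ D
  z≤n₀ D = ℕₚ.≤-trans (ℕₚ.≤-trans (ℕₚ.m≤m+n z _) (ℕₚ.≤-trans (ℕₚ.m≤n+m _ (4 * c₅)) (ℕₚ.m≤n+m _ (2 * c₁)))) (rest≤n₀ D)

  k+d≤n₀ : ∀ D → k + d ≤ n₀ D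
  k+d≤n₀ D = ℕₚ.≤-trans (ℕₚ.≤-trans (ℕₚ.m≤n+m (k + d) z) (ℕₚ.≤-trans (ℕₚ.m≤n+m _ (4 * c₅)) (ℕₚ.m≤n+m _ (2 * c₁)))) (rest≤n₀ D)

  instance
    M-nonZero : NonZero M
    M-nonZero = M-pos

  record Sizes : Set where
    no-eta-equality
    field
      D n a b : ℕ
      D₀≤D    : D₀ ≤ D
      n₀≤n    : n₀ D ≤ n
      a+b     : a + b ≡ n
      n≤za    : n ≤ z * a
      za<n+z  : z * a < n + z

  module Discharge (sizes : Sizes) where

    open Sizes sizes

    θ : ℕ
    θ = n / M

    n≤Mθ : n ≤ M * suc θ
    n≤Mθ = begin
      n                    ≡⟨ m≡m%n+[m/n]*n n M ⟩
      n % M + θ * M        ≤⟨ ℕₚ.+-monoˡ-≤ (θ * M) (ℕₚ.<⇒≤ (m%n<n n M)) ⟩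
      suc θ * M            ≡⟨ ℕₚ.*-comm (suc θ) M ⟩
      M * suc θ            ∎
      where open ℕₚ.≤-Reasoning

    Mθ≤n : M * θ ≤ n
    Mθ≤n = ℕₚ.≤-trans (ℕₚ.≤-reflexive (ℕₚ.*-comm M θ)) (m/n*n≤m n M)

    0<z : 0 < z
    0<z = ℕₚ.≤-trans (s≤s z≤n) 4≤z

    -- |A| is about n/z with z ≥ 4; the rounding error is absorbed by z ≤ n.
    a-half : a + a ≤ n
    a-half = cancel-*-≤ z 0<z (begin
      z * (a + a)                ≡⟨ ℕₚ.*-distribˡ-+ z a a ⟩
      z * a + z * a              ≤⟨ ℕₚ.+-mono-≤ (ℕₚ.<⇒≤ za<n+z) (ℕₚ.<⇒≤ za<n+z) ⟩
      (n + z) + (n + z)          ≤⟨ ℕₚ.+-mono-≤ (ℕₚ.+-monoʳ-≤ n z≤n′) (ℕₚ.+-monoʳ-≤ n z≤n′) ⟩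
      (n + n) + (n + n)          ≡⟨ a-half-identity n ⟩
      4 * n                      ≤⟨ ℕₚ.*-monoˡ-≤ n 4≤z ⟩
      z * n                      ∎)
      where
      open ℕₚ.≤-Reasoning
      z≤n′ : z ≤ n
      z≤n′ = ℕₚ.≤-trans (z≤n₀ D) n₀≤n

    half : n ≤ 2 * b
    half = ℕₚ.+-cancelˡ-≤ (a + a) _ _ (begin
      a + a + n                  ≤⟨ ℕₚ.+-monoˡ-≤ n a-half ⟩
      n + n                      ≡⟨ cong₂ _+_ (sym a+b) (sym a+b) ⟩
      (a + b) + (a + b)          ≡⟨ half-identity a b ⟩
      a + a + 2 * b              ∎)
      where
      open ℕₚ.≤-Reasoning

    1≤D : 1 ≤ D
    1≤D = ℕₚ.≤-trans (s≤s z≤n) (ℕₚ.≤-trans 13≤D₀ D₀≤D)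

    -- One of the four factors D swallows the constant 2 4^κ Γ k! c₀, which is at most `D₀`.
    e-small : ∀ e → e * (D * D * D * D) ≤ c₀ * (n * n ^ κ) → 2 * (4 ^ κ * Γ * (D * D * D) * (k ! * e)) ≤ n * n ^ κ
    e-small e h = cancel-*-≤ D 1≤D (begin
      D * (2 * (4 ^ κ * Γ * (D * D * D) * (k ! * e)))            ≡⟨ e-small-identity D (4 ^ κ) Γ (k !) e ⟩
      2 * (4 ^ κ * Γ * (k ! * (e * (D * D * D * D))))            ≤⟨ ℕₚ.*-monoʳ-≤ 2 (ℕₚ.*-monoʳ-≤ (4 ^ κ * Γ) (ℕₚ.*-monoʳ-≤ (k !) h)) ⟩
      2 * (4 ^ κ * Γ * (k ! * (c₀ * (n * n ^ κ))))               ≡⟨ e-small-identity₂ (4 ^ κ) Γ (k !) c₀ (n * n ^ κ) ⟩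
      2 * (4 ^ κ * Γ * (k ! * c₀)) * (n * n ^ κ)                 ≤⟨ ℕₚ.*-monoˡ-≤ (n * n ^ κ) (ℕₚ.≤-trans edges≤D₀ D₀≤D) ⟩
      D * (n * n ^ κ)                                            ∎)
      where
      open ℕₚ.≤-Reasoning

    module Small (ao bo : ℕ) (ao≤ : ao * Γ * (D * D) ≤ n) (bo≤ : bo * Γ * (D * D) ≤ n) where

      w : ℕ
      w = ao + bo

      enough-A : (s * s⋆ + 5 * s + 5) * suc w ≤ a
      enough-A = scaled-≤ z ((s * s⋆ + 5 * s + 5) * suc w) 0<z n≤za (ℕₚ.*-cancelˡ-≤ 2 (begin
        2 * (z * ((s * s⋆ + 5 * s + 5) * suc w))       ≡⟨ enough-A-identity z (s * s⋆ + 5 * s + 5) w ⟩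
        2 * c₁ + 2 * c₁ * w                            ≤⟨ ℕₚ.+-mono-≤ (ℕₚ.≤-trans (2c₁≤n₀ D) n₀≤n) (fraction₁ (2 * c₁) Γ {D} {n} {ao} {bo} 1≤D (ℕₚ.≤-trans (ℕₚ.≤-reflexive (sym (ℕₚ.*-assoc 2 2 c₁))) 4c₁≤Γ) ao≤ bo≤) ⟩
        n + n                                          ≡⟨ cong (n +_) (sym (ℕₚ.+-identityʳ n)) ⟩
        2 * n                                          ∎))
        where
        open ℕₚ.≤-Reasoning

      sparse-used : 8 * (4 ^ κ * (D * (κ * (cᵤ * w)))) ≤ n
      sparse-used = ℕₚ.≤-trans (ℕₚ.≤-reflexive (sparse-used-identity (4 ^ κ) D κ cᵤ w)) (fraction c₂ Γ {D} {n} {ao} {bo} 1≤D 2c₂≤Γ ao≤ bo≤)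

      enough-room : demand k θ (cᵤ * w) + suc cᵤ * w < a
      enough-room = scaled-≤ z (suc (demand k θ (cᵤ * w) + suc cᵤ * w)) 0<z n≤za (ℕₚ.*-cancelˡ-≤ 4 (begin
        4 * (z * suc (demand k θ (cᵤ * w) + suc cᵤ * w))
          ≡⟨ cong (λ x → 4 * (z * suc (x + suc cᵤ * w))) (demand-linear k θ (cᵤ * w)) ⟩
        4 * (z * suc (cᵤ * w * (2 * k * k + 2) + θ * ((16 * k * k * k + 8 * k) * (2 * k * k + 2) + 8 * k) + (4 * k * k * (2 * k * k + 2) + 2) + suc cᵤ * w))
          ≡⟨ enough-room-identity z cᵤ w (2 * k * k + 2) θ ((16 * k * k * k + 8 * k) * (2 * k * k + 2) + 8 * k) (4 * k * k * (2 * k * k + 2)) ⟩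
        4 * c₃ * w + 4 * c₄ * θ + 4 * c₅
          ≤⟨ ℕₚ.+-mono-≤ (ℕₚ.+-mono-≤ (fraction₁ (4 * c₃) Γ {D} {n} {ao} {bo} 1≤D (ℕₚ.≤-trans (ℕₚ.≤-reflexive (sym (ℕₚ.*-assoc 2 4 c₃))) 8c₃≤Γ) ao≤ bo≤)
               (ℕₚ.≤-trans (ℕₚ.*-monoˡ-≤ θ 4c₄≤M) Mθ≤n)) (ℕₚ.≤-trans (4c₅≤n₀ D) n₀≤n) ⟩
        n + n + n
          ≤⟨ ℕₚ.m≤m+n _ n ⟩
        n + n + n + n
          ≡⟨ enough-room-identity₂ n ⟩
        4 * n ∎))
        where
        open ℕₚ.≤-Reasoning

  -- The theorem without real numbers

  LinkableBy : ∀ {n} → KGraph k n → Subset n → ℕ → List (Fin n) → Set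
  LinkableBy H B D W = ∀ j → j < s′ → deg H (toSubset (drop (j * d) W)) B * D ≤ 6 * (∣ B ∣ C (k ∸ ∣ toSubset (drop (j * d) W) ∣))

  record Instance (n : ℕ) : Set₁ where
    no-eta-equality
    field
      H         : KGraph k n
      A B A′ B′ : Subset n
      D m       : ℕ
      D₀≤D     : D₀ ≤ D
      n₀≤n     : n₀ D ≤ n
      n-eq     : n ≡ m * d
      parts    : ∀ v → lookup A v ≡ not (lookup B v)
      codeg    : ∀ S → ∣ S ∣ ≡ κ → ∣ A ∣ ≤ count (λ v → does (edge? H (S ∪ ⁅ v ⁆)))
      A′-in    : ∀ v → lookup A′ v ≡ true → D * (∣ B ∣ C κ) ≤ deg H ⁅ v ⁆ B * D + 6 * (∣ B ∣ C κ)
      A′-out   : ∀ v → lookup A′ v ≡ false → deg H ⁅ v ⁆ B * D + (∣ B ∣ C κ) ≤ D * (∣ B ∣ C κ)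
      B′-in    : ∀ v → lookup B′ v ≡ true → deg H ⁅ v ⁆ B * D ≤ 6 * (∣ B ∣ C κ)
      B′-out   : ∀ v → lookup B′ v ≡ false → ∣ B ∣ C κ ≤ deg H ⁅ v ⁆ B * D
      e-bound  : e H B * (D * D * D * D) ≤ c₀ * (n * n ^ κ)
      A-lower  : n ≤ z * ∣ A ∣
      A-upper  : z * ∣ A ∣ < n + z

  module Reduced {n : ℕ} (inst : Instance n) where

    open Instance inst

    sizes : Sizes
    sizes = record
      { D = D ; n = n ; a = ∣ A ∣ ; b = ∣ B ∣ ; D₀≤D = D₀≤D ; n₀≤n = n₀≤n ; a+b = sum-parts {A = A} {B} parts ; n≤za = A-lower ; za<n+z = A-upper }

    module Di = Discharge sizes

    extremality : Extremality κ n
    extremality = record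
      { H = H ; A = A ; B = B ; A′ = A′ ; B′ = B′ ; D = D ; Γ = Γ ; parts = parts ; codeg = codeg ; A′-in = A′-in ; A′-out = A′-out ; B′-in = B′-in ; B′-out = B′-out
      ; e-small = Di.e-small (e H B) e-bound ; n-large = ℕₚ.≤-trans (large≤n₀ D) n₀≤n ; half = Di.half
      ; D-large = ℕₚ.≤-trans 13≤D₀ D₀≤D ; Γ-large = 4k≤Γ }

    ao bo : ℕ
    ao = Bounds.ao extremality
    bo = Bounds.bo extremality

    module Sm = Di.Small ao bo (Bounds.ao-small extremality) (Bounds.bo-small extremality)

    n-walk : 2 * (4 ^ κ * (D * (κ * (s′ * d * (κ + s′ * d))))) < n
    n-walk = ℕₚ.≤-<-trans (ℕₚ.*-monoʳ-≤ 2 (ℕₚ.*-monoʳ-≤ (4 ^ κ) (ℕₚ.*-monoʳ-≤ D (ℕₚ.*-monoʳ-≤ κ (ℕₚ.*-mono-≤ grow (ℕₚ.+-monoʳ-≤ κ grow))))))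
      (ℕₚ.<-≤-trans (walk<n₀ D) n₀≤n)
      where
      grow : s′ * d ≤ suc s′ * d
      grow = ℕₚ.*-monoˡ-≤ d (ℕₚ.n≤1+n s′)

    A-low : m ≤ suc s′ * ∣ A ∣
    A-low = cancel-*-≤ d 0<d (begin
      d * m                  ≡⟨ trans (ℕₚ.*-comm d m) (sym n-eq) ⟩
      n                      ≤⟨ A-lower ⟩
      suc s′ * d * ∣ A ∣     ≡⟨ A-low-identity (suc s′) d ∣ A ∣ ⟩
      d * (suc s′ * ∣ A ∣)   ∎)
      where
      open ℕₚ.≤-Reasoning

    A-high : suc s′ * ∣ A ∣ ≤ m + suc s′
    A-high = cancel-*-≤ d 0<d (begin
      d * (suc s′ * ∣ A ∣)   ≡⟨ A-high-identity (suc s′) d ∣ A ∣ ⟩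
      suc s′ * d * ∣ A ∣     ≤⟨ ℕₚ.<⇒≤ A-upper ⟩
      n + suc s′ * d         ≡⟨ cong (_+ suc s′ * d) n-eq ⟩
      m * d + suc s′ * d     ≡⟨ A-high-identity₂ m d (suc s′) ⟩
      d * (m + suc s′)       ∎)
      where
      open ℕₚ.≤-Reasoning

    coreSetting : CoreSetting ρ n
    coreSetting = record
      { hyp = extremality ; resolution = record { M = M ; θ = Di.θ ; n≤Mθ = Di.n≤Mθ ; D>M = ℕₚ.<-≤-trans M<D₀ D₀≤D } ; ℓ = ℓ ; s′ = s′
      ; k-eq = k-eq ; s′d≤κ = s′d≤κ ; ℓ<s′d = ℓ<s′d ; D-dense = ℕₚ.≤-trans dense≤D₀ D₀≤D ; D-κ = ℕₚ.≤-trans κ≤D₀ D₀≤D ; n-walk = n-walk }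

    module _ (q : ℕ) (q-eq : q ≡ count (λ v → lookup A v ∧ lookup B′ v))
      (P : Fin (s * q) → Path ℓ (H [ B′ ])) (P-disjoint : ∀ i j → i ≢ j → Disjoint (Path.vertices (P i)) (Path.vertices (P j)))
      (P-size : ∀ i → Path.size (P i) ≤ s⋆)
      (P-ends : ∀ i → LinkableBy H B D (Path.initialEnd (P i)) × LinkableBy H B D (Path.terminalEnd (P i))) where

      hamilton : ∃[ xs ] (Unique xs × length xs ≡ n × (∀ (i : Fin m) → does (edge? H (toSubset (take k (drop (toℕ i * d) (xs ++ xs))))) ≡ true))
      hamilton = Core.Final.hamilton coreSetting (record
        { m = m ; n-eq = n-eq ; k≤n = ℕₚ.≤-trans (ℕₚ.m≤m+n k d) (ℕₚ.≤-trans (k+d≤n₀ D) n₀≤n) ; s⋆ = s⋆ ; q = q ; q-eq = q-eq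
        ; P = P ; P-disjoint = P-disjoint ; P-size = P-size ; P-ends = P-ends ; A-low = A-low ; A-high = A-high ; A-half = Di.a-half
        ; enough-A = Sm.enough-A ; enough-room = Sm.enough-room ; sparse-used = Sm.sparse-used })

-- Rational and real arithmetic

opaque

  ⟪_⟫ : ℕ → ℚ
  ⟪ n ⟫ = ℤ.+ n ℚ./ 1

  ⟪⟫-def : ∀ n → ℤ.+ n ℚ./ 1 ≡ ⟪ n ⟫
  ⟪⟫-def n = refl

  ⟪0⟫ : ⟪ 0 ⟫ ≡ 0ℚ
  ⟪0⟫ = refl

  ⟪1⟫ : ⟪ 1 ⟫ ≡ 1ℚ
  ⟪1⟫ = refl

⟪⟫-toℚᵘ : ∀ n → ℚ.toℚᵘ ⟪ n ⟫ ℚᵘ.≃ ℚᵘ.mkℚᵘ (ℤ.+ n) 0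
⟪⟫-toℚᵘ n = subst (λ p → ℚ.toℚᵘ p ℚᵘ.≃ ℚᵘ.mkℚᵘ (ℤ.+ n) 0) (⟪⟫-def n) (ℚₚ.toℚᵘ-fromℚᵘ (ℚᵘ.mkℚᵘ (ℤ.+ n) 0))

⟪⟫-+ : ∀ a b → ⟪ a ⟫ ℚ.+ ⟪ b ⟫ ≡ ⟪ a + b ⟫
⟪⟫-+ a b = ℚₚ.toℚᵘ-injective (ℚᵘₚ.≃-trans (ℚₚ.toℚᵘ-homo-+ ⟪ a ⟫ ⟪ b ⟫)
  (ℚᵘₚ.≃-trans (ℚᵘₚ.+-cong (⟪⟫-toℚᵘ a) (⟪⟫-toℚᵘ b))
  (ℚᵘₚ.≃-trans (ℚᵘ.*≡* (cong (ℤ._* ℤ.+ 1) (trans (cong₂ ℤ._+_ (ℤₚ.*-identityʳ (ℤ.+ a)) (ℤₚ.*-identityʳ (ℤ.+ b))) refl))) (ℚᵘₚ.≃-sym (⟪⟫-toℚᵘ (a + b))))))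

⟪⟫-* : ∀ a b → ⟪ a ⟫ ℚ.* ⟪ b ⟫ ≡ ⟪ a * b ⟫
⟪⟫-* a b = ℚₚ.toℚᵘ-injective (ℚᵘₚ.≃-trans (ℚₚ.toℚᵘ-homo-* ⟪ a ⟫ ⟪ b ⟫)
  (ℚᵘₚ.≃-trans (ℚᵘₚ.*-cong (⟪⟫-toℚᵘ a) (⟪⟫-toℚᵘ b))
  (ℚᵘₚ.≃-trans (ℚᵘ.*≡* (cong (ℤ._* ℤ.+ 1) (sym (ℤₚ.pos-* a b)))) (ℚᵘₚ.≃-sym (⟪⟫-toℚᵘ (a * b))))))

⟪⟫-mono : ∀ {a b} → a ≤ b → ⟪ a ⟫ ℚ.≤ ⟪ b ⟫
⟪⟫-mono {a} {b} a≤b = ℚₚ.toℚᵘ-cancel-≤ (ℚᵘₚ.≤-respˡ-≃ (ℚᵘₚ.≃-sym (⟪⟫-toℚᵘ a)) (ℚᵘₚ.≤-respʳ-≃ (ℚᵘₚ.≃-sym (⟪⟫-toℚᵘ b))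
  (ℚᵘ.*≤* (ℤₚ.*-monoʳ-≤-nonNeg (ℤ.+ 1) (ℤ.+≤+ a≤b)))))

⟪⟫-cancel : ∀ {a b} → ⟪ a ⟫ ℚ.≤ ⟪ b ⟫ → a ≤ b
⟪⟫-cancel {a} {b} h with ℚᵘₚ.≤-respˡ-≃ (⟪⟫-toℚᵘ a) (ℚᵘₚ.≤-respʳ-≃ (⟪⟫-toℚᵘ b) (ℚₚ.toℚᵘ-mono-≤ h))
... | ℚᵘ.*≤* g = ℤₚ.drop‿+≤+ (ℤₚ.*-cancelʳ-≤-pos (ℤ.+ a) (ℤ.+ b) (ℤ.+ 1) g)

⟪⟫-cancel-< : ∀ {a b} → ⟪ a ⟫ ℚ.< ⟪ b ⟫ → a < b
⟪⟫-cancel-< h = ℕₚ.≰⇒> λ b≤a → ℚₚ.<-irrefl refl (ℚₚ.<-≤-trans h (⟪⟫-mono b≤a))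

⟪⟫-mono-< : ∀ {a b} → a < b → ⟪ a ⟫ ℚ.< ⟪ b ⟫
⟪⟫-mono-< h = ℚₚ.≰⇒> λ b≤a → ℕₚ.<⇒≱ h (⟪⟫-cancel b≤a)

0≤⟪⟫ : ∀ n → 0ℚ ℚ.≤ ⟪ n ⟫
0≤⟪⟫ n = subst (ℚ._≤ ⟪ n ⟫) ⟪0⟫ (⟪⟫-mono z≤n)

floor-bounds : ∀ p N → ℤ.+ N ≡ ℚ.floor p → ⟪ N ⟫ ℚ.≤ p × p ℚ.< ⟪ suc N ⟫
floor-bounds p@(ℚ.mkℚ a b-1 _) N eq =
  ℚₚ.toℚᵘ-cancel-≤ (ℚᵘₚ.≤-respˡ-≃ (ℚᵘₚ.≃-sym (⟪⟫-toℚᵘ N)) (ℚᵘ.*≤* (subst₂ ℤ._≤_ (cong (ℤ._* ℤ.+ suc b-1) (sym eq)) (sym (ℤₚ.*-identityʳ a)) (ℤ-DivMod.[n/d]*d≤n a (ℤ.+ suc b-1))))) ,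
  ℚₚ.toℚᵘ-cancel-< (ℚᵘₚ.<-respʳ-≃ (ℚᵘₚ.≃-sym (⟪⟫-toℚᵘ (suc N))) (ℚᵘ.*<* (subst₂ ℤ._<_ (sym (ℤₚ.*-identityʳ a))
    (cong (λ x → ℤ.suc x ℤ.* ℤ.+ suc b-1) (trans (sym (ℤ-DivMod.div-pos-is-/ℕ a (suc b-1))) (sym eq))) (ℤ-DivMod.n<s[n/ℕd]*d a (suc b-1)))))

archimedean : ∀ p → ∃[ K ] p ℚ.≤ ⟪ K ⟫
archimedean p@(ℚ.mkℚ a b-1 _) = ℤ.∣ a ∣ , ℚₚ.toℚᵘ-cancel-≤ (ℚᵘₚ.≤-respʳ-≃ (ℚᵘₚ.≃-sym (⟪⟫-toℚᵘ ℤ.∣ a ∣))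
  (ℚᵘ.*≤* (subst (ℤ._≤ ℤ.+ ℤ.∣ a ∣ ℤ.* ℤ.+ suc b-1) (sym (ℤₚ.*-identityʳ a)) (bound a))))
  where
  bound : ∀ a → a ℤ.≤ ℤ.+ ℤ.∣ a ∣ ℤ.* ℤ.+ suc b-1
  bound (ℤ.+ a) = subst (ℤ.+ a ℤ.≤_) (ℤₚ.pos-* a (suc b-1)) (ℤ.+≤+ (ℕₚ.m≤m*n a (suc b-1)))
  bound -[1+ a ] = ℤ.-≤+

-- p ≤ q is proved by writing q - p as a nonnegative combination of nonnegative rationals.

diff : ∀ {p q} → p ℚ.≤ q → 0ℚ ℚ.≤ q ℚ.- p
diff {p} {q} h = subst (ℚ._≤ q ℚ.- p) (ℚₚ.+-inverseʳ p) (ℚₚ.+-monoˡ-≤ (ℚ.- p) h)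

from-diff : ∀ {p q r} → 0ℚ ℚ.≤ r → p ℚ.+ r ≡ q → p ℚ.≤ q
from-diff {p} {q} {r} h eq = subst (p ℚ.≤_) eq (subst (ℚ._≤ p ℚ.+ r) (ℚₚ.+-identityʳ p) (ℚₚ.+-monoʳ-≤ p h))

infixl 6 _⊕_
infixl 7 _⊛_

_⊕_ : ∀ {p q} → 0ℚ ℚ.≤ p → 0ℚ ℚ.≤ q → 0ℚ ℚ.≤ p ℚ.+ q
_⊕_ {p} {q} 0≤p 0≤q = subst (ℚ._≤ p ℚ.+ q) (ℚₚ.+-identityʳ 0ℚ) (ℚₚ.+-mono-≤ 0≤p 0≤q)

_⊛_ : ∀ {p q} → 0ℚ ℚ.≤ p → 0ℚ ℚ.≤ q → 0ℚ ℚ.≤ p ℚ.* q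
_⊛_ {p} {q} 0≤p 0≤q = subst (ℚ._≤ p ℚ.* q) (ℚₚ.*-zeroʳ p) (ℚₚ.*-monoˡ-≤-nonNeg p {{ℚ.nonNegative 0≤p}} 0≤q)

*-pos : ∀ {p q} → 0ℚ ℚ.< p → 0ℚ ℚ.< q → 0ℚ ℚ.< p ℚ.* q
*-pos {p} {q} 0<p 0<q = subst (ℚ._< p ℚ.* q) (ℚₚ.*-zeroʳ p) (ℚₚ.*-monoʳ-<-pos p {{ℚ.positive 0<p}} 0<q)

*-mono : ∀ {p q r t} → 0ℚ ℚ.≤ p → 0ℚ ℚ.≤ r → p ℚ.≤ q → r ℚ.≤ t → p ℚ.* r ℚ.≤ q ℚ.* t
*-mono {p} {q} {r} {t} 0≤p 0≤r p≤q r≤t = ℚₚ.≤-trans (ℚₚ.*-monoˡ-≤-nonNeg p {{ℚ.nonNegative 0≤p}} r≤t)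
  (ℚₚ.*-monoʳ-≤-nonNeg t {{ℚ.nonNegative (ℚₚ.≤-trans 0≤r r≤t)}} p≤q)

cancel-≤ : ∀ r {p q} → 0ℚ ℚ.< r → r ℚ.* p ℚ.≤ r ℚ.* q → p ℚ.≤ q
cancel-≤ r 0<r = ℚₚ.*-cancelˡ-≤-pos r {{ℚ.positive 0<r}}

reciprocal : ∀ p → 0ℚ ℚ.< p → ∃[ r ] (0ℚ ℚ.< r × p ℚ.* r ≡ 1ℚ)
reciprocal p 0<p = (ℚ.1/ p) {{ℚ.>-nonZero 0<p}} , ℚₚ.positive⁻¹ _ {{ℚₚ.1/pos⇒pos p {{ℚ.positive 0<p}}}} , ℚₚ.*-inverseʳ p {{ℚ.>-nonZero 0<p}}

archimedean-* : ∀ p → 0ℚ ℚ.< p → ∀ q → ∃[ K ] q ℚ.≤ p ℚ.* ⟪ K ⟫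
archimedean-* p 0<p q = let (r , 0<r , pr≡1) = reciprocal p 0<p ; (K , h) = archimedean (r ℚ.* q) in
  K , ℚₚ.≤-trans (ℚₚ.≤-reflexive (trans (sym (trans (cong (ℚ._* q) pr≡1) (ℚₚ.*-identityˡ q))) (ℚₚ.*-assoc p r q)))
        (ℚₚ.*-monoˡ-≤-nonNeg p {{ℚ.nonNegative (ℚₚ.<⇒≤ 0<p)}} h)

-- The witness is the least D with 2 ≤ p * D.
scale : ∀ p → 0ℚ ℚ.< p → p ℚ.≤ 1ℚ → ∃[ D ] (⟪ 2 ⟫ ℚ.≤ p ℚ.* ⟪ D ⟫ × p ℚ.* ⟪ D ⟫ ℚ.≤ ⟪ 3 ⟫)
scale p 0<p p≤1 = let (K , h) = archimedean-* p 0<p ⟪ 2 ⟫ in search K h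
  where
  search : ∀ K → ⟪ 2 ⟫ ℚ.≤ p ℚ.* ⟪ K ⟫ → ∃[ D ] (⟪ 2 ⟫ ℚ.≤ p ℚ.* ⟪ D ⟫ × p ℚ.* ⟪ D ⟫ ℚ.≤ ⟪ 3 ⟫)
  search zero h = ⊥-elim (ℕₚ.<⇒≱ {0} {2} (s≤s z≤n) (⟪⟫-cancel (subst (⟪ 2 ⟫ ℚ.≤_) (trans (cong (p ℚ.*_) ⟪0⟫) (trans (ℚₚ.*-zeroʳ p) (sym ⟪0⟫))) h)))
  search (suc K) h with ⟪ 2 ⟫ ℚₚ.≤? p ℚ.* ⟪ K ⟫
  ... | yes g = search K g
  ... | no ¬g = suc K , h , ℚₚ.≤-trans (ℚₚ.≤-reflexive (trans (cong (p ℚ.*_) (sym (⟪⟫-+ 1 K))) (trans (ℚₚ.*-distribˡ-+ p ⟪ 1 ⟫ ⟪ K ⟫) (cong (ℚ._+ p ℚ.* ⟪ K ⟫) (trans (cong (p ℚ.*_) ⟪1⟫) (ℚₚ.*-identityʳ p))))))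
        (subst (p ℚ.+ p ℚ.* ⟪ K ⟫ ℚ.≤_) (⟪⟫-+ 1 2) (ℚₚ.+-mono-≤ (subst (p ℚ.≤_) (sym ⟪1⟫) p≤1) (ℚₚ.<⇒≤ (ℚₚ.≰⇒> ¬g))))

Eventually : (ℕ → Set) → Set
Eventually P = ∃[ N ] ∀ n → N ≤ n → P n

both : ∀ {P Q} → Eventually P → Eventually Q → Eventually (λ n → P n × Q n)
both (M , p) (N , q) = M ⊔ N , λ n h → p n (ℕₚ.m⊔n≤o⇒m≤o M N h) , q n (ℕₚ.m⊔n≤o⇒n≤o M N h)

∣∣-bounds : ∀ {p q} → ℚ.∣ p ∣ ℚ.< q → p ℚ.≤ q × ℚ.- p ℚ.≤ q
∣∣-bounds {p} {q} h = upper p h , upper (ℚ.- p) (subst (ℚ._< q) (sym (ℚₚ.∣-p∣≡∣p∣ p)) h)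
  where
  upper : ∀ p → ℚ.∣ p ∣ ℚ.< q → p ℚ.≤ q
  upper p h with ℚ._≤?_ 0ℚ p
  ... | yes 0≤p = subst (ℚ._≤ q) (ℚₚ.0≤p⇒∣p∣≡p 0≤p) (ℚₚ.<⇒≤ h)
  ... | no ¬0≤p = ℚₚ.≤-trans (ℚₚ.<⇒≤ (ℚₚ.≰⇒> ¬0≤p)) (ℚₚ.≤-trans (ℚₚ.0≤∣p∣ p) (ℚₚ.<⇒≤ h))

near : ∀ x h → 0ℚ ℚ.< h → ∃[ N ] ∀ n → N ≤ n → seq x n ℚ.≤ seq x N ℚ.+ h × seq x N ℚ.≤ seq x n ℚ.+ h
near x h 0<h = let (N , c) = cauchy x h 0<h in N , λ n N≤n →
  let (u , l) = ∣∣-bounds (c n N N≤n ℕₚ.≤-refl) in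
  from-diff (diff u) (arith₁ (seq x n) (seq x N) h) , from-diff (diff l) (arith₂ (seq x n) (seq x N) h)
  where
  open +-*-Solver
  arith₁ : ∀ a b h → a ℚ.+ (h ℚ.- (a ℚ.- b)) ≡ b ℚ.+ h
  arith₁ = solve 3 (λ a b h → a :+ (h :- (a :- b)) := b :+ h) refl
  arith₂ : ∀ a b h → b ℚ.+ (h ℚ.- (ℚ.- (a ℚ.- b))) ≡ a ℚ.+ h
  arith₂ = solve 3 (λ a b h → b :+ (h :- (:- (a :- b))) := a :+ h) refl

module Compare (a b : ℕ → ℚ) (c f : ℚ) (0<f : 0ℚ ℚ.< f) where

  open +-*-Solver

  lesser : ∀ n → c ℚ.≤ f ℚ.+ f ℚ.+ f → a n ℚ.- b n ℚ.≤ c ℚ.+ f → a n ℚ.≤ b n ℚ.+ (f ℚ.+ f ℚ.+ (f ℚ.+ f))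
  lesser n p q = from-diff (diff p ⊕ diff q) (arith (a n) (b n) c f)
    where
    arith : ∀ a b c f → a ℚ.+ ((f ℚ.+ f ℚ.+ f ℚ.- c) ℚ.+ (c ℚ.+ f ℚ.- (a ℚ.- b))) ≡ b ℚ.+ (f ℚ.+ f ℚ.+ (f ℚ.+ f))
    arith = solve 4 (λ a b c f → a :+ ((f :+ f :+ f :- c) :+ (c :+ f :- (a :- b))) := b :+ (f :+ f :+ (f :+ f))) refl

  greater : ∀ n → ¬ (c ℚ.≤ f ℚ.+ f ℚ.+ f) → c ℚ.≤ a n ℚ.- b n ℚ.+ f → b n ℚ.+ f ℚ.≤ a n
  greater n p q = from-diff (diff (ℚₚ.<⇒≤ (ℚₚ.≰⇒> p)) ⊕ diff q ⊕ ℚₚ.<⇒≤ 0<f) (arith (a n) (b n) c f)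
    where
    arith : ∀ a b c f → b ℚ.+ f ℚ.+ ((c ℚ.- (f ℚ.+ f ℚ.+ f)) ℚ.+ (a ℚ.- b ℚ.+ f ℚ.- c) ℚ.+ f) ≡ a
    arith = solve 4 (λ a b c f → b :+ f :+ ((c :- (f :+ f :+ f)) :+ (a :- b :+ f :- c) :+ f) := a) refl

abstract

  half-split : ∀ h → 0ℚ ℚ.< h → ∃[ g ] (0ℚ ℚ.< g × g ℚ.+ g ≡ h)
  half-split h 0<h = ℚ.½ ℚ.* h , *-pos (ℚₚ.positive⁻¹ ℚ.½) 0<h , trans (sym (ℚₚ.*-distribʳ-+ h ℚ.½ ℚ.½)) (ℚₚ.*-identityˡ h)

  quarter-split : ∀ h → 0ℚ ℚ.< h → ∃[ f ] (0ℚ ℚ.< f × f ℚ.+ f ℚ.+ (f ℚ.+ f) ≡ h)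
  quarter-split h 0<h = let (g , 0<g , eq) = half-split h 0<h ; (f , 0<f , eq′) = half-split g 0<g in f , 0<f , trans (cong₂ ℚ._+_ eq′ eq′) eq

-- Up to an arbitrarily small error h, the real order is the eventual order of the approximating sequences.
≤ᴿ-eventually : ∀ x y → x ≤ᴿ y → ∀ h → 0ℚ ℚ.< h → Eventually (λ n → seq x n ℚ.≤ seq y n ℚ.+ h)
≤ᴿ-eventually x y x≤y h 0<h = subst (λ h → Eventually (λ n → seq x n ℚ.≤ seq y n ℚ.+ h)) eq (split (c ℚₚ.≤? f ℚ.+ f ℚ.+ f))
  where
  f : ℚ
  f = proj₁ (quarter-split h 0<h)
  0<f : 0ℚ ℚ.< f
  0<f = proj₁ (proj₂ (quarter-split h 0<h))
  eq : f ℚ.+ f ℚ.+ (f ℚ.+ f) ≡ h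
  eq = proj₂ (proj₂ (quarter-split h 0<h))
  N : ℕ
  N = proj₁ (near (x -ᴿ y) f 0<f)
  c : ℚ
  c = seq (x -ᴿ y) N
  close : ∀ n → N ≤ n → seq (x -ᴿ y) n ℚ.≤ c ℚ.+ f × c ℚ.≤ seq (x -ᴿ y) n ℚ.+ f
  close = proj₂ (near (x -ᴿ y) f 0<f)
  -- The rational c approximates x - y up to f = h/4, so comparing it with 3f is decidable: either
  -- all later differences are at most 4f = h, or all are at least f, which witnesses `y <ᴿ x`.
  split : Dec (c ℚ.≤ f ℚ.+ f ℚ.+ f) → Eventually (λ n → seq x n ℚ.≤ seq y n ℚ.+ (f ℚ.+ f ℚ.+ (f ℚ.+ f)))
  split (yes p) = N , λ n N≤n → Compare.lesser (seq x) (seq y) c f 0<f n p (proj₁ (close n N≤n))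
  split (no ¬p) = ⊥-elim (x≤y (f , 0<f , N , λ n N≤n → Compare.greater (seq x) (seq y) c f 0<f n ¬p (proj₂ (close n N≤n))))

0<1 : 0ℚ ℚ.< 1ℚ
0<1 = ℚₚ.positive⁻¹ 1ℚ

0<⟪⟫ : ∀ {n} → 1 ≤ n → 0ℚ ℚ.< ⟪ n ⟫
0<⟪⟫ {n} 1≤n = subst (ℚ._< ⟪ n ⟫) ⟪0⟫ (⟪⟫-mono-< 1≤n)

nonpositive : ∀ {p r} → 0ℚ ℚ.< p → 0ℚ ℚ.≤ r → p ℚ.+ r ≡ 0ℚ → ⊥
nonpositive 0<p 0≤r eq = ℚₚ.<-irrefl refl (ℚₚ.<-≤-trans 0<p (from-diff 0≤r eq))

fourth : ℚ → ℚ
fourth p = (p ℚ.* p) ℚ.* (p ℚ.* p)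

square-bound : ∀ {p q} → ℚ.- q ℚ.≤ p → p ℚ.≤ q → p ℚ.* p ℚ.≤ q ℚ.* q
square-bound {p} {q} -q≤p p≤q = from-diff (diff p≤q ⊛ diff -q≤p) (arith p q)
  where
  open +-*-Solver
  arith : ∀ p q → p ℚ.* p ℚ.+ (q ℚ.- p) ℚ.* (p ℚ.- ℚ.- q) ≡ q ℚ.* q
  arith = solve 2 (λ p q → p :* p :+ (q :- p) :* (p :- (:- q)) := q :* q) refl

0≤square : ∀ p → 0ℚ ℚ.≤ p ℚ.* p
0≤square p with ℚ._≤?_ 0ℚ p
... | yes 0≤p = 0≤p ⊛ 0≤p
... | no ¬0≤p = subst (0ℚ ℚ.≤_) (arith p) (0≤-p ⊛ 0≤-p)
  where
  open +-*-Solver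
  0≤-p : 0ℚ ℚ.≤ ℚ.- p
  0≤-p = ℚₚ.neg-antimono-≤ (ℚₚ.<⇒≤ (ℚₚ.≰⇒> ¬0≤p))
  arith : ∀ p → ℚ.- p ℚ.* ℚ.- p ≡ p ℚ.* p
  arith = solve 1 (λ p → :- p :* :- p := p :* p) refl

fourth-bound : ∀ {p q} → ℚ.- q ℚ.≤ p → p ℚ.≤ q → fourth p ℚ.≤ fourth q
fourth-bound {p} {q} -q≤p p≤q = *-mono (0≤square p) (0≤square p) (square-bound -q≤p p≤q) (square-bound -q≤p p≤q)

fourth-pos : ∀ {p} → 0ℚ ℚ.< p → 0ℚ ℚ.< fourth p
fourth-pos 0<p = *-pos (*-pos 0<p 0<p) (*-pos 0<p 0<p)

below-both : ∀ g → 0ℚ ℚ.< g → ∃[ τ ] (0ℚ ℚ.< τ × τ ℚ.≤ g × τ ℚ.≤ 1ℚ)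
below-both g 0<g with g ℚₚ.≤? 1ℚ
... | yes g≤1 = g , 0<g , ℚₚ.≤-refl , g≤1
... | no ¬g≤1 = 1ℚ , 0<1 , ℚₚ.<⇒≤ (ℚₚ.≰⇒> ¬g≤1) , ℚₚ.≤-refl

fourth≤ : ∀ {τ} → 0ℚ ℚ.≤ τ → τ ℚ.≤ 1ℚ → fourth τ ℚ.≤ τ
fourth≤ {τ} 0≤τ τ≤1 = subst (fourth τ ℚ.≤_) (ℚₚ.*-identityʳ τ)
  (subst (fourth τ ℚ.≤_) (cong (ℚ._* 1ℚ) (ℚₚ.*-identityʳ τ))
    (*-mono (0≤τ ⊛ 0≤τ) (0≤τ ⊛ 0≤τ) (*-mono 0≤τ 0≤τ ℚₚ.≤-refl τ≤1)
      (subst (τ ℚ.* τ ℚ.≤_) (ℚₚ.*-identityʳ 1ℚ) (*-mono 0≤τ 0≤τ τ≤1 τ≤1))))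

-- If u < τ, then |u| ≤ τ and u⁴ ≤ τ⁴ ≤ τ ≤ g, so 4g = K η ≤ K t ≤ u⁴ + g ≤ 2g, which is absurd for
-- g > 0. The bound 0 ≤ u + τ replaces nonnegativity of u, which the approximations satisfy only up
-- to an error.
root-lower : ∀ {K η t g τ u} → 0ℚ ℚ.≤ K → 0ℚ ℚ.< g → g ℚ.+ g ℚ.+ (g ℚ.+ g) ≡ K ℚ.* η → 0ℚ ℚ.< τ → τ ℚ.≤ g → τ ℚ.≤ 1ℚ →
             η ℚ.≤ t → 0ℚ ℚ.≤ u ℚ.+ τ → K ℚ.* t ℚ.≤ fourth u ℚ.+ g → τ ℚ.≤ u
root-lower {K} {η} {t} {g} {τ} {u} 0≤K 0<g eq 0<τ τ≤g τ≤1 η≤t 0≤u+τ h with τ ℚₚ.≤? u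
... | yes τ≤u = τ≤u
... | no ¬τ≤u = ⊥-elim (nonpositive 0<g (ℚₚ.<⇒≤ 0<g ⊕ diff (ℚₚ.≤-trans (ℚₚ.≤-reflexive eq) (ℚₚ.≤-trans Kη≤ small))) (arith g))
  where
  open +-*-Solver
  arith : ∀ g → g ℚ.+ (g ℚ.+ (g ℚ.+ g ℚ.- (g ℚ.+ g ℚ.+ (g ℚ.+ g)))) ≡ 0ℚ
  arith = solve 1 (λ g → g :+ (g :+ (g :+ g :- (g :+ g :+ (g :+ g)))) := con 0ℚ) refl
  arith′ : ∀ u τ → ℚ.- τ ℚ.+ (u ℚ.+ τ) ≡ u
  arith′ = solve 2 (λ u τ → :- τ :+ (u :+ τ) := u) refl
  Kη≤ : K ℚ.* η ℚ.≤ K ℚ.* t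
  Kη≤ = ℚₚ.*-monoˡ-≤-nonNeg K {{ℚ.nonNegative 0≤K}} η≤t
  u⁴≤g : fourth u ℚ.≤ g
  u⁴≤g = ℚₚ.≤-trans (fourth-bound (from-diff 0≤u+τ (arith′ u τ)) (ℚₚ.<⇒≤ (ℚₚ.≰⇒> ¬τ≤u))) (ℚₚ.≤-trans (fourth≤ (ℚₚ.<⇒≤ 0<τ) τ≤1) τ≤g)
  small : K ℚ.* t ℚ.≤ g ℚ.+ g
  small = ℚₚ.≤-trans h (ℚₚ.+-monoˡ-≤ g u⁴≤g)

four : ℚ → ℚ
four p = p ℚ.+ p ℚ.+ p ℚ.+ p

-- With Y = 4 X⁴, the inequality u X > 1 would give Y u⁴ ≥ 4, whereas Y (2 K δ₀ + h) = 3. The second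
-- δ₀ is the error allowed in the approximation of t.
root-upper : ∀ {K X t u δ₀ h} → 0ℚ ℚ.< K → 0ℚ ℚ.< X → four (fourth X) ℚ.* K ℚ.* δ₀ ≡ 1ℚ → four (fourth X) ℚ.* h ≡ 1ℚ →
             t ℚ.≤ δ₀ ℚ.+ δ₀ → fourth u ℚ.≤ K ℚ.* t ℚ.+ h → u ℚ.* X ℚ.≤ 1ℚ
root-upper {K} {X} {t} {u} {δ₀} {h} 0<K 0<X eq eq′ t≤ u⁴≤ with u ℚ.* X ℚₚ.≤? 1ℚ
... | yes small = small
... | no large = ⊥-elim (nonpositive 0<1 (diff (ℚₚ.≤-trans (ℚₚ.≤-trans four≤ step₁) step₂)) (arith 1ℚ))
  where
  open +-*-Solver
  Y : ℚ
  Y = four (fourth X)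
  0≤X⁴ : 0ℚ ℚ.≤ fourth X
  0≤X⁴ = ℚₚ.<⇒≤ (fourth-pos 0<X)
  0≤Y : 0ℚ ℚ.≤ Y
  0≤Y = 0≤X⁴ ⊕ 0≤X⁴ ⊕ 0≤X⁴ ⊕ 0≤X⁴
  arith : ∀ i → i ℚ.+ (i ℚ.+ i ℚ.+ i ℚ.- (i ℚ.+ i ℚ.+ i ℚ.+ i)) ≡ 0ℚ
  arith = solve 1 (λ i → i :+ (i :+ i :+ i :- (i :+ i :+ i :+ i)) := con 0ℚ) refl
  1≤uX : 1ℚ ℚ.≤ u ℚ.* X
  1≤uX = ℚₚ.<⇒≤ (ℚₚ.≰⇒> large)
  1≤ : 1ℚ ℚ.≤ fourth (u ℚ.* X)
  1≤ = *-mono (ℚₚ.<⇒≤ 0<1) (ℚₚ.<⇒≤ 0<1) square square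
    where
    square : 1ℚ ℚ.≤ (u ℚ.* X) ℚ.* (u ℚ.* X)
    square = *-mono (ℚₚ.<⇒≤ 0<1) (ℚₚ.<⇒≤ 0<1) 1≤uX 1≤uX
  rearrange : ∀ u X → four (fourth (u ℚ.* X)) ≡ four (fourth X) ℚ.* fourth u
  rearrange = solve 2 (λ u X → let w = ((u :* X) :* (u :* X)) :* ((u :* X) :* (u :* X)) ; x = (X :* X) :* (X :* X) in
    w :+ w :+ w :+ w := (x :+ x :+ x :+ x) :* ((u :* u) :* (u :* u))) refl
  four≤ : four 1ℚ ℚ.≤ Y ℚ.* fourth u
  four≤ = subst (four 1ℚ ℚ.≤_) (rearrange u X) (ℚₚ.+-mono-≤ (ℚₚ.+-mono-≤ (ℚₚ.+-mono-≤ 1≤ 1≤) 1≤) 1≤)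
  step₁ : Y ℚ.* fourth u ℚ.≤ Y ℚ.* (K ℚ.* (δ₀ ℚ.+ δ₀) ℚ.+ h)
  step₁ = ℚₚ.*-monoˡ-≤-nonNeg Y {{ℚ.nonNegative 0≤Y}} (ℚₚ.≤-trans u⁴≤ (ℚₚ.+-monoˡ-≤ h (ℚₚ.*-monoˡ-≤-nonNeg K {{ℚ.nonNegative (ℚₚ.<⇒≤ 0<K)}} t≤)))
  distribute : ∀ y K d h → y ℚ.* (K ℚ.* (d ℚ.+ d) ℚ.+ h) ≡ y ℚ.* K ℚ.* d ℚ.+ y ℚ.* K ℚ.* d ℚ.+ y ℚ.* h
  distribute = solve 4 (λ y K d h → y :* (K :* (d :+ d) :+ h) := y :* K :* d :+ y :* K :* d :+ y :* h) refl
  step₂ : Y ℚ.* (K ℚ.* (δ₀ ℚ.+ δ₀) ℚ.+ h) ℚ.≤ 1ℚ ℚ.+ 1ℚ ℚ.+ 1ℚ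
  step₂ = ℚₚ.≤-reflexive (trans (distribute Y K δ₀ h) (cong₂ ℚ._+_ (cong₂ ℚ._+_ eq eq) eq′))

-- Any D with ε * D bounded away from 0 and bounded above can replace the real number ε.
Calibrated : ℝ → ℕ → Set
Calibrated x D = Eventually (λ n → 1ℚ ℚ.≤ seq x n ℚ.* ⟪ D ⟫ × seq x n ℚ.* ⟪ D ⟫ ℚ.≤ ⟪ 5 ⟫)

-- `D` is fitted to a single approximation u₀, with 2 ≤ u₀ D ≤ 3. Later terms differ from u₀ by at
-- most 2f = τ/2 ≤ u₀/2, so they stay between u₀/2 and 3 u₀/2, which leads to the bounds 1 and 9/2 ≤
-- 5. From u₀ X ≤ 1 < u₀ D follows `X ≤ D`.
calibrate : ∀ x X τ → 1 ≤ X → 0ℚ ℚ.< τ → Eventually (λ n → τ ℚ.≤ seq x n) → Eventually (λ n → seq x n ℚ.* ⟪ X ⟫ ℚ.≤ 1ℚ) →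
            ∃[ D ] (X ≤ D × Calibrated x D)
calibrate x X τ 1≤X 0<τ (N₁ , lower) (N₂ , upper) with quarter-split τ 0<τ
... | f , 0<f , eq = D , X≤D , N , λ n N≤n → bounds (seq x n) (proj₁ (close n N≤n)) (proj₂ (close n N≤n))
  where
  open +-*-Solver
  N M : ℕ
  N = proj₁ (near x f 0<f)
  M = N ⊔ (N₁ ⊔ N₂)
  c u₀ : ℚ
  c = seq x N
  u₀ = seq x M
  close : ∀ n → N ≤ n → seq x n ℚ.≤ c ℚ.+ f × c ℚ.≤ seq x n ℚ.+ f
  close = proj₂ (near x f 0<f)
  N₁⊔N₂≤M : N₁ ⊔ N₂ ≤ M
  N₁⊔N₂≤M = ℕₚ.m≤n⊔m N (N₁ ⊔ N₂)
  τ≤e : τ ℚ.≤ u₀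
  τ≤e = lower M (ℕₚ.≤-trans (ℕₚ.m≤m⊔n N₁ N₂) N₁⊔N₂≤M)
  eX≤1 : u₀ ℚ.* ⟪ X ⟫ ℚ.≤ 1ℚ
  eX≤1 = upper M (ℕₚ.≤-trans (ℕₚ.m≤n⊔m N₁ N₂) N₁⊔N₂≤M)
  0<e : 0ℚ ℚ.< u₀
  0<e = ℚₚ.<-≤-trans 0<τ τ≤e
  0≤e : 0ℚ ℚ.≤ u₀
  0≤e = ℚₚ.<⇒≤ 0<e
  e≤1 : u₀ ℚ.≤ 1ℚ
  e≤1 = ℚₚ.≤-trans (subst (ℚ._≤ u₀ ℚ.* ⟪ X ⟫) (ℚₚ.*-identityʳ u₀) (ℚₚ.*-monoˡ-≤-nonNeg u₀ {{ℚ.nonNegative 0≤e}} (subst (ℚ._≤ ⟪ X ⟫) ⟪1⟫ (⟪⟫-mono 1≤X)))) eX≤1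
  D : ℕ
  D = proj₁ (scale u₀ 0<e e≤1)
  2≤eD : ⟪ 2 ⟫ ℚ.≤ u₀ ℚ.* ⟪ D ⟫
  2≤eD = proj₁ (proj₂ (scale u₀ 0<e e≤1))
  eD≤3 : u₀ ℚ.* ⟪ D ⟫ ℚ.≤ ⟪ 3 ⟫
  eD≤3 = proj₂ (proj₂ (scale u₀ 0<e e≤1))
  X≤D : X ≤ D
  X≤D = ℕₚ.≮⇒≥ λ D<X → ℕₚ.<⇒≱ {1} {2} (s≤s (s≤s z≤n)) (⟪⟫-cancel (ℚₚ.≤-trans 2≤eD
    (ℚₚ.≤-trans (ℚₚ.*-monoˡ-≤-nonNeg u₀ {{ℚ.nonNegative 0≤e}} (⟪⟫-mono (ℕₚ.<⇒≤ D<X))) (subst (u₀ ℚ.* ⟪ X ⟫ ℚ.≤_) (sym ⟪1⟫) eX≤1))))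
  0≤D : 0ℚ ℚ.≤ ⟪ D ⟫
  0≤D = 0≤⟪⟫ D
  bounds : ∀ u → u ℚ.≤ c ℚ.+ f → c ℚ.≤ u ℚ.+ f → 1ℚ ℚ.≤ u ℚ.* ⟪ D ⟫ × u ℚ.* ⟪ D ⟫ ℚ.≤ ⟪ 5 ⟫
  bounds u u≤ ≤u = subst (ℚ._≤ u ℚ.* ⟪ D ⟫) ⟪1⟫ (halve (⟪⟫-+ 1 1) (ℚₚ.≤-trans 2≤eD double-lower))
                 , halve refl (ℚₚ.≤-trans double-upper (ℚₚ.≤-trans (ℚₚ.+-mono-≤ (ℚₚ.+-mono-≤ eD≤3 eD≤3) eD≤3) nine≤))
    where
    halve : ∀ {p q r} → p ℚ.+ p ≡ r → r ℚ.≤ q ℚ.+ q → p ℚ.≤ q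
    halve {p} {q} refl h = ℚₚ.≮⇒≥ λ q<p → ℚₚ.<-irrefl refl (ℚₚ.<-≤-trans (ℚₚ.+-mono-< q<p q<p) h)
    nine≤ : ⟪ 3 ⟫ ℚ.+ ⟪ 3 ⟫ ℚ.+ ⟪ 3 ⟫ ℚ.≤ ⟪ 5 ⟫ ℚ.+ ⟪ 5 ⟫
    nine≤ = subst₂ ℚ._≤_ (sym (trans (cong (ℚ._+ ⟪ 3 ⟫) (⟪⟫-+ 3 3)) (⟪⟫-+ 6 3))) (sym (⟪⟫-+ 5 5)) (⟪⟫-mono (ℕₚ.n≤1+n 9))
    e-close : 0ℚ ℚ.≤ u₀ ℚ.- (f ℚ.+ f ℚ.+ (f ℚ.+ f))
    e-close = diff (ℚₚ.≤-trans (ℚₚ.≤-reflexive eq) τ≤e)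
    double-lower : u₀ ℚ.* ⟪ D ⟫ ℚ.≤ u ℚ.* ⟪ D ⟫ ℚ.+ u ℚ.* ⟪ D ⟫
    double-lower = from-diff ((e-close ⊕ (diff (proj₁ (close M (ℕₚ.m≤m⊔n N _))) ⊕ diff ≤u) ⊕ (diff (proj₁ (close M (ℕₚ.m≤m⊔n N _))) ⊕ diff ≤u)) ⊛ 0≤D) (arith u₀ f c u ⟪ D ⟫)
      where
      arith : ∀ E f c u d → E ℚ.* d ℚ.+ (E ℚ.- (f ℚ.+ f ℚ.+ (f ℚ.+ f)) ℚ.+ ((c ℚ.+ f ℚ.- E) ℚ.+ (u ℚ.+ f ℚ.- c)) ℚ.+ ((c ℚ.+ f ℚ.- E) ℚ.+ (u ℚ.+ f ℚ.- c))) ℚ.* d ≡ u ℚ.* d ℚ.+ u ℚ.* d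
      arith = solve 5 (λ E f c u d → E :* d :+ (E :- (f :+ f :+ (f :+ f)) :+ ((c :+ f :- E) :+ (u :+ f :- c)) :+ ((c :+ f :- E) :+ (u :+ f :- c))) :* d := u :* d :+ u :* d) refl
    double-upper : u ℚ.* ⟪ D ⟫ ℚ.+ u ℚ.* ⟪ D ⟫ ℚ.≤ u₀ ℚ.* ⟪ D ⟫ ℚ.+ u₀ ℚ.* ⟪ D ⟫ ℚ.+ u₀ ℚ.* ⟪ D ⟫
    double-upper = from-diff ((e-close ⊕ (diff u≤ ⊕ diff (proj₂ (close M (ℕₚ.m≤m⊔n N _)))) ⊕ (diff u≤ ⊕ diff (proj₂ (close M (ℕₚ.m≤m⊔n N _))))) ⊛ 0≤D) (arith u₀ f c u ⟪ D ⟫)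
      where
      arith : ∀ E f c u d → u ℚ.* d ℚ.+ u ℚ.* d ℚ.+ (E ℚ.- (f ℚ.+ f ℚ.+ (f ℚ.+ f)) ℚ.+ ((c ℚ.+ f ℚ.- u) ℚ.+ (E ℚ.+ f ℚ.- c)) ℚ.+ ((c ℚ.+ f ℚ.- u) ℚ.+ (E ℚ.+ f ℚ.- c))) ℚ.* d ≡ E ℚ.* d ℚ.+ E ℚ.* d ℚ.+ E ℚ.* d
      arith = solve 5 (λ E f c u d → u :* d :+ u :* d :+ (E :- (f :+ f :+ (f :+ f)) :+ ((c :+ f :- u) :+ (E :+ f :- c)) :+ ((c :+ f :- u) :+ (E :+ f :- c))) :* d := E :* d :+ E :* d :+ E :* d) refl

abstract

  -- Real inequalities are available only up to an error r. If it stays below 1 after multiplication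
  -- by D, `round` removes it from an inequality between natural numbers.
  gap : ∀ D → ∃[ r ] (0ℚ ℚ.< r × r ℚ.* ⟪ D ⟫ ℚ.< 1ℚ)
  gap D = let (r , 0<r , eq) = reciprocal ⟪ suc D ⟫ (0<⟪⟫ (s≤s z≤n)) in
    r , 0<r , ℚₚ.<-≤-trans (ℚₚ.*-monoʳ-<-pos r {{ℚ.positive 0<r}} (⟪⟫-mono-< (ℕₚ.n<1+n D))) (ℚₚ.≤-reflexive (trans (ℚₚ.*-comm r ⟪ suc D ⟫) eq))

round : ∀ {a b r} → r ℚ.< 1ℚ → ⟪ a ⟫ ℚ.≤ ⟪ b ⟫ ℚ.+ r → a ≤ b
round {a} {b} {r} r<1 h = ℕₚ.≤-pred (⟪⟫-cancel-< (ℚₚ.≤-<-trans h (subst (⟪ b ⟫ ℚ.+ r ℚ.<_) (trans (cong (⟪ b ⟫ ℚ.+_) (sym ⟪1⟫)) (trans (⟪⟫-+ b 1) (cong ⟪_⟫ (ℕₚ.+-comm b 1)))) (ℚₚ.+-monoʳ-< ⟪ b ⟫ r<1))))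

module _ {u r ε : ℚ} {m M D : ℕ} where

  open +-*-Solver

  at-most-bound : u ℚ.* ⟪ D ⟫ ℚ.≤ ⟪ 5 ⟫ → r ℚ.* ⟪ D ⟫ ℚ.< 1ℚ → ⟪ m ⟫ ℚ.≤ u ℚ.* ⟪ M ⟫ ℚ.+ r → m * D ≤ 6 * M
  at-most-bound u≤ small h = ℕₚ.≤-trans (round {m * D} {5 * M} small (subst₂ (λ p q → p ℚ.≤ q ℚ.+ r ℚ.* ⟪ D ⟫) (⟪⟫-* m D) (⟪⟫-* 5 M)
    (from-diff (diff u≤ ⊛ 0≤⟪⟫ M ⊕ diff h ⊛ 0≤⟪⟫ D)
      (solve 6 (λ u m c d r f → m :* d :+ ((f :- u :* d) :* c :+ (u :* c :+ r :- m) :* d) := f :* c :+ r :* d) refl u ⟪ m ⟫ ⟪ M ⟫ ⟪ D ⟫ r ⟪ 5 ⟫)))) (ℕₚ.*-monoˡ-≤ M (ℕₚ.n≤1+n 5))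

  above-bound : 1ℚ ℚ.≤ u ℚ.* ⟪ D ⟫ → 0ℚ ℚ.< ε → u ℚ.* ⟪ M ⟫ ℚ.+ ε ℚ.≤ ⟪ m ⟫ → M ≤ m * D
  above-bound ≤u 0<ε h = ⟪⟫-cancel (subst₂ ℚ._≤_ (ℚₚ.*-identityʳ ⟪ M ⟫) (⟪⟫-* m D)
    (from-diff (diff h ⊛ 0≤⟪⟫ D ⊕ diff ≤u ⊛ 0≤⟪⟫ M ⊕ ℚₚ.<⇒≤ 0<ε ⊛ 0≤⟪⟫ D)
      (solve 6 (λ u m c d ε i → c :* i :+ ((m :- (u :* c :+ ε)) :* d :+ (u :* d :- i) :* c :+ ε :* d) := m :* d) refl u ⟪ m ⟫ ⟪ M ⟫ ⟪ D ⟫ ε 1ℚ)))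

  at-least-bound : u ℚ.* ⟪ D ⟫ ℚ.≤ ⟪ 5 ⟫ → r ℚ.* ⟪ D ⟫ ℚ.< 1ℚ → (1ℚ ℚ.- u) ℚ.* ⟪ M ⟫ ℚ.≤ ⟪ m ⟫ ℚ.+ r → D * M ≤ m * D + 6 * M
  at-least-bound u≤ small h = ℕₚ.≤-trans (round {D * M} {m * D + 5 * M} small (subst₂ (λ p q → p ℚ.≤ q ℚ.+ r ℚ.* ⟪ D ⟫) (⟪⟫-* D M)
      (trans (cong₂ ℚ._+_ (⟪⟫-* m D) (⟪⟫-* 5 M)) (⟪⟫-+ (m * D) (5 * M)))
    (from-diff (diff u≤ ⊛ 0≤⟪⟫ M ⊕ diff h ⊛ 0≤⟪⟫ D)
      (solve 6 (λ u m c d r f → d :* c :+ ((f :- u :* d) :* c :+ (m :+ r :- (con 1ℚ :- u) :* c) :* d) := (m :* d :+ f :* c) :+ r :* d) refl u ⟪ m ⟫ ⟪ M ⟫ ⟪ D ⟫ r ⟪ 5 ⟫))))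
    (ℕₚ.+-monoʳ-≤ (m * D) (ℕₚ.*-monoˡ-≤ M (ℕₚ.n≤1+n 5)))

  below-bound : 1ℚ ℚ.≤ u ℚ.* ⟪ D ⟫ → 0ℚ ℚ.< ε → ⟪ m ⟫ ℚ.+ ε ℚ.≤ (1ℚ ℚ.- u) ℚ.* ⟪ M ⟫ → m * D + M ≤ D * M
  below-bound ≤u 0<ε h = ⟪⟫-cancel (subst₂ ℚ._≤_ (trans (cong₂ ℚ._+_ (⟪⟫-* m D) (ℚₚ.*-identityʳ ⟪ M ⟫)) (⟪⟫-+ (m * D) M)) (trans (ℚₚ.*-identityʳ _) (⟪⟫-* D M))
    (from-diff (diff h ⊛ 0≤⟪⟫ D ⊕ diff ≤u ⊛ 0≤⟪⟫ M ⊕ ℚₚ.<⇒≤ 0<ε ⊛ 0≤⟪⟫ D)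
      (solve 6 (λ u m c d ε i → (m :* d :+ c :* i) :+ (((i :- u) :* c :- (m :+ ε)) :* d :+ (u :* d :- i) :* c :+ ε :* d) := d :* c :* i) refl u ⟪ m ⟫ ⟪ M ⟫ ⟪ D ⟫ ε 1ℚ)))

module Threshold (x : ℝ) (D : ℕ) (cal : Calibrated x D) (m M : ℕ) where

  at-most : fromℕ m ≤ᴿ x *ᴿ fromℕ M → m * D ≤ 6 * M
  at-most h =
    let (r , 0<r , small) = gap D
        (N , p) = both cal (≤ᴿ-eventually (fromℕ m) (x *ᴿ fromℕ M) h r 0<r)
        ((_ , u≤) , h′) = p N ℕₚ.≤-refl
    in at-most-bound {seq x N} {r} {r} u≤ small (subst₂ (λ p q → p ℚ.≤ seq x N ℚ.* q ℚ.+ r) (⟪⟫-def m) (⟪⟫-def M) h′)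

  -- Because `≤ᴿ` is itself a negation, the hypothesis only excludes the absence of a witness of the
  -- strict inequality. The conclusion is decidable, so it may be proved by contradiction, which
  -- makes a witness available.
  not-at-most : ¬ (fromℕ m ≤ᴿ x *ᴿ fromℕ M) → M ≤ m * D
  not-at-most ¬h = decidable-stable (M ℕₚ.≤? m * D) λ ¬goal → ¬h λ (ε , 0<ε , ev) →
    let (N , p) = both cal ev
        ((≤u , _) , h′) = p N ℕₚ.≤-refl
    in ¬goal (above-bound {seq x N} {ε} {ε} ≤u 0<ε (subst₂ (λ p q → seq x N ℚ.* q ℚ.+ ε ℚ.≤ p) (⟪⟫-def m) (⟪⟫-def M) h′))

  at-least : (1ℝ -ᴿ x) *ᴿ fromℕ M ≤ᴿ fromℕ m → D * M ≤ m * D + 6 * M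
  at-least h =
    let (r , 0<r , small) = gap D
        (N , p) = both cal (≤ᴿ-eventually ((1ℝ -ᴿ x) *ᴿ fromℕ M) (fromℕ m) h r 0<r)
        ((_ , u≤) , h′) = p N ℕₚ.≤-refl
    in at-least-bound {seq x N} {r} {r} u≤ small (subst₂ (λ p q → (1ℚ ℚ.- seq x N) ℚ.* q ℚ.≤ p ℚ.+ r) (⟪⟫-def m) (⟪⟫-def M) h′)

  not-at-least : ¬ ((1ℝ -ᴿ x) *ᴿ fromℕ M ≤ᴿ fromℕ m) → m * D + M ≤ D * M
  not-at-least ¬h = decidable-stable (m * D + M ℕₚ.≤? D * M) λ ¬goal → ¬h λ (ε , 0<ε , ev) →
    let (N , p) = both cal ev
        ((≤u , _) , h′) = p N ℕₚ.≤-refl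
    in ¬goal (below-bound {seq x N} {ε} {ε} ≤u 0<ε (subst₂ (λ p q → p ℚ.+ ε ℚ.≤ (1ℚ ℚ.- seq x N) ℚ.* q) (⟪⟫-def m) (⟪⟫-def M) h′))

fourth-seq : ∀ x n → seq (x ^ᴿ 4) n ≡ fourth (seq x n)
fourth-seq x n = arith (seq x n)
  where
  open +-*-Solver
  arith : ∀ u → u ℚ.* (u ℚ.* (u ℚ.* (u ℚ.* 1ℚ))) ≡ (u ℚ.* u) ℚ.* (u ℚ.* u)
  arith = solve 1 (λ u → u :* (u :* (u :* (u :* con 1ℚ))) := (u :* u) :* (u :* u)) refl

-- Multiplied by D⁴, the relation K Δ = ε₁⁴ turns into (ε₁ D)⁴ ≤ 5⁴. The errors f and g are chosen
-- to contribute at most 1 each per unit of N, so c₀ only has to satisfy K c₀ ≥ 5⁴ + 2.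
edges-bound : ∀ K → 0ℚ ℚ.< K → ∀ {D N m c₀ u τ f g} → 1 ≤ D → 1 ≤ N → fourth ⟪ D ⟫ ℚ.* f ≡ 1ℚ → K ℚ.* fourth ⟪ D ⟫ ℚ.* g ≡ 1ℚ →
              fourth ⟪ 5 ⟫ ℚ.+ 1ℚ ℚ.+ 1ℚ ℚ.≤ K ℚ.* ⟪ c₀ ⟫ → 1ℚ ℚ.≤ u ℚ.* ⟪ D ⟫ → u ℚ.* ⟪ D ⟫ ℚ.≤ ⟪ 5 ⟫ →
              K ℚ.* τ ℚ.≤ fourth u ℚ.+ f → ⟪ m ⟫ ℚ.≤ τ ℚ.* ⟪ N ⟫ ℚ.+ g → m * (D * D * D * D) ≤ c₀ * N
edges-bound K 0<K {D} {N} {m} {c₀} {u} {τ} {f} {g} 1≤D 1≤N Wf KWg c₀-large ≤u u≤ h₁ h₂ =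
  ⟪⟫-cancel (subst₂ ℚ._≤_ (trans (cong (⟪ m ⟫ ℚ.*_) W-def) (⟪⟫-* m (D * D * D * D))) (⟪⟫-* c₀ N)
    (cancel-≤ K 0<K (ℚₚ.≤-trans step₁ (ℚₚ.≤-trans step₂ step₃))))
  where
  open +-*-Solver
  arith₁ : ∀ K m w t n g → K ℚ.* (m ℚ.* w) ℚ.+ K ℚ.* w ℚ.* (t ℚ.* n ℚ.+ g ℚ.- m) ≡ K ℚ.* t ℚ.* (w ℚ.* n) ℚ.+ K ℚ.* w ℚ.* g
  arith₁ = solve 6 (λ K m w t n g → K :* (m :* w) :+ K :* w :* (t :* n :+ g :- m) := K :* t :* (w :* n) :+ K :* w :* g) refl
  arith₂ : ∀ u f d n → (u ℚ.* u ℚ.* (u ℚ.* u) ℚ.+ f) ℚ.* (d ℚ.* d ℚ.* (d ℚ.* d) ℚ.* n) ≡ (u ℚ.* d ℚ.* (u ℚ.* d)) ℚ.* (u ℚ.* d ℚ.* (u ℚ.* d)) ℚ.* n ℚ.+ d ℚ.* d ℚ.* (d ℚ.* d) ℚ.* f ℚ.* n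
  arith₂ = solve 4 (λ u f d n → (u :* u :* (u :* u) :+ f) :* (d :* d :* (d :* d) :* n) := (u :* d :* (u :* d)) :* (u :* d :* (u :* d)) :* n :+ d :* d :* (d :* d) :* f :* n) refl
  arith₃ : ∀ F n i → F ℚ.* n ℚ.+ i ℚ.* n ℚ.+ i ℚ.* n ≡ (F ℚ.+ i ℚ.+ i) ℚ.* n
  arith₃ = solve 3 (λ F n i → F :* n :+ i :* n :+ i :* n := (F :+ i :+ i) :* n) refl
  W n′ : ℚ
  W = fourth ⟪ D ⟫
  n′ = ⟪ N ⟫
  0≤K : 0ℚ ℚ.≤ K
  0≤K = ℚₚ.<⇒≤ 0<K
  0≤W : 0ℚ ℚ.≤ W
  0≤W = ℚₚ.<⇒≤ (fourth-pos (0<⟪⟫ 1≤D))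
  W-def : W ≡ ⟪ D * D * D * D ⟫
  W-def = trans (cong₂ ℚ._*_ (⟪⟫-* D D) (⟪⟫-* D D)) (trans (⟪⟫-* (D * D) (D * D)) (cong ⟪_⟫ (sym (ℕₚ.*-assoc (D * D) D D))))
  1≤n′ : 1ℚ ℚ.≤ n′
  1≤n′ = subst (ℚ._≤ n′) ⟪1⟫ (⟪⟫-mono 1≤N)
  step₁ : K ℚ.* (⟪ m ⟫ ℚ.* W) ℚ.≤ K ℚ.* τ ℚ.* (W ℚ.* n′) ℚ.+ K ℚ.* W ℚ.* g
  step₁ = from-diff ((0≤K ⊛ 0≤W) ⊛ diff h₂) (arith₁ K ⟪ m ⟫ W τ n′ g)
  5-bound : fourth (u ℚ.* ⟪ D ⟫) ℚ.≤ fourth ⟪ 5 ⟫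
  5-bound = fourth-bound (ℚₚ.≤-trans (ℚₚ.neg-antimono-≤ (0≤⟪⟫ 5)) (ℚₚ.≤-trans (ℚₚ.<⇒≤ 0<1) ≤u)) u≤
  step₂ : K ℚ.* τ ℚ.* (W ℚ.* n′) ℚ.+ K ℚ.* W ℚ.* g ℚ.≤ fourth ⟪ 5 ⟫ ℚ.* n′ ℚ.+ 1ℚ ℚ.* n′ ℚ.+ 1ℚ ℚ.* n′
  step₂ = ℚₚ.+-mono-≤
    (ℚₚ.≤-trans (ℚₚ.*-monoʳ-≤-nonNeg (W ℚ.* n′) {{ℚ.nonNegative (0≤W ⊛ 0≤⟪⟫ N)}} h₁)
      (ℚₚ.≤-trans (ℚₚ.≤-reflexive (arith₂ u f ⟪ D ⟫ n′))
        (ℚₚ.+-mono-≤ (ℚₚ.*-monoʳ-≤-nonNeg n′ {{ℚ.nonNegative (0≤⟪⟫ N)}} 5-bound) (ℚₚ.≤-reflexive (cong (ℚ._* n′) Wf)))))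
    (ℚₚ.≤-trans (ℚₚ.≤-reflexive KWg) (ℚₚ.≤-trans 1≤n′ (ℚₚ.≤-reflexive (sym (ℚₚ.*-identityˡ n′)))))
  step₃ : fourth ⟪ 5 ⟫ ℚ.* n′ ℚ.+ 1ℚ ℚ.* n′ ℚ.+ 1ℚ ℚ.* n′ ℚ.≤ K ℚ.* (⟪ c₀ ⟫ ℚ.* n′)
  step₃ = ℚₚ.≤-trans (ℚₚ.≤-reflexive (arith₃ (fourth ⟪ 5 ⟫) n′ 1ℚ))
    (ℚₚ.≤-trans (ℚₚ.*-monoʳ-≤-nonNeg n′ {{ℚ.nonNegative (0≤⟪⟫ N)}} c₀-large) (ℚₚ.≤-reflexive (ℚₚ.*-assoc K ⟪ c₀ ⟫ n′)))

four-pos : ∀ {p} → 0ℚ ℚ.< p → 0ℚ ℚ.< four p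
four-pos 0<p = ℚₚ.+-mono-< (ℚₚ.+-mono-< (ℚₚ.+-mono-< 0<p 0<p) 0<p) 0<p

module Root (K : ℚ) (0<K : 0ℚ ℚ.< K) (x y t : ℝ) (y-seq : ∀ n → seq y n ≡ K ℚ.* seq t n) (root : IsFourthRoot x y) where

  private
    0≤K : 0ℚ ℚ.≤ K
    0≤K = ℚₚ.<⇒≤ 0<K

  nonnegative : ∀ h → 0ℚ ℚ.< h → Eventually (λ n → 0ℚ ℚ.≤ seq x n ℚ.+ h)
  nonnegative = ≤ᴿ-eventually 0ℝ x (proj₁ root)

  fourth-upper : ∀ h → 0ℚ ℚ.< h → Eventually (λ n → fourth (seq x n) ℚ.≤ K ℚ.* seq t n ℚ.+ h)
  fourth-upper h 0<h = let (N , p) = ≤ᴿ-eventually (x ^ᴿ 4) y (proj₁ (proj₂ root)) h 0<h in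
    N , λ n N≤n → subst₂ (λ a b → a ℚ.≤ b ℚ.+ h) (fourth-seq x n) (y-seq n) (p n N≤n)

  fourth-lower : ∀ h → 0ℚ ℚ.< h → Eventually (λ n → K ℚ.* seq t n ℚ.≤ fourth (seq x n) ℚ.+ h)
  fourth-lower h 0<h = let (N , p) = ≤ᴿ-eventually y (x ^ᴿ 4) (proj₂ (proj₂ root)) h 0<h in
    N , λ n N≤n → subst₂ (λ a b → a ℚ.≤ b ℚ.+ h) (y-seq n) (fourth-seq x n) (p n N≤n)

  root-below : 0ℝ <ᴿ t → ∃[ τ ] (0ℚ ℚ.< τ × Eventually (λ n → τ ℚ.≤ seq x n))
  root-below (η , 0<η , ev) =
    let (g , 0<g , eq) = quarter-split (K ℚ.* η) (*-pos 0<K 0<η)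
        (τ , 0<τ , τ≤g , τ≤1) = below-both g 0<g
        (N , p) = both ev (both (nonnegative τ 0<τ) (fourth-lower g 0<g))
    in τ , 0<τ , N , λ n N≤n → let (q₁ , q₂ , q₃) = p n N≤n in
       root-lower 0≤K 0<g eq 0<τ τ≤g τ≤1 (subst (ℚ._≤ seq t n) (ℚₚ.+-identityˡ η) q₁) q₂ q₃

  root-above : ∀ X → 0ℚ ℚ.< X → ∀ δ₀ → 0ℚ ℚ.< δ₀ → four (fourth X) ℚ.* K ℚ.* δ₀ ≡ 1ℚ → t ≤ᴿ fromℚ δ₀ → Eventually (λ n → seq x n ℚ.* X ℚ.≤ 1ℚ)
  root-above X 0<X δ₀ 0<δ₀ eq t≤ =
    let (h , 0<h , eq′) = reciprocal (four (fourth X)) (four-pos (fourth-pos 0<X))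
        (N , p) = both (≤ᴿ-eventually t (fromℚ δ₀) t≤ δ₀ 0<δ₀) (fourth-upper h 0<h)
    in N , λ n N≤n → let (q₁ , q₂) = p n N≤n in root-upper {u = seq x n} 0<K 0<X eq eq′ q₁ q₂
  module _ (c₀ D : ℕ) (c₀-large : fourth ⟪ 5 ⟫ ℚ.+ 1ℚ ℚ.+ 1ℚ ℚ.≤ K ℚ.* ⟪ c₀ ⟫) (1≤D : 1 ≤ D) (cal : Calibrated x D) where

    few : ∀ {m N} → 1 ≤ N → fromℕ m ≤ᴿ t *ᴿ fromℕ N → m * (D * D * D * D) ≤ c₀ * N
    few {m} {N} 1≤N h =
      let W = fourth ⟪ D ⟫
          0<W = fourth-pos (0<⟪⟫ 1≤D)
          (f , 0<f , Wf) = reciprocal W 0<W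
          (g , 0<g , KWg) = reciprocal (K ℚ.* W) (*-pos 0<K 0<W)
          (i , p) = both cal (both (fourth-lower f 0<f) (≤ᴿ-eventually (fromℕ m) (t *ᴿ fromℕ N) h g 0<g))
          ((≤u , u≤) , h₁ , h₂) = p i ℕₚ.≤-refl
      in edges-bound K 0<K {u = seq x i} 1≤D 1≤N Wf KWg c₀-large ≤u u≤ h₁
           (subst₂ (λ p q → p ℚ.≤ seq t i ℚ.* q ℚ.+ g) (⟪⟫-def m) (⟪⟫-def N) h₂)

-- The ceiling s and the size of the class A

ceiling-upper : ∀ k d .{{_ : NonZero d}} → ¬ (d ∣ k) → k < ⌈ k / d ⌉ * d
ceiling-upper k d@(suc d′) ¬d∣k = ℕₚ.≤∧≢⇒< (ℕₚ.+-cancelʳ-≤ d′ k (⌈ k / d ⌉ * d) (begin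
  k + d′                             ≡⟨ m≡m%n+[m/n]*n (k + d′) d ⟩
  (k + d′) % d + ⌈ k / d ⌉ * d       ≤⟨ ℕₚ.+-monoˡ-≤ (⌈ k / d ⌉ * d) (ℕₚ.≤-pred (m%n<n (k + d′) d)) ⟩
  d′ + ⌈ k / d ⌉ * d                 ≡⟨ ℕₚ.+-comm d′ _ ⟩
  ⌈ k / d ⌉ * d + d′                 ∎)) λ eq → ¬d∣k (divides ⌈ k / d ⌉ eq)
  where open ℕₚ.≤-Reasoning

ceiling-lower : ∀ k d .{{_ : NonZero d}} → ⌈ k / d ⌉ * d < k + d
ceiling-lower k d@(suc d′) = ℕₚ.≤-trans (s≤s (m/n*n≤m (k + d′) d)) (ℕₚ.≤-reflexive (sym (ℕₚ.+-suc k d′)))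

-- d ∤ k is what separates ℓ = k - d strictly from (s - 1)d.
ceiling-bounds : ∀ {k ℓ d σ} → 2 ≤ ℓ → k ≡ ℓ + d → 1 ≤ d → k < σ * d → σ * d < k + d →
                 ∃[ s′ ] (σ ≡ suc s′ × s′ * d < k × ℓ < s′ * d × 4 ≤ suc s′ * d)
ceiling-bounds {σ = zero} _ _ _ () _
ceiling-bounds {k} {ℓ} {d} {suc s′} 2≤ℓ eq 1≤d k< <k+d = s′ , refl , ℕₚ.+-cancelˡ-< d _ _ (subst (suc s′ * d <_) (ℕₚ.+-comm k d) <k+d)
  , ℕₚ.+-cancelˡ-< d _ _ (subst (_< suc s′ * d) (trans eq (ℕₚ.+-comm ℓ d)) k<)
  , ℕₚ.≤-trans (s≤s (subst (3 ≤_) (sym eq) (ℕₚ.+-mono-≤ 2≤ℓ 1≤d))) k<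

quotient-* : ∀ z .{{_ : NonZero z}} n → ⟪ z ⟫ ℚ.* (ℤ.+ n ℚ./ z) ≡ ⟪ n ⟫
quotient-* (suc z) n = ℚₚ.toℚᵘ-injective (ℚᵘₚ.≃-trans (ℚₚ.toℚᵘ-homo-* ⟪ suc z ⟫ (ℤ.+ n ℚ./ suc z))
  (ℚᵘₚ.≃-trans (ℚᵘₚ.*-cong (⟪⟫-toℚᵘ (suc z)) (ℚₚ.toℚᵘ-fromℚᵘ (ℚᵘ.mkℚᵘ (ℤ.+ n) z)))
  (ℚᵘₚ.≃-trans (ℚᵘ.*≡* (cross (suc z) n)) (ℚᵘₚ.≃-sym (⟪⟫-toℚᵘ n)))))
  where
  cross : ∀ z n → (ℤ.+ z ℤ.* ℤ.+ n) ℤ.* ℤ.+ 1 ≡ ℤ.+ n ℤ.* ℤ.+ (z + 0)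
  cross z n = trans (ℤₚ.*-identityʳ (ℤ.+ z ℤ.* ℤ.+ n)) (trans (ℤₚ.*-comm (ℤ.+ z) (ℤ.+ n)) (cong (λ x → ℤ.+ n ℤ.* ℤ.+ x) (sym (ℕₚ.+-identityʳ z))))

upper-identity : ∀ z N n → z * suc N + n ≡ z * N + (n + z)
upper-identity = solve 3 (λ z N n → z :* (con 1 :+ N) :+ n := z :* N :+ (n :+ z)) refl
  where open ℕ-Solver

module Ratio (z : ℕ) {{_ : NonZero z}} where

  private
    r : ℚ
    r = ℤ.+ 1 ℚ./ z

  zr≡1 : ⟪ z ⟫ ℚ.* r ≡ 1ℚ
  zr≡1 = trans (quotient-* z 1) ⟪1⟫

  z[1-r] : ∀ p → ⟪ z ⟫ ℚ.* ((1ℚ ℚ.- r) ℚ.* p) ℚ.+ p ≡ ⟪ z ⟫ ℚ.* p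
  z[1-r] p = trans (arith ⟪ z ⟫ r p) (trans (cong (λ x → ⟪ z ⟫ ℚ.* p ℚ.+ (1ℚ ℚ.- x) ℚ.* p) zr≡1) (arith′ (⟪ z ⟫ ℚ.* p) p))
    where
    open +-*-Solver
    arith : ∀ z r p → z ℚ.* ((1ℚ ℚ.- r) ℚ.* p) ℚ.+ p ≡ z ℚ.* p ℚ.+ (1ℚ ℚ.- z ℚ.* r) ℚ.* p
    arith = solve 3 (λ z r p → z :* ((con 1ℚ :- r) :* p) :+ p := z :* p :+ (con 1ℚ :- z :* r) :* p) refl
    arith′ : ∀ q p → q ℚ.+ (1ℚ ℚ.- 1ℚ) ℚ.* p ≡ q
    arith′ = solve 2 (λ q p → q :+ (con 1ℚ :- con 1ℚ) :* p := q) refl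

  0<1-r : 2 ≤ z → 0ℚ ℚ.< 1ℚ ℚ.- r
  0<1-r 2≤z = ℚₚ.≰⇒> λ β≤0 → ℕₚ.<⇒≱ 2≤z (⟪⟫-cancel (subst₂ ℚ._≤_ total (trans (cong (ℚ._+ 1ℚ) (ℚₚ.*-zeroʳ ⟪ z ⟫)) (trans (ℚₚ.+-identityˡ 1ℚ) (sym ⟪1⟫)))
    (ℚₚ.+-monoˡ-≤ 1ℚ (ℚₚ.*-monoˡ-≤-nonNeg ⟪ z ⟫ {{ℚ.nonNegative (0≤⟪⟫ z)}} β≤0))))
    where
    total : ⟪ z ⟫ ℚ.* (1ℚ ℚ.- r) ℚ.+ 1ℚ ≡ ⟪ z ⟫
    total = trans (cong (λ x → ⟪ z ⟫ ℚ.* x ℚ.+ 1ℚ) (sym (ℚₚ.*-identityʳ (1ℚ ℚ.- r)))) (trans (z[1-r] 1ℚ) (ℚₚ.*-identityʳ ⟪ z ⟫))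

  -- Rounding down the size of B rounds the size of A up: it is the least integer not below n/z.
  -- Multiplying the bounds for the floor by z removes the fraction.
  size-bounds : ∀ {n N a} → ℤ.+ N ≡ ℚ.floor ((1ℚ ℚ.- r) ℚ.* (ℤ.+ n ℚ./ 1)) → a + N ≡ n → n ≤ z * a × z * a < n + z
  size-bounds {n} {N} {a} eq a+N = lower , upper
    where
    open ℕₚ.≤-Reasoning
    p : ℚ
    p = (1ℚ ℚ.- r) ℚ.* ⟪ n ⟫
    bounds : ⟪ N ⟫ ℚ.≤ p × p ℚ.< ⟪ suc N ⟫
    bounds = floor-bounds p N (trans eq (cong (λ x → ℚ.floor ((1ℚ ℚ.- r) ℚ.* x)) (⟪⟫-def n)))
    nonneg : ℚ.NonNegative ⟪ z ⟫
    nonneg = ℚ.nonNegative (0≤⟪⟫ z)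
    zN+n≤zn : z * N + n ≤ z * n
    zN+n≤zn = ⟪⟫-cancel (subst₂ ℚ._≤_ (trans (cong (ℚ._+ ⟪ n ⟫) (⟪⟫-* z N)) (⟪⟫-+ (z * N) n)) (trans (z[1-r] ⟪ n ⟫) (⟪⟫-* z n))
      (ℚₚ.+-monoˡ-≤ ⟪ n ⟫ (ℚₚ.*-monoˡ-≤-nonNeg ⟪ z ⟫ {{nonneg}} (proj₁ bounds))))
    zn<zN+z+n : z * n < z * suc N + n
    zn<zN+z+n = ⟪⟫-cancel-< (subst₂ ℚ._<_ (trans (z[1-r] ⟪ n ⟫) (⟪⟫-* z n)) (trans (cong (ℚ._+ ⟪ n ⟫) (⟪⟫-* z (suc N))) (⟪⟫-+ (z * suc N) n))
      (ℚₚ.+-monoˡ-< ⟪ n ⟫ (ℚₚ.*-monoʳ-<-pos ⟪ z ⟫ {{ℚ.positive (0<⟪⟫ (>-nonZero⁻¹ z))}} (proj₂ bounds))))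
    split : z * n ≡ z * N + z * a
    split = trans (cong (z *_) (trans (sym a+N) (ℕₚ.+-comm a N))) (ℕₚ.*-distribˡ-+ z N a)
    lower : n ≤ z * a
    lower = ℕₚ.+-cancelˡ-≤ (z * N) _ _ (ℕₚ.≤-trans zN+n≤zn (ℕₚ.≤-reflexive split))
    upper : z * a < n + z
    upper = ℕₚ.+-cancelˡ-< (z * N) _ _ (begin-strict
      z * N + z * a       ≡⟨ sym split ⟩
      z * n               <⟨ zn<zN+z+n ⟩
      z * suc N + n       ≡⟨ upper-identity z N n ⟩
      z * N + (n + z)     ∎)

  -- The integer δ is at least n/z and a is n/z rounded up: z a < n + z ≤ z (δ + 1).
  degree-bound : ∀ {n a δ} → ℤ.+ n ℚ./ z ℚ.≤ ℤ.+ δ ℚ./ 1 → z * a < n + z → a ≤ δ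
  degree-bound {n} {a} {δ} h za< = ℕₚ.≤-pred (ℕₚ.*-cancelˡ-< z a (suc δ) (ℕₚ.<-≤-trans za< (begin
    n + z           ≤⟨ ℕₚ.+-monoˡ-≤ z n≤zδ ⟩
    z * δ + z       ≡⟨ ℕₚ.+-comm (z * δ) z ⟩
    z + z * δ       ≡⟨ sym (ℕₚ.*-suc z δ) ⟩
    z * suc δ       ∎)))
    where
    open ℕₚ.≤-Reasoning
    n≤zδ : n ≤ z * δ
    n≤zδ = ⟪⟫-cancel (subst₂ ℚ._≤_ (quotient-* z n) (trans (cong (⟪ z ⟫ ℚ.*_) (⟪⟫-def δ)) (⟪⟫-* z δ))
      (ℚₚ.*-monoˡ-≤-nonNeg ⟪ z ⟫ {{ℚ.nonNegative (0≤⟪⟫ z)}} h))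

^ℚ-pos : ∀ {p} → 0ℚ ℚ.< p → ∀ n → 0ℚ ℚ.< p ^ℚ n
^ℚ-pos 0<p zero = 0<1
^ℚ-pos 0<p (suc n) = *-pos 0<p (^ℚ-pos 0<p n)

-- From the real hypotheses to natural numbers

∉-lookup : ∀ {n} {v : Fin n} {S : Subset n} → lookup S v ≡ false → ¬ v ∈ˢ S
∉-lookup h v∈S = true≢false (Vecₚ.[]=⇒lookup v∈S) h

partition-parts : ∀ {n} {A B : Subset n} → IsPartition A B → ∀ v → lookup A v ≡ not (lookup B v)
partition-parts {n} {A} {B} (A∪B , A∩B) v = exclusive (lookup A v) (lookup B v)
  (trans (sym (Vecₚ.lookup-zipWith _∨_ v A B)) (trans (cong (λ S → lookup S v) A∪B) (Vecₚ.lookup-replicate v true)))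
  (trans (sym (Vecₚ.lookup-zipWith _∧_ v A B)) (trans (cong (λ S → lookup S v) A∩B) (Vecₚ.lookup-replicate v false)))
  where
  exclusive : ∀ a b → a ∨ b ≡ true → a ∧ b ≡ false → a ≡ not b
  exclusive true false _ _ = refl
  exclusive false true _ _ = refl
  exclusive true true _ ()
  exclusive false false () _

card-∩ : ∀ {n} (A B : Subset n) → ∣ A ∩ B ∣ ≡ count (λ v → lookup A v ∧ lookup B v)
card-∩ A B = trans (card-count (A ∩ B)) (count-cong λ v → Vecₚ.lookup-zipWith _∧_ v A B)

∁-partition : ∀ {n} (B : Subset n) → IsPartition (∁ B) B
∁-partition B = trans (Subsetₚ.∪-comm (∁ B) B) (Subsetₚ.p∪∁p≡⊤ B) , Subsetₚ.∩-inverseˡ B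

HoldsAt : ∀ k ℓ → 2 ≤ ℓ → ℓ < k → ℕ → ℝ → ℝ → Set₁
HoldsAt k ℓ 2≤ℓ ℓ<k t Δ ε₁ = let open Setting k ℓ 2≤ℓ ℓ<k in
  ∃[ n₀ ] (∀ n → n₀ ≤ n → k ∸ ℓ ∣ n →
    (H : KGraph k n) → Extremal Δ H → MinCodegreeCondition H → (A B : Subset n) → OptimalPartition H A B →
    (A′ B′ V₀ : Subset n) → VertexClasses H ε₁ B A′ B′ V₀ → (P : Fin (s * ∣ A ∩ B′ ∣) → Path ℓ (H [ B′ ])) →
    (∀ i j → i ≢ j → Disjoint (Path.vertices (P i)) (Path.vertices (P j))) → (∀ i → Path.size (P i) ≤ t) →
    (∀ i → Linkable H ε₁ B (Path.initialEnd (P i)) × Linkable H ε₁ B (Path.terminalEnd (P i))) → HamiltonCycle ℓ H)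

HoldsForSmallΔ : ∀ k ℓ → 2 ≤ ℓ → ℓ < k → ℕ → Set₁
HoldsForSmallΔ k ℓ 2≤ℓ ℓ<k t = let open Setting k ℓ 2≤ℓ ℓ<k in
  ∃[ Δ₀ ] (0ℝ <ᴿ Δ₀ × (∀ Δ → 0ℝ <ᴿ Δ → Δ ≤ᴿ Δ₀ → ∀ ε₁ → IsFourthRoot ε₁ (ε₀ Δ) → HoldsAt k ℓ 2≤ℓ ℓ<k t Δ ε₁))

module Reduction (parameters : Parameters) (2≤ℓ : 2 ≤ Parameters.ℓ parameters) (ℓ<k : Parameters.ℓ parameters < suc (Parameters.κ parameters))
  (s-eq : Setting.s (suc (Parameters.κ parameters)) (Parameters.ℓ parameters) 2≤ℓ ℓ<k ≡ Parameters.s parameters)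
  (K : ℚ) (0<K : 0ℚ ℚ.< K)
  (ε₀-seq : ∀ Δ n → seq (Setting.ε₀ (suc (Parameters.κ parameters)) (Parameters.ℓ parameters) 2≤ℓ ℓ<k Δ) n ≡ K ℚ.* seq Δ n)
  (c₀-large : fourth ⟪ 5 ⟫ ℚ.+ 1ℚ ℚ.+ 1ℚ ℚ.≤ K ℚ.* ⟪ Parameters.c₀ parameters ⟫) where

  open Parameters parameters hiding (s)
  open Setting (suc κ) ℓ 2≤ℓ ℓ<k
  open Constants parameters using (Instance; LinkableBy; n₀; D₀)

  1≤D₀ : 1 ≤ D₀
  1≤D₀ = ℕₚ.≤-trans (s≤s z≤n) (Constants.13≤D₀ parameters)

  finish : ∀ {σ n} → σ ≡ suc s′ → (inst : Instance n) → let open Constants.Instance inst in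
           (P : Fin (σ * ∣ A ∩ B′ ∣) → Path ℓ (H [ B′ ])) → (∀ i j → i ≢ j → Disjoint (Path.vertices (P i)) (Path.vertices (P j))) → (∀ i → Path.size (P i) ≤ s⋆) →
           (∀ i → LinkableBy H B (Constants.Instance.D inst) (Path.initialEnd (P i)) × LinkableBy H B (Constants.Instance.D inst) (Path.terminalEnd (P i))) → HamiltonCycle ℓ H
  finish {n = n} refl inst P P-disjoint P-size P-ends = record
    { vertices = proj₁ cycle ; distinct = proj₁ (proj₂ cycle) ; spanning = proj₁ (proj₂ (proj₂ cycle)) ; divisible = divides m n-eq
    ; long = ℕₚ.≤-trans (Constants.k+d≤n₀ parameters (Constants.Instance.D inst)) n₀≤n
    ; edges = λ i i*d<n → from-does (edge? H _) (subst (λ j → does (edge? H (toSubset (take (suc κ) (drop (j * d) (proj₁ cycle ++ proj₁ cycle))))) ≡ true)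
        (Finₚ.toℕ-fromℕ< (i<m i i*d<n)) (proj₂ (proj₂ (proj₂ cycle)) (fromℕ< (i<m i i*d<n)))) }
    where
    open Constants.Instance inst using (H; A; B′; m; n-eq; n₀≤n)
    i<m : ∀ i → i * d < n → i < m
    i<m i h = ℕₚ.*-cancelʳ-< d i m (subst (i * d <_) n-eq h)
    cycle : ∃[ xs ] (Unique xs × length xs ≡ n × (∀ (i : Fin m) → does (edge? H (toSubset (take (suc κ) (drop (toℕ i * d) (xs ++ xs))))) ≡ true))
    cycle = Constants.Reduced.hamilton parameters inst ∣ A ∩ B′ ∣ (card-∩ A B′) P P-disjoint P-size P-ends

  module Calibrate (Δ ε₁ : ℝ) (root : IsFourthRoot ε₁ (ε₀ Δ)) (D : ℕ) (D₀≤D : D₀ ≤ D) (cal : Calibrated ε₁ D) where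

    linkable : ∀ {n} (H : KGraph (suc κ) n) (B : Subset n) W → Linkable H ε₁ B W → LinkableBy H B D W
    linkable H B W link j j<s′ = Threshold.at-most ε₁ D cal (deg H (toSubset (drop (j * d) W)) B) (∣ B ∣ C (suc κ ∸ ∣ toSubset (drop (j * d) W) ∣))
      -- Linkability numbers its suffixes from 1, here they are numbered from 0.
      (link (suc j) (s≤s z≤n) (subst (λ σ → suc j ≤ σ ∸ 1) (sym s-eq) j<s′))

    reduce : ∀ {n} (H : KGraph (suc κ) n) (A B A′ B′ V₀ : Subset n) m → n₀ D ≤ n → n ≡ m * d → Extremal Δ H → MinCodegreeCondition H → OptimalPartition H A B →
             VertexClasses H ε₁ B A′ B′ V₀ → Instance n
    reduce {n} H A B A′ B′ V₀ m n₀≤n n-eq (B₀ , B₀-size , B₀-edges) codegree optimal classes = record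
      { H = H ; A = A ; B = B ; A′ = A′ ; B′ = B′ ; D = D ; m = m ; D₀≤D = D₀≤D ; n₀≤n = n₀≤n
      ; n-eq = n-eq
      ; parts = parts
      ; codeg = λ S ∣S∣≡κ → ℕₚ.≤-trans A≤δ (Degrees.δ≤codegree H S ∣S∣≡κ)
      ; A′-in = λ v v∈ → T.at-least v (Equivalence.to (A′-spec v) (Vecₚ.lookup⇒[]= v A′ v∈))
      ; A′-out = λ v v∉ → T.not-at-least v λ h → ∉-lookup v∉ (Equivalence.from (A′-spec v) h)
      ; B′-in = λ v v∈ → T.at-most v (Equivalence.to (B′-spec v) (Vecₚ.lookup⇒[]= v B′ v∈))
      ; B′-out = λ v v∉ → T.not-at-most v λ h → ∉-lookup v∉ (Equivalence.from (B′-spec v) h)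
      -- Extremality speaks of some set B₀; minimality of the given partition carries the bound over
      -- to `B`.
      ; e-bound = ℕₚ.≤-trans (ℕₚ.*-monoˡ-≤ (D * D * D * D) (minimal (∁ B₀) B₀ (∁-partition B₀) B₀-size))
          (Root.few K 0<K ε₁ (ε₀ Δ) Δ (ε₀-seq Δ) root c₀ D c₀-large (ℕₚ.≤-trans 1≤D₀ D₀≤D) cal {e H B₀} {n ^ suc κ} (ℕₚ.m^n>0 n {{>-nonZero 1≤n}} (suc κ)) B₀-edges)
      ; A-lower = subst (λ σ → n ≤ σ * d * ∣ A ∣) s-eq (proj₁ bounds)
      ; A-upper = subst (λ σ → σ * d * ∣ A ∣ < n + σ * d) s-eq (proj₂ bounds)
      }
      where
      open OptimalPartition optimal
      open VertexClasses classes
      module T v = Threshold ε₁ D cal (deg H ⁅ v ⁆ B) (∣ B ∣ C κ)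
      1≤n : 1 ≤ n
      1≤n = ℕₚ.≤-trans (s≤s z≤n) (ℕₚ.≤-trans (Constants.k+d≤n₀ parameters D) n₀≤n)
      parts : ∀ v → lookup A v ≡ not (lookup B v)
      parts = partition-parts partition
      bounds : n ≤ s * d * ∣ A ∣ × s * d * ∣ A ∣ < n + s * d
      bounds = Ratio.size-bounds (s * d) {n} {∣ B ∣} {∣ A ∣} size (sum-parts {A = A} {B} parts)
      A≤δ : ∣ A ∣ ≤ δ H
      A≤δ = Ratio.degree-bound (s * d) {n} {∣ A ∣} {δ H} codegree (proj₂ bounds)

    holds : HoldsAt (suc κ) ℓ 2≤ℓ ℓ<k s⋆ Δ ε₁
    holds = n₀ D , λ n n₀≤n (divides m n-eq) H extremal codegree A B optimal A′ B′ V₀ classes P P-disjoint P-size P-ends →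
      finish s-eq (reduce H A B A′ B′ V₀ m n₀≤n n-eq extremal codegree optimal classes)
        P P-disjoint P-size (λ i → linkable H B (Path.initialEnd (P i)) (proj₁ (P-ends i)) , linkable H B (Path.terminalEnd (P i)) (proj₂ (P-ends i)))

  for-root : ∀ δ₀ → 0ℚ ℚ.< δ₀ → four (fourth ⟪ D₀ ⟫) ℚ.* K ℚ.* δ₀ ≡ 1ℚ → ∀ Δ → 0ℝ <ᴿ Δ → Δ ≤ᴿ fromℚ δ₀ → ∀ ε₁ → IsFourthRoot ε₁ (ε₀ Δ) → HoldsAt (suc κ) ℓ 2≤ℓ ℓ<k s⋆ Δ ε₁
  for-root δ₀ 0<δ₀ δ₀-eq Δ 0<Δ Δ≤δ₀ ε₁ root = from-lower (Root.root-below K 0<K ε₁ (ε₀ Δ) Δ (ε₀-seq Δ) root 0<Δ)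
    where
    at-scale : ∃[ D ] (D₀ ≤ D × Calibrated ε₁ D) → HoldsAt (suc κ) ℓ 2≤ℓ ℓ<k s⋆ Δ ε₁
    at-scale (D , D₀≤D , cal) = Calibrate.holds Δ ε₁ root D D₀≤D cal
    from-lower : ∃[ τ ] (0ℚ ℚ.< τ × Eventually (λ n → τ ℚ.≤ seq ε₁ n)) → HoldsAt (suc κ) ℓ 2≤ℓ ℓ<k s⋆ Δ ε₁
    from-lower (τ , 0<τ , lower) = at-scale (calibrate ε₁ D₀ τ 1≤D₀ 0<τ lower
      (Root.root-above K 0<K ε₁ (ε₀ Δ) Δ (ε₀-seq Δ) root ⟪ D₀ ⟫ (0<⟪⟫ 1≤D₀) δ₀ 0<δ₀ δ₀-eq Δ≤δ₀))

  exists-Δ₀ : ∃[ δ₀ ] (0ℚ ℚ.< δ₀ × four (fourth ⟪ D₀ ⟫) ℚ.* K ℚ.* δ₀ ≡ 1ℚ) →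
              HoldsForSmallΔ (suc κ) ℓ 2≤ℓ ℓ<k s⋆
  exists-Δ₀ (δ₀ , 0<δ₀ , δ₀-eq) = fromℚ δ₀ , (δ₀ , 0<δ₀ , 0 , λ _ _ → ℚₚ.≤-reflexive (ℚₚ.+-identityˡ δ₀)) , for-root δ₀ 0<δ₀ δ₀-eq

  for-small-Δ : HoldsForSmallΔ (suc κ) ℓ 2≤ℓ ℓ<k s⋆
  -- The witness is δ₀ = 1/(4 D₀⁴ K). Then ε₁⁴ = K Δ ≤ 1/(4 D₀⁴), where the 4 leaves room for the
  -- approximation errors of `root-upper`; so ε₁ D₀ ≤ 1, which yields D ≥ D₀ in `calibrate`.
  for-small-Δ = exists-Δ₀ (reciprocal (four (fourth ⟪ D₀ ⟫) ℚ.* K) (*-pos (four-pos (fourth-pos (0<⟪⟫ 1≤D₀))) 0<K))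

abstract

  -- The factor K = 2 k! β^(-k) is rational, and products of reals are taken termwise. So the
  -- defining relation of ε₁ can be studied on the rational terms of Δ.
  ε₀-factor : ∀ k ℓ 2≤ℓ ℓ<k → 2 ≤ Setting.s k ℓ 2≤ℓ ℓ<k * (k ∸ ℓ) → ∃[ K ] (0ℚ ℚ.< K × (∀ Δ n → seq (Setting.ε₀ k ℓ 2≤ℓ ℓ<k Δ) n ≡ K ℚ.* seq Δ n))
  ε₀-factor k ℓ 2≤ℓ ℓ<k 2≤z = ⟪ 2 * k ! ⟫ ℚ.* b , *-pos (0<⟪⟫ (ℕₚ.*-mono-≤ {1} {2} (s≤s z≤n) (ℕₚ.1≤n! k))) (^ℚ-pos 0<1/β k) , λ Δ n →
    trans (cong (λ x → x ℚ.* seq Δ n ℚ.* b) (⟪⟫-def (2 * k !))) (arith ⟪ 2 * k ! ⟫ (seq Δ n) b)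
    where
    open Setting k ℓ 2≤ℓ ℓ<k
    open +-*-Solver
    b : ℚ
    b = (ℚ.1/ β) ^ℚ k
    0<1/β : 0ℚ ℚ.< ℚ.1/ β
    0<1/β = ℚₚ.positive⁻¹ _ {{ℚₚ.1/pos⇒pos β {{ℚ.positive (Ratio.0<1-r (s * (k ∸ ℓ)) 2≤z)}}}}
    arith : ∀ a x b → a ℚ.* x ℚ.* b ≡ a ℚ.* b ℚ.* x
    arith = solve 3 (λ a x b → a :* x :* b := a :* b :* x) refl

theorem3p1 : (k ℓ : ℕ) (2≤ℓ : 2 ≤ ℓ) (ℓ<k : ℓ < k) → ¬ (k ∸ ℓ ∣ k) → (s⋆ : ℕ → ℕ) →
  let open Setting k ℓ 2≤ℓ ℓ<k in
  ∃[ Δ₀ ] (0ℝ <ᴿ Δ₀ ×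
    (∀ Δ → 0ℝ <ᴿ Δ → Δ ≤ᴿ Δ₀ → ∀ ε₁ → IsFourthRoot ε₁ (ε₀ Δ) →
     ∃[ n₀ ] (∀ n → n₀ ≤ n → k ∸ ℓ ∣ n →
      (H : KGraph k n) → Extremal Δ H → MinCodegreeCondition H →
      (A B : Subset n) → OptimalPartition H A B →
      (A′ B′ V₀ : Subset n) → VertexClasses H ε₁ B A′ B′ V₀ →
      let q = ∣ A ∩ B′ ∣ in
      (P : Fin (s * q) → Path ℓ (H [ B′ ])) →
      (∀ i j → i ≢ j → Disjoint (Path.vertices (P i)) (Path.vertices (P j))) →
      (∀ i → Path.size (P i) ≤ s⋆ k) →
      (∀ i → Linkable H ε₁ B (Path.initialEnd (P i)) ×
             Linkable H ε₁ B (Path.terminalEnd (P i))) →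
      HamiltonCycle ℓ H)))
theorem3p1 zero ℓ 2≤ℓ ()
theorem3p1 (suc zero) (suc ℓ) (s≤s 1≤ℓ) (s≤s ())
theorem3p1 k@(suc (suc ρ)) ℓ 2≤ℓ ℓ<k d∤k s⋆ = with-ceiling
  (ceiling-bounds {σ = s} 2≤ℓ k-eq 0<d (ceiling-upper k d {{k∸ℓ-nonZero}} d∤k) (ceiling-lower k d {{k∸ℓ-nonZero}}))
  where
  open Setting k ℓ 2≤ℓ ℓ<k
  d : ℕ
  d = k ∸ ℓ
  k-eq : k ≡ ℓ + d
  k-eq = sym (ℕₚ.m+[n∸m]≡n (ℕₚ.<⇒≤ ℓ<k))
  0<d : 0 < d
  0<d = ℕₚ.m<n⇒0<n∸m ℓ<k
  with-ceiling : ∃[ s′ ] (s ≡ suc s′ × s′ * d < k × ℓ < s′ * d × 4 ≤ suc s′ * d) → HoldsForSmallΔ k ℓ 2≤ℓ ℓ<k (s⋆ k)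
  with-ceiling (s′ , s≡ , s′d<k , ℓ<s′d , 4≤z) = with-factor (ε₀-factor k ℓ 2≤ℓ ℓ<k (subst (λ σ → 2 ≤ σ * d) (sym s≡) (ℕₚ.≤-trans (s≤s (s≤s z≤n)) 4≤z)))
    where
    with-factor : ∃[ K ] (0ℚ ℚ.< K × (∀ Δ n → seq (ε₀ Δ) n ≡ K ℚ.* seq Δ n)) → HoldsForSmallΔ k ℓ 2≤ℓ ℓ<k (s⋆ k)
    with-factor (K , 0<K , ε₀-seq) = with-c₀ (archimedean-* K 0<K (fourth ⟪ 5 ⟫ ℚ.+ 1ℚ ℚ.+ 1ℚ))
      where
      with-c₀ : ∃[ c₀ ] fourth ⟪ 5 ⟫ ℚ.+ 1ℚ ℚ.+ 1ℚ ℚ.≤ K ℚ.* ⟪ c₀ ⟫ → HoldsForSmallΔ k ℓ 2≤ℓ ℓ<k (s⋆ k)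
      with-c₀ (c₀ , c₀-large) = Reduction.for-small-Δ (record
        { ρ = ρ ; ℓ = ℓ ; s′ = s′ ; s⋆ = s⋆ k ; c₀ = c₀ ; k-eq = k-eq ; s′d≤κ = ℕₚ.≤-pred s′d<k ; ℓ<s′d = ℓ<s′d ; 0<d = 0<d ; 4≤z = 4≤z })
        2≤ℓ ℓ<k s≡ K 0<K ε₀-seq c₀-large
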